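{- Every finite simple graph with no $K_8^=$ minor is $8$-colorable.
   Context: All graphs are finite and simple. A graph $H$ is a minor of $G$ if $H$ can be obtained from a subgraph of $G$ by contracting edges. $K_8^=$ denotes the graph obtained from the complete graph $K_8$ by removing two edges. A graph is $c$-colorable if it has a proper vertex coloring with at most $c$ colors. -}

module Defs where

open import Data.Nat using (ℕ)
open import Data.Fin using (Fin)
open import Data.Fin.Properties using (_≟_)
open import Data.Bool using (Bool; true; false; not; _∧_; _∨_)
open import Data.Empty using (⊥)
open import Data.Maybe using (Maybe; just)
open import Data.Product using (Σ; _×_; ∃; ∃-syntax)
open import Relation.Binary.PropositionalEquality using (_≡_; _≢_)
open import Relation.Nullary.Decidable using (⌊_⌋)

record Graph : Set where
  field
    n      : ℕ
    adj    : Fin n → Fin n → Bool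
    sym    : ∀ u v → adj u v ≡ adj v u
    irrefl : ∀ v → adj v v ≡ false
open Graph public

data WalkIn (G : Graph) (P : Fin (n G) → Set) : Fin (n G) → Fin (n G) → Set where
  here : ∀ {u} → P u → WalkIn G P u u
  step : ∀ {u w v} → P u → adj G u w ≡ true → WalkIn G P w v → WalkIn G P u v

-- H (a graph on Fin m given by its adjacency) is a minor of G, expressed via a
-- minor model: branch sets  branch⁻¹(just i)  are pairwise disjoint (automatic,
-- since branch is a function), nonempty, connected in G, and every edge ij of H
-- is realised by an edge of G between the branch sets of i and j.
record MinorModel {m : ℕ} (H : Fin m → Fin m → Bool) (G : Graph) : Set where
  field
    branch    : Fin (n G) → Maybe (Fin m)
    nonempty  : ∀ i → ∃[ v ] branch v ≡ just i
    connected : ∀ i u v → branch u ≡ just i → branch v ≡ just i →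
                WalkIn G (λ w → branch w ≡ just i) u v
    edges     : ∀ i j → H i j ≡ true →
                ∃[ u ] ∃[ v ] (branch u ≡ just i × branch v ≡ just j × adj G u v ≡ true)

_≼_ : {m : ℕ} → (Fin m → Fin m → Bool) → Graph → Set
H ≼ G = MinorModel H G

sameEdge : {k : ℕ} → Fin k → Fin k → Fin k → Fin k → Bool
sameEdge x y a b = (⌊ x ≟ a ⌋ ∧ ⌊ y ≟ b ⌋) ∨ (⌊ x ≟ b ⌋ ∧ ⌊ y ≟ a ⌋)

K8minus2 : Fin 8 → Fin 8 → Fin 8 → Fin 8 → (Fin 8 → Fin 8 → Bool)
K8minus2 a b c d x y = not ⌊ x ≟ y ⌋ ∧ not (sameEdge x y a b) ∧ not (sameEdge x y c d)

NoK8=Minor : Graph → Set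
NoK8=Minor G = ∀ (a b c d : Fin 8) → a ≢ b → c ≢ d → sameEdge a b c d ≡ false →
               MinorModel (K8minus2 a b c d) G → ⊥

Colorable : ℕ → Graph → Set
Colorable k G = Σ (Fin (n G) → Fin k) λ c → ∀ u v → adj G u v ≡ true → c u ≢ c v

{-# OPTIONS --safe #-}

-- Edges.  A graph on n ≥ 4 vertices without these minors has at most 5n − 14 edges.  In a minimal denser graph every edge
-- lies in at least 5 triangles, as otherwise it could be contracted; so a vertex x of minimum degree d has 6 ≤ d ≤ 9, and
-- in its neighbourhood every vertex has at most d − 6 non-neighbours.  Contract a component C of G − N[x] to a vertex y.
-- A finite case analysis shows that either x, y and N(x) contain a minor, or the neighbours of C lie in a set S of at most
-- 5 vertices which the rest of N[x] completes to a clique.  In the latter case the bound for the two sides of S, one with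
-- S completed, contradicts the number of edges of G.
--
-- Colours.  In a minimal uncolourable G every degree is at least 9, so by the edge bound at least 28 vertices have degree
-- 9.  Let x be one of them.  Contracting x with two non-adjacent neighbours a, b colours G − x so that a, b is the only
-- pair of neighbours of x with equal colours; Kempe chains then add a star forest on the other seven neighbours.  A finite
-- case analysis on the (triangle-free) complement of N(x) gives a minor unless N(x) contains a 5-clique.  So each vertex of
-- degree 9 lies in a 6-clique.  Two 6-cliques are joined by six disjoint paths: otherwise, by Menger's theorem, both sides
-- of a smallest separator can be coloured with the separator completed.  If at least two of the paths are non-trivial,
-- contracting the other four gives a minor.  Otherwise any two of the 6-cliques share 5 vertices, so three vertices are
-- joined to a common 5-clique, and a path between two of them again gives a minor.

module Submission where

open import Defs
open import Data.Nat using (ℕ; zero; suc; _+_; _*_; _≤_; _<_; _≥_; z≤n; s≤s; _≡ᵇ_; _≤ᵇ_; _≤?_)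
open import Data.Nat.Properties hiding (_≟_; suc-injective)
open import Data.Nat.DivMod using (_/_; _%_)
open import Data.Nat.Tactic.RingSolver using (solve-∀)
open import Data.Fin using (Fin; zero; suc; toℕ; inject≤)
open import Data.Fin.Properties using (_≟_; suc-injective; toℕ<n; inject≤-injective; any?; all?)
open import Data.Fin.Permutation using (permutation)
open import Data.Bool using (Bool; true; false; not; _∧_; _∨_; _xor_; if_then_else_; T)
open import Data.Bool.Properties using (∨-comm; ∧-identityʳ) renaming (_≟_ to _≟ᵇ_)
open import Data.Empty using (⊥; ⊥-elim)
open import Data.Unit using (tt)
open import Data.Maybe using (Maybe; just; nothing; _>>=_; maybe′; is-just)
import Data.Maybe
open import Data.List using (List; []; _∷_; map)
open import Data.Vec using (Vec; []; _∷_; lookup; tabulate; _[_]≔_)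
open import Data.Vec.Properties using (lookup∘tabulate; lookup∘update; lookup∘update′)
open import Data.Product using (Σ; _×_; ∃; ∃-syntax; _,_; proj₁; proj₂)
open import Data.Sum using (_⊎_; inj₁; inj₂; [_,_]′)
open import Function using (_∘_; id)
open import Relation.Nullary using (¬_; Dec; yes; no)
open import Relation.Nullary.Decidable using (⌊_⌋; map′; ¬?; _→-dec_; from-no; from-yes)
open import Relation.Binary.PropositionalEquality using (_≡_; _≢_; refl; trans; cong; cong₂; subst; subst₂; module ≡-Reasoning) renaming (sym to ≡-sym)
import Algebra.Properties.CommutativeMonoid.Sum +-0-commutativeMonoid as Std

-- Classical reasoning is available when the goal is ⊥.

-- The constants come from `K₄` and `K₇`, which attain `5n − 14`; the triangle violates the bound,
-- hence `n ≥ 4`. When a graph is split along `S`, the two sides exceed the bound by one edge if `S`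
-- has 4 vertices, but the count balances exactly if it has 5. Then one more edge must be gained by
-- contracting the component into `S` on the side where `S` was not completed. Kempe chains are
-- arranged in stars because chains from one centre may cross harmlessly, all being contracted into
-- that centre, while chains of different stars have no colour in common and so are disjoint. An
-- arbitrary graph of chains gives no disjoint branch sets in general. Components, reachable sets
-- and linkages are obtained under a double negation. They are used only to derive `⊥`, and the
-- theorem itself follows because colourability is decidable. The finite analyses are decision trees
-- on the adjacency of `x`, `y` and `N(x)`, run by the type checker. Symmetry enters through
-- references back to states refuted earlier, up to renaming the neighbours of `x`.

by-cases : ∀ {P : Set} → (P → ⊥) → (¬ P → ⊥) → ⊥
by-cases f g = g f

decide-all : ∀ {m} (P : Fin m → Set) → ((∀ i → Dec (P i)) → ⊥) → ⊥
decide-all {zero} P k = k λ ()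
decide-all {suc m} P k = by-cases {P zero}
  (λ p → decide-all (P ∘ suc) λ d → k λ { zero → yes p ; (suc i) → d i })
  (λ p → decide-all (P ∘ suc) λ d → k λ { zero → no p ; (suc i) → d i })

-- Reachability comes without a decision procedure. Finitely many instances of excluded middle can
-- be assumed together when refuting something, so such a predicate may be taken to be Boolean; this
-- is how reachable sets become branch sets.
decide-subset : ∀ {m} (P : Fin m → Set) →
  ((p : Fin m → Bool) → (∀ i → p i ≡ true → P i) → (∀ i → P i → p i ≡ true) → ⊥) → ⊥
decide-subset P k = decide-all P λ d → k (λ i → ⌊ d i ⌋) (λ i → fw (d i)) (λ i → bw (d i))
  where
  fw : ∀ {A : Set} (d : Dec A) → ⌊ d ⌋ ≡ true → A
  fw (yes a) _ = a
  bw : ∀ {A : Set} (d : Dec A) → A → ⌊ d ⌋ ≡ true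
  bw (yes _) _ = refl
  bw (no ¬a) a = ⊥-elim (¬a a)

-- Booleans as propositions

true≢false : ∀ {b : Bool} → b ≡ true → b ≡ false → ⊥
true≢false refl ()

¬true⇒false : ∀ {b : Bool} → (b ≡ true → ⊥) → b ≡ false
¬true⇒false {true} h = ⊥-elim (h refl)
¬true⇒false {false} h = refl

bool-cases : ∀ (b : Bool) → b ≡ true ⊎ b ≡ false
bool-cases true = inj₁ refl
bool-cases false = inj₂ refl

∧-elim : ∀ {a b} → a ∧ b ≡ true → a ≡ true × b ≡ true
∧-elim {true} {true} _ = refl , refl

∧-intro : ∀ {a b} → a ≡ true → b ≡ true → a ∧ b ≡ true
∧-intro refl refl = refl

∨-elim : ∀ {a b} → a ∨ b ≡ true → a ≡ true ⊎ b ≡ true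
∨-elim {true} _ = inj₁ refl
∨-elim {false} p = inj₂ p

∨-introˡ : ∀ {a b} → a ≡ true → a ∨ b ≡ true
∨-introˡ refl = refl

∨-introʳ : ∀ {a b} → b ≡ true → a ∨ b ≡ true
∨-introʳ {true} _ = refl
∨-introʳ {false} p = p

not-elim : ∀ {a} → not a ≡ true → a ≡ false
not-elim {false} _ = refl

not-intro : ∀ {a} → a ≡ false → not a ≡ true
not-intro refl = refl

infix 5 _==_
_==_ : ∀ {m} → Fin m → Fin m → Bool
u == v = ⌊ u ≟ v ⌋

==⇒≡ : ∀ {m} {u v : Fin m} → (u == v) ≡ true → u ≡ v
==⇒≡ {u = u} {v} p with u ≟ v
... | yes q = q

==-refl : ∀ {m} (u : Fin m) → (u == u) ≡ true
==-refl u with u ≟ u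
... | yes _ = refl
... | no q = ⊥-elim (q refl)

≢⇒== : ∀ {m} {u v : Fin m} → u ≢ v → (u == v) ≡ false
≢⇒== {u = u} {v} p with u ≟ v
... | yes q = ⊥-elim (p q)
... | no _ = refl

==⇒≢ : ∀ {m} {u v : Fin m} → (u == v) ≡ false → u ≢ v
==⇒≢ {u = u} p refl = true≢false (==-refl u) p

==-sym : ∀ {m} (u v : Fin m) → (u == v) ≡ (v == u)
==-sym u v with u ≟ v
... | yes refl = ≡-sym (==-refl u)
... | no q = ≡-sym (≢⇒== (q ∘ ≡-sym))

-- Sums and counting

[_] : Bool → ℕ
[ true ] = 1
[ false ] = 0

[]≤1 : ∀ b → [ b ] ≤ 1
[]≤1 true = ≤-refl
[]≤1 false = z≤n

sum : ∀ {m} → (Fin m → ℕ) → ℕ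
sum {zero} f = 0
sum {suc m} f = f zero + sum (f ∘ suc)

-- Transfers additivity and invariance under permutations from the library's sum.
sum≡std : ∀ {m} (f : Fin m → ℕ) → sum f ≡ Std.sum f
sum≡std {zero} f = refl
sum≡std {suc m} f = cong (f zero +_) (sum≡std (f ∘ suc))

sum-cong-≗ : ∀ {m} {f g : Fin m → ℕ} → (∀ i → f i ≡ g i) → sum f ≡ sum g
sum-cong-≗ {zero} h = refl
sum-cong-≗ {suc m} h = cong₂ _+_ (h zero) (sum-cong-≗ (h ∘ suc))

∑-distrib-+ : ∀ {m} (f g : Fin m → ℕ) → sum (λ i → f i + g i) ≡ sum f + sum g
∑-distrib-+ f g = trans (sum≡std (λ i → f i + g i)) (trans (Std.∑-distrib-+ f g) (≡-sym (cong₂ _+_ (sum≡std f) (sum≡std g))))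

∑-comm : ∀ {m k} (f : Fin m → Fin k → ℕ) → sum (λ i → sum (f i)) ≡ sum (λ j → sum (λ i → f i j))
∑-comm {zero} {k} f = ≡-sym (lem k)
  where
  lem : ∀ k → sum {k} (λ _ → 0) ≡ 0
  lem zero = refl
  lem (suc k) = lem k
∑-comm {suc m} f = trans (cong (sum (f zero) +_) (∑-comm (f ∘ suc))) (≡-sym (∑-distrib-+ (f zero) _))

infix 8 #_
#_ : ∀ {m} → (Fin m → Bool) → ℕ
# p = sum λ v → [ p v ]

sum-mono : ∀ {m} {f g : Fin m → ℕ} → (∀ i → f i ≤ g i) → sum f ≤ sum g
sum-mono {zero} h = z≤n
sum-mono {suc m} h = +-mono-≤ (h zero) (sum-mono (h ∘ suc))

sum-const : ∀ m c → sum {m} (λ _ → c) ≡ m * c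
sum-const zero c = refl
sum-const (suc m) c = cong (c +_) (sum-const m c)

sum-zero : ∀ {m} {f : Fin m → ℕ} → (∀ i → f i ≡ 0) → sum f ≡ 0
sum-zero {m} h = trans (sum-cong-≗ h) (trans (sum-const m 0) (*-zeroʳ m))

sum-*ˡ : ∀ {m} c (f : Fin m → ℕ) → sum (λ i → c * f i) ≡ c * sum f
sum-*ˡ {zero} c f = ≡-sym (*-zeroʳ c)
sum-*ˡ {suc m} c f = trans (cong (c * f zero +_) (sum-*ˡ c (f ∘ suc))) (≡-sym (*-distribˡ-+ c (f zero) _))

sum-delta : ∀ {m} (a : Fin m) (f : Fin m → ℕ) → sum (λ v → [ v == a ] * f v) ≡ f a
sum-delta {suc m} zero f = trans (cong (f zero + 0 +_) (sum-zero {m} {λ i → [ suc i == zero ] * f (suc i)} λ i → refl)) (trans (+-identityʳ _) (+-identityʳ _))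
sum-delta {suc m} (suc a) f = trans (sum-cong-≗ (λ v → cong (λ z → [ z ] * f (suc v)) (lem v))) (sum-delta a (f ∘ suc))
  where
  lem : ∀ v → (suc v == suc a) ≡ (v == a)
  lem v with v ≟ a
  ... | yes refl = refl
  ... | no q = refl

term≤sum : ∀ {m} (f : Fin m → ℕ) i → f i ≤ sum f
term≤sum f zero = m≤m+n _ _
term≤sum f (suc i) = ≤-trans (term≤sum (f ∘ suc) i) (m≤n+m _ _)

sum-positive : ∀ {m} (f : Fin m → ℕ) → 0 < sum f → ∃[ i ] (0 < f i)
sum-positive {suc m} f h with f zero in eq
... | suc k = zero , subst (0 <_) (≡-sym eq) (s≤s z≤n)
... | zero with sum-positive (f ∘ suc) h
...   | i , p = suc i , p

[]-positive : ∀ {b} → 0 < [ b ] → b ≡ true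
[]-positive {true} _ = refl

#≤ : ∀ {m} (p : Fin m → Bool) → # p ≤ m
#≤ {m} p = ≤-trans (sum-mono (λ v → []≤1 (p v))) (≤-reflexive (trans (sum-const m 1) (*-identityʳ m)))

#-all : ∀ {m} {p : Fin m → Bool} → (∀ v → p v ≡ true) → # p ≡ m
#-all {m} h = trans (sum-cong-≗ (λ v → cong [_] (h v))) (trans (sum-const m 1) (*-identityʳ m))

#-missing : ∀ {m} (p : Fin m → Bool) v → p v ≡ false → # p < m
#-missing {suc m} p zero h rewrite h = s≤s (#≤ (p ∘ suc))
#-missing {suc m} p (suc v) h = ≤-trans (s≤s (+-monoˡ-≤ _ ([]≤1 (p zero)))) (s≤s (#-missing (p ∘ suc) v h))

#-missing₁ : ∀ {m} (p : Fin m → Bool) v → p v ≡ false → (∀ u → u ≢ v → p u ≡ true) → suc (# p) ≡ m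
#-missing₁ {m} p v h h′ = begin
  suc (# p) ≡⟨ cong (_+ # p) (≡-sym (sum-delta v (λ _ → 1))) ⟩
  sum (λ u → [ u == v ] * 1) + # p ≡⟨ ≡-sym (∑-distrib-+ (λ u → [ u == v ] * 1) _) ⟩
  sum (λ u → [ u == v ] * 1 + [ p u ]) ≡⟨ sum-cong-≗ lem ⟩
  sum {m} (λ _ → 1) ≡⟨ trans (sum-const m 1) (*-identityʳ m) ⟩
  m ∎
  where
  open ≡-Reasoning
  lem : ∀ u → [ u == v ] * 1 + [ p u ] ≡ 1
  lem u with u ≟ v
  ... | yes refl rewrite h = refl
  ... | no q rewrite h′ u q = refl

-- Besides numbering the set, `from` decides membership and so can serve as a branch map; `to-sum`
-- turns sums over a subgraph into weighted sums over the ambient vertices, where different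
-- subgraphs can be compared.
record Enum {N : ℕ} (p : Fin N → Bool) (m : ℕ) : Set where
  field
    to       : Fin m → Fin N
    to-sat   : ∀ i → p (to i) ≡ true
    from     : Fin N → Maybe (Fin m)
    from-to  : ∀ i → from (to i) ≡ just i
    to-from  : ∀ {v i} → from v ≡ just i → to i ≡ v
    from-sat : ∀ {v} → p v ≡ true → ∃[ i ] (to i ≡ v)
    to-sum   : ∀ f → sum (f ∘ to) ≡ sum (λ v → [ p v ] * f v)
  to-inj : ∀ {i j} → to i ≡ to j → i ≡ j
  to-inj {i} {j} h with trans (≡-sym (from-to i)) (trans (cong from h) (from-to j))
  ... | refl = refl

enum : ∀ {N} (p : Fin N → Bool) → Enum p (# p)
enum {zero} p = record { to = λ (); to-sat = λ (); from = λ (); from-to = λ () ; to-from = λ {} ; from-sat = λ {} ; to-sum = λ _ → refl }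
enum {suc N} p with p zero in eq | enum (p ∘ suc)
... | true | E = record
  { to = ext
  ; to-sat = λ { zero → eq ; (suc i) → to-sat i }
  ; from = λ { zero → just zero ; (suc v) → Data.Maybe.map suc (from v) }
  ; from-to = λ { zero → refl ; (suc i) → cong (Data.Maybe.map suc) (from-to i) }
  ; to-from = λ { {zero} refl → refl ; {suc v} {i} h → tf v {i} h }
  ; from-sat = λ { {zero} _ → zero , refl ; {suc v} h → suc (proj₁ (from-sat h)) , cong suc (proj₂ (from-sat h)) }
  ; to-sum = λ f → cong₂ _+_ (≡-sym (trans (cong (λ b → [ b ] * f zero) eq) (+-identityʳ _))) (to-sum (f ∘ suc)) }
  where
  open Enum E
  ext : Fin (suc (# (p ∘ suc))) → Fin (suc N)
  ext zero = zero
  ext (suc i) = suc (to i)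
  tf : ∀ v {i} → Data.Maybe.map suc (from v) ≡ just i → ext i ≡ suc v
  tf v h with from v in e2
  tf v refl | just j = cong suc (to-from e2)
... | false | E = record
  { to = λ i → suc (to i)
  ; to-sat = to-sat
  ; from = λ { zero → nothing ; (suc v) → from v }
  ; from-to = from-to
  ; to-from = λ { {zero} () ; {suc v} h → cong suc (to-from h) }
  ; from-sat = λ { {zero} h → ⊥-elim (true≢false h eq) ; {suc v} h → proj₁ (from-sat h) , cong suc (proj₂ (from-sat h)) }
  ; to-sum = λ f → trans (to-sum (f ∘ suc)) (cong (λ b → [ b ] * f zero + sum (λ v → [ p (suc v) ] * f (suc v))) (≡-sym eq)) }
  where open Enum E

-- Walks and minors

module _ {G : Graph} where

  walk-map : ∀ {P Q : Fin (n G) → Set} {u v} → (∀ {w} → P w → Q w) → WalkIn G P u v → WalkIn G Q u v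
  walk-map f (here p) = here (f p)
  walk-map f (step p e w) = step (f p) e (walk-map f w)

  walk-++ : ∀ {P : Fin (n G) → Set} {u v w} → WalkIn G P u v → WalkIn G P v w → WalkIn G P u w
  walk-++ (here p) w₂ = w₂
  walk-++ (step p e w₁) w₂ = step p e (walk-++ w₁ w₂)

  walk-start : ∀ {P : Fin (n G) → Set} {u v} → WalkIn G P u v → P u
  walk-start (here p) = p
  walk-start (step p e w) = p

  walk-end : ∀ {P : Fin (n G) → Set} {u v} → WalkIn G P u v → P v
  walk-end (here p) = p
  walk-end (step p e w) = walk-end w

  walk-snoc : ∀ {P : Fin (n G) → Set} {u v w} → WalkIn G P u v → adj G v w ≡ true → P w → WalkIn G P u w
  walk-snoc (here p) e q = step p e (here q)
  walk-snoc (step p e′ w) e q = step p e′ (walk-snoc w e q)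

  walk-rev : ∀ {P : Fin (n G) → Set} {u v} → WalkIn G P u v → WalkIn G P v u
  walk-rev (here p) = here p
  walk-rev (step p e w) = walk-snoc (walk-rev w) (trans (sym G _ _) e) p

  -- The walks stay inside `R` and not merely inside `P`, because every vertex of such a walk is
  -- reachable too. Hence `R` is connected and can be a branch set; the last clause makes it
  -- maximal.
  reachable : (P : Fin (n G) → Set) (s : Fin (n G)) → P s →
    ((R : Fin (n G) → Bool) → R s ≡ true →
      (∀ w → R w ≡ true → WalkIn G (λ z → R z ≡ true) s w) →
      (∀ w → R w ≡ true → P w) →
      (∀ u w → R u ≡ true → adj G u w ≡ true → P w → R w ≡ true) → ⊥) → ⊥
  reachable P s ps k = decide-subset (WalkIn G P s) λ R sound complete →
    let inside : ∀ {u w} → WalkIn G P s u → WalkIn G P u w → WalkIn G (λ z → R z ≡ true) u w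
        inside = λ a b → go R complete a b
    in k R (complete s (here ps)) (λ w r → inside (here ps) (sound w r)) (λ w r → walk-end (sound w r))
         (λ u w r e p → complete w (walk-snoc (sound u r) e p))
    where
    go : ∀ (R : Fin (n G) → Bool) → (∀ i → WalkIn G P s i → R i ≡ true) → ∀ {u w} →
         WalkIn G P s u → WalkIn G P u w → WalkIn G (λ z → R z ≡ true) u w
    go R c a (here p) = here (c _ a)
    go R c a (step p e b) = step (c _ a) e (go R c (walk-snoc a e (walk-start b)) b)

bind-just : ∀ {A B : Set} (x : Maybe A) {f : A → Maybe B} {i} → (x >>= f) ≡ just i → ∃[ v ] (x ≡ just v × f v ≡ just i)
bind-just (just v) h = v , refl , h

bind-intro : ∀ {A B : Set} {x : Maybe A} {f : A → Maybe B} {v i} → x ≡ just v → f v ≡ just i → (x >>= f) ≡ just i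
bind-intro refl h = h

-- A minor model in which branch sets may be empty.
record Pre {m : ℕ} (A : Fin m → Fin m → Bool) (G : Graph) : Set where
  field
    branch    : Fin (n G) → Maybe (Fin m)
    connected : ∀ i u v → branch u ≡ just i → branch v ≡ just i → WalkIn G (λ w → branch w ≡ just i) u v
    edges     : ∀ i j → A i j ≡ true → ∃[ u ] ∃[ v ] (branch u ≡ just i × branch v ≡ just j × adj G u v ≡ true)

-- A composite branch set is the union of the inner sets over a connected outer one. Inner sets may
-- be empty, so one inhabited inner set is demanded for each vertex of `H`; edges of `L` supply the
-- others that a walk passes.
minor-via : ∀ {k} {H : Fin k → Fin k → Bool} {L G : Graph} (M : MinorModel H L) (P : Pre (adj L) G) →
  (∀ i → ∃[ v ] (MinorModel.branch M v ≡ just i × ∃[ w ] Pre.branch P w ≡ just v)) → MinorModel H G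
minor-via {L = L} {G} M P ne = record
  { branch = λ w → P.branch w >>= M.branch
  ; nonempty = λ i → let v , hv , w , hw = ne i in w , bind-intro hw hv
  ; connected = λ i u v hu hv →
      let u′ , pu , mu = bind-just (P.branch u) hu
          v′ , pv , mv = bind-just (P.branch v) hv
      in lift (M.connected i u′ v′ mu mv) pu pv
  ; edges = λ i j h →
      let u′ , v′ , mu , mv , e = M.edges i j h
          u , v , pu , pv , e′ = P.edges u′ v′ e
      in u , v , bind-intro pu mu , bind-intro pv mv , e′ }
  where
  module M = MinorModel M
  module P = Pre P
  lift : ∀ {i u′ v′ u v} → WalkIn L (λ w → M.branch w ≡ just i) u′ v′ → P.branch u ≡ just u′ → P.branch v ≡ just v′ →
         WalkIn G (λ w → (P.branch w >>= M.branch) ≡ just i) u v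
  lift (here p) hu hv = walk-map (λ h → bind-intro h p) (P.connected _ _ _ hu hv)
  lift (step {u = u′} {w = w′} p e w) hu hv =
    let a , b , ha , hb , e′ = P.edges u′ w′ e
    in walk-++ (walk-map (λ h → bind-intro h p) (P.connected _ _ _ hu ha))
               (step (bind-intro ha p) e′ (lift w hb hv))

minor-trans : ∀ {k} {H : Fin k → Fin k → Bool} {L G : Graph} → MinorModel H L → MinorModel (adj L) G → MinorModel H G
minor-trans M N = minor-via M (record { branch = N.branch ; connected = N.connected ; edges = N.edges })
  (λ i → let v , hv = M.nonempty i in v , hv , N.nonempty v)
  where
  module M = MinorModel M
  module N = MinorModel N

-- A minor of G whose vertices are named by representatives in their own branch sets.
record Sub (G : Graph) : Set where
  field
    V       : Fin (n G) → Bool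
    E       : Fin (n G) → Fin (n G) → Bool
    E-sym   : ∀ u v → E u v ≡ E v u
    E-irr   : ∀ v → E v v ≡ false
    br      : Fin (n G) → Maybe (Fin (n G))
    br-rep  : ∀ v → V v ≡ true → br v ≡ just v
    br-conn : ∀ {w v} → V v ≡ true → br w ≡ just v → WalkIn G (λ z → br z ≡ just v) w v
    real    : ∀ u v → V u ≡ true → V v ≡ true → E u v ≡ true →
              ∃[ a ] ∃[ b ] (br a ≡ just u × br b ≡ just v × adj G a b ≡ true)

degree-sum : Graph → ℕ
degree-sum G = sum λ u → sum λ v → [ adj G u v ]

module _ {G : Graph} (M : Sub G) where
  open Sub M
  private
    module N = Enum (enum V)

  sub-graph : Graph
  sub-graph = record { n = # V ; adj = λ i j → E (N.to i) (N.to j) ; sym = λ i j → E-sym _ _ ; irrefl = λ i → E-irr _ }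

  sub-model : MinorModel (adj sub-graph) G
  sub-model = record
    { branch = λ w → br w >>= N.from
    ; nonempty = λ i → N.to i , bind-intro (br-rep _ (N.to-sat i)) (N.from-to i)
    ; connected = λ i u v hu hv → walk-++ (conn i u hu) (walk-rev (conn i v hv))
    ; edges = λ i j h → let a , b , ha , hb , e = real _ _ (N.to-sat i) (N.to-sat j) h
                        in a , b , bind-intro ha (N.from-to i) , bind-intro hb (N.from-to j) , e }
    where
    conn : ∀ i u → (br u >>= N.from) ≡ just i → WalkIn G (λ w → (br w >>= N.from) ≡ just i) u (N.to i)
    conn i u h with bind-just (br u) h
    ... | v , p , q with N.to-from q
    ...   | refl = walk-map (λ r → bind-intro r q) (br-conn (N.to-sat i) p)

  sub-free : NoK8=Minor G → NoK8=Minor sub-graph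
  sub-free free a b c d ab cd s m = free a b c d ab cd s (minor-trans m sub-model)

  sub-degree-sum : degree-sum sub-graph ≡ sum λ u → sum λ v → [ V u ] * ([ V v ] * [ E u v ])
  sub-degree-sum = trans (sum-cong-≗ (λ i → N.to-sum (λ v → [ E (N.to i) v ])))
    (trans (N.to-sum (λ u → sum (λ v → [ V v ] * [ E u v ])))
      (sum-cong-≗ (λ u → ≡-sym (sum-*ˡ [ V u ] (λ v → [ V v ] * [ E u v ])))))

  sub-colouring : ∀ {k} → Colorable k sub-graph → Fin k →
    ∃[ c ] (∀ u v → V u ≡ true → V v ≡ true → E u v ≡ true → c u ≢ c v)
  sub-colouring {k} (c , proper) z = c′ , λ u v hu hv e eq →
    let i , pi = N.from-sat hu
        j , pj = N.from-sat hv
    in proper i j (subst₂ (λ a b → E a b ≡ true) (≡-sym pi) (≡-sym pj) e)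
         (trans (≡-sym (val i u pi)) (trans eq (val j v pj)))
    where
    c′ : Fin (n G) → Fin k
    -- Vertices outside `V` receive the arbitrary colour `z`; properness is claimed inside `V` only.
    c′ u = maybe′ c z (N.from u)
    val : ∀ i u → N.to i ≡ u → c′ u ≡ c i
    val i u refl = cong (maybe′ c z) (N.from-to i)

-- Degree sums of minors

sum₂ : ∀ {k} → (Fin k → Fin k → ℕ) → ℕ
sum₂ f = sum λ u → sum (f u)

sum₂-cong : ∀ {k} {f g : Fin k → Fin k → ℕ} → (∀ u v → f u v ≡ g u v) → sum₂ f ≡ sum₂ g
sum₂-cong h = sum-cong-≗ λ u → sum-cong-≗ (h u)

sum₂-mono : ∀ {k} {f g : Fin k → Fin k → ℕ} → (∀ u v → f u v ≤ g u v) → sum₂ f ≤ sum₂ g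
sum₂-mono h = sum-mono λ u → sum-mono (h u)

sum₂-+ : ∀ {k} (f g : Fin k → Fin k → ℕ) → sum₂ (λ u v → f u v + g u v) ≡ sum₂ f + sum₂ g
sum₂-+ f g = trans (sum-cong-≗ λ u → ∑-distrib-+ (f u) (g u)) (∑-distrib-+ (λ u → sum (f u)) (λ u → sum (g u)))

sum₂-row : ∀ {k} (a : Fin k) (f : Fin k → ℕ) → sum₂ (λ u v → [ u == a ] * f v) ≡ sum f
sum₂-row a f = trans (sum-cong-≗ λ u → sum-*ˡ [ u == a ] f) (sum-delta a λ _ → sum f)

sum₂-col : ∀ {k} (a : Fin k) (f : Fin k → ℕ) → sum₂ (λ u v → [ v == a ] * f u) ≡ sum f
sum₂-col a f = sum-cong-≗ λ u → sum-delta a λ _ → f u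

sum₂-diag : ∀ {k} (f : Fin k → ℕ) → sum₂ (λ u v → [ v == u ] * f u) ≡ sum f
sum₂-diag f = sum-cong-≗ λ u → sum-delta u λ _ → f u

sum₂-product : ∀ {k} (f g : Fin k → ℕ) → sum₂ (λ u v → f u * g v) ≡ sum f * sum g
sum₂-product f g = begin
  sum (λ u → sum (λ v → f u * g v)) ≡⟨ sum-cong-≗ (λ u → trans (sum-*ˡ (f u) g) (*-comm (f u) (sum g))) ⟩
  sum (λ u → sum g * f u) ≡⟨ sum-*ˡ (sum g) f ⟩
  sum g * sum f ≡⟨ *-comm (sum g) (sum f) ⟩
  sum f * sum g ∎
  where open ≡-Reasoning

-- Twice the number of edges of `E` inside `V`: the degree sum of a subgraph, expressed over the
-- ambient vertex set.
weight : ∀ {k} → (Fin k → Bool) → (Fin k → Fin k → Bool) → ℕ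
weight V E = sum₂ λ u v → [ V u ] * ([ V v ] * [ E u v ])

-- Handshake lemma by peeling off one vertex, whose row and column contribute equally. Parity is
-- what bridges the gap between 26 and 28 in the edge bound.
even-sum : ∀ {k} (A : Fin k → Fin k → Bool) → (∀ u v → A u v ≡ A v u) → (∀ v → A v v ≡ false) →
  ∃[ e ] sum₂ (λ u v → [ A u v ]) ≡ e + e
even-sum {zero} A s i = 0 , refl
even-sum {suc k} A s i with even-sum (λ u v → A (suc u) (suc v)) (λ u v → s (suc u) (suc v)) (λ v → i (suc v))
... | e , p = row + e , (begin
  [ A zero zero ] + row + sum (λ u → [ A (suc u) zero ] + sum (λ v → [ A (suc u) (suc v) ])) ≡⟨ cong₂ (λ a b → [ a ] + row + b) (i zero) (∑-distrib-+ (λ u → [ A (suc u) zero ]) _) ⟩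
  row + (sum (λ u → [ A (suc u) zero ]) + sum₂ (λ u v → [ A (suc u) (suc v) ])) ≡⟨ cong₂ (λ a b → row + (a + b)) (sum-cong-≗ (λ u → cong [_] (s (suc u) zero))) p ⟩
  row + (row + (e + e)) ≡⟨ solve-lem row e ⟩
  row + e + (row + e) ∎)
  where
  open ≡-Reasoning
  row : ℕ
  row = sum λ v → [ A zero (suc v) ]
  solve-lem : ∀ r e → r + (r + (e + e)) ≡ r + e + (r + e)
  solve-lem = solve-∀

-- Both sides are even, so a strict inequality between them has a margin of 2.
even-gap : ∀ e k → e + e + 26 < 10 * k → e + e + 28 ≤ 10 * k
even-gap e k h = subst₂ _≤_ (l₁ e) (l₂ k) (*-monoʳ-≤ 2 (*-cancelˡ-< 2 (e + 13) (5 * k) (subst₂ _<_ (l₃ e) (≡-sym (l₂ k)) h)))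
  where
  l₁ : ∀ e → 2 * suc (e + 13) ≡ e + e + 28
  l₁ = solve-∀
  l₂ : ∀ k → 2 * (5 * k) ≡ 10 * k
  l₂ = solve-∀
  l₃ : ∀ e → e + e + 26 ≡ 2 * (e + 13)
  l₃ = solve-∀

-- Edge counts under deletion, contraction and separation

degree : (G : Graph) → Fin (n G) → ℕ
degree G v = # adj G v

module _ (G : Graph) where

  restrict : (V : Fin (n G) → Bool) → Sub G
  restrict V = record
    { V = V ; E = adj G ; E-sym = sym G ; E-irr = irrefl G
    ; br = just ; br-rep = λ v _ → refl ; br-conn = λ { _ refl → here refl }
    ; real = λ u v _ _ e → u , v , refl , refl , e }

  delete-bound : ∀ x → degree-sum G ≤ weight (λ w → not (w == x)) (adj G) + (degree G x + degree G x)
  delete-bound x = ≤-trans (sum₂-mono point) (≤-reflexive (trans (sum₂-+ (λ u v → [ not (u == x) ] * ([ not (v == x) ] * [ adj G u v ])) _)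
      (cong (weight (λ w → not (w == x)) (adj G) +_) (trans (sum₂-+ (λ u v → [ u == x ] * [ adj G x v ]) (λ u v → [ v == x ] * [ adj G x u ]))
        (cong₂ _+_ (sum₂-row x _) (sum₂-col x _))))))
    where
    point : ∀ u v → [ adj G u v ] ≤ [ not (u == x) ] * ([ not (v == x) ] * [ adj G u v ]) + ([ u == x ] * [ adj G x v ] + [ v == x ] * [ adj G x u ])
    point u v with u ≟ x | v ≟ x
    ... | yes refl | _ = ≤-trans (m≤m+n _ 0) (m≤m+n _ _)
    ... | no _ | yes refl = ≤-reflexive (trans (cong [_] (sym G u v)) (≡-sym (+-identityʳ _)))
    ... | no _ | no _ = ≤-reflexive (lem [ adj G u v ])
      where
      lem : ∀ a → a ≡ 1 * (1 * a) + 0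
      lem = solve-∀

  module Contract (u v : Fin (n G)) (uv : adj G u v ≡ true) where
    u≢v : u ≢ v
    u≢v refl = true≢false uv (irrefl G u)

    contract : Sub G
    contract = record
      { V = λ w → not (w == v) ; E = E′
      ; E-sym = λ a b → cong₂ (λ p q → not p ∧ q) (==-sym a b) (cong₂ _∨_ (sym G a b) (swap (a == u) (b == u) a b))
      ; E-irr = λ a → cong (λ p → not p ∧ (adj G a a ∨ ((a == u) ∧ adj G v a ∨ (a == u) ∧ adj G v a))) (==-refl a)
      ; br = br ; br-rep = λ w h → rep w (not-elim h) ; br-conn = λ {w} {z} → conn w z
      ; real = real }
      where
      swap : ∀ p q a b → (p ∧ adj G v b) ∨ (q ∧ adj G v a) ≡ (q ∧ adj G v a) ∨ (p ∧ adj G v b)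
      swap true true a b with adj G v a | adj G v b
      ... | true | true = refl
      ... | true | false = refl
      ... | false | true = refl
      ... | false | false = refl
      swap true false a b with adj G v b
      ... | true = refl
      ... | false = refl
      swap false true a b with adj G v a
      ... | true = refl
      ... | false = refl
      swap false false a b = refl
      E′ : Fin (n G) → Fin (n G) → Bool
      E′ a b = not (a == b) ∧ (adj G a b ∨ ((a == u) ∧ adj G v b ∨ (b == u) ∧ adj G v a))
      br : Fin (n G) → Maybe (Fin (n G))
      br w = if w == v then just u else just w
      rep : ∀ w → (w == v) ≡ false → br w ≡ just w
      rep w h rewrite h = refl
      brv : br v ≡ just u
      brv rewrite ==-refl v = refl
      conn : ∀ w z → not (z == v) ≡ true → br w ≡ just z → WalkIn G (λ y → br y ≡ just z) w z
      conn w z hz h with w ≟ v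
      conn w z hz refl | no w≢v = here (rep w (≢⇒== w≢v))
      conn w z hz refl | yes refl = step brv (trans (sym G v u) uv) (here (rep u (≢⇒== u≢v)))
      real : ∀ a b → not (a == v) ≡ true → not (b == v) ≡ true → E′ a b ≡ true →
             ∃[ p ] ∃[ q ] (br p ≡ just a × br q ≡ just b × adj G p q ≡ true)
      real a b ha hb h with ∨-elim {adj G a b} (proj₂ (∧-elim {not (a == b)} h))
      ... | inj₁ e = a , b , rep a (not-elim ha) , rep b (not-elim hb) , e
      ... | inj₂ h′ with ∨-elim {(a == u) ∧ adj G v b} h′
      ...   | inj₁ e with ==⇒≡ (proj₁ (∧-elim {a == u} e))
      ...     | refl = v , b , brv , rep b (not-elim hb) , proj₂ (∧-elim {a == u} e)
      real a b ha hb h | inj₂ h′ | inj₂ e with ==⇒≡ (proj₁ (∧-elim {b == u} e))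
      ...     | refl = a , v , rep a (not-elim ha) , brv , trans (sym G a v) (proj₂ (∧-elim {b == u} e))

    common : ℕ
    common = # λ w → adj G u w ∧ adj G v w

    private
      -- The neighbours that `u` gains when `v` is merged into it.
      new : Fin (n G) → Bool
      new w = not (w == u) ∧ (adj G v w ∧ not (adj G u w))
      V′ = Sub.V contract
      E″ = Sub.E contract
      new-v : new v ≡ false
      new-v with not (v == u)
      ... | false = refl
      ... | true rewrite irrefl G v = refl
      E-old : ∀ a b → adj G a b ≡ true → E″ a b ≡ true
      E-old a b e with a ≟ b
      ... | yes refl = ⊥-elim (true≢false e (irrefl G a))
      ... | no _ rewrite e = refl
      new≢u : ∀ {b} → new b ≡ true → u ≢ b
      new≢u h refl = true≢false (==-refl u) (not-elim (proj₁ (∧-elim {not (u == u)} h)))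
      E-new : ∀ b → new b ≡ true → E″ u b ≡ true
      E-new b h = ∧-intro (not-intro (≢⇒== (new≢u h)))
        (∨-introʳ {adj G u b} (∨-introˡ (∧-intro (==-refl u) (proj₁ (∧-elim {adj G v b} (proj₂ (∧-elim {not (b == u)} h)))))))
      new-adj : ∀ b → new b ≡ true → adj G u b ≡ false
      new-adj b h = not-elim (proj₂ (∧-elim {adj G v b} (proj₂ (∧-elim {not (b == u)} h))))

      plus≤ : ∀ (p q r : Bool) → (p ≡ true → r ≡ true) → (q ≡ true → r ≡ true) → (q ≡ true → p ≡ false) → [ p ] + [ q ] ≤ [ r ]
      plus≤ false false r f g h = z≤n
      plus≤ false true r f g h rewrite g refl = ≤-refl
      plus≤ true false r f g h rewrite f refl = ≤-refl
      plus≤ true true r f g h with h refl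
      ... | ()

      -- The count for the contraction, one matrix entry at a time: the entries gained in row and
      -- column `u` stand on the left, the lost row and column of `v` on the right, so no
      -- subtraction occurs.
      point : ∀ a b → [ adj G a b ] + ([ a == u ] * [ new b ] + [ b == u ] * [ new a ]) ≤
                      [ V′ a ] * ([ V′ b ] * [ E″ a b ]) + ([ a == v ] * [ adj G v b ] + [ b == v ] * [ adj G v a ])
      point a b with a ≟ v
      ... | yes refl = l₁ [ adj G a b ] (a == u) [ new b ] [ b == u ] (new a) ([ b == a ] * [ adj G a a ]) (≢⇒== (u≢v ∘ ≡-sym)) new-v
        where
        l₁ : ∀ s p x y q r → p ≡ false → q ≡ false → s + ([ p ] * x + y * [ q ]) ≤ s + 0 + r
        l₁ s p x y q r refl refl rewrite *-zeroʳ y | +-identityʳ s = m≤m+n s r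
      ... | no a≢v with b ≟ v
      ...   | yes refl = l₂ [ adj G a b ] [ adj G b a ] (b == u) [ new a ] [ a == u ] (new b) (cong [_] (sym G a b)) (≢⇒== (u≢v ∘ ≡-sym)) new-v
        where
        l₂ : ∀ s t p x y q → s ≡ t → p ≡ false → q ≡ false → s + (y * [ q ] + [ p ] * x) ≤ t + 0
        l₂ s t p x y q refl refl refl rewrite *-zeroʳ y = ≤-refl
      ...   | no b≢v = ≤-trans (by-ends (a == u) (b == u) both left right neither) (≤-reflexive (l₃ _))
        where
        l₃ : ∀ E → E ≡ E + 0 + 0 + 0
        l₃ = solve-∀
        A = [ adj G a b ]
        by-ends : ∀ p q → (p ≡ true → q ≡ true → A + ([ new b ] + [ new a ]) ≤ [ E″ a b ]) → (p ≡ true → A + [ new b ] ≤ [ E″ a b ]) →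
                  (q ≡ true → A + [ new a ] ≤ [ E″ a b ]) → A ≤ [ E″ a b ] → A + ([ p ] * [ new b ] + [ q ] * [ new a ]) ≤ [ E″ a b ]
        by-ends true true f _ _ _ rewrite +-identityʳ [ new b ] | +-identityʳ [ new a ] = f refl refl
        by-ends true false _ f _ _ rewrite +-identityʳ [ new b ] | +-identityʳ [ new b ] = f refl
        by-ends false true _ _ f _ rewrite +-identityʳ [ new a ] = f refl
        by-ends false false _ _ _ f rewrite +-identityʳ A = f
        both : (a == u) ≡ true → (b == u) ≡ true → A + ([ new b ] + [ new a ]) ≤ [ E″ a b ]
        both h₁ h₂ with ==⇒≡ h₁ | ==⇒≡ h₂
        ... | refl | refl = ≤-trans (≤-reflexive (cong₂ (λ p q → [ p ] + ([ q ] + [ q ])) (irrefl G u) new-u)) z≤n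
          where
          new-u : new u ≡ false
          new-u = ¬true⇒false λ h → new≢u h refl
        left : (a == u) ≡ true → A + [ new b ] ≤ [ E″ a b ]
        left h with ==⇒≡ h
        ... | refl = plus≤ _ _ _ (E-old u b) (E-new b) (new-adj b)
        right : (b == u) ≡ true → A + [ new a ] ≤ [ E″ a b ]
        right h with ==⇒≡ h
        ... | refl = plus≤ _ _ _ (E-old a u) (λ h → trans (Sub.E-sym contract a u) (E-new a h)) (λ h → trans (sym G a u) (new-adj a h))
        neither : A ≤ [ E″ a b ]
        neither = ≤-trans (≤-reflexive (≡-sym (+-identityʳ A))) (plus≤ _ false _ (E-old a b) (λ ()) (λ ()))

      degree-v : degree G v ≤ # new + (common + 1)
      degree-v = ≤-trans (sum-mono pt) (≤-reflexive (trans (∑-distrib-+ (λ w → [ new w ]) _) (cong (# new +_) (trans (∑-distrib-+ (λ w → [ adj G u w ∧ adj G v w ]) _) (cong (common +_) (sum-delta u λ _ → 1))))))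
        where
        pt : ∀ w → [ adj G v w ] ≤ [ new w ] + ([ adj G u w ∧ adj G v w ] + [ w == u ] * 1)
        pt w with adj G v w
        ... | false = z≤n
        ... | true with w == u
        ...   | true = ≤-trans (m≤n+m 1 [ adj G u w ∧ true ]) (m≤n+m _ 0)
        ...   | false with adj G u w
        ...     | true = ≤-refl
        ...     | false = ≤-refl

    -- The contraction loses the edge `uv` and one edge for each common neighbour, each counted in
    -- both directions. The gained neighbours are added to both sides and cancelled at the end.
    contract-bound : degree-sum G ≤ weight (Sub.V contract) (Sub.E contract) + (common + common + 2)
    contract-bound = +-cancelʳ-≤ (# new + # new) _ _ (begin
      degree-sum G + (# new + # new) ≡⟨ cong (degree-sum G +_) (≡-sym (trans (sum₂-+ (λ a b → [ a == u ] * [ new b ]) _) (cong₂ _+_ (sum₂-row u _) (sum₂-col u _)))) ⟩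
      degree-sum G + sum₂ (λ a b → [ a == u ] * [ new b ] + [ b == u ] * [ new a ]) ≡⟨ ≡-sym (sum₂-+ (λ a b → [ adj G a b ]) _) ⟩
      sum₂ (λ a b → [ adj G a b ] + ([ a == u ] * [ new b ] + [ b == u ] * [ new a ])) ≤⟨ sum₂-mono point ⟩
      sum₂ (λ a b → [ V′ a ] * ([ V′ b ] * [ E″ a b ]) + ([ a == v ] * [ adj G v b ] + [ b == v ] * [ adj G v a ])) ≡⟨ trans (sum₂-+ (λ a b → [ V′ a ] * ([ V′ b ] * [ E″ a b ])) _) (cong (weight V′ E″ +_) (trans (sum₂-+ (λ a b → [ a == v ] * [ adj G v b ]) _) (cong₂ _+_ (sum₂-row v _) (sum₂-col v _)))) ⟩
      weight V′ E″ + (degree G v + degree G v) ≤⟨ +-monoʳ-≤ (weight V′ E″) (+-mono-≤ degree-v degree-v) ⟩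
      weight V′ E″ + (# new + (common + 1) + (# new + (common + 1))) ≡⟨ lem (weight V′ E″) (# new) common ⟩
      weight V′ E″ + (common + common + 2) + (# new + # new) ∎)
      where
      open ≤-Reasoning
      lem : ∀ w z t → w + (z + (t + 1) + (z + (t + 1))) ≡ w + (t + t + 2) + (z + z)
      lem = solve-∀

  module Separation (C S : Fin (n G) → Bool) (disjoint : ∀ w → C w ≡ true → S w ≡ false)
    (closed : ∀ u w → C u ≡ true → adj G u w ≡ true → C w ≡ false → S w ≡ true) where

    VA VB : Fin (n G) → Bool
    VA w = C w ∨ S w
    VB w = not (C w)

    EA : Fin (n G) → Fin (n G) → Bool
    EA a b = adj G a b ∨ (S a ∧ (S b ∧ not (a == b)))

    private
      no-cross : ∀ u w → C u ≡ true → C w ≡ false → S w ≡ false → adj G u w ≡ false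
      no-cross u w h₁ h₂ h₃ = ¬true⇒false λ e → true≢false (closed u w h₁ e h₂) h₃

      point : ∀ a b → [ VA a ] * ([ VA b ] * [ EA a b ]) + ([ VB a ] * ([ VB b ] * [ adj G a b ]) + [ b == a ] * [ S a ]) ≡ [ adj G a b ] + [ S a ] * [ S b ]
      point a b with C a in ca | C b in cb
      ... | true | true rewrite disjoint a ca with adj G a b | b == a
      ...   | true | true = refl
      ...   | true | false = refl
      ...   | false | true = refl
      ...   | false | false = refl
      point a b | true | false rewrite disjoint a ca | *-zeroʳ [ b == a ] with S b in sb
      ...   | true with adj G a b
      ...     | true = refl
      ...     | false = refl
      point a b | true | false | false rewrite no-cross a b ca cb sb = refl
      point a b | false | true rewrite disjoint b cb with S a in sa
      ...   | true rewrite ≢⇒== {u = b} {a} (λ { refl → true≢false cb ca }) with adj G a b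
      ...     | true = refl
      ...     | false = refl
      point a b | false | true | false rewrite *-zeroʳ [ b == a ] | sym G a b | no-cross b a cb ca sa = refl
      point a b | false | false with S a in sa | S b in sb
      ...   | true | false rewrite ≢⇒== {u = b} {a} (λ { refl → true≢false sa sb }) with adj G a b
      ...     | true = refl
      ...     | false = refl
      point a b | false | false | false | _ rewrite *-zeroʳ [ b == a ] with adj G a b
      ...     | true = refl
      ...     | false = refl
      point a b | false | false | true | true rewrite ==-sym a b with b ≟ a
      ...     | yes refl rewrite irrefl G a = refl
      ...     | no _ with adj G a b
      ...       | true = refl
      ...       | false = refl

    -- An edge meeting `C` is counted on side `A`, every other edge of `G` on side `B`, and the
    -- completed `S` adds `s(s − 1)` on side `A`. Putting `# S` on the left and `s · s` on the right
    -- avoids subtraction.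
    weights : weight VA EA + (weight VB (adj G) + # S) ≡ degree-sum G + # S * # S
    weights = begin
      weight VA EA + (weight VB (adj G) + # S) ≡⟨ cong (weight VA EA +_) (trans (cong (weight VB (adj G) +_) (≡-sym (sum₂-diag (λ a → [ S a ])))) (≡-sym (sum₂-+ (λ a b → [ VB a ] * ([ VB b ] * [ adj G a b ])) _))) ⟩
      weight VA EA + sum₂ (λ a b → [ VB a ] * ([ VB b ] * [ adj G a b ]) + [ b == a ] * [ S a ]) ≡⟨ ≡-sym (sum₂-+ (λ a b → [ VA a ] * ([ VA b ] * [ EA a b ])) _) ⟩
      sum₂ (λ a b → [ VA a ] * ([ VA b ] * [ EA a b ]) + ([ VB a ] * ([ VB b ] * [ adj G a b ]) + [ b == a ] * [ S a ])) ≡⟨ sum₂-cong point ⟩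
      sum₂ (λ a b → [ adj G a b ] + [ S a ] * [ S b ]) ≡⟨ sum₂-+ (λ a b → [ adj G a b ]) _ ⟩
      degree-sum G + sum₂ (λ a b → [ S a ] * [ S b ]) ≡⟨ cong (degree-sum G +_) (sum₂-product (λ a → [ S a ]) (λ b → [ S b ])) ⟩
      degree-sum G + # S * # S ∎
      where open ≡-Reasoning

    sizes : # VA + # VB ≡ n G + # S
    sizes = begin
      # VA + # VB ≡⟨ ≡-sym (∑-distrib-+ (λ w → [ VA w ]) _) ⟩
      sum (λ w → [ VA w ] + [ VB w ]) ≡⟨ sum-cong-≗ pt ⟩
      sum (λ w → 1 + [ S w ]) ≡⟨ ∑-distrib-+ {n G} (λ _ → 1) (λ w → [ S w ]) ⟩
      sum {n G} (λ _ → 1) + # S ≡⟨ cong (_+ # S) (trans (sum-const (n G) 1) (*-identityʳ _)) ⟩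
      n G + # S ∎
      where
      open ≡-Reasoning
      pt : ∀ w → [ VA w ] + [ VB w ] ≡ 1 + [ S w ]
      pt w with C w in cw
      ... | true rewrite disjoint w cw = refl
      ... | false = +-comm [ S w ] 1

    S≤VA : # S ≤ # VA
    S≤VA = sum-mono pt
      where
      pt : ∀ w → [ S w ] ≤ [ VA w ]
      pt w with C w
      ... | true = []≤1 (S w)
      ... | false = ≤-refl

    S≤VB : # S ≤ # VB
    S≤VB = sum-mono pt
      where
      pt : ∀ w → [ S w ] ≤ [ VB w ]
      pt w with C w in cw
      ... | true rewrite disjoint w cw = ≤-refl
      ... | false = []≤1 (S w)

    -- Contracting C into s adds the edge st to the other side.
    module Absorb (s t c c′ : Fin (n G)) (Ss : S s ≡ true) (St : S t ≡ true) (nst : adj G s t ≡ false) (s≢t : s ≢ t)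
      (cs : adj G c s ≡ true) (c′t : adj G c′ t ≡ true) (Cc′ : C c′ ≡ true)
      (toc : ∀ w → C w ≡ true → WalkIn G (λ z → C z ≡ true) w c) where

      private
        edge : Fin (n G) → Fin (n G) → Bool
        edge a b = ((a == s) ∧ (b == t)) ∨ ((b == s) ∧ (a == t))
        EB : Fin (n G) → Fin (n G) → Bool
        EB a b = adj G a b ∨ edge a b
        Cs : C s ≡ false
        Cs = ¬true⇒false λ h → true≢false Ss (disjoint s h)
        Ct : C t ≡ false
        Ct = ¬true⇒false λ h → true≢false St (disjoint t h)
        br : Fin (n G) → Maybe (Fin (n G))
        br w = if C w then just s else just w
        br-in : ∀ w → C w ≡ true → br w ≡ just s
        br-in w h rewrite h = refl
        br-out : ∀ w → C w ≡ false → br w ≡ just w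
        br-out w h rewrite h = refl
        conn : ∀ w z → VB z ≡ true → br w ≡ just z → WalkIn G (λ y → br y ≡ just z) w z
        conn w z hz h with C w in cw
        conn w z hz refl | false = here (br-out w cw)
        conn w z hz refl | true = walk-snoc (walk-map (λ {y} → br-in y) (toc w cw)) cs (br-out s Cs)
        edge-comm : ∀ a b → edge a b ≡ edge b a
        edge-comm a b with a == s | b == t | b == s | a == t
        ... | true | true | true | true = refl
        ... | true | true | true | false = refl
        ... | true | true | false | true = refl
        ... | true | true | false | false = refl
        ... | true | false | true | true = refl
        ... | true | false | true | false = refl
        ... | true | false | false | true = refl
        ... | true | false | false | false = refl
        ... | false | true | true | true = refl
        ... | false | true | true | false = refl
        ... | false | true | false | true = refl
        ... | false | true | false | false = refl
        ... | false | false | true | true = refl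
        ... | false | false | true | false = refl
        ... | false | false | false | true = refl
        ... | false | false | false | false = refl
        edge-irr : ∀ a → edge a a ≡ false
        edge-irr a with a ≟ s | a ≟ t
        ... | yes refl | yes q = ⊥-elim (s≢t q)
        ... | yes _ | no _ = refl
        ... | no _ | yes _ = refl
        ... | no _ | no _ = refl
        real : ∀ a b → VB a ≡ true → VB b ≡ true → EB a b ≡ true → ∃[ p ] ∃[ q ] (br p ≡ just a × br q ≡ just b × adj G p q ≡ true)
        real a b ha hb h with ∨-elim {adj G a b} h
        ... | inj₁ e = a , b , br-out a (not-elim ha) , br-out b (not-elim hb) , e
        ... | inj₂ h′ with ∨-elim {(a == s) ∧ (b == t)} h′
        ...   | inj₁ e with ==⇒≡ (proj₁ (∧-elim {a == s} e)) | ==⇒≡ (proj₂ (∧-elim {a == s} e))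
        ...     | refl | refl = c′ , t , br-in c′ Cc′ , br-out t Ct , c′t
        real a b ha hb h | inj₂ h′ | inj₂ e with ==⇒≡ (proj₁ (∧-elim {b == s} e)) | ==⇒≡ (proj₂ (∧-elim {b == s} e))
        ...     | refl | refl = t , c′ , br-out t Ct , br-in c′ Cc′ , trans (sym G t c′) c′t

      absorb : Sub G
      absorb = record
        { V = VB ; E = EB ; E-sym = λ a b → cong₂ _∨_ (sym G a b) (edge-comm a b)
        ; E-irr = λ a → cong₂ _∨_ (irrefl G a) (edge-irr a)
        ; br = br ; br-rep = λ w h → br-out w (not-elim h) ; br-conn = λ {w} {z} → conn w z ; real = real }

      -- The pair `st` is not an edge of `G` and both ends lie outside `C`, so both of its ordered
      -- entries are gained.
      absorb-weight : weight VB (adj G) + 2 ≤ weight VB EB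
      absorb-weight = begin
        weight VB (adj G) + 2 ≡⟨ cong (weight VB (adj G) +_) (≡-sym (trans (sum₂-+ (λ a b → [ a == s ] * [ b == t ]) _) (cong₂ _+_ (trans (sum₂-row s _) one) (trans (sum₂-col s _) one)))) ⟩
        weight VB (adj G) + sum₂ (λ a b → [ a == s ] * [ b == t ] + [ b == s ] * [ a == t ]) ≡⟨ ≡-sym (sum₂-+ (λ a b → [ VB a ] * ([ VB b ] * [ adj G a b ])) _) ⟩
        sum₂ (λ a b → [ VB a ] * ([ VB b ] * [ adj G a b ]) + ([ a == s ] * [ b == t ] + [ b == s ] * [ a == t ])) ≤⟨ sum₂-mono pt ⟩
        weight VB EB ∎
        where
        open ≤-Reasoning
        one : sum (λ b → [ b == t ]) ≡ 1
        one = trans (sum-cong-≗ {n G} {λ b → [ b == t ]} {λ b → [ b == t ] * 1} (λ b → ≡-sym (*-identityʳ _))) (sum-delta t (λ _ → 1))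
        pt : ∀ a b → [ VB a ] * ([ VB b ] * [ adj G a b ]) + ([ a == s ] * [ b == t ] + [ b == s ] * [ a == t ]) ≤ [ VB a ] * ([ VB b ] * [ EB a b ])
        pt a b with a ≟ s | b ≟ t
        ... | yes refl | yes refl rewrite Cs | Ct | nst | ≢⇒== {u = t} {s} (s≢t ∘ ≡-sym) = ≤-refl
        ... | yes refl | no _ rewrite ≢⇒== s≢t | *-zeroʳ [ b == s ] | +-identityʳ ([ VB s ] * ([ VB b ] * [ adj G s b ])) with adj G s b
        ...   | true = ≤-refl
        ...   | false = ≤-trans (≤-reflexive (trans (cong ([ VB s ] *_) (*-zeroʳ [ VB b ])) (*-zeroʳ [ VB s ]))) z≤n
        pt a b | no _ | _ with b ≟ s | a ≟ t
        ... | yes refl | yes refl rewrite Cs | Ct | sym G t s | nst = ≤-refl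
        ... | yes refl | no _ rewrite +-identityʳ ([ VB a ] * ([ VB s ] * [ adj G a s ])) = weaken a s
          where
          weaken : ∀ a b → [ VB a ] * ([ VB b ] * [ adj G a b ]) ≤ [ VB a ] * ([ VB b ] * [ adj G a b ∨ false ])
          weaken a b with adj G a b
          ... | true = ≤-refl
          ... | false = ≤-refl
        ... | no _ | _ rewrite +-identityʳ ([ VB a ] * ([ VB b ] * [ adj G a b ])) with adj G a b
        ...   | true = ≤-refl
        ...   | false = ≤-trans (≤-reflexive (trans (cong ([ VB a ] *_) (*-zeroʳ [ VB b ])) (*-zeroʳ [ VB a ]))) z≤n

-- Certificates

-- Reduces by matching on both arguments without constructing proofs, which matters because the type
-- checker runs the certificates.
eqF : ∀ {m k} → Fin m → Fin k → Bool
eqF zero zero = true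
eqF (suc i) (suc j) = eqF i j
eqF _ _ = false

eqF⇒≡ : ∀ {m} (i j : Fin m) → eqF i j ≡ true → i ≡ j
eqF⇒≡ zero zero _ = refl
eqF⇒≡ (suc i) (suc j) h = cong suc (eqF⇒≡ i j h)

eqF-refl : ∀ {m} (i : Fin m) → eqF i i ≡ true
eqF-refl zero = refl
eqF-refl (suc i) = eqF-refl i

==≡eqF : ∀ {m} (i j : Fin m) → (i == j) ≡ eqF i j
==≡eqF i j with i ≟ j
... | yes refl = ≡-sym (eqF-refl i)
... | no ne with eqF i j in eq
...   | true = ⊥-elim (ne (eqF⇒≡ i j eq))
...   | false = refl

allF : ∀ {m} → (Fin m → Bool) → Bool
allF {zero} f = true
allF {suc m} f = f zero ∧ allF (f ∘ suc)

allF-elim : ∀ {m} (f : Fin m → Bool) → allF f ≡ true → ∀ i → f i ≡ true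
allF-elim f h zero = proj₁ (∧-elim {f zero} h)
allF-elim f h (suc i) = allF-elim (f ∘ suc) (proj₂ (∧-elim {f zero} h)) i

anyF : ∀ {m} → (Fin m → Bool) → Bool
anyF {zero} f = false
anyF {suc m} f = f zero ∨ anyF (f ∘ suc)

anyF-elim : ∀ {m} (f : Fin m → Bool) → anyF f ≡ true → ∃[ i ] f i ≡ true
anyF-elim {suc m} f h with f zero in eq
... | true = zero , eq
... | false = let i , p = anyF-elim (f ∘ suc) h in suc i , p

data _∈ˡ_ {A : Set} (a : A) : List A → Set where
  hd : ∀ {l} → a ∈ˡ (a ∷ l)
  tl : ∀ {b l} → a ∈ˡ l → a ∈ˡ (b ∷ l)

allL : ∀ {A : Set} → List A → (A → Bool) → Bool
allL [] f = true
allL (a ∷ l) f = f a ∧ allL l f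

allL-elim : ∀ {A : Set} (l : List A) f → allL l f ≡ true → ∀ {a} → a ∈ˡ l → f a ≡ true
allL-elim (a ∷ l) f h hd = proj₁ (∧-elim {f a} h)
allL-elim (a ∷ l) f h (tl p) = allL-elim l f (proj₂ (∧-elim {f a} h)) p

anyL : ∀ {A : Set} → List A → (A → Bool) → Bool
anyL [] f = false
anyL (a ∷ l) f = f a ∨ anyL l f

anyL-elim : ∀ {A : Set} (l : List A) f → anyL l f ≡ true → ∃[ a ] (a ∈ˡ l × f a ≡ true)
anyL-elim (a ∷ l) f h with f a in eq
... | true = a , hd , eq
... | false = let b , p , q = anyL-elim l f h in b , tl p , q

mapˡ : ∀ {A B : Set} (f : A → B) {a l} → a ∈ˡ l → f a ∈ˡ map f l
mapˡ f hd = hd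
mapˡ f (tl p) = tl (mapˡ f p)

unmapˡ : ∀ {A B : Set} (f : A → B) l {b} → b ∈ˡ map f l → ∃[ a ] (a ∈ˡ l × f a ≡ b)
unmapˡ f (a ∷ l) hd = a , hd , refl
unmapˡ f (_ ∷ l) (tl p) = let a , q , e = unmapˡ f l p in a , tl q , e

match : ∀ {k} → Maybe (Fin k) → Fin k → Bool
match (just j) i = eqF j i
match nothing i = false

match⇒≡ : ∀ {k} (c : Maybe (Fin k)) i → match c i ≡ true → c ≡ just i
match⇒≡ (just j) i h = cong just (eqF⇒≡ j i h)

members : ∀ {k m} → Vec (Maybe (Fin k)) m → Fin k → List (Fin m)
members [] i = []
members (c ∷ cs) i = if match c i then zero ∷ map suc (members cs i) else map suc (members cs i)

members-sound : ∀ {k m} (cs : Vec (Maybe (Fin k)) m) i {v} → v ∈ˡ members cs i → lookup cs v ≡ just i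
members-sound (c ∷ cs) i p with match c i in eq
members-sound (c ∷ cs) i hd | true = match⇒≡ c i eq
members-sound (c ∷ cs) i (tl p) | true with unmapˡ suc (members cs i) p
... | v , q , refl = members-sound cs i q
members-sound (c ∷ cs) i p | false with unmapˡ suc (members cs i) p
... | v , q , refl = members-sound cs i q

members-complete : ∀ {k m} (cs : Vec (Maybe (Fin k)) m) i v → lookup cs v ≡ just i → v ∈ˡ members cs i
members-complete (_ ∷ cs) i zero refl rewrite eqF-refl i = hd
members-complete (c ∷ cs) i (suc v) h with match c i
... | true = tl (mapˡ suc (members-complete cs i v h))
... | false = mapˡ suc (members-complete cs i v h)

missing : Fin 8 → Fin 8 → Fin 8 → Fin 8 → Fin 8 → Fin 8 → Bool
missing a b c d x y = ((eqF x a ∧ eqF y b) ∨ (eqF x b ∧ eqF y a)) ∨ ((eqF x c ∧ eqF y d) ∨ (eqF x d ∧ eqF y c))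

module _ {m : ℕ} (K : Fin m → Fin m → Bool) where

  -- Branch sets in certificates are tested only for connections of length at most 2 inside the
  -- class, which keeps the test a bounded search.
  short : List (Fin m) → Fin m → Fin m → Bool
  short ms u v = eqF u v ∨ (K u v ∨ anyL ms (λ w → K u w ∧ K w v))

  touch : List (Fin m) → List (Fin m) → Bool
  touch us vs = anyL us λ u → anyL vs λ v → K u v

  private
    -- `linked` asks for a member with a known neighbour: in a `Pre` the branch set of a vertex may
    -- be empty, but that of a vertex lying on an edge is inhabited.
    linked inside : Vec (List (Fin m)) 8 → Fin 8 → Bool
    linked ms i = anyL (lookup ms i) (λ u → anyF (K u))
    inside ms i = allL (lookup ms i) (λ u → allL (lookup ms i) (λ v → short (lookup ms i) u v))

    pair : Fin 8 → Fin 8 → Fin 8 → Fin 8 → Vec (List (Fin m)) 8 → Fin 8 → Fin 8 → Bool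
    pair a b c d ms i j = eqF i j ∨ (missing a b c d i j ∨ touch (lookup ms i) (lookup ms j))

    apart : Fin 8 → Fin 8 → Fin 8 → Fin 8 → Bool
    apart a b c d = not (eqF a b) ∧ (not (eqF c d) ∧ not ((eqF a c ∧ eqF b d) ∨ (eqF a d ∧ eqF b c)))

    modelOK : Fin 8 → Fin 8 → Fin 8 → Fin 8 → Vec (List (Fin m)) 8 → Bool
    modelOK a b c d ms = apart a b c d ∧ (allF (linked ms) ∧ (allF (inside ms) ∧ allF (λ i → allF (pair a b c d ms i))))

  minorOK : Vec (Maybe (Fin 8)) m → Fin 8 → Fin 8 → Fin 8 → Fin 8 → Bool
  minorOK cs a b c d = modelOK a b c d (tabulate (members cs))

  -- `K` is only a lower bound for the adjacency of `L`, so a minor found among the entries known so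
  -- far is present in every graph that extends them.
  minorOK-sound : ∀ cs a b c d → minorOK cs a b c d ≡ true → ∀ {G : Graph} (L : Graph) (eq : n L ≡ m) →
    (∀ i j → K (subst Fin eq i) (subst Fin eq j) ≡ true → adj L i j ≡ true) → Pre (adj L) G → NoK8=Minor G → ⊥
  minorOK-sound cs a b c d ok {G} L refl KL P free =
    let p₁ , q₁ = ∧-elim {apart a b c d} {allF (linked ms) ∧ (allF (inside ms) ∧ allF (λ i → allF (pair a b c d ms i)))} ok
        ab , p₂ = ∧-elim {not (eqF a b)} p₁
        cd , s = ∧-elim {not (eqF c d)} p₂
        ne , q₂ = ∧-elim {allF (linked ms)} q₁
        co , ed = ∧-elim {allF (inside ms)} q₂
        ne′ = allF-elim (linked ms) ne
    in free a b c d (distinct ab) (distinct cd) (same s)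
         (minor-via (model ne′ (allF-elim (inside ms) co) (λ i → allF-elim (pair a b c d ms i) (allF-elim (λ i → allF (pair a b c d ms i)) ed i))) P λ i →
           let u , p , h = anyL-elim (lookup ms i) (λ u → anyF (K u)) (ne′ i)
               v , q = anyF-elim (K u) h
               w , _ , hw , _ = Pre.edges P u v (KL u v q)
           in u , mem i p , w , hw)
    where
    ms : Vec (List (Fin m)) 8
    ms = tabulate (members cs)
    mem : ∀ i {u} → u ∈ˡ lookup ms i → lookup cs u ≡ just i
    mem i {u} p = members-sound cs i (subst (u ∈ˡ_) (lookup∘tabulate (members cs) i) p)
    mem⁻ : ∀ i u → lookup cs u ≡ just i → u ∈ˡ lookup ms i
    mem⁻ i u h = subst (u ∈ˡ_) (≡-sym (lookup∘tabulate (members cs) i)) (members-complete cs i u h)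
    distinct : ∀ {a b : Fin 8} → not (eqF a b) ≡ true → a ≢ b
    distinct {a} h refl = true≢false (eqF-refl a) (not-elim h)
    same : not ((eqF a c ∧ eqF b d) ∨ (eqF a d ∧ eqF b c)) ≡ true → sameEdge a b c d ≡ false
    same h rewrite ==≡eqF a c | ==≡eqF b d | ==≡eqF a d | ==≡eqF b c = not-elim h
    wanted : ∀ i j → K8minus2 a b c d i j ≡ true → eqF i j ≡ false × missing a b c d i j ≡ false
    wanted i j h rewrite ==≡eqF i j | ==≡eqF i a | ==≡eqF j b | ==≡eqF i b | ==≡eqF j a | ==≡eqF i c | ==≡eqF j d | ==≡eqF i d | ==≡eqF j c
      with ∧-elim {not (eqF i j)} h
    ... | h₁ , h₂ with ∧-elim {not ((eqF i a ∧ eqF j b) ∨ (eqF i b ∧ eqF j a))} h₂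
    ...   | h₃ , h₄ rewrite not-elim h₃ | not-elim h₄ = not-elim h₁ , refl
    model : (∀ i → linked ms i ≡ true) → (∀ i → inside ms i ≡ true) → (∀ i j → pair a b c d ms i j ≡ true) → MinorModel (K8minus2 a b c d) L
    model ne co ed = record
      { branch = lookup cs
      ; nonempty = λ i → let u , p , _ = anyL-elim (lookup ms i) (λ u → anyF (K u)) (ne i) in u , mem i p
      ; connected = λ i u v hu hv → walk i u v hu hv
          (allL-elim (lookup ms i) (λ v → short (lookup ms i) u v)
            (allL-elim (lookup ms i) (λ u → allL (lookup ms i) (λ v → short (lookup ms i) u v)) (co i) (mem⁻ i u hu)) (mem⁻ i v hv))
      ; edges = λ i j h → edge i j (wanted i j h) (ed i j) }
      where
      walk : ∀ i u v → lookup cs u ≡ just i → lookup cs v ≡ just i → short (lookup ms i) u v ≡ true →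
             WalkIn L (λ w → lookup cs w ≡ just i) u v
      walk i u v hu hv h with ∨-elim {eqF u v} h
      ... | inj₁ e = subst (WalkIn L _ u) (eqF⇒≡ u v e) (here hu)
      ... | inj₂ h′ with ∨-elim {K u v} h′
      ...   | inj₁ e = step hu (KL u v e) (here hv)
      ...   | inj₂ e with anyL-elim (lookup ms i) (λ w → K u w ∧ K w v) e
      ...     | w , p , q = step hu (KL u w (proj₁ (∧-elim {K u w} q))) (step (mem i p) (KL w v (proj₂ (∧-elim {K u w} q))) (here hv))
      edge : ∀ i j → eqF i j ≡ false × missing a b c d i j ≡ false →
             (eqF i j ∨ (missing a b c d i j ∨ touch (lookup ms i) (lookup ms j))) ≡ true →
             ∃[ u ] ∃[ v ] (lookup cs u ≡ just i × lookup cs v ≡ just j × adj L u v ≡ true)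
      edge i j (h₁ , h₂) h rewrite h₁ | h₂ with anyL-elim (lookup ms i) (λ u → anyL (lookup ms j) λ v → K u v) h
      ... | u , p , q with anyL-elim (lookup ms j) (λ v → K u v) q
      ...   | v , p′ , e = u , v , mem i p , mem j p′ , KL u v e

-- Partial knowledge of an adjacency matrix, with `nothing` for an undecided pair. As a table,
-- unlike a function, it absorbs an update by replacing an entry, without a further test at every
-- later lookup.
St : ℕ → Set
St m = Vec (Vec (Maybe Bool) m) m

get : ∀ {m} → St m → Fin m → Fin m → Maybe Bool
get σ i j = lookup (lookup σ i) j

put₁ : ∀ {m} → St m → Fin m → Fin m → Bool → St m
put₁ σ i j b = σ [ i ]≔ (lookup σ i [ j ]≔ just b)

put : ∀ {m} → St m → Fin m → Fin m → Bool → St m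
put σ i j b = put₁ (put₁ σ i j b) j i b

infix 4 _⊨_
_⊨_ : ∀ {m} → (Fin m → Fin m → Bool) → St m → Set
A ⊨ σ = ∀ i j b → get σ i j ≡ just b → A i j ≡ b

put₁-sound : ∀ {m} {A : Fin m → Fin m → Bool} (σ : St m) i j b → A ⊨ σ → A i j ≡ b → A ⊨ put₁ σ i j b
put₁-sound σ i j b s e k l c h with k ≟ i
... | no k≢i rewrite lookup∘update′ k≢i σ (lookup σ i [ j ]≔ just b) = s k l c h
... | yes refl rewrite lookup∘update i σ (lookup σ i [ j ]≔ just b) with l ≟ j
...   | no l≢j rewrite lookup∘update′ l≢j (lookup σ i) (just b) = s k l c h
...   | yes refl rewrite lookup∘update j (lookup σ i) (just b) with h
...     | refl = e

put-sound : ∀ {m} {A : Fin m → Fin m → Bool} → (∀ i j → A i j ≡ A j i) → ∀ (σ : St m) i j b → A ⊨ σ → A i j ≡ b → A ⊨ put σ i j b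
put-sound s σ i j b h e = put₁-sound (put₁ σ i j b) j i b (put₁-sound σ i j b h e) (trans (s j i) e)

-- Numbers out of range are sent to the last element. This cannot harm soundness: a bad code merely
-- denotes some other certificate, which is checked all the same.
toF : ∀ m → ℕ → Fin (suc m)
toF zero k = zero
toF (suc m) zero = zero
toF (suc m) (suc k) = suc (toF m k)

-- Least significant digit first: the rightmost digit of a code belongs to position 0, and leading
-- zeros may be dropped.
digits : ∀ {A : Set} → (ℕ → A) → ∀ m → ℕ → Vec A m
digits f zero k = []
digits f (suc m) k = f (k % 10) ∷ digits f m (k / 10)

-- B i j c₀ c₁ splits on the pair ij (first non-adjacent, then adjacent); B′ also records the refuted state;
-- R k π refers to the k-th recorded state, whose vertices are renamed by the decimal digits of π.
data Cert (Leaf : Set) : Set where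
  B B′ : ℕ → ℕ → Cert Leaf → Cert Leaf → Cert Leaf
  L    : Leaf → Cert Leaf
  R    : ℕ → ℕ → Cert Leaf

-- Vertex 0 is the centre x, vertex 1 is the contracted component y, vertex 2 + i is the i-th neighbour of x.
lift₂ : ∀ {d} → (Fin d → Fin d) → Fin (2 + d) → Fin (2 + d)
lift₂ π zero = zero
lift₂ π (suc zero) = suc zero
lift₂ π (suc (suc i)) = suc (suc (π i))

find : ∀ {d k} → Vec (Fin d) k → Fin d → Maybe (Fin k)
find [] j = nothing
find (i ∷ π) j = if eqF i j then just zero else Data.Maybe.map suc (find π j)

-- The value falls back to `j` when `j` is not hit. `permOK` tests both inverse laws, so digit
-- strings that are not permutations are rejected.
inverse : ∀ {d} → Vec (Fin d) d → Fin d → Fin d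
inverse π j = maybe′ id j (find π j)

leftInv rightInv : ∀ {d} → Vec (Fin d) d → Fin d → Bool
leftInv π i = eqF (inverse π (lookup π i)) i
rightInv π j = eqF (lookup π (inverse π j)) j

permOK : ∀ {d} → Vec (Fin d) d → Bool
permOK π = allF (leftInv π) ∧ allF (rightInv π)

sameMB : Bool → Maybe Bool → Bool
sameMB true (just true) = true
sameMB false (just false) = true
sameMB _ _ = false

sameMB⇒≡ : ∀ b x → sameMB b x ≡ true → x ≡ just b
sameMB⇒≡ true (just true) _ = refl
sameMB⇒≡ false (just false) _ = refl

entry : Maybe Bool → Maybe Bool → Bool
entry nothing x = true
entry (just b) x = sameMB b x

rowOK : ∀ {m k} → Vec (Maybe Bool) k → (Fin k → Fin m) → Vec (Maybe Bool) m → Bool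
rowOK [] π r = true
rowOK (x ∷ xs) π r = entry x (lookup r (π zero)) ∧ rowOK xs (π ∘ suc) r

rowOK-elim : ∀ {m k} (xs : Vec (Maybe Bool) k) (π : Fin k → Fin m) r → rowOK xs π r ≡ true →
  ∀ j b → lookup xs j ≡ just b → lookup r (π j) ≡ just b
rowOK-elim (x ∷ xs) π r h zero b refl = sameMB⇒≡ b _ (proj₁ (∧-elim {entry (just b) (lookup r (π zero))} h))
rowOK-elim (x ∷ xs) π r h (suc j) b e = rowOK-elim xs (π ∘ suc) r (proj₂ (∧-elim {entry x (lookup r (π zero))} h)) j b e

module Checker (d′ : ℕ) (Leaf : Set) (leafOK : St (2 + suc d′) → Leaf → Bool) where
  d m : ℕ
  d = suc d′
  m = 2 + d

  rowsOK : St m → Vec (Fin d) d → St m → Fin m → Bool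
  rowsOK τ π σ i = rowOK (lookup τ i) (lift₂ (lookup π)) (lookup σ (lift₂ (lookup π) i))

  -- After renaming by `π`, the state `σ` must contain every entry that `τ` knows. It may know more,
  -- so one refuted state closes all its refinements.
  refOK : Maybe (St m) → Vec (Fin d) d → St m → Bool
  refOK nothing π σ = false
  refOK (just τ) π σ = permOK π ∧ allF (rowsOK τ π σ)

  nth : List (St m) → ℕ → Maybe (St m)
  nth [] k = nothing
  nth (σ ∷ Γ) zero = just σ
  nth (σ ∷ Γ) (suc k) = nth Γ k

  guard : Bool → List (St m) → Maybe (List (St m))
  guard true Γ = just Γ
  guard false Γ = nothing

  check : Cert Leaf → St m → List (St m) → Maybe (List (St m))
  check (B i j c₀ c₁) σ Γ = check c₀ (put σ (toF _ i) (toF _ j) false) Γ >>= check c₁ (put σ (toF _ i) (toF _ j) true)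
  -- The refuted state goes to the front, so `R 0` means the latest one; what the first branch
  -- records is already available in the second.
  check (B′ i j c₀ c₁) σ Γ = (check c₀ (put σ (toF _ i) (toF _ j) false) Γ >>= check c₁ (put σ (toF _ i) (toF _ j) true)) >>= λ Γ′ → just (σ ∷ Γ′)
  check (L l) σ Γ = guard (leafOK σ l) Γ
  check (R k p) σ Γ = guard (refOK (nth Γ k) (digits (toF d′) d p) σ) Γ

  accepts : Cert Leaf → St m → List (St m) → Bool
  accepts c σ Γ = is-just (check c σ Γ)

  -- The class of matrices is a parameter closed under renaming the neighbours: it is instantiated
  -- once by neighbourhoods in a minimal dense graph and once by those in a minimal uncolourable
  -- graph.
  module Sound
    (Valid : (Fin m → Fin m → Bool) → Set)
    (Valid-sym : ∀ {A} → Valid A → ∀ i j → A i j ≡ A j i)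
    (Valid-perm : ∀ {A} (π π⁻¹ : Fin d → Fin d) → (∀ i → π⁻¹ (π i) ≡ i) → (∀ j → π (π⁻¹ j) ≡ j) →
                  Valid A → Valid (λ i j → A (lift₂ π i) (lift₂ π j)))
    (leaf-sound : ∀ σ l → leafOK σ l ≡ true → ∀ A → Valid A → A ⊨ σ → ⊥) where

    Refuted : St m → Set
    Refuted σ = ∀ A → Valid A → A ⊨ σ → ⊥

    data AllRefuted : List (St m) → Set where
      []  : AllRefuted []
      _∷_ : ∀ {σ Γ} → Refuted σ → AllRefuted Γ → AllRefuted (σ ∷ Γ)

    nth-sound : ∀ {Γ} → AllRefuted Γ → ∀ k {τ} → nth Γ k ≡ just τ → Refuted τ
    nth-sound (r ∷ rs) zero refl = r
    nth-sound (r ∷ rs) (suc k) h = nth-sound rs k h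

    guard-elim : ∀ b Γ {Γ′} → guard b Γ ≡ just Γ′ → b ≡ true × Γ ≡ Γ′
    guard-elim true Γ refl = refl , refl

    split : ∀ σ i j → Refuted (put σ i j false) → Refuted (put σ i j true) → Refuted σ
    split σ i j r₀ r₁ A v s with A i j in eq
    ... | false = r₀ A v (put-sound (Valid-sym v) σ i j false s eq)
    ... | true = r₁ A v (put-sound (Valid-sym v) σ i j true s eq)

    -- A valid matrix satisfying `σ` becomes, after renaming by `π`, a valid matrix satisfying `τ`.
    -- So the refutation of `τ` need not be repeated for its symmetric copies.
    ref-sound : ∀ τ π σ → refOK (just τ) π σ ≡ true → Refuted τ → Refuted σ
    ref-sound τ π σ h r A v s with ∧-elim {permOK π} h
    ... | p , q with ∧-elim {allF (leftInv π)} p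
    ...   | p₁ , p₂ = r _ (Valid-perm (lookup π) (inverse π) (λ i → eqF⇒≡ _ _ (allF-elim (leftInv π) p₁ i)) (λ j → eqF⇒≡ _ _ (allF-elim (rightInv π) p₂ j)) v)
      λ i j b e → s _ _ b (rowOK-elim (lookup τ i) (lift₂ (lookup π)) (lookup σ (lift₂ (lookup π) i)) (allF-elim (rowsOK τ π σ) q i) j b e)

    check-sound : ∀ c σ {Γ Γ′} → check c σ Γ ≡ just Γ′ → AllRefuted Γ → Refuted σ × AllRefuted Γ′
    check-sound (B i j c₀ c₁) σ {Γ} h rs with bind-just (check c₀ (put σ (toF _ i) (toF _ j) false) Γ) h
    ... | Γ₁ , h₀ , h₁ with check-sound c₀ _ h₀ rs
    ...   | r₀ , rs₀ with check-sound c₁ _ h₁ rs₀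
    ...     | r₁ , rs₁ = split σ _ _ r₀ r₁ , rs₁
    check-sound (B′ i j c₀ c₁) σ {Γ} h rs with bind-just (check c₀ (put σ (toF _ i) (toF _ j) false) Γ >>= check c₁ (put σ (toF _ i) (toF _ j) true)) h
    ... | Γ₂ , h₂ , refl with bind-just (check c₀ (put σ (toF _ i) (toF _ j) false) Γ) h₂
    ...   | Γ₁ , h₀ , h₁ with check-sound c₀ _ h₀ rs
    ...     | r₀ , rs₀ with check-sound c₁ _ h₁ rs₀
    ...       | r₁ , rs₁ = split σ _ _ r₀ r₁ , (split σ _ _ r₀ r₁ ∷ rs₁)
    check-sound (L l) σ {Γ} h rs with guard-elim (leafOK σ l) Γ h
    ... | ok , refl = leaf-sound σ l ok , rs
    check-sound (R k p) σ {Γ} h rs with guard-elim (refOK (nth Γ k) (digits (toF d′) d p) σ) Γ h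
    ... | ok , refl with nth Γ k in eq
    ...   | just τ = ref-sound τ (digits (toF d′) d p) σ ok (nth-sound rs k eq) , rs

    accepts-sound : ∀ c σ Γ → accepts c σ Γ ≡ true → AllRefuted Γ → Refuted σ
    accepts-sound c σ Γ h rs with check c σ Γ in eq
    ... | just Γ′ = proj₁ (check-sound c σ eq rs)

isTrue isFalse : Maybe Bool → Bool
isTrue (just true) = true
isTrue _ = false
isFalse (just false) = true
isFalse _ = false

isTrue⇒ : ∀ x → isTrue x ≡ true → x ≡ just true
isTrue⇒ (just true) _ = refl

isFalse⇒ : ∀ x → isFalse x ≡ true → x ≡ just false
isFalse⇒ (just false) _ = refl

known : ∀ {m} → St m → Fin m → Fin m → Bool
known σ i j = isTrue (get σ i j)

-- Neighbourhood matrices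

nb : ∀ {d} → Fin d → Fin (2 + d)
nb i = suc (suc i)

-- The graph on `x`, `y` and the neighbours of `x`: `A` is the adjacency among the neighbours, and
-- `S` the set of those attached to `y`.
local : ∀ {d} → (Fin d → Fin d → Bool) → (Fin d → Bool) → Fin (2 + d) → Fin (2 + d) → Bool
local A S zero zero = false
local A S zero (suc zero) = false
local A S zero (suc (suc j)) = true
local A S (suc zero) zero = false
local A S (suc zero) (suc zero) = false
local A S (suc zero) (suc (suc j)) = S j
local A S (suc (suc i)) zero = true
local A S (suc (suc i)) (suc zero) = S i
local A S (suc (suc i)) (suc (suc j)) = A i j

local-sym : ∀ {d} {A : Fin d → Fin d → Bool} {S} → (∀ i j → A i j ≡ A j i) → ∀ i j → local A S i j ≡ local A S j i
local-sym s zero zero = refl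
local-sym s zero (suc zero) = refl
local-sym s zero (suc (suc j)) = refl
local-sym s (suc zero) zero = refl
local-sym s (suc zero) (suc zero) = refl
local-sym s (suc zero) (suc (suc j)) = refl
local-sym s (suc (suc i)) zero = refl
local-sym s (suc (suc i)) (suc zero) = refl
local-sym s (suc (suc i)) (suc (suc j)) = s i j

local-lift : ∀ {d} (A : Fin d → Fin d → Bool) S (π : Fin d → Fin d) i j →
  local A S (lift₂ π i) (lift₂ π j) ≡ local (λ a b → A (π a) (π b)) (S ∘ π) i j
local-lift A S π zero zero = refl
local-lift A S π zero (suc zero) = refl
local-lift A S π zero (suc (suc j)) = refl
local-lift A S π (suc zero) zero = refl
local-lift A S π (suc zero) (suc zero) = refl
local-lift A S π (suc zero) (suc (suc j)) = refl
local-lift A S π (suc (suc i)) zero = refl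
local-lift A S π (suc (suc i)) (suc zero) = refl
local-lift A S π (suc (suc i)) (suc (suc j)) = refl

module Neighbourhood (G : Graph) (x : Fin (n G)) (d : ℕ) where

  record Numbering : Set where
    field
      e     : Fin d → Fin (n G)
      ix    : Fin (n G) → Maybe (Fin d)
      ix-e  : ∀ i → ix (e i) ≡ just i
      e-ix  : ∀ {w i} → ix w ≡ just i → e i ≡ w
      e-nbr : ∀ i → adj G x (e i) ≡ true
      onto  : ∀ {w} → adj G x w ≡ true → ∃[ i ] e i ≡ w
      e-sum : ∀ f → sum (f ∘ e) ≡ sum (λ w → [ adj G x w ] * f w)

    e-inj : ∀ {i j} → e i ≡ e j → i ≡ j
    e-inj {i} {j} h with trans (≡-sym (ix-e i)) (trans (cong ix h) (ix-e j))
    ... | refl = refl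

    x≢e : ∀ i → x ≢ e i
    x≢e i h = true≢false (subst (λ z → adj G x z ≡ true) (≡-sym h) (e-nbr i)) (irrefl G x)

    ix-x : ix x ≡ nothing
    ix-x with ix x in eq
    ... | nothing = refl
    ... | just i = ⊥-elim (x≢e i (≡-sym (e-ix eq)))

  numbering : degree G x ≡ d → Numbering
  numbering refl = record
    { e = to ; ix = from ; ix-e = from-to ; e-ix = to-from ; e-nbr = to-sat ; onto = from-sat ; e-sum = to-sum }
    where open Enum (enum (adj G x))

  renumber : (π π⁻¹ : Fin d → Fin d) → (∀ i → π⁻¹ (π i) ≡ i) → (∀ j → π (π⁻¹ j) ≡ j) → Numbering → Numbering
  renumber π π⁻¹ l r N = record
    { e = e ∘ π ; ix = λ w → Data.Maybe.map π⁻¹ (ix w)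
    ; ix-e = λ i → trans (cong (Data.Maybe.map π⁻¹) (ix-e (π i))) (cong just (l i))
    ; e-ix = λ {w} {i} → back w i
    ; e-nbr = λ i → e-nbr (π i)
    ; onto = λ h → let i , p = onto h in π⁻¹ i , trans (cong e (r i)) p
    ; e-sum = λ f → trans (≡-sym (sum-bijection (f ∘ e))) (e-sum f) }
    where
    open Numbering N
    back : ∀ w i → Data.Maybe.map π⁻¹ (ix w) ≡ just i → e (π i) ≡ w
    back w i h with ix w in eq
    back w _ refl | just j = trans (cong e (r j)) (e-ix eq)
    sum-bijection : ∀ (f : Fin d → ℕ) → sum f ≡ sum (f ∘ π)
    sum-bijection f = trans (sum≡std f) (trans (Std.sum-permute f (permutation π π⁻¹ r l)) (≡-sym (sum≡std (f ∘ π))))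

anyF-intro : ∀ {m} (f : Fin m → Bool) i → f i ≡ true → anyF f ≡ true
anyF-intro f zero h = ∨-introˡ h
anyF-intro f (suc i) h = ∨-introʳ {f zero} (anyF-intro (f ∘ suc) i h)

-- Local configurations in a minimal dense graph

-- Leaves: too many non-neighbours; a minor; a separation along a completable set of 4 or of 5 vertices.
data LeafE : Set where
  D  : ℕ → LeafE
  M  : ℕ → ℕ → LeafE
  S₄ : ℕ → LeafE
  S₅ : ℕ → ℕ → ℕ → LeafE

-- Digits 0 to 7 name branch sets; 8 and 9 leave the vertex out.
class₈ : ℕ → Maybe (Fin 8)
class₈ k = if k ≤ᵇ 7 then just (toF 7 k) else nothing

digit₈ : ℕ → Fin 4 → Fin 8
digit₈ p = lookup (digits (toF 7) 4 p)

minorCode : ∀ {m} → (Fin m → Fin m → Bool) → ℕ → ℕ → Bool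
minorCode {m} K c p = minorOK K (digits class₈ m c) (digit₈ p zero) (digit₈ p (suc zero)) (digit₈ p (suc (suc zero))) (digit₈ p (suc (suc (suc zero))))

minorCode-sound : ∀ {m} (K : Fin m → Fin m → Bool) c p → minorCode K c p ≡ true → ∀ {G : Graph} (H : Graph) (eq : n H ≡ m) →
  (∀ i j → K (subst Fin eq i) (subst Fin eq j) ≡ true → adj H i j ≡ true) → Pre (adj H) G → NoK8=Minor G → ⊥
minorCode-sound {m} K c p = minorOK-sound K (digits class₈ m c) (digit₈ p zero) (digit₈ p (suc zero)) (digit₈ p (suc (suc zero))) (digit₈ p (suc (suc (suc zero))))

module ExtLeaf (d′ : ℕ) where
  d m : ℕ
  d = suc d′
  m = 2 + d

  y : Fin m
  y = suc zero

  class : ℕ → Maybe (Fin d)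
  class k = if k ≤ᵇ 8 then just (toF d′ k) else nothing

  module _ (σ : St m) where

    refuses : Fin d → Fin d → Bool
    refuses i j = not (eqF i j) ∧ isFalse (get σ (nb i) (nb j))

    module _ (cs : Vec (Maybe (Fin d)) m) where

      -- The code assigns vertices of `N[x]` to classes named after neighbours of `x`. The
      -- neighbours assigned to themselves form `S`; `cover` says that every neighbour outside `S`
      -- is known not to be attached to `C`.
      rep cover : Fin d → Bool
      rep i = match (lookup cs (nb i)) i
      cover i = rep i ∨ isFalse (get σ y (nb i))

      -- Each class is to be contracted onto its representative, so every member must reach it
      -- within two steps inside the class.
      nearTo : Vec (List (Fin m)) d → Fin m → Maybe (Fin d) → Bool
      nearTo ms v nothing = true
      nearTo ms v (just s) = rep s ∧ short (known σ) (lookup ms s) v (nb s)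

      near : Vec (List (Fin m)) d → Fin m → Bool
      near ms v = nearTo ms v (lookup cs v)

      joined : Vec (List (Fin m)) d → Fin d → Fin d → Bool
      joined ms s t = not (rep s) ∨ (not (rep t) ∨ (eqF s t ∨ touch (known σ) (lookup ms s) (lookup ms t)))

      -- `C` is kept intact on the completed side, so `y` must not be spent on contracting `N[x]`
      -- onto `S`.
      free-of-y : Bool
      free-of-y = not (is-just (lookup cs y))

      completes : Vec (List (Fin m)) d → Bool
      completes ms = free-of-y ∧ (allF cover ∧ (allF (near ms) ∧ allF (λ s → allF (joined ms s))))

      sepOK : ℕ → Bool
      sepOK k = (# rep ≡ᵇ k) ∧ completes (tabulate (members cs))

  leafOK : St m → LeafE → Bool
  leafOK σ (D i) = d ≤ᵇ # refuses σ (toF d′ i) + 5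
  leafOK σ (M c p) = minorCode (known σ) c p
  leafOK σ (S₄ c) = sepOK σ (digits class m c) 4
  leafOK σ (S₅ c s t) = sepOK σ (digits class m c) 5 ∧
    ((rep σ (digits class m c) s′ ∧ rep σ (digits class m c) t′) ∧
     ((isTrue (get σ y (nb s′)) ∧ isTrue (get σ y (nb t′))) ∧ (isFalse (get σ (nb s′) (nb t′)) ∧ not (eqF s′ t′))))
    where
    s′ t′ : Fin d
    s′ = toF d′ s
    t′ = toF d′ t

  open Checker d′ LeafE leafOK public using (accepts)

  module Refute (G : Graph) (free : NoK8=Minor G) (dense : 10 * n G ≤ degree-sum G + 26)
    (IH : ∀ (N : Sub G) → 4 ≤ # Sub.V N → # Sub.V N < n G → weight (Sub.V N) (Sub.E N) + 28 ≤ 10 * # Sub.V N)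
    (x : Fin (n G)) (triangles : ∀ w → adj G x w ≡ true → 5 ≤ # (λ z → adj G x z ∧ adj G w z))
    (C : Fin (n G) → Bool) (c₀ : Fin (n G)) (Cc₀ : C c₀ ≡ true)
    (C-conn : ∀ w → C w ≡ true → WalkIn G (λ z → C z ≡ true) c₀ w)
    (C-out : ∀ w → C w ≡ true → w ≢ x × adj G x w ≡ false)
    (C-closed : ∀ u w → C u ≡ true → adj G u w ≡ true → w ≢ x → adj G x w ≡ false → C w ≡ true) where

    open Neighbourhood G x d

    attached : Fin (n G) → Bool
    attached w = anyF λ c → C c ∧ adj G c w

    shape : Numbering → Fin m → Fin m → Bool
    shape N = local (λ i j → adj G (e i) (e j)) (λ i → attached (e i))
      where open Numbering N

    -- The matrix seen from `x` under some numbering, with the component `C` shrunk to `y`.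
    Valid : (Fin m → Fin m → Bool) → Set
    Valid A = Σ Numbering λ N → ∀ i j → A i j ≡ shape N i j

    shape-sym : ∀ N i j → shape N i j ≡ shape N j i
    shape-sym N = local-sym λ i j → sym G _ _

    Valid-sym : ∀ {A} → Valid A → ∀ i j → A i j ≡ A j i
    Valid-sym (N , h) i j = trans (h i j) (trans (shape-sym N i j) (≡-sym (h j i)))

    Valid-perm : ∀ {A} (π π⁻¹ : Fin d → Fin d) → (∀ i → π⁻¹ (π i) ≡ i) → (∀ j → π (π⁻¹ j) ≡ j) →
                 Valid A → Valid (λ i j → A (lift₂ π i) (lift₂ π j))
    Valid-perm π π⁻¹ l r (N , h) = renumber π π⁻¹ l r N , λ i j → trans (h _ _) (local-lift _ _ π i j)

    not-x : ∀ w → adj G x w ≡ true → C w ≡ false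
    not-x w h = ¬true⇒false λ c → true≢false h (proj₂ (C-out w c))

    C-x : C x ≡ false
    C-x = ¬true⇒false λ c → proj₁ (C-out x c) refl

    module _ (N : Numbering) (σ : St m) (sat : shape N ⊨ σ) where
      open Numbering N

      C-e : ∀ i → C (e i) ≡ false
      C-e i = not-x (e i) (e-nbr i)

      pos : Fin (n G) → Maybe (Fin m)
      pos w = if w == x then just zero else Data.Maybe.map nb (ix w)

      pos-x : pos x ≡ just zero
      pos-x rewrite ==-refl x = refl

      pos-e : ∀ i → pos (e i) ≡ just (nb i)
      pos-e i rewrite ≢⇒== (x≢e i ∘ ≡-sym) | ix-e i = refl

      pos-cases : ∀ w p → pos w ≡ just p → (p ≡ zero × w ≡ x) ⊎ ∃[ i ] (p ≡ nb i × w ≡ e i)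
      pos-cases w p h with w ≟ x
      pos-cases w _ refl | yes q = inj₁ (refl , q)
      ... | no q with ix w in eq
      pos-cases w _ refl | no q | just i = inj₂ (i , refl , ≡-sym (e-ix eq))

      -- The vertex has at least 5 neighbours in `N(x)` by the triangle count; these, its known
      -- non-neighbours and the vertex itself must fit among the `d` neighbours of `x`.
      degree-leaf : ∀ i → # refuses σ i + 5 ≥ d → ⊥
      degree-leaf i h = <⇒≱ (s≤s (≤-trans (+-monoʳ-≤ (# refuses σ i) tri) (≤-reflexive (+-comm (# refuses σ i) _)))) bound
        where
        nbs : ℕ
        nbs = sum λ j → [ adj G (e i) (e j) ]
        tri : 5 ≤ nbs
        tri = ≤-trans (triangles (e i) (e-nbr i)) (≤-reflexive (trans (sum-cong-≗ (λ z → split (adj G x z) (adj G (e i) z))) (≡-sym (e-sum (λ z → [ adj G (e i) z ])))))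
          where
          split : ∀ a b → [ a ∧ b ] ≡ [ a ] * [ b ]
          split true b = ≡-sym (+-identityʳ [ b ])
          split false b = refl
        bound : nbs + # refuses σ i < # refuses σ i + 5
        bound = ≤-trans total h
          where
          pt : ∀ j → [ adj G (e i) (e j) ] + [ refuses σ i j ] + [ j == i ] * 1 ≤ 1
          pt j with j ≟ i
          ... | yes refl rewrite irrefl G (e i) | eqF-refl i = ≤-refl
          ... | no q with eqF i j in eq
          ...   | true = ⊥-elim (q (≡-sym (eqF⇒≡ i j eq)))
          ...   | false with isFalse (get σ (nb i) (nb j)) in eq′
          ...     | true rewrite sat (nb i) (nb j) false (isFalse⇒ _ eq′) = ≤-refl
          ...     | false with adj G (e i) (e j)
          ...       | true = ≤-refl
          ...       | false = z≤n
          total : suc (nbs + # refuses σ i) ≤ d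
          total = begin
            suc (nbs + # refuses σ i) ≡⟨ +-comm 1 _ ⟩
            nbs + # refuses σ i + 1 ≡⟨ cong₂ _+_ (≡-sym (∑-distrib-+ (λ j → [ adj G (e i) (e j) ]) (λ j → [ refuses σ i j ]))) (≡-sym (sum-delta i λ _ → 1)) ⟩
            sum (λ j → [ adj G (e i) (e j) ] + [ refuses σ i j ]) + sum (λ j → [ j == i ] * 1) ≡⟨ ≡-sym (∑-distrib-+ (λ j → [ adj G (e i) (e j) ] + [ refuses σ i j ]) (λ j → [ j == i ] * 1)) ⟩
            sum (λ j → [ adj G (e i) (e j) ] + [ refuses σ i j ] + [ j == i ] * 1) ≤⟨ sum-mono pt ⟩
            sum {d} (λ _ → 1) ≡⟨ trans (sum-const d 1) (*-identityʳ d) ⟩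
            d ∎
            where open ≤-Reasoning

      shape-irr : ∀ p → shape N p p ≡ false
      shape-irr zero = refl
      shape-irr (suc zero) = refl
      shape-irr (suc (suc i)) = irrefl G (e i)

      shape-graph : Graph
      shape-graph = record { n = m ; adj = shape N ; sym = shape-sym N ; irrefl = shape-irr }

      model : Pre (shape N) G
      model = record { branch = br ; connected = conn ; edges = edge }
        where
        br : Fin (n G) → Maybe (Fin m)
        br w = if C w then just y else pos w
        br-C : ∀ w → C w ≡ true → br w ≡ just y
        br-C w h rewrite h = refl
        br-pos : ∀ w → C w ≡ false → br w ≡ pos w
        br-pos w h rewrite h = refl
        br-x : br x ≡ just zero
        br-x = trans (br-pos x C-x) pos-x
        br-e : ∀ i → br (e i) ≡ just (nb i)
        br-e i = trans (br-pos _ (C-e i)) (pos-e i)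
        kinds : ∀ w p → br w ≡ just p → (C w ≡ true × p ≡ y) ⊎ ((p ≡ zero × w ≡ x) ⊎ ∃[ i ] (p ≡ nb i × w ≡ e i))
        kinds w p h with C w
        kinds w _ refl | true = inj₁ (refl , refl)
        ... | false = inj₂ (pos-cases w p h)
        conn : ∀ p u v → br u ≡ just p → br v ≡ just p → WalkIn G (λ w → br w ≡ just p) u v
        conn p u v hu hv with kinds u p hu | kinds v p hv
        ... | inj₁ (cu , refl) | inj₁ (cv , _) = walk-map (λ {w} → br-C w) (walk-++ (walk-rev (C-conn u cu)) (C-conn v cv))
        ... | inj₁ (cu , refl) | inj₂ (inj₁ (() , _))
        ... | inj₁ (cu , refl) | inj₂ (inj₂ (_ , () , _))
        ... | inj₂ (inj₁ (refl , refl)) | inj₂ (inj₁ (_ , refl)) = here hu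
        ... | inj₂ (inj₁ (refl , refl)) | inj₂ (inj₂ (_ , () , _))
        ... | inj₂ (inj₂ (i , refl , refl)) | inj₂ (inj₂ (j , refl , refl)) = here hu
        edge : ∀ p q → shape N p q ≡ true → ∃[ u ] ∃[ v ] (br u ≡ just p × br v ≡ just q × adj G u v ≡ true)
        edge zero (suc (suc j)) _ = x , e j , br-x , br-e j , e-nbr j
        edge (suc (suc i)) zero _ = e i , x , br-e i , br-x , trans (sym G _ _) (e-nbr i)
        edge (suc zero) (suc (suc j)) h with anyF-elim (λ c → C c ∧ adj G c (e j)) h
        ... | c , q = c , e j , br-C c (proj₁ (∧-elim {C c} q)) , br-e j , proj₂ (∧-elim {C c} q)
        edge (suc (suc i)) (suc zero) h with anyF-elim (λ c → C c ∧ adj G c (e i)) h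
        ... | c , q = e i , c , br-e i , br-C c (proj₁ (∧-elim {C c} q)) , trans (sym G _ _) (proj₂ (∧-elim {C c} q))
        edge (suc (suc i)) (suc (suc j)) h = e i , e j , br-e i , br-e j , h

      known⇒ : ∀ p q → known σ p q ≡ true → shape N p q ≡ true
      known⇒ p q h = sat p q true (isTrue⇒ _ h)

      minor-leaf : ∀ c p → minorCode (known σ) c p ≡ true → ⊥
      minor-leaf c p h = minorCode-sound (known σ) c p h shape-graph refl known⇒ model free

      -- Contracting `N[x]` onto `S` turns `C` together with `S` into a minor in which `S` is
      -- complete. That side misses `x` and the other side misses `C`, so both are small enough for
      -- the induction hypothesis.
      module Completion (cs : Vec (Maybe (Fin d)) m) (k : ℕ) (ok : sepOK σ cs k ≡ true) where
        ms : Vec (List (Fin m)) d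
        ms = tabulate (members cs)
        reps : Fin d → Bool
        reps = rep σ cs
        private
          ok₁ = ∧-elim {# reps ≡ᵇ k} {completes σ cs ms} ok
          ok₂ = ∧-elim {free-of-y σ cs} {allF (cover σ cs) ∧ (allF (near σ cs ms) ∧ allF (λ s → allF (joined σ cs ms s)))} (proj₂ ok₁)
          ok₃ = ∧-elim {allF (cover σ cs)} {allF (near σ cs ms) ∧ allF (λ s → allF (joined σ cs ms s))} (proj₂ ok₂)
          ok₄ = ∧-elim {allF (near σ cs ms)} {allF (λ s → allF (joined σ cs ms s))} (proj₂ ok₃)
        size : # reps ≡ k
        size = ≡ᵇ⇒≡ (# reps) k (subst T (≡-sym (proj₁ ok₁)) tt)
        cs-y : lookup cs y ≡ nothing
        cs-y with lookup cs y | proj₁ ok₂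
        ... | nothing | _ = refl
        mem : ∀ s {p} → p ∈ˡ lookup ms s → lookup cs p ≡ just s
        mem s {p} h = members-sound cs s (subst (p ∈ˡ_) (lookup∘tabulate (members cs) s) h)

        S : Fin (n G) → Bool
        S w = maybe′ reps false (ix w)
        S-e : ∀ i → S (e i) ≡ reps i
        S-e i = cong (maybe′ reps false) (ix-e i)
        S-inv : ∀ w → S w ≡ true → ∃[ i ] (e i ≡ w × reps i ≡ true)
        S-inv w h with ix w in eq
        ... | just i = i , e-ix eq , h

        #S : # S ≡ k
        #S = begin
          # S ≡⟨ sum-cong-≗ pt ⟩
          sum (λ w → [ adj G x w ] * [ S w ]) ≡⟨ ≡-sym (e-sum (λ w → [ S w ])) ⟩
          sum (λ i → [ S (e i) ]) ≡⟨ sum-cong-≗ (λ i → cong [_] (S-e i)) ⟩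
          # reps ≡⟨ size ⟩
          k ∎
          where
          open ≡-Reasoning
          pt : ∀ w → [ S w ] ≡ [ adj G x w ] * [ S w ]
          pt w with S w in eq
          ... | false = ≡-sym (*-zeroʳ [ adj G x w ])
          ... | true with S-inv w eq
          ...   | i , refl , _ rewrite e-nbr i = refl

        disjoint : ∀ w → C w ≡ true → S w ≡ false
        disjoint w c = ¬true⇒false λ h → let i , q , _ = S-inv w h in true≢false (subst (λ z → C z ≡ true) (≡-sym q) c) (C-e i)

        -- `C` is a full component outside `N[x]` and `x` has no neighbour in it, so a neighbour of
        -- `C` outside `C` lies in `N(x)`; being attached to `C`, it is in `S` by `cover`.
        closed : ∀ u w → C u ≡ true → adj G u w ≡ true → C w ≡ false → S w ≡ true
        closed u w cu a cw with adj G x w in axw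
        ... | false = ⊥-elim (true≢false (C-closed u w cu a (λ { refl → true≢false (trans (sym G x u) a) (proj₂ (C-out u cu)) }) axw) cw)
        ... | true with onto axw
        ...   | i , refl with ∨-elim {reps i} (allF-elim (cover σ cs) (proj₁ ok₃) i)
        ...     | inj₁ r = trans (S-e i) r
        ...     | inj₂ f = ⊥-elim (true≢false (anyF-intro (λ c → C c ∧ adj G c (e i)) u (∧-intro cu a)) (sat y (nb i) false (isFalse⇒ _ f)))

        open Separation G C S disjoint closed public

        ψ : Fin m → Fin (n G)
        ψ zero = x
        -- A placeholder: no class contains `y`, and `used` excludes it wherever `ψ` is applied to a
        -- class.
        ψ (suc zero) = c₀
        ψ (suc (suc i)) = e i

        used : ∀ {p s} → lookup cs p ≡ just s → p ≢ y
        used {p} h refl with trans (≡-sym h) cs-y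
        ... | ()

        pos-ψ : ∀ p → p ≢ y → pos (ψ p) ≡ just p
        pos-ψ zero q = pos-x
        pos-ψ (suc zero) q = ⊥-elim (q refl)
        pos-ψ (suc (suc i)) q = pos-e i

        C-ψ : ∀ p → p ≢ y → C (ψ p) ≡ false
        C-ψ zero q = C-x
        C-ψ (suc zero) q = ⊥-elim (q refl)
        C-ψ (suc (suc i)) q = C-e i

        adj-ψ : ∀ p q → p ≢ y → q ≢ y → known σ p q ≡ true → adj G (ψ p) (ψ q) ≡ true
        adj-ψ p q hp hq h = go p q hp hq (known⇒ p q h)
          where
          go : ∀ p q → p ≢ y → q ≢ y → shape N p q ≡ true → adj G (ψ p) (ψ q) ≡ true
          go zero (suc zero) hp hq h = ⊥-elim (hq refl)
          go zero (suc (suc j)) hp hq h = e-nbr j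
          go (suc zero) _ hp hq h = ⊥-elim (hp refl)
          go (suc (suc i)) zero hp hq h = trans (sym G _ _) (e-nbr i)
          go (suc (suc i)) (suc zero) hp hq h = ⊥-elim (hq refl)
          go (suc (suc i)) (suc (suc j)) hp hq h = h

        br : Fin (n G) → Maybe (Fin (n G))
        br w = if C w then just w else (pos w >>= λ p → Data.Maybe.map e (lookup cs p))
        br-C : ∀ w → C w ≡ true → br w ≡ just w
        br-C w h rewrite h = refl
        br-ψ : ∀ {p s} → lookup cs p ≡ just s → br (ψ p) ≡ just (e s)
        br-ψ {p} h rewrite C-ψ p (used h) | pos-ψ p (used h) | h = refl
        br-S : ∀ i → reps i ≡ true → br (e i) ≡ just (e i)
        br-S i r = br-ψ {nb i} (match⇒≡ (lookup cs (nb i)) i r)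
        br-V : ∀ w → VA w ≡ true → br w ≡ just w
        br-V w h with ∨-elim {C w} h
        ... | inj₁ c = br-C w c
        ... | inj₂ s with S-inv w s
        ...   | i , refl , r = br-S i r

        class-walk : ∀ p s → lookup cs p ≡ just s → WalkIn G (λ z → br z ≡ just (e s)) (ψ p) (e s)
        class-walk p s h = go (subst (λ c → nearTo σ cs ms p c ≡ true) h (allF-elim (near σ cs ms) (proj₁ ok₄) p))
          where
          rs : ∀ {r} → rep σ cs s ∧ r ≡ true → lookup cs (nb s) ≡ just s
          rs q = match⇒≡ _ s (proj₁ (∧-elim {rep σ cs s} q))
          go : (rep σ cs s ∧ short (known σ) (lookup ms s) p (nb s)) ≡ true → WalkIn G (λ z → br z ≡ just (e s)) (ψ p) (e s)
          go q with ∨-elim {eqF p (nb s)} (proj₂ (∧-elim {rep σ cs s} q))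
          ... | inj₁ eq with eqF⇒≡ p (nb s) eq
          ...   | refl = here (br-ψ {nb s} h)
          go q | inj₂ q′ with ∨-elim {known σ p (nb s)} q′
          ...   | inj₁ k = step (br-ψ h) (adj-ψ p (nb s) (used h) (λ ()) k) (here (br-ψ {nb s} (rs q)))
          ...   | inj₂ k with anyL-elim (lookup ms s) (λ w → known σ p w ∧ known σ w (nb s)) k
          ...     | w , inw , q″ = step (br-ψ h) (adj-ψ p w (used h) (used (mem s inw)) (proj₁ (∧-elim {known σ p w} q″)))
                      (step (br-ψ (mem s inw)) (adj-ψ w (nb s) (used (mem s inw)) (λ ()) (proj₂ (∧-elim {known σ p w} q″))) (here (br-ψ {nb s} (rs q))))

        br-conn : ∀ w v → br w ≡ just v → WalkIn G (λ z → br z ≡ just v) w v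
        br-conn w v h with C w in cw
        br-conn w _ refl | true = here (br-C w cw)
        ... | false with pos w in pw
        ...   | just p with lookup cs p in cp
        ...     | just s with pos-cases w p pw
        br-conn w _ refl | false | just .zero | just s | inj₁ (refl , refl) = class-walk zero s cp
        br-conn w _ refl | false | just .(nb i) | just s | inj₂ (i , refl , refl) = class-walk (nb i) s cp

        real : ∀ u v → VA u ≡ true → VA v ≡ true → EA u v ≡ true → ∃[ a ] ∃[ b ] (br a ≡ just u × br b ≡ just v × adj G a b ≡ true)
        real u v hu hv h with ∨-elim {adj G u v} h
        ... | inj₁ a = u , v , br-V u hu , br-V v hv , a
        ... | inj₂ q with ∧-elim {S u} q
        ...   | su , q′ with ∧-elim {S v} q′
        ...     | sv , ne with S-inv u su | S-inv v sv
        ...       | i , refl , ri | j , refl , rj with allF-elim (joined σ cs ms i) (allF-elim (λ s → allF (joined σ cs ms s)) (proj₂ ok₄) i) j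
        ...         | t rewrite ri | rj with ∨-elim {eqF i j} t
        ...           | inj₁ eq = ⊥-elim (==⇒≢ (not-elim ne) (cong e (eqF⇒≡ i j eq)))
        ...           | inj₂ t′ with anyL-elim (lookup ms i) (λ u → anyL (lookup ms j) λ v → known σ u v) t′
        ...             | p , inp , t″ with anyL-elim (lookup ms j) (known σ p) t″
        ...               | q″ , inq , k = ψ p , ψ q″ , br-ψ (mem i inp) , br-ψ (mem j inq) , adj-ψ p q″ (used (mem i inp)) (used (mem j inq)) k

        EA-sym : ∀ a b → EA a b ≡ EA b a
        EA-sym a b = cong₂ _∨_ (sym G a b) (trans (cong (λ t → S a ∧ (S b ∧ not t)) (==-sym a b)) (flip₃ (S a) (S b) _))
          where
          flip₃ : ∀ p q r → p ∧ (q ∧ r) ≡ q ∧ (p ∧ r)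
          flip₃ true q r = refl
          flip₃ false true r = refl
          flip₃ false false r = refl
        EA-irr : ∀ a → EA a a ≡ false
        EA-irr a rewrite irrefl G a | ==-refl a with S a
        ... | true = refl
        ... | false = refl

        sideA : Sub G
        sideA = record { V = VA ; E = EA ; E-sym = EA-sym ; E-irr = EA-irr ; br = br ; br-rep = br-V
                       ; br-conn = λ {w} {v} _ → br-conn w v ; real = real }

        x∉A : VA x ≡ false
        x∉A rewrite C-x | ix-x = refl
        c₀∉B : VB c₀ ≡ false
        c₀∉B rewrite Cc₀ = refl

        boundA : 4 ≤ k → weight VA EA + 28 ≤ 10 * # VA
        boundA h = IH sideA (≤-trans h (≤-trans (≤-reflexive (≡-sym #S)) S≤VA)) (#-missing VA x x∉A)

      -- The two sides have n + k vertices and degree sum D + k (k − 1) in all, which is too much if both obey the bound.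
      sep₄-leaf : ∀ cs → sepOK σ cs 4 ≡ true → ⊥
      sep₄-leaf cs ok = clash (weight VA EA) (weight VB (adj G)) (degree-sum G) (# VA) (# VB) (n G)
          (subst (λ s → weight VA EA + (weight VB (adj G) + s) ≡ degree-sum G + s * s) #S weights)
          (subst (λ s → # VA + # VB ≡ n G + s) #S sizes) (boundA ≤-refl)
          (IH (restrict G VB) (≤-trans (≤-reflexive (≡-sym #S)) S≤VB) (#-missing VB c₀ c₀∉B)) dense
        where
        open Completion cs 4 ok
        -- Together the two sides have degree sum `r + 12`, but the bounds allow at most
        -- `10(n + 4) − 56`, which is at most `r + 10`.
        clash : ∀ p q r a b n → p + (q + 4) ≡ r + 16 → a + b ≡ n + 4 → p + 28 ≤ 10 * a → q + 28 ≤ 10 * b → 10 * n ≤ r + 26 → ⊥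
        clash p q r a b n e₁ e₂ h₁ h₂ h₃ = from-no (68 ≤? 66) (+-cancelˡ-≤ r 68 66 (begin
          r + 68 ≡⟨ lem₁ r ⟩
          r + 16 + 52 ≡⟨ cong (_+ 52) (≡-sym e₁) ⟩
          p + (q + 4) + 52 ≡⟨ lem₂ p q ⟩
          p + 28 + (q + 28) ≤⟨ +-mono-≤ h₁ h₂ ⟩
          10 * a + 10 * b ≡⟨ ≡-sym (*-distribˡ-+ 10 a b) ⟩
          10 * (a + b) ≡⟨ cong (10 *_) e₂ ⟩
          10 * (n + 4) ≡⟨ *-distribˡ-+ 10 n 4 ⟩
          10 * n + 40 ≤⟨ +-monoˡ-≤ 40 h₃ ⟩
          r + 26 + 40 ≡⟨ +-assoc r 26 40 ⟩
          r + 66 ∎))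
          where
          open ≤-Reasoning
          lem₁ : ∀ r → r + 68 ≡ r + 16 + 52
          lem₁ = solve-∀
          lem₂ : ∀ p q → p + (q + 4) + 52 ≡ p + 28 + (q + 28)
          lem₂ = solve-∀

      -- With five vertices in `S` the bounds allow `10(n + 5) − 56`, at most `r + 20`, and the two
      -- sides have exactly `r + 20`. The pair `s`, `t` tips the balance: it is not an edge and both
      -- ends are attached to `C`, so contracting `C` into `s` adds 2 to the degree sum of the other
      -- side.
      sep₅-leaf : ∀ cs → sepOK σ cs 5 ≡ true → ∀ s t → rep σ cs s ≡ true → rep σ cs t ≡ true →
        isTrue (get σ y (nb s)) ≡ true → isTrue (get σ y (nb t)) ≡ true → isFalse (get σ (nb s) (nb t)) ≡ true → s ≢ t → ⊥
      sep₅-leaf cs ok s t rs rt ys yt st s≢t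
        with anyF-elim (λ c → C c ∧ adj G c (e s)) (known⇒ y (nb s) ys) | anyF-elim (λ c → C c ∧ adj G c (e t)) (known⇒ y (nb t) yt)
      ... | c , hc | c′ , hc′ = clash (weight VA EA) (weight VB (adj G)) (weight VB EB) (degree-sum G) (# VA) (# VB) (n G)
          (subst (λ s → weight VA EA + (weight VB (adj G) + s) ≡ degree-sum G + s * s) #S weights)
          (subst (λ s → # VA + # VB ≡ n G + s) #S sizes) (boundA (from-yes (4 ≤? 5)))
          (IH absorb (≤-trans (from-yes (4 ≤? 5)) (≤-trans (≤-reflexive (≡-sym #S)) S≤VB)) (#-missing VB c₀ c₀∉B)) absorb-weight dense
        where
        open Completion cs 5 ok
        open Absorb (e s) (e t) c c′ (trans (S-e s) rs) (trans (S-e t) rt) (sat (nb s) (nb t) false (isFalse⇒ _ st)) (s≢t ∘ e-inj)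
          (proj₂ (∧-elim {C c} hc)) (proj₂ (∧-elim {C c′} hc′)) (proj₁ (∧-elim {C c′} hc′))
          (λ w cw → walk-++ (walk-rev (C-conn w cw)) (C-conn c (proj₁ (∧-elim {C c} hc))))
        EB = Sub.E absorb
        clash : ∀ p q q′ r a b n → p + (q + 5) ≡ r + 25 → a + b ≡ n + 5 → p + 28 ≤ 10 * a → q′ + 28 ≤ 10 * b → q + 2 ≤ q′ → 10 * n ≤ r + 26 → ⊥
        clash p q q′ r a b n e₁ e₂ h₁ h₂ h₄ h₃ = from-no (78 ≤? 76) (+-cancelˡ-≤ r 78 76 (begin
          r + 78 ≡⟨ lem₁ r ⟩
          r + 25 + 53 ≡⟨ cong (_+ 53) (≡-sym e₁) ⟩
          p + (q + 5) + 53 ≡⟨ lem₂ p q ⟩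
          p + 28 + (q + 2 + 28) ≤⟨ +-mono-≤ h₁ (≤-trans (+-monoˡ-≤ 28 h₄) h₂) ⟩
          10 * a + 10 * b ≡⟨ ≡-sym (*-distribˡ-+ 10 a b) ⟩
          10 * (a + b) ≡⟨ cong (10 *_) e₂ ⟩
          10 * (n + 5) ≡⟨ *-distribˡ-+ 10 n 5 ⟩
          10 * n + 50 ≤⟨ +-monoˡ-≤ 50 h₃ ⟩
          r + 26 + 50 ≡⟨ +-assoc r 26 50 ⟩
          r + 76 ∎))
          where
          open ≤-Reasoning
          lem₁ : ∀ r → r + 78 ≡ r + 25 + 53
          lem₁ = solve-∀
          lem₂ : ∀ p q → p + (q + 5) + 53 ≡ p + 28 + (q + 2 + 28)
          lem₂ = solve-∀

      leaf : ∀ l → leafOK σ l ≡ true → ⊥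
      leaf (D i) h = degree-leaf (toF d′ i) (≤ᵇ⇒≤ d _ (subst T (≡-sym h) tt))
      leaf (M c p) h = minor-leaf c p h
      leaf (S₄ c) h = sep₄-leaf (digits class m c) h
      leaf (S₅ c s t) h =
        let h₁ , q₁ = ∧-elim {sepOK σ cs 5} h
            h₂ , q₂ = ∧-elim {rep σ cs s′ ∧ rep σ cs t′} q₁
            rs , rt = ∧-elim {rep σ cs s′} h₂
            h₃ , q₃ = ∧-elim {isTrue (get σ y (nb s′)) ∧ isTrue (get σ y (nb t′))} q₂
            ys , yt = ∧-elim {isTrue (get σ y (nb s′))} h₃
            st , ne = ∧-elim {isFalse (get σ (nb s′) (nb t′))} q₃
        in sep₅-leaf cs h₁ s′ t′ rs rt ys yt st (λ { eq → true≢false (subst (λ z → eqF s′ z ≡ true) eq (eqF-refl s′)) (not-elim ne) })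
        where
        cs = digits class m c
        s′ t′ : Fin d
        s′ = toF d′ s
        t′ = toF d′ t

    leaf-sound : ∀ σ l → leafOK σ l ≡ true → ∀ A → Valid A → A ⊨ σ → ⊥
    leaf-sound σ l h A (N , v) s = leaf N σ (λ i j b e → trans (≡-sym (v i j)) (s i j b e)) l h

    open Checker.Sound d′ LeafE leafOK Valid Valid-sym Valid-perm leaf-sound public

-- Found by computer search. For a vertex of degree d, small-cut-d treats components with at most 4 neighbours in N(x).
small-cut-6 : Cert LeafE
small-cut-6 =
  B 2 3 (L (D 0)) (B 2 4 (L (D 0)) (B 2 5 (L (D 0)) (B 3 4 (L (D 1)) (L (S₄ 99321093)))))

large-cut-6 : Cert LeafE
large-cut-6 =
  B 2 3 (L (D 0)) (B 2 4 (L (D 0)) (B 2 5 (L (D 0)) (B 2 6 (L (D 0)) (B 2 7 (L (D 0)) (B 3 4 (L (D 1)) (B 3 5 (L (D 1)) (B 3 6 (L (D 1)) (B 3 7 (L (D 1)) (B 4 5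
  (L (D 2)) (B 4 6 (L (D 2)) (B 4 7 (L (D 2)) (B 5 6 (L (D 3)) (B 5 7 (L (D 3)) (B 6 7 (L (D 4)) (B 2 1 (B 3 1 (R 0 103245) (B′ 4 1 (R 0 203415) (B′ 5 1 (R 0
  304215) (B′ 6 1 (R 0 403215) (B′ 7 1 (R 0 503214) (L (M 54321076 7670))))))) (B 3 1 (R 0 543201) (B 4 1 (R 1 543102) (B 5 1 (R 2 542103) (B 6 1 (R 3 532104) (L
  (M 54321076 7675)))))))))))))))))))))

small-cut-7 : Cert LeafE
small-cut-7 =
  B 2 3 (B 2 4 (L (D 0)) (B′ 2 5 (L (D 0)) (B′ 3 4 (L (D 1)) (B 3 5 (L (D 1)) (B 4 5 (B 2 6 (L (D 0)) (B 2 7 (L (D 0)) (B 2 8 (L (D 0)) (B 3 6 (L (D 1)) (L (S₄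
  990321092)))))) (L (S₄ 999321090))))))) (B 2 4 (R 0 6543120) (B 2 5 (R 1 6542130) (B 3 4 (R 0 6543021) (L (S₄ 999321093)))))

large-cut-7 : Cert LeafE
large-cut-7 =
  B 2 3 (B 2 4 (L (D 0)) (B′ 2 5 (L (D 0)) (B′ 2 6 (L (D 0)) (B′ 2 7 (L (D 0)) (B′ 2 8 (L (D 0)) (B′ 3 4 (L (D 1)) (B′ 3 5 (L (D 1)) (B′ 3 6 (L (D 1)) (B′ 3 7 (L
  (D 1)) (B 3 8 (L (D 1)) (B 4 5 (B 4 6 (L (D 2)) (B′ 4 7 (L (D 2)) (B′ 4 8 (L (D 2)) (B′ 5 6 (L (D 3)) (B′ 5 7 (L (D 3)) (B′ 5 8 (L (D 3)) (B 6 7 (B 6 8 (L (D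
  4)) (B′ 7 8 (L (D 5)) (B′ 2 1 (B′ 4 1 (B′ 6 1 (R 0 4203516) (B 7 1 (R 0 5203416) (L (M 654321047 3210)))) (B 5 1 (R 0 6542310) (L (M 654321027 5410)))) (B 3 1
  (R 0 6543201) (L (M 654321007 5432)))))) (B 6 8 (R 0 5643210) (B 7 8 (R 1 4653210) (L (M 654321087 3210))))))))))) (B 4 6 (R 0 6534210) (B 4 7 (R 1 6435210) (B
  4 8 (R 2 5436210) (B 5 6 (R 0 6524310) (B 5 7 (R 1 6425310) (B 5 8 (R 3 5426310) (B 6 7 (R 1 6325410) (B 6 8 (R 4 5326410) (L (M 654321087
  6510))))))))))))))))))))) (B 2 4 (R 0 6543120) (B 2 5 (R 1 6542130) (B 2 6 (R 2 6532140) (B 2 7 (R 3 6432150) (B 2 8 (R 4 5432160) (B 3 4 (R 0 6543021) (B 3 5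
  (R 1 6542031) (B 3 6 (R 2 6532041) (B 3 7 (R 3 6432051) (B 3 8 (R 5 5432061) (B 4 5 (R 1 6541032) (B 4 6 (R 2 6531042) (B 4 7 (R 3 6431052) (B 4 8 (R 6 5431062)
  (B 5 6 (R 2 6521043) (B 5 7 (R 3 6421053) (B 5 8 (R 7 5421063) (B 6 7 (R 3 6321054) (L (M 654321087 6564))))))))))))))))))))

small-cut-8 : Cert LeafE
small-cut-8 =
  B 2 3 (B 2 4 (B′ 2 5 (L (D 0)) (B′ 3 4 (B 3 5 (L (D 1)) (B 4 5 (L (D 2)) (B 2 6 (L (D 0)) (B 2 7 (L (D 0)) (B 2 8 (L (D 0)) (B 2 9 (L (D 0)) (B 3 6 (L (D 1)) (L
  (S₄ 9990321092))))))))) (B 3 5 (B 4 5 (B 2 6 (L (D 0)) (B 2 7 (L (D 0)) (B 2 8 (L (D 0)) (B 2 9 (L (D 0)) (B 3 6 (L (D 1)) (B 3 7 (L (D 1)) (B 3 8 (L (D 1)) (B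
  3 9 (L (D 1)) (B 4 6 (L (D 2)) (L (S₄ 9990321093))))))))))) (B′ 2 6 (L (D 0)) (B 2 7 (L (D 0)) (B 2 8 (L (D 0)) (B 2 9 (L (D 0)) (B 3 6 (L (D 1)) (B 3 7 (L (D
  1)) (B 3 8 (L (D 1)) (B 3 9 (L (D 1)) (B 4 6 (B 4 7 (L (D 2)) (L (S₄ 9909321091))) (L (S₄ 9990321091)))))))))))) (B′ 4 5 (R 0 76543120) (L (S₄ 9999321090))))))
  (B′ 2 5 (R 1 76542310) (B′ 3 4 (R 0 76543201) (B 3 5 (R 2 76542301) (B 4 5 (B 2 6 (B′ 2 7 (L (D 0)) (B′ 2 8 (L (D 0)) (B′ 2 9 (L (D 0)) (B′ 3 6 (B 6 4 (L (D 4))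
  (B 6 5 (L (D 4)) (L (S₄ 9992321090)))) (B 4 6 (B 6 5 (L (D 4)) (B′ 4 7 (L (D 2)) (B 4 8 (L (D 2)) (B 4 9 (L (D 2)) (B 3 7 (B 3 8 (L (D 1)) (L (S₄ 9099321092)))
  (L (S₄ 9909321092))))))) (B 5 6 (R 0 76542310) (L (S₄ 9992321090)))))))) (B 2 7 (R 1 76453210) (B 2 8 (R 2 75463210) (B 2 9 (R 3 65473210) (B 3 6 (R 0 76543201)
  (L (S₄ 9990321092))))))) (L (S₄ 9999321090))))))) (B 2 4 (R 0 76543120) (B 2 5 (R 1 76542130) (B 3 4 (R 0 76543021) (L (S₄ 9999321093)))))

large-cut-8 : Cert LeafE
large-cut-8 =
  B 2 3 (B 2 4 (B′ 2 5 (L (D 0)) (B′ 2 6 (L (D 0)) (B′ 2 7 (L (D 0)) (B′ 2 8 (L (D 0)) (B′ 2 9 (L (D 0)) (B′ 3 4 (B 3 5 (L (D 1)) (B 3 6 (L (D 1)) (B 3 7 (L (D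
  1)) (B′ 3 8 (L (D 1)) (B′ 3 9 (L (D 1)) (B 4 5 (L (D 2)) (B 4 6 (L (D 2)) (B 4 7 (L (D 2)) (B 4 8 (L (D 2)) (B 4 9 (L (D 2)) (B 5 6 (B 5 7 (B′ 5 8 (L (D 3)) (B′
  5 9 (L (D 3)) (B′ 6 7 (B 6 8 (L (D 4)) (B 6 9 (L (D 4)) (B 7 8 (L (D 5)) (B 7 9 (L (D 5)) (B 8 9 (B 2 1 (B′ 5 1 (B 3 1 (B′ 6 1 (R 0 43105267) (B 7 1 (R 0
  53104267) (L (M 6543021037 6521)))) (B′ 4 1 (R 0 76543120) (L (M 6543021017 6543)))) (B 6 1 (R 0 76210534) (L (M 6504321037 6521)))) (B 3 1 (R 0 76543201) (L (M
  6543221007 6543)))) (L (M 6543021087 4321))))))) (B 6 8 (B′ 6 9 (L (D 4)) (B′ 7 8 (B 7 9 (L (D 5)) (B 8 9 (L (D 6)) (B 2 1 (B′ 5 1 (B′ 8 1 (B 3 1 (R 3 63104257)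
  (B 4 1 (R 3 63204517) (L (M 6543021017 5453)))) (B 6 1 (B 7 1 (R 3 54306217) (L (M 6543021047 5321))) (L (M 6543021037 5421)))) (B 6 1 (R 0 75634210) (L (M
  6504321037 5421)))) (B 3 1 (R 0 76543201) (L (M 6543221007 5453)))))) (B 7 9 (B 8 9 (B′ 2 1 (B 3 1 (B 4 1 (B 5 1 (R 5 32104567) (B 6 1 (R 5 42103567) (B 7 1 (R
  5 52103467) (L (M 6054321037 6521))))) (B′ 5 1 (B 6 1 (R 5 43105267) (B′ 8 1 (R 5 63104257) (B′ 9 1 (R 5 73104256) (L (M 6543021057 6421))))) (B 6 1 (R 0
  75634210) (B 7 1 (R 1 64735210) (L (M 6054321037 6521)))))) (B′ 4 1 (R 0 76543120) (B′ 5 1 (B 6 1 (B 7 1 (R 8 54306217) (B 8 1 (R 8 64305217) (B 9 1 (R 8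
  74305216) (L (S₅ 7659921791 2 1))))) (B′ 8 1 (B 7 1 (R 8 65304217) (B′ 9 1 (R 8 76304215) (L (S₅ 7954921591 2 1)))) (B′ 9 1 (B 7 1 (R 9 75304216) (R 0
  67453210)) (L (M 6543021057 6421))))) (B 6 1 (R 0 75634210) (B 7 1 (R 1 64735210) (L (M 6054321037 6521))))))) (B 3 1 (R 0 76543201) (B 4 1 (R 1 76543102) (B 5
  1 (B 6 1 (B 7 1 (B 8 1 (R 13 65437210) (B′ 9 1 (R 13 75436210) (L (S₅ 7691621090 1 0)))) (B′ 8 1 (R 0 75634210) (B′ 9 1 (L (S₅ 9659121090 1 0)) (L (M 6543021067
  5321))))) (B′ 7 1 (R 0 67453210) (B 8 1 (B 9 1 (R 1 35476210) (L (M 5143021076 7654))) (L (M 1543021076 7653))))) (B 6 1 (R 0 75634210) (B 7 1 (R 0 64735210) (L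
  (M 6054321037 6521)))))))) (B′ 2 1 (B′ 5 1 (B 3 1 (B′ 6 1 (R 18 43105267) (B 8 1 (R 18 63104257) (L (M 6543021037 6421)))) (B 4 1 (R 0 76543120) (L (M
  6543021017 6453)))) (B 6 1 (B 7 1 (B 3 1 (R 19 54103267) (B 4 1 (R 19 54203617) (L (M 6543021017 6453)))) (L (M 6540321037 6421))) (L (M 6504321037 5421)))) (B
  3 1 (R 0 76543201) (L (M 6543221007 6453))))) (B′ 8 9 (R 0 75634210) (L (M 6543021087 5321)))))) (B 6 9 (R 1 67543210) (B′ 7 8 (R 0 76453210) (B 7 9 (R 2
  67453210) (L (M 6543021087 6521))))))))) (B′ 5 8 (R 1 75643210) (B′ 5 9 (R 2 65743210) (B′ 6 7 (R 0 76534210) (B 6 8 (R 1 75634210) (B 6 9 (R 3 65734210) (B 7 8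
  (B 7 9 (R 2 43765210) (L (M 6054321087 4321))) (L (M 654321087 4321))))))))) (B 5 7 (R 0 76453210) (B 5 8 (R 1 75463210) (B 5 9 (R 2 65473210) (B 6 7 (R 0
  76354210) (B 6 8 (R 1 75364210) (L (M 654321087 6521)))))))))))))))))) (B 3 5 (B′ 3 6 (L (D 1)) (B′ 3 7 (L (D 1)) (B′ 3 8 (L (D 1)) (B′ 3 9 (L (D 1)) (B′ 4 5 (B
  4 6 (L (D 2)) (B 4 7 (L (D 2)) (B 4 8 (L (D 2)) (B 4 9 (L (D 2)) (B 5 6 (L (D 3)) (B 5 7 (L (D 3)) (B 5 8 (L (D 3)) (B 5 9 (L (D 3)) (B 6 7 (B 6 8 (B′ 6 9 (L (D
  4)) (B′ 7 8 (R 1 73210654) (B 7 9 (B 8 9 (B 2 1 (B 3 1 (B 4 1 (B 5 1 (R 33 32104567) (B′ 6 1 (R 33 42103567) (B 7 1 (R 33 52103467) (B 8 1 (R 33 62103457) (L (M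
  654321047 3231)))))) (B′ 5 1 (R 0 76542301) (B 6 1 (B 7 1 (R 34 54103267) (B′ 8 1 (R 34 64103257) (B 9 1 (R 34 74103256) (L (S₅ 7659329792 3 2))))) (B 7 1 (R 0
  67453210) (B 8 1 (R 0 57463210) (L (M 654321047 3231))))))) (B′ 4 1 (R 0 76543120) (B 5 1 (B 6 1 (B 7 1 (R 36 54306217) (B′ 8 1 (R 36 64305217) (B 9 1 (R 36
  74305216) (L (S₅ 7659921997 7 5))))) (B 7 1 (R 0 67453210) (B 8 1 (R 0 57463210) (L (M 654321047 3231))))) (L (M 6540321037 6564))))) (B 3 1 (R 0 76542301) (B 4
  1 (R 0 76541302) (L (M 6543321007 6564))))) (B′ 2 1 (B′ 5 1 (B′ 6 1 (B 7 1 (R 38 54306217) (B 9 1 (R 38 74305216) (L (M 6540321047 3231)))) (B 8 1 (B 7 1 (R 38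
  65304217) (B 9 1 (R 38 76304215) (L (M 6540321047 3231)))) (L (M 6504321047 3231)))) (B 3 1 (B 4 1 (R 0 76542301) (L (M 6540321027 6431))) (L (M 6540321017
  6432)))) (B 3 1 (R 0 76542301) (L (M 6542321007 6431))))) (B′ 8 9 (R 0 75643210) (L (M 6540321087 3231)))))) (B′ 6 9 (R 1 67543210) (B 7 8 (R 0 76453210) (B 7 9
  (R 2 67453210) (B 8 9 (B 2 1 (B′ 5 1 (B′ 6 1 (B′ 8 1 (R 44 64305217) (B 9 1 (R 44 74305216) (L (M 6540321057 3231)))) (B 7 1 (R 0 76453210) (L (M 6054321047
  3231)))) (B 3 1 (B 4 1 (R 0 76542301) (L (M 6540321027 6531))) (L (M 6540321017 6532)))) (B 3 1 (R 0 76542301) (L (M 6542321007 6531)))) (L (M 6540321087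
  3231))))))) (B 6 8 (R 0 75643210) (B 7 8 (R 0 74653210) (L (M 654321087 3231))))))))))))) (B 4 6 (B′ 4 7 (L (D 2)) (B′ 4 8 (L (D 2)) (B′ 4 9 (L (D 2)) (B′ 5 6
  (B 5 7 (L (D 3)) (B 5 8 (L (D 3)) (B 5 9 (L (D 3)) (B 6 7 (L (D 4)) (B 6 8 (L (D 4)) (B 6 9 (L (D 4)) (B 7 8 (B 7 9 (B 8 9 (R 30 43210765) (B′ 2 1 (B′ 5 1 (B 4
  1 (B 3 1 (R 48 32104567) (B′ 6 1 (R 48 43205617) (B 7 1 (R 48 53204617) (B 8 1 (R 48 63204517) (B 9 1 (R 48 73204516) (L (S₅ 7654991995 6 5))))))) (B 6 1 (R 0
  76510324) (L (M 6504321027 4331)))) (B 3 1 (B 6 1 (R 0 76524031) (L (M 6504321037 4231))) (L (M 6504321017 4342)))) (B 3 1 (R 0 76542301) (L (M 6524321007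
  4331))))) (B′ 8 9 (R 0 75643210) (B′ 2 1 (B′ 5 1 (B 4 1 (B′ 7 1 (R 51 53204617) (B 8 1 (R 51 63204517) (L (M 6543211047 3210)))) (B 6 1 (R 0 76520413) (L (M
  6543021027 5410)))) (B 3 1 (B 6 1 (R 0 76534120) (L (M 6543211027 5410))) (L (M 6543021017 5432)))) (B 3 1 (R 0 76542301) (L (M 6543211007 5432)))))) (B 7 9 (R
  0 67543210) (B 8 9 (R 1 57643210) (L (M 6543211087 3210))))))))))) (B 5 7 (B′ 5 8 (L (D 3)) (B′ 5 9 (L (D 3)) (B′ 6 7 (B 6 8 (L (D 4)) (B 6 9 (L (D 4)) (B 7 8
  (L (D 5)) (B 7 9 (L (D 5)) (B 8 9 (B 2 1 (B′ 5 1 (B′ 6 1 (B 8 1 (R 55 64305217) (B 9 1 (R 55 74305216) (L (M 6543221057 4310)))) (B 4 1 (B 7 1 (R 55 53204617)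
  (L (M 6543221037 6510))) (L (M 6504321027 6531)))) (B 3 1 (B 7 1 (R 0 76425031) (L (M 6541321037 6520))) (L (M 6504321017 6542)))) (B 3 1 (R 0 76452301) (L (M
  6543221007 6543)))) (L (M 6543221087 4310))))))) (B 6 8 (B′ 6 9 (L (D 4)) (B′ 7 8 (B 7 9 (L (D 5)) (B 8 9 (L (D 6)) (B 2 1 (B′ 5 1 (B′ 6 1 (B 7 1 (R 57
  54306217) (B 8 1 (R 57 64305217) (L (M 6543221047 5310)))) (B 4 1 (B 8 1 (R 57 63204517) (L (M 6543221037 5410))) (L (M 6504321027 5431)))) (B 3 1 (B 7 1 (R 0
  74625031) (L (M 6541321037 5420))) (L (M 6504321017 5442)))) (B 3 1 (R 0 76452301) (L (M 6543221007 5453)))))) (B 7 9 (B 8 9 (B 2 1 (B 3 1 (B 4 1 (B 5 1 (R 59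
  32104567) (B 7 1 (R 59 52103467) (B 9 1 (R 59 72103456) (L (M 6541321047 6520))))) (B 6 1 (B′ 5 1 (R 59 43105267) (B 7 1 (R 59 54103267) (B 9 1 (R 59 74103256)
  (L (M 6541321047 6520))))) (B 8 1 (B′ 5 1 (R 60 63104257) (B 7 1 (R 60 65103247) (B 9 1 (R 60 76103245) (L (S₅ 7954329592 4 2))))) (L (M 6504321047 6531)))))
  (B′ 5 1 (B 4 1 (R 1 75634120) (B 6 1 (B 7 1 (R 61 54306217) (B 8 1 (R 61 64305217) (B 9 1 (R 61 74305216) (L (S₅ 7659921997 7 5))))) (B 8 1 (B′ 7 1 (R 61
  65304217) (B′ 9 1 (R 61 76304215) (L (S₅ 7954921592 4 2)))) (L (M 6504321047 6531))))) (B′ 7 1 (B 4 1 (R 2 75634120) (B 6 1 (R 0 75634120) (B 8 1 (B 9 1 (R 63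
  76503214) (R 1 20416375)) (L (M 6504321047 6531))))) (L (M 6054321037 6542))))) (B 3 1 (R 0 67452301) (B 4 1 (R 1 57361402) (L (M 6543321007 6564))))) (B′ 2 1
  (B′ 5 1 (B 6 1 (B 7 1 (R 65 54306217) (B 9 1 (R 65 74305216) (L (M 6543221047 5310)))) (B 4 1 (B 8 1 (R 65 63204517) (L (M 6543221037 6410))) (L (M 6504321027
  5431)))) (B 3 1 (B 7 1 (B 6 1 (R 65 54103267) (B 4 1 (R 65 52103467) (L (M 6504321027 5431)))) (L (M 6541321037 6420))) (L (M 6504321017 5442)))) (B 3 1 (R 0
  67452301) (L (M 6543221007 6453))))) (B′ 8 9 (R 0 75634120) (L (M 6543221087 5310)))))) (B 6 9 (R 1 67543210) (B′ 7 8 (R 0 76452301) (B 7 9 (R 2 67452301) (L (M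
  6543221087 6510))))))))) (B 5 8 (R 1 75643210) (B 5 9 (R 2 65743210) (B′ 6 7 (R 0 76534120) (B 6 8 (R 1 75634120) (B 6 9 (R 3 65734120) (B 7 8 (B 7 9 (B 8 9 (R
  53 43210765) (L (M 6504321087 4231))) (L (M 6054321087 4231))) (L (M 654321087 4231))))))))))))) (B 4 7 (R 1 76453210) (B 4 8 (R 2 75463210) (B 4 9 (R 3
  65473210) (B′ 5 6 (R 0 76542301) (B 5 7 (R 1 76452301) (B 5 8 (R 2 75462301) (B 5 9 (R 4 65472301) (B 6 7 (B 6 8 (B 6 9 (L (D 4)) (B′ 7 8 (R 47 73210654) (B 7 9
  (B 8 9 (R 38 32107654) (L (M 6540321087 6431))) (L (M 6540321087 6531))))) (B′ 6 9 (R 0 67543210) (L (M 6504321087 6531)))) (B 6 8 (R 0 75643210) (L (M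
  654321087 6531))))))))))))))))) (B 3 6 (R 1 76534210) (B 3 7 (R 2 76435210) (B 3 8 (R 3 75436210) (B 3 9 (R 4 65437210) (B′ 4 5 (R 0 76543120) (B 4 6 (R 1
  76534120) (B′ 4 7 (R 2 76435120) (B 4 8 (R 3 75436120) (B 4 9 (R 5 65437120) (B 5 6 (B 5 7 (B′ 5 8 (L (D 3)) (B′ 5 9 (L (D 3)) (B′ 6 7 (R 54 76210543) (B 6 8 (R
  3 72106543) (B 6 9 (R 4 62107543) (L (M 6504321087 6543))))))) (B′ 5 8 (R 1 75643210) (B′ 5 9 (R 2 65743210) (B 6 7 (R 0 76534210) (B 6 8 (R 1 75634210) (L (M
  654321087 6543))))))) (B 5 7 (R 0 76453210) (B 5 8 (R 1 75463210) (B 6 7 (R 0 76354210) (L (M 654321087 6564)))))))))))))))))))))) (B′ 2 5 (R 1 76542310) (B′ 2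
  6 (R 2 76532410) (B′ 2 7 (R 3 76432510) (B′ 2 8 (R 4 75432610) (B′ 2 9 (R 5 65432710) (B′ 3 4 (R 0 76543201) (B′ 3 5 (R 1 76542301) (B′ 3 6 (R 2 76532401) (B 3
  7 (R 3 76432501) (B 3 8 (R 4 75432601) (B 3 9 (R 6 65432701) (B 4 5 (B 4 6 (R 2 76510432) (B′ 4 7 (R 3 76410532) (B′ 4 8 (R 4 75410632) (B′ 4 9 (R 5 65410732)
  (B′ 5 6 (R 2 76510423) (B 5 7 (R 3 76410523) (B 5 8 (R 4 75410623) (B 5 9 (R 7 65410723) (B 6 7 (B 6 8 (R 4 73210654) (B′ 6 9 (R 5 63210754) (L (M 6504321087
  6532)))) (B 6 8 (R 0 75643210) (L (M 654321087 6532)))))))))))) (B 4 6 (R 0 76534210) (B 4 7 (R 1 76435210) (B 4 8 (R 2 75436210) (B 4 9 (R 3 65437210) (B 5 6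
  (R 0 76524310) (B 5 7 (R 1 76425310) (B 5 8 (R 2 75426310) (B 6 7 (R 1 76325410) (L (M 654321087 6564))))))))))))))))))))))) (B 2 4 (R 0 76543120) (B 2 5 (R 1
  76542130) (B 2 6 (R 2 76532140) (B 2 7 (R 3 76432150) (B 2 8 (R 4 75432160) (B 2 9 (R 5 65432170) (B 3 4 (R 0 76543021) (B 3 5 (R 1 76542031) (B 3 6 (R 2
  76532041) (B 3 7 (R 3 76432051) (B 3 8 (R 4 75432061) (B 3 9 (R 6 65432071) (B 4 5 (R 1 76541032) (B 4 6 (R 2 76531042) (B 4 7 (R 3 76431052) (B 4 8 (R 4
  75431062) (B 4 9 (R 7 65431072) (B 5 6 (R 2 76521043) (B 5 7 (R 3 76421053) (B 5 8 (R 4 75421063) (B 6 7 (R 3 76321054) (L (M 8654321087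
  6564)))))))))))))))))))))))

small-cut-9 : Cert LeafE
small-cut-9 =
  B 2 3 (B 2 4 (B′ 2 5 (B 3 4 (B 3 5 (B 4 5 (B 2 6 (L (D 0)) (B 2 7 (L (D 0)) (B 2 8 (L (D 0)) (B 2 9 (L (D 0)) (B 2 10 (L (D 0)) (B 3 6 (L (D 1)) (B 3 7 (L (D
  1)) (B 3 8 (L (D 1)) (B 3 9 (L (D 1)) (B 3 10 (L (D 1)) (B 4 6 (L (D 2)) (L (S₄ 99902321093))))))))))))) (B′ 2 6 (L (D 0)) (B 2 7 (L (D 0)) (B 2 8 (L (D 0)) (B
  2 9 (L (D 0)) (B 2 10 (L (D 0)) (B 3 6 (L (D 1)) (B 3 7 (L (D 1)) (B 3 8 (L (D 1)) (B 3 9 (L (D 1)) (B 3 10 (L (D 1)) (B 4 6 (B 4 7 (L (D 2)) (L (S₄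
  99920321093))) (L (S₄ 99902321093)))))))))))))) (B′ 4 5 (R 0 876543120) (B′ 2 6 (L (D 0)) (B 2 7 (L (D 0)) (B 2 8 (L (D 0)) (B 2 9 (L (D 0)) (B 2 10 (L (D 0))
  (B 3 6 (B′ 3 7 (L (D 1)) (B′ 3 8 (L (D 1)) (B′ 3 9 (L (D 1)) (B′ 3 10 (L (D 1)) (B′ 4 6 (B 4 7 (L (D 2)) (L (S₄ 99919321090))) (B 4 7 (B 4 8 (L (D 2)) (L (S₄
  99199321090))) (L (S₄ 99919321090)))))))) (B 3 7 (R 1 876453210) (B 3 8 (R 2 875463210) (B 3 9 (R 3 865473210) (B 3 10 (R 4 765483210) (B 4 6 (R 0 876543120) (L
  (S₄ 99991321090))))))))))))))) (B 3 5 (R 0 876542310) (B 4 5 (R 1 876541320) (L (S₄ 99999321090))))) (B′ 3 4 (B 3 5 (R 0 876543201) (B 4 5 (R 1 876543102) (B 2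
  6 (B′ 2 7 (L (D 0)) (B′ 2 8 (L (D 0)) (B′ 2 9 (L (D 0)) (B′ 2 10 (L (D 0)) (B′ 3 6 (B′ 3 7 (L (D 1)) (L (S₄ 99909321092))) (B 4 6 (R 0 876543120) (L (S₄
  99991321090)))))))) (B 2 7 (R 1 876453210) (B 2 8 (R 2 875463210) (B 2 9 (R 3 865473210) (B 2 10 (R 4 765483210) (B 3 6 (R 0 876543201) (L (S₄
  99990321092)))))))))) (B 3 5 (B 4 5 (B 2 6 (B′ 2 7 (L (D 0)) (B′ 2 8 (L (D 0)) (B′ 2 9 (L (D 0)) (B′ 2 10 (L (D 0)) (B′ 3 6 (B′ 3 7 (L (D 1)) (B 3 8 (L (D 1))
  (B 3 9 (L (D 1)) (B 3 10 (L (D 1)) (B 4 6 (B 6 5 (L (D 4)) (B′ 4 7 (L (D 2)) (L (S₄ 99909321093)))) (B 5 6 (R 0 876542301) (B 4 7 (B 4 8 (L (D 2)) (L (S₄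
  99099321093))) (L (S₄ 99909321093))))))))) (B′ 4 6 (R 0 876543120) (B 5 6 (B 5 7 (L (D 3)) (B 5 8 (L (D 3)) (B 5 9 (L (D 3)) (B 5 10 (L (D 3)) (B 3 7 (B 3 8 (L
  (D 1)) (L (S₄ 99199321092))) (L (S₄ 99919321092))))))) (L (S₄ 99993321090))))))))) (B 2 7 (R 1 876453210) (B 2 8 (R 2 875463210) (B 2 9 (R 3 865473210) (B 2 10
  (R 4 765483210) (B 3 6 (R 0 876542301) (B 3 7 (R 1 876452301) (B 3 8 (R 2 875462301) (B 3 9 (R 3 865472301) (B 3 10 (R 5 765482301) (B 4 6 (R 0 876541302) (L
  (S₄ 99990321093))))))))))))) (B′ 2 6 (B′ 2 7 (L (D 0)) (B′ 2 8 (L (D 0)) (B′ 2 9 (L (D 0)) (B′ 2 10 (L (D 0)) (B′ 3 6 (B 3 7 (L (D 1)) (B 3 8 (L (D 1)) (B 3 9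
  (L (D 1)) (B 3 10 (L (D 1)) (B 6 4 (B 6 5 (L (D 4)) (B′ 4 7 (B 4 8 (L (D 2)) (L (S₄ 99099321091))) (L (S₄ 99909321091)))) (B 6 5 (R 0 876542301) (B 4 7 (B 4 8
  (B 4 9 (L (D 2)) (L (S₄ 90999321091))) (L (S₄ 99099321091))) (L (S₄ 99909321091))))))))) (B 3 7 (B 3 8 (L (D 1)) (B′ 3 9 (L (D 1)) (B′ 3 10 (L (D 1)) (B′ 4 6
  (B′ 4 7 (B 4 8 (L (D 2)) (L (S₄ 99099321091))) (L (S₄ 99909321091))) (B 4 7 (B 7 5 (R 0 876452301) (B 4 8 (B 4 9 (L (D 2)) (L (S₄ 90999321091))) (L (S₄
  99099321091)))) (L (S₄ 99909321091))))))) (B 3 8 (R 0 875643210) (B 3 9 (R 1 865743210) (B 3 10 (R 2 765843210) (B′ 4 6 (B 6 5 (B 4 7 (B 4 8 (L (D 2)) (L (S₄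
  99099321091))) (L (S₄ 99909321091))) (L (S₄ 99991321090))) (B 5 6 (B 5 7 (B 5 8 (L (D 3)) (L (S₄ 99199321090))) (L (S₄ 99919321090))) (L (S₄
  99991321090))))))))))))) (B 2 7 (R 1 876453210) (B 2 8 (R 2 875463210) (B 2 9 (R 3 865473210) (B 2 10 (R 4 765483210) (B 3 6 (R 0 876542301) (B 3 7 (R 1
  876452301) (B 3 8 (R 2 875462301) (B 3 9 (R 3 865472301) (B 3 10 (R 5 765482301) (B 4 6 (B 4 7 (B 4 8 (L (D 2)) (L (S₄ 99099321091))) (L (S₄ 99909321091))) (L
  (S₄ 99990321091)))))))))))))) (B′ 4 5 (R 0 876543120) (L (S₄ 99999321090)))))) (B′ 2 5 (R 1 876542310) (B′ 3 4 (R 0 876543201) (B 3 5 (R 2 876542301) (B 4 5 (B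
  2 6 (B′ 2 7 (B′ 2 8 (L (D 0)) (B′ 2 9 (L (D 0)) (B′ 2 10 (L (D 0)) (B′ 3 6 (B′ 3 7 (B 3 8 (L (D 1)) (L (S₄ 99099321092))) (B′ 6 4 (B 6 5 (L (D 4)) (B′ 4 7 (B 4
  8 (L (D 2)) (B 4 9 (L (D 2)) (B 4 10 (L (D 2)) (B 7 5 (B 3 8 (B 3 9 (L (D 1)) (L (S₄ 90999321092))) (L (S₄ 99099321092))) (B′ 3 8 (B 3 9 (L (D 1)) (L (S₄
  90999321092))) (L (S₄ 99099321092))))))) (B′ 3 8 (B 3 9 (L (D 1)) (L (S₄ 90999321092))) (L (S₄ 99099321092))))) (B 6 5 (R 0 876542310) (L (S₄ 99992321090)))))
  (B′ 3 7 (R 1 876453210) (B 4 6 (B′ 4 7 (B′ 4 8 (L (D 2)) (B 4 9 (L (D 2)) (B 4 10 (L (D 2)) (B 6 5 (R 0 876541032) (B 7 5 (R 4 876451032) (B 3 8 (B 3 9 (B 3 10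
  (L (D 1)) (L (S₄ 9999321092))) (L (S₄ 90999321092))) (L (S₄ 99099321092)))))))) (B′ 6 5 (B 5 7 (R 0 876542310) (L (S₄ 99929321090))) (B 4 8 (B′ 4 9 (L (D 2))
  (B′ 4 10 (L (D 2)) (B′ 3 8 (B 8 5 (R 4 875460132) (B 3 9 (B 3 10 (L (D 1)) (L (S₄ 9999321092))) (L (S₄ 90999321092)))) (L (S₄ 99099321092))))) (B 4 9 (R 1
  867543210) (B 4 10 (R 2 768543210) (B 5 7 (B 5 8 (R 0 876452310) (L (S₄ 99299321090))) (L (S₄ 99929321090)))))))) (B 4 7 (R 1 876453210) (B 5 6 (R 0 876542310)
  (L (S₄ 99992321090)))))))))) (B′ 2 8 (R 1 875643210) (B′ 2 9 (R 2 865743210) (B′ 2 10 (R 3 765843210) (B′ 3 6 (B 6 4 (B 6 5 (L (D 4)) (B′ 3 7 (R 0 876543201) (L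
  (S₄ 99909321092)))) (B 6 5 (R 0 876542310) (L (S₄ 99992321090)))) (B 4 6 (B 6 5 (B 4 7 (R 1 876541032) (B 4 8 (R 2 875641032) (B 4 9 (R 3 865741032) (B 4 10 (R
  12 765841032) (R 0 876541032))))) (B′ 4 7 (R 1 876541032) (B 4 8 (R 2 875641032) (B 4 9 (R 3 865741032) (B 4 10 (R 5 765841032) (B 3 7 (B 3 8 (R 2 874653201) (L
  (S₄ 99099321092))) (L (S₄ 99909321092)))))))) (B 5 6 (R 0 876542310) (L (S₄ 99992321090))))))))) (B 2 7 (R 1 876453210) (B 2 8 (R 2 875463210) (B 2 9 (R 3
  865473210) (B 2 10 (R 4 765483210) (B 3 6 (R 0 876543201) (L (S₄ 99990321092)))))))) (L (S₄ 99999321090))))))) (B 2 4 (R 0 876543120) (B 2 5 (R 1 876542130) (B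
  3 4 (R 0 876543021) (L (S₄ 99999321093)))))

large-cut-9 : Cert LeafE
large-cut-9 =
  B 2 3 (B 2 4 (B′ 2 5 (B′ 2 6 (L (D 0)) (B′ 2 7 (L (D 0)) (B′ 2 8 (L (D 0)) (B′ 2 9 (L (D 0)) (B′ 2 10 (L (D 0)) (B′ 3 4 (B 3 5 (B′ 3 6 (L (D 1)) (B′ 3 7 (L (D
  1)) (B 3 8 (L (D 1)) (B′ 3 9 (L (D 1)) (B 3 10 (L (D 1)) (B 4 5 (B 4 6 (L (D 2)) (B 4 7 (L (D 2)) (B 4 8 (L (D 2)) (B 4 9 (L (D 2)) (B 4 10 (L (D 2)) (B 5 6 (L
  (D 3)) (B 5 7 (L (D 3)) (B 5 8 (L (D 3)) (B 5 9 (L (D 3)) (B 5 10 (L (D 3)) (B 6 7 (B 6 8 (B 6 9 (B 6 10 (L (D 4)) (B′ 7 10 (B 7 8 (B 7 9 (L (D 5)) (B′ 8 9 (B 8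
  10 (L (D 6)) (L (M 61504321087 5432))) (L (M 16540321087 5432)))) (B 7 9 (R 0 867543210) (L (M 16540321087 6532)))) (L (M 61054321087 5432)))) (B′ 6 10 (R 0
  786543210) (L (M 65104321087 6532)))) (B′ 6 9 (R 0 867543210) (L (M 16504321087 6532)))) (B 6 8 (R 0 875643210) (L (M 10654321087 6532)))))))))))))) (B 4 6 (B′
  4 7 (L (D 2)) (B′ 4 8 (L (D 2)) (B′ 4 9 (L (D 2)) (B′ 4 10 (L (D 2)) (B′ 5 6 (B 5 7 (L (D 3)) (B 5 8 (L (D 3)) (B 5 9 (L (D 3)) (B 5 10 (L (D 3)) (B 6 7 (B 6 8
  (L (D 4)) (B′ 6 9 (L (D 4)) (B′ 6 10 (L (D 4)) (B′ 7 8 (B 7 9 (B 7 10 (L (D 5)) (L (M 63254321087 5410))) (L (M 36254321087 5410))) (L (M 32654321087 5410))))))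
  (B 6 8 (R 0 875643210) (B 6 9 (R 1 865743210) (B 6 10 (R 2 765843210) (L (M 65324321087 6510)))))))))) (B 5 7 (B 5 8 (L (D 3)) (B′ 5 9 (L (D 3)) (B′ 5 10 (L (D
  3)) (B′ 6 7 (B 6 8 (B′ 6 9 (L (D 4)) (B′ 6 10 (L (D 4)) (B′ 7 8 (B 7 9 (L (D 5)) (B 7 10 (L (D 5)) (B 8 9 (B 8 10 (L (D 6)) (B′ 9 10 (B 2 1 (B′ 6 1 (B′ 3 1 (B 7
  1 (B 9 1 (R 7 754103268) (B 8 1 (R 7 654103278) (L (M 65420321047 6531)))) (B 5 1 (B 8 1 (R 7 643105278) (L (M 61540321047 4320))) (L (M 65041321037 6521)))) (B
  4 1 (B 5 1 (B 8 1 (R 7 643205718) (B 7 1 (R 7 543206718) (L (M 61540321047 4320)))) (L (M 65043221017 6543))) (L (M 65043221017 6543)))) (B 4 1 (B 7 1 (R 0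
  876452310) (L (M 65043221037 6521))) (L (M 65041321027 6543)))) (B 3 1 (R 0 876543201) (L (M 65423321007 6554)))) (L (M 65043221087 4321)))) (B 8 10 (R 0
  786543210) (L (M 65420321087 6531)))))) (B 7 9 (B 7 10 (L (D 5)) (L (M 62354321087 5410))) (L (M 26354321087 5410)))))) (B 6 9 (R 1 867543210) (B 6 10 (R 2
  768543210) (B 7 8 (R 0 876452310) (B 7 9 (R 1 867452310) (L (M 26354321087 5410))))))) (B 6 8 (B 6 9 (B 6 10 (L (D 4)) (B′ 7 10 (B 7 8 (B 7 9 (L (D 5)) (B′ 8 9
  (B 8 10 (L (D 6)) (L (M 60524321087 5431))) (L (M 6543321087 5421)))) (B 7 9 (R 0 867543210) (L (M 6543321087 6521)))) (L (M 61054321087 5342)))) (B′ 6 10 (R 0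
  786543210) (L (M 65024321087 6531)))) (B 6 9 (R 0 867543210) (L (M 6524321087 6531)))))))) (B 5 8 (R 0 875643210) (B 5 9 (R 1 865743210) (B 5 10 (R 2 765843210)
  (B′ 6 7 (B 6 8 (B 6 9 (L (D 4)) (B′ 6 10 (L (D 4)) (L (M 65104321087 6542)))) (B′ 6 9 (R 0 867543210) (L (M 16504321087 6542)))) (B 6 8 (R 0 875643210) (L (M
  10654321087 6542))))))))))))) (B 4 7 (R 1 876453210) (B 4 8 (R 2 875463210) (B 4 9 (R 3 865473210) (B 4 10 (R 4 765483210) (B 5 6 (R 0 876542310) (B 5 7 (R 1
  876452310) (B 5 8 (R 2 875462310) (B 5 9 (R 3 865472310) (B 5 10 (R 5 765482310) (B 6 7 (B 6 8 (B 6 9 (B 6 10 (L (D 4)) (L (M 65104321087 6554))) (L (M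
  65104321087 6564))) (L (M 61504321087 6564))) (L (M 61054321087 6564))))))))))))))))))) (B′ 4 5 (R 0 876543120) (B′ 3 6 (B′ 3 7 (L (D 1)) (B′ 3 8 (L (D 1)) (B′
  3 9 (L (D 1)) (B′ 3 10 (L (D 1)) (B′ 4 6 (R 1 876534021) (B 4 7 (B 4 8 (L (D 2)) (B′ 4 9 (L (D 2)) (B′ 4 10 (L (D 2)) (B′ 5 6 (B 5 7 (B′ 5 8 (L (D 3)) (B 5 9 (L
  (D 3)) (B 5 10 (L (D 3)) (B 6 7 (B 6 8 (L (D 4)) (B 6 9 (L (D 4)) (B 6 10 (L (D 4)) (B 7 8 (L (D 5)) (B 7 9 (L (D 5)) (B 7 10 (L (D 5)) (B 8 9 (B 8 10 (B 9 10
  (B 2 1 (B′ 6 1 (B′ 4 1 (B 5 1 (B 3 1 (R 30 432105678) (B′ 7 1 (R 30 543206718) (B 8 1 (R 30 643205718) (B 9 1 (R 30 743205618) (B 10 1 (R 30 843205617) (L (S₅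
  87659991796 7 6))))))) (B 7 1 (R 0 876102435) (L (M 64054321037 5221)))) (B 3 1 (B 7 1 (R 0 876354021) (L (M 64054321027 5321))) (L (M 64054321017 5352)))) (B 3
  1 (B 5 1 (R 0 876534201) (L (M 65054321037 4121))) (L (M 65054321017 4321)))) (B 3 1 (R 0 876534201) (L (M 63254321007 5441)))) (B′ 2 1 (B′ 6 1 (B′ 4 1 (B 5 1
  (B 3 1 (R 33 432105678) (B′ 7 1 (R 33 543206718) (B 8 1 (R 33 643205718) (B 9 1 (R 33 743205618) (B 10 1 (R 33 843205617) (L (S₅ 87659991996 7 6))))))) (B 7 1
  (R 0 876102435) (L (M 65043221027 4331)))) (B 3 1 (B 7 1 (R 0 876354021) (L (M 65043121027 4331))) (L (M 65048321017 4342)))) (B 3 1 (B 5 1 (R 0 876534201) (L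
  (M 65043121017 4342))) (L (M 65043121017 4342)))) (B 3 1 (R 0 876534201) (L (M 65243821007 4331))))) (B′ 9 10 (R 0 867543210) (B′ 2 1 (B′ 6 1 (B′ 4 1 (B 5 1 (B′
  8 1 (R 37 643205718) (B 9 1 (R 37 743205618) (L (M 65432111047 3210)))) (B 7 1 (R 0 876345012) (L (M 65430221027 5410)))) (B 3 1 (B 7 1 (R 0 876354021) (L (M
  65430121027 5410))) (L (M 65430201017 5432)))) (B 3 1 (B 5 1 (R 0 876534201) (L (M 65430121017 5432))) (L (M 65430121017 5432)))) (B 3 1 (R 0 876534201) (L (M
  65432111007 5432)))))) (B 8 10 (R 0 786543210) (B 9 10 (R 1 687543210) (L (M 65432111087 3210))))))))))) (B 6 8 (B′ 6 9 (L (D 4)) (B′ 6 10 (L (D 4)) (B′ 7 8 (B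
  7 9 (L (D 5)) (B 7 10 (L (D 5)) (B 8 9 (B 8 10 (L (D 6)) (B′ 9 10 (B 2 1 (B 6 1 (B 7 1 (B 9 1 (B 3 1 (R 42 754103268) (B 4 1 (R 42 754203618) (L (M 65042321017
  6543)))) (B 8 1 (B 10 1 (R 42 865403217) (L (M 65043121057 4231))) (L (M 65412321047 6530)))) (B 4 1 (B 5 1 (B 8 1 (R 42 643205718) (L (M 60542321047 4321))) (L
  (M 65043221027 6531))) (L (M 65043121027 6531)))) (B 3 1 (B 5 1 (B 8 1 (B 4 1 (R 42 632104578) (B 7 1 (R 42 653104278) (L (M 65043121027 6531)))) (L (M
  60514321047 4321))) (L (M 65043121017 6542))) (L (M 65043121017 6542)))) (B 3 1 (B 4 1 (B 5 1 (B 8 1 (B 9 1 (R 42 763214580) (B 10 1 (R 42 863214570) (L (M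
  65043121057 4231)))) (B 6 1 (B 7 1 (R 42 543216780) (L (M 60542321047 4321))) (L (M 60514321047 4321)))) (L (M 65412321007 6554))) (L (M 63514321007 5421))) (L
  (M 63542321007 5421)))) (L (M 65043121087 4231)))) (B 8 10 (R 0 786543210) (L (M 65412321087 6530)))))) (B 7 9 (B 7 10 (L (D 5)) (B′ 8 9 (B 8 10 (B 9 10 (B′ 2 1
  (B 6 1 (B 7 1 (B 8 1 (B′ 3 1 (R 43 654103278) (B 4 1 (R 43 654203718) (L (M 65014321017 6543)))) (B 9 1 (R 0 867453120) (L (M 6544321057 4321)))) (B 4 1 (B 5 1
  (B 9 1 (R 44 743205618) (L (M 63254321057 4110))) (L (M 65044321037 6521))) (L (M 65014321027 6543)))) (B 3 1 (B 5 1 (B 8 1 (B 7 1 (R 44 653104278) (B 4 1 (R 44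
  632104578) (L (M 65014321027 6543)))) (L (M 61354321047 5220))) (L (M 65014321037 6521))) (L (M 60254321017 5343)))) (B 3 1 (B 4 1 (B 5 1 (B 8 1 (B 9 1 (R 44
  763214580) (B 7 1 (R 44 653214780) (L (M 63254321057 4110)))) (B 6 1 (B 9 1 (R 44 743215680) (L (M 6544321057 4321))) (L (M 61354321047 5220)))) (L (M
  65214321007 6543))) (L (M 61354321007 5243))) (L (M 63254321007 5341)))) (L (M 65014321087 4321))) (L (M 60542321087 4321))) (L (M 6544321087 4321)))) (B 7 10
  (R 0 786543210) (L (M 63254321087 4110))))))) (B 6 9 (R 1 867543210) (B 6 10 (R 2 768543210) (B 7 8 (R 0 876453120) (B 7 9 (R 1 867453120) (L (M 16354321087
  5220))))))))))) (B′ 6 7 (R 0 876534201) (B′ 5 8 (B′ 5 9 (L (D 3)) (B′ 5 10 (L (D 3)) (B′ 6 8 (B 6 9 (L (D 4)) (B 6 10 (L (D 4)) (B 8 7 (B 8 9 (L (D 6)) (B 8 10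
  (L (D 6)) (B 7 9 (B 7 10 (L (D 5)) (B′ 9 10 (B 2 1 (B′ 6 1 (B′ 7 1 (B 3 1 (B 5 1 (R 50 543106278) (B 8 1 (R 50 654103278) (L (M 65402321037 6521)))) (B 4 1 (B 5
  1 (R 50 543206718) (B 8 1 (R 50 654203718) (L (M 65402321037 6521)))) (L (M 65402321017 6543)))) (B 4 1 (B 8 1 (B 9 1 (R 50 764203518) (L (M 65043221047 6531)))
  (L (M 60543221047 5331))) (L (M 64504321027 5321)))) (B 3 1 (B 5 1 (R 0 876534201) (L (M 65204321037 6541))) (L (M 65403221017 6543)))) (B 3 1 (R 0 876534201)
  (L (M 63543221007 5420)))) (L (M 65403221087 4331)))) (B 7 10 (R 0 786543210) (L (M 65043221087 6531)))))) (B 8 9 (B 8 10 (L (D 6)) (L (M 61534321087 5420))) (L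
  (M 16534321087 5420)))))) (B 6 9 (B 6 10 (L (D 4)) (B′ 7 10 (B 7 8 (B 7 9 (L (D 5)) (B′ 8 9 (B 8 10 (L (D 6)) (L (M 60544321087 5321))) (L (M 6544321087
  5321)))) (B 7 9 (R 0 867534201) (B 8 9 (B 8 10 (B 9 10 (B 2 1 (B′ 6 1 (B′ 8 1 (B 4 1 (B 10 1 (R 54 864203517) (B 9 1 (R 54 764203518) (L (M 65142321057 6430))))
  (B 3 1 (B 7 1 (R 54 654103278) (L (M 60154321027 6543))) (L (M 60534321017 6541)))) (B 5 1 (B 9 1 (B 10 1 (R 54 874305216) (L (M 60543221057 6431))) (L (M
  6543221057 6331))) (L (M 60544321037 6521)))) (B 3 1 (B 5 1 (R 0 867534201) (L (M 60154321037 6552))) (L (M 60254321017 6543)))) (B 3 1 (R 0 867534201) (L (M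
  65244321007 6530)))) (L (M 65142321087 6430))) (L (M 60543221087 6431))) (L (M 6543221087 6331))))) (L (M 60154321087 5243)))) (B 6 10 (R 0 786543210) (L (M
  65134321087 6520))))))) (B 5 9 (R 1 867543210) (B 5 10 (R 2 768543210) (B 6 8 (R 0 876534201) (B 6 9 (R 1 867534201) (L (M 6544321087 6521))))))))) (B 5 7 (R 0
  876453120) (B 6 7 (R 1 876354021) (B 5 8 (B′ 5 9 (B′ 5 10 (L (D 3)) (B′ 6 8 (B′ 6 9 (B′ 6 10 (L (D 4)) (B 8 9 (B 8 7 (L (D 6)) (B 8 10 (L (D 6)) (R 34
  852104376))) (B 8 7 (B′ 8 10 (L (D 6)) (B 7 9 (B 7 10 (L (D 5)) (B 9 10 (L (D 7)) (B 2 1 (B′ 6 1 (B 7 1 (B 5 1 (B 3 1 (R 62 543106278) (B 4 1 (R 62 543206718)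
  (L (M 65400321017 5343)))) (B 8 1 (B 9 1 (R 62 765403218) (L (M 65400321037 4321))) (L (M 65400321037 5321)))) (B 4 1 (B 8 1 (B 9 1 (R 62 764203518) (L (M
  65430121037 4332))) (L (M 65430121037 5332))) (L (M 65430121027 5343)))) (B 3 1 (B 8 1 (B 9 1 (B 4 1 (R 62 762103458) (B 7 1 (R 62 765103248) (L (M 65430121027
  5343)))) (L (M 65403121037 4320))) (L (M 65403121037 5320))) (L (M 65430221017 5343)))) (B 3 1 (R 0 876534201) (L (M 65432121007 5343)))))) (B 7 10 (B′ 9 10 (B′
  5 1 (B 6 1 (B 7 1 (B 2 1 (B 3 1 (R 63 543106278) (B′ 4 1 (R 63 543206718) (B 8 1 (R 63 654307218) (B 9 1 (R 63 754306218) (B 10 1 (R 63 854306217) (L (S₅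
  87699921791 2 1))))))) (B 3 1 (R 0 876534201) (B 4 1 (B 8 1 (R 64 654327810) (B 9 1 (R 64 754326810) (B 10 1 (R 64 854326710) (L (S₅ 87699971090 1 0))))) (L (M
  65433121007 6543))))) (B 10 1 (B 4 1 (B 2 1 (R 64 843205617) (B 3 1 (R 64 843215670) (B 8 1 (R 64 864325710) (B 9 1 (R 64 874325610) (L (S₅ 7659991095 1 0))))))
  (B 8 1 (B 2 1 (R 64 864305217) (B 3 1 (R 64 864315270) (L (M 65433121007 6543)))) (L (M 65430121037 6563)))) (L (M 62054321057 4130)))) (B 3 1 (B 8 1 (B′ 10 1
  (B 2 1 (R 64 863104257) (B 4 1 (R 64 863214570) (B 7 1 (R 64 865314270) (B 9 1 (R 64 876314250) (L (S₅ 97954427092 2 0)))))) (B 7 1 (B 9 1 (R 64 765314280) (L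
  (M 65403121057 4320))) (L (M 62054321057 4130)))) (L (M 62504321047 5341))) (L (M 62504321017 5453)))) (B 2 1 (B 8 1 (B 6 1 (R 0 876534201) (B 3 1 (B 9 1 (B 7 1
  (R 65 765103248) (B 10 1 (R 65 876103245) (L (M 62054321057 4130)))) (L (M 65204321057 6541))) (L (M 62504321017 5453)))) (L (M 62504321037 5441))) (L (M
  62514321007 5453)))) (B 2 1 (B′ 6 1 (B 7 1 (B 5 1 (B 3 1 (R 66 543106278) (B 4 1 (R 66 543206718) (L (M 65400321017 5343)))) (B 8 1 (B 9 1 (R 66 765403218) (L
  (M 65400321037 4321))) (L (M 65400321037 5321)))) (B 4 1 (B 8 1 (B 10 1 (R 66 864203517) (L (M 65430121037 4332))) (L (M 65430121037 6332))) (L (M 65430121027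
  6343)))) (B 3 1 (B 8 1 (B 9 1 (B 7 1 (R 66 765103248) (B 4 1 (R 66 762103458) (L (M 65430121027 6343)))) (L (M 65403121037 4320))) (L (M 65403121037 5320))) (L
  (M 65430221017 6343)))) (B 3 1 (R 0 876534201) (L (M 65432121007 6343))))) (L (M 62054321087 4130))))) (B 9 7 (R 0 867543210) (B 8 10 (B 9 10 (B 10 7 (B 4 1 (B
  5 1 (B 6 1 (B 10 1 (B 2 1 (R 69 843205617) (B 3 1 (R 69 843215670) (B 8 1 (R 69 864325710) (B 9 1 (R 69 874325610) (B 7 1 (R 69 854326710) (L (S₅ 97659991090 1
  0))))))) (B 7 1 (B 8 1 (R 69 654327810) (B 9 1 (R 69 754326810) (L (M 65430121067 6332)))) (L (M 60254321057 4130)))) (B 3 1 (B 8 1 (B 9 1 (R 69 763214580) (L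
  (M 61254321047 6530))) (L (M 62154321047 6530))) (L (M 60254321017 6530)))) (B 2 1 (B 8 1 (B 9 1 (B 3 1 (R 69 762103458) (B 6 1 (R 69 764203518) (L (M
  60254321017 6530)))) (L (M 60254321037 6541))) (L (M 62054321037 6541))) (L (M 60254321007 6541)))) (B 2 1 (B 3 1 (B 7 1 (B 5 1 (B 6 1 (R 69 543106278) (B 8 1
  (R 69 653104278) (L (M 62154321047 6530)))) (B 8 1 (B 9 1 (R 69 765103248) (L (M 60254321037 6541))) (L (M 62054321037 6541)))) (L (M 6543121027 6353))) (L (M
  6542321017 6353))) (L (M 16543221007 6353)))) (L (M 60254321087 4130))) (B′ 7 10 (B 2 1 (B′ 6 1 (B 4 1 (B 5 1 (B 10 1 (R 69 843205617) (B 8 1 (R 69 643205718)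
  (L (M 65430121047 6332)))) (B 8 1 (B 9 1 (R 69 764203518) (L (M 65240321037 6410))) (L (M 16540321037 6342)))) (B 3 1 (B 7 1 (B 5 1 (R 69 543106278) (B 8 1 (R
  69 654103278) (L (M 16540321037 6342)))) (L (M 65430121027 6463))) (L (M 65430321017 6410)))) (B 3 1 (B 8 1 (B 9 1 (B 7 1 (R 69 765103248) (B 4 1 (R 69
  762103458) (L (M 65430121027 6463)))) (L (M 65243121037 6410))) (L (M 6543121037 6342))) (L (M 65240321017 6453)))) (B 3 1 (R 0 876534201) (L (M 65243121007
  6453)))) (L (M 65243121087 5310)))) (B 9 10 (R 0 867543210) (L (M 65430121087 6332)))))))) (B′ 8 7 (B 8 9 (L (D 6)) (B 8 10 (L (D 6)) (B 7 9 (R 0 876453120) (B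
  6 10 (B 7 10 (R 4 786354021) (B′ 9 10 (B 2 1 (B′ 6 1 (B 4 1 (B 5 1 (B 8 1 (R 72 643205718) (B 7 1 (R 72 543206718) (L (M 65430121037 6532)))) (B 8 1 (B 9 1 (R
  72 764203518) (L (M 65140321037 6542))) (L (M 61540321037 5442)))) (B 3 1 (B 7 1 (B 5 1 (R 72 543106278) (B 8 1 (R 72 654103278) (L (M 61540321037 5442)))) (L
  (M 65430121027 6543))) (L (M 64540321017 5310)))) (B 3 1 (B 8 1 (B 10 1 (B 4 1 (R 72 862103457) (B 7 1 (R 72 865103247) (L (M 65430121027 6543)))) (L (M
  65043121037 6542))) (L (M 6543121037 5442))) (L (M 65430221017 6543)))) (B 3 1 (R 0 786534201) (L (M 65432121007 6543)))) (L (M 65430121087 4332)))) (B 7 10 (R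
  0 876453120) (L (M 65043121087 6542))))))) (B 6 10 (B 8 9 (B 8 10 (L (D 6)) (B′ 9 7 (B 9 10 (L (D 7)) (B 7 10 (B′ 2 1 (B′ 6 1 (B 7 1 (B 5 1 (B 3 1 (R 74
  543106278) (B 4 1 (R 74 543206718) (B 8 1 (R 74 654307218) (B 9 1 (R 74 754306218) (B 10 1 (R 74 854306217) (L (S₅ 87699921691 2 1))))))) (B 8 1 (B 9 1 (R 74
  765403218) (L (M 65204321037 6441))) (L (M 61540321037 6442)))) (B 4 1 (B 9 1 (B 10 1 (R 74 874203516) (L (M 65243321047 5410))) (L (M 65243321047 6410))) (L (M
  61540321027 6453)))) (B 3 1 (B 8 1 (B 10 1 (B 7 1 (R 74 865103247) (B 4 1 (R 74 862103457) (L (M 61540321027 6453)))) (L (M 65204321047 5341))) (L (M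
  61534321047 6420))) (L (M 65204321017 6453)))) (B 3 1 (B 4 1 (B 5 1 (R 0 821540763) (L (M 65214321007 6453))) (L (M 61534321007 6454))) (L (M 65243321007
  6454)))) (L (M 65243321087 5410)))) (L (M 6254321087 6341)))) (B 8 10 (R 0 786534201) (B 7 9 (B 7 10 (B 9 10 (R 1 687435102) (B 2 1 (B′ 6 1 (B 7 1 (B 5 1 (B 3 1
  (R 77 543106278) (B 4 1 (R 77 543206718) (L (M 65400321017 5343)))) (B 8 1 (B 9 1 (R 77 765403218) (L (M 65400321037 4321))) (L (M 65400321037 5321)))) (B 4 1
  (B 9 1 (B 10 1 (R 77 874203516) (L (M 65430121037 5332))) (L (M 65430121037 6332))) (L (M 65430121027 6353)))) (B 3 1 (B 8 1 (B 10 1 (B 7 1 (R 77 865103247) (B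
  4 1 (R 77 862103457) (L (M 65430121027 6353)))) (L (M 65403121037 4320))) (L (M 65403121037 6320))) (L (M 65430221017 6353)))) (B 3 1 (R 0 786534201) (L (M
  65432121007 6353))))) (L (M 61540321087 5342))) (L (M 6543121087 5342))))) (L (M 61254321087 6530))))) (B 6 9 (R 1 867543210) (B′ 7 8 (R 0 876453120) (L (M
  1654321087 6352)))))) (B′ 5 10 (R 1 786543210) (B′ 6 8 (B′ 6 9 (R 0 876534201) (B 6 10 (R 4 786534201) (L (M 65204321087 6541)))) (B 7 8 (R 0 876453120) (B 6 9
  (B 6 10 (R 3 687534201) (L (M 60154321087 6552))) (L (M 6154321087 6552))))))) (B 5 9 (R 1 867543210) (B 5 10 (R 2 768543210) (B 6 8 (R 0 876534201) (B 6 9 (R 1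
  867534201) (L (M 6514321087 6521))))))))))))) (B′ 4 8 (R 0 875643210) (B′ 4 9 (R 1 865743210) (B′ 4 10 (R 2 765843210) (B′ 5 6 (B 5 7 (B′ 5 8 (L (D 3)) (B′ 5 9
  (L (D 3)) (B′ 5 10 (L (D 3)) (B′ 6 7 (B 6 8 (L (D 4)) (B 6 9 (L (D 4)) (B 6 10 (L (D 4)) (B 7 8 (R 0 872610543) (B 7 9 (R 1 862710543) (L (M 6454321087
  5321))))))) (B 6 8 (B 6 9 (L (D 4)) (B′ 6 10 (L (D 4)) (L (M 65014321087 6543)))) (B 6 9 (R 0 867543210) (L (M 6514321087 6543)))))))) (B 5 8 (R 1 875643210) (B
  5 9 (R 2 865743210) (B 5 10 (R 3 765843210) (B 6 7 (R 0 876534201) (B 6 8 (R 1 875634201) (B 6 9 (R 2 865734201) (L (M 6514321087 6543))))))))) (B 5 7 (B′ 5 8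
  (B′ 5 9 (L (D 3)) (B′ 5 10 (L (D 3)) (B′ 6 7 (B 6 8 (B 6 9 (L (D 4)) (B 6 10 (L (D 4)) (B 7 8 (B 7 9 (L (D 5)) (B 7 10 (L (D 5)) (R 67 872104365))) (B 7 9 (B 7
  10 (L (D 5)) (B′ 8 10 (B 8 9 (L (D 6)) (B 9 10 (B 5 1 (B 6 1 (B 9 1 (B 8 1 (B′ 2 1 (R 95 764305218) (B 3 1 (R 95 764315280) (B 4 1 (R 95 764325810) (L (M
  65443121007 6543))))) (B 10 1 (B 2 1 (R 96 874305216) (B 3 1 (R 96 874315260) (B 4 1 (R 96 874325610) (L (M 65443121007 6543))))) (L (M 65430121047 6553)))) (B
  7 1 (B 10 1 (R 0 785643210) (L (M 65430121057 6453))) (L (M 65430121037 6564)))) (B 3 1 (B 7 1 (B 8 1 (B′ 9 1 (R 96 765314280) (B 10 1 (R 96 865314270) (L (M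
  65430121057 6453)))) (L (M 65403121037 6564))) (L (M 65043121037 6554))) (L (M 65104321017 6530)))) (B 2 1 (B 7 1 (B 8 1 (B 3 1 (B 9 1 (R 97 765103248) (B 10 1
  (R 97 865103247) (L (M 65430121057 6453)))) (B 6 1 (R 0 876534201) (L (M 65104321017 6530)))) (L (M 65410321037 6564))) (L (M 65140321037 6554))) (L (M
  65104321007 6541)))) (L (M 65430121087 6453)))) (L (M 60543121087 5343)))) (B 7 10 (R 0 786543210) (L (M 65043121087 6543))))))) (B′ 7 8 (B 7 9 (L (D 5)) (B′ 7
  10 (L (D 5)) (L (M 65140321087 6543)))) (B 6 9 (B 6 10 (L (D 4)) (B′ 7 9 (R 0 867534201) (B 7 10 (B 8 9 (B 8 10 (B 9 10 (R 54 210435768) (L (M 65140321087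
  6443))) (L (M 60543121087 6443))) (L (M 6543121087 6343))) (L (M 65140321087 6543))))) (B 6 10 (R 0 786543210) (L (M 65104321087 6530)))))) (B 6 8 (R 0
  875643210) (B 6 9 (B 6 10 (B 7 9 (B 7 10 (B 7 8 (L (D 5)) (B 9 8 (B 9 10 (L (D 7)) (B 8 10 (B′ 2 1 (B′ 6 1 (B 7 1 (B 8 1 (B 3 1 (R 101 654103278) (B 4 1 (R 101
  654203718) (L (M 65403321017 6454)))) (B 5 1 (B 9 1 (R 101 754306218) (L (M 65403321047 6421))) (L (M 65410321037 6454)))) (B 5 1 (B 9 1 (B 10 1 (R 101
  874305216) (L (M 65043321047 5421))) (L (M 65043321047 6421))) (L (M 65140321037 6454)))) (B 3 1 (B 9 1 (B 10 1 (B 5 1 (R 101 873104256) (B 7 1 (R 101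
  875103246) (L (M 65140321037 6454)))) (L (M 65014321047 5430))) (L (M 65014321047 6430))) (L (M 10654321017 6353)))) (B 3 1 (R 0 658734201) (L (M 65423321007
  6454)))) (L (M 65403321087 5421)))) (L (M 6543121087 6463)))) (L (M 60154321087 6453))) (L (M 6154321087 6453))) (L (M 60514321087 6553))) (L (M 6514321087
  6553))))))) (B′ 5 9 (R 1 867543210) (B′ 5 10 (R 2 768543210) (B′ 6 7 (B 6 8 (R 0 876534201) (B 6 9 (R 1 867534201) (L (M 6514321087 6541)))) (B 6 8 (B 6 9 (R 1
  857634201) (L (M 65014321087 6564))) (L (M 60514321087 6564))))))) (B 5 8 (R 1 875643210) (B 5 9 (R 2 865743210) (B 5 10 (R 3 765843210) (B 6 7 (R 0 876534201)
  (B 6 8 (R 1 875634201) (L (M 60514321087 6564)))))))))))))))))) (B 3 7 (R 1 876453210) (B′ 3 8 (R 2 875463210) (B 3 9 (R 3 865473210) (B 3 10 (R 4 765483210) (B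
  4 6 (R 0 876543120) (B 4 7 (R 1 876453120) (B 4 8 (R 2 875463120) (B 4 9 (R 3 865473120) (B 4 10 (R 8 765483120) (B′ 5 6 (B 5 7 (B 5 8 (L (D 3)) (B′ 5 9 (L (D
  3)) (B′ 5 10 (L (D 3)) (B′ 6 7 (B 6 8 (R 2 872160543) (B 6 9 (R 3 862170543) (L (M 6514321087 6543)))) (B 6 8 (B 6 9 (B 6 10 (L (D 4)) (B′ 7 10 (B 7 8 (B 7 9 (L
  (D 5)) (B′ 8 9 (R 3 821053764) (L (M 6541321087 5443)))) (B 7 9 (R 0 867543210) (L (M 6541321087 6543)))) (L (M 61054321087 5343)))) (B′ 6 10 (R 0 786543210) (L
  (M 65014321087 6543)))) (B 6 9 (R 0 867543210) (L (M 6514321087 6543)))))))) (B′ 5 8 (R 0 875643210) (B′ 5 9 (R 1 865743210) (B′ 5 10 (R 2 765843210) (B′ 6 7 (B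
  6 8 (B 6 9 (L (D 4)) (B′ 6 10 (L (D 4)) (L (M 65104321087 6543)))) (B′ 6 9 (R 0 867543210) (L (M 16504321087 6543)))) (B 6 8 (R 0 875643210) (L (M 10654321087
  6543)))))))) (B 5 7 (R 0 876453210) (B 5 8 (R 1 875463210) (B 5 9 (R 2 865473210) (B 5 10 (R 3 765483210) (B 6 7 (B 6 8 (B 6 9 (B 6 10 (L (D 4)) (L (M
  65104321087 6554))) (L (M 65104321087 6564))) (L (M 61504321087 6564))) (L (M 61054321087 6564)))))))))))))))))))) (B 3 5 (R 0 876542310) (B′ 4 5 (R 1
  876541320) (B 3 6 (B′ 3 7 (B′ 3 8 (L (D 1)) (B′ 3 9 (L (D 1)) (B′ 3 10 (L (D 1)) (B′ 6 7 (R 1 876320541) (B 4 6 (B 4 7 (B′ 4 8 (L (D 2)) (B 4 9 (L (D 2)) (B 4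
  10 (L (D 2)) (B 6 5 (B′ 6 8 (L (D 4)) (B′ 6 9 (L (D 4)) (B 6 10 (L (D 4)) (B 5 7 (B 5 8 (L (D 3)) (B 5 9 (L (D 3)) (B 5 10 (L (D 3)) (B 7 8 (L (D 5)) (B 7 9 (L
  (D 5)) (B 7 10 (L (D 5)) (B 8 9 (B 8 10 (B 9 10 (B 2 1 (B′ 6 1 (B′ 7 1 (B 3 1 (B 4 1 (R 135 542103678) (B′ 5 1 (R 135 543106278) (B′ 8 1 (R 135 654103278) (B 9
  1 (R 135 754103268) (B 10 1 (R 135 854103267) (L (S₅ 87699329796 7 6))))))) (B 4 1 (R 0 876543120) (B 5 1 (R 1 876542130) (B 8 1 (B 9 1 (R 137 765403218) (B′ 10
  1 (R 137 865403217) (L (S₅ 87999321997 8 7)))) (B 9 1 (R 0 867543210) (L (M 54084321076 7675))))))) (B 3 1 (B 4 1 (B 5 1 (R 138 432105678) (L (M 64054321037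
  5251))) (L (M 64054321027 5351))) (L (M 64054321017 5352)))) (B 3 1 (B 4 1 (R 0 876325401) (L (M 65054321027 4341))) (L (M 65054321017 4342)))) (B 3 1 (R 0
  876325401) (L (M 63254321007 5141)))) (B′ 2 1 (B′ 6 1 (B′ 7 1 (B 3 1 (B 4 1 (R 140 542103678) (B′ 5 1 (R 140 543106278) (B′ 8 1 (R 140 654103278) (B 9 1 (R 140
  754103268) (B 10 1 (R 140 854103267) (L (S₅ 87699329996 7 6))))))) (B 4 1 (R 0 876543120) (B 5 1 (R 1 876542130) (B 8 1 (B 9 1 (R 142 765403218) (B 10 1 (R 142
  865403217) (L (M 54088321076 7670)))) (B 9 1 (B 10 1 (R 142 875403216) (L (S₅ 89699321996 8 6))) (L (M 54088321076 7675))))))) (B 3 1 (B 4 1 (B 5 1 (R 142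
  432105678) (L (M 65048321037 4241))) (L (M 65048321027 4341))) (L (M 65048321017 4342)))) (B 3 1 (B 4 1 (R 0 876325401) (L (M 65042321027 4341))) (L (M
  65041321017 4342)))) (B 3 1 (R 0 876325401) (L (M 65143210007 4232))))) (B′ 9 10 (R 0 867543210) (B′ 2 1 (B′ 6 1 (B′ 7 1 (B 3 1 (B 4 1 (R 145 542103678) (B′ 5 1
  (R 145 543106278) (B′ 8 1 (R 145 654103278) (B 9 1 (R 145 754103268) (B 10 1 (R 145 854103267) (L (S₅ 87699329996 7 6))))))) (B 4 1 (R 0 876543120) (B 5 1 (R 1
  876542130) (B 8 1 (B 9 1 (R 147 765403218) (B′ 10 1 (R 147 865403217) (L (M 54088321076 7670)))) (B 9 1 (R 0 867543210) (L (M 54088321076 7675))))))) (B 3 1 (B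
  4 1 (B 5 1 (R 148 432105678) (L (M 65034321037 4241))) (L (M 65024321027 4341))) (L (M 65014321017 4342)))) (B 3 1 (B 4 1 (R 0 876325401) (L (M 65042321027
  4341))) (L (M 65041321017 4342)))) (B 3 1 (R 0 876325401) (L (M 65143210007 4232)))))) (B 8 10 (R 0 786543210) (B 9 10 (R 1 687543210) (B 2 1 (B′ 6 1 (B′ 7 1 (B
  3 1 (B 4 1 (R 152 542103678) (B′ 5 1 (R 152 543106278) (B′ 8 1 (R 152 654103278) (B 9 1 (R 152 754103268) (B 10 1 (R 152 854103267) (L (M 54388210876
  7670))))))) (B 4 1 (R 0 876543120) (B 5 1 (R 1 876542130) (B 8 1 (B 9 1 (R 154 765403218) (B′ 10 1 (R 154 865403217) (L (M 54388210876 7673)))) (B 9 1 (R 0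
  867543210) (L (M 54388210876 7675))))))) (B 3 1 (B 4 1 (B 5 1 (R 155 432105678) (L (M 65423210827 3130))) (L (M 65413210817 3230))) (L (M 65403210807 3231))))
  (B 3 1 (B 4 1 (R 0 876325401) (L (M 65431210817 3230))) (L (M 65430210807 3231)))) (B 3 1 (R 0 876325401) (L (M 65432180007 3121))))))))))))) (B 5 8 (B′ 5 9 (L
  (D 3)) (B′ 5 10 (L (D 3)) (B′ 7 8 (B 7 9 (L (D 5)) (B 7 10 (L (D 5)) (B 8 9 (B 8 10 (L (D 6)) (B′ 9 10 (B 2 1 (B′ 6 1 (B′ 7 1 (B 5 1 (B 9 1 (R 157 754306218) (B
  10 1 (R 157 854306217) (L (M 65034321057 4241)))) (B 8 1 (B 9 1 (R 157 765403218) (B 10 1 (R 157 865403217) (L (M 65034321057 4241)))) (L (M 60534321037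
  4241)))) (B 3 1 (B 4 1 (B 8 1 (R 157 642103578) (L (M 60534321037 4241))) (L (M 64054321027 5130))) (L (M 64054321017 5230)))) (B 3 1 (B 4 1 (R 0 876325401) (L
  (M 65034321027 6541))) (L (M 65034321017 6542)))) (B 3 1 (R 0 876325401) (L (M 65234321007 6541)))) (L (M 65034321087 4241)))) (B 8 10 (R 0 786543210) (B 9 10
  (B 2 1 (B′ 6 1 (B′ 7 1 (B 5 1 (B 9 1 (R 160 754306218) (B 10 1 (R 160 854306217) (L (M 65403021057 3231)))) (B 8 1 (B 9 1 (R 160 765403218) (B 10 1 (R 160
  865403217) (L (M 65403021057 3231)))) (L (M 60534321037 4241)))) (B 3 1 (B 4 1 (B 8 1 (R 160 642103578) (L (M 60534321037 4241))) (L (M 64504321027 5310))) (L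
  (M 64504321017 5320)))) (B 3 1 (B 4 1 (R 0 876325401) (L (M 65403021027 6531))) (L (M 65403021017 6532)))) (B 3 1 (R 0 876325401) (L (M 65423221007 6531)))) (L
  (M 65403021087 3231))))))) (B 7 9 (B 7 10 (L (D 5)) (B′ 8 9 (B 8 10 (B 9 10 (R 59 214053876) (L (M 65034321087 4241))) (L (M 60534321087 4241))) (L (M
  6534321087 4241)))) (B 7 10 (R 0 786543210) (L (M 62154321087 4330))))))) (B 5 9 (R 1 867543210) (B 5 10 (R 2 768543210) (B 7 8 (R 0 876325401) (L (M
  40654321087 5251)))))))))) (B 7 5 (R 0 876453210) (B 6 8 (B′ 6 9 (L (D 4)) (B′ 6 10 (L (D 4)) (B′ 7 8 (R 1 873056214) (B 7 9 (B 7 10 (L (D 5)) (B′ 5 8 (B 5 9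
  (B′ 5 10 (L (D 3)) (B 8 9 (R 52 852140763) (B 8 10 (B 9 10 (B′ 2 1 (B 6 1 (B 7 1 (B 5 1 (B 10 1 (R 168 854306217) (B 8 1 (R 168 654307218) (L (M 64534321057
  2010)))) (B 8 1 (B 9 1 (R 168 765403218) (L (M 60554321037 4241))) (L (M 64054321037 5251)))) (B 3 1 (B 4 1 (B 9 1 (R 168 742103568) (L (M 26543121047 5310)))
  (L (M 64054321027 5130))) (L (M 64054321017 5230)))) (B 3 1 (B 4 1 (B 8 1 (B 9 1 (R 168 762103458) (B 5 1 (R 168 632104578) (L (M 60554321037 4241)))) (L (M
  26543121037 6410))) (L (M 60554321027 4130))) (L (M 60554321017 4230)))) (B 3 1 (B 4 1 (B 5 1 (B 8 1 (B 9 1 (R 168 763214580) (B 7 1 (R 168 653214780) (L (M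
  26543121047 5310)))) (B 6 1 (B 10 1 (R 168 843215670) (L (M 64534321057 2010))) (L (M 26543121037 6410)))) (L (M 60554321007 4241))) (L (M 65443321007 6510)))
  (L (M 65443321007 6520)))) (L (M 65443321087 2010))) (L (M 64534321087 2010))))) (B′ 8 9 (R 0 873506214) (B′ 5 10 (B 8 10 (R 58 752140863) (L (M 64534321087
  2010))) (L (M 60554321087 4241))))) (B 5 9 (R 0 867453210) (B 8 9 (R 1 837056214) (B 5 10 (B 8 10 (B 10 9 (B 2 1 (B 6 1 (B 7 1 (B 10 1 (B 3 1 (R 172 854103267)
  (B 4 1 (R 172 854203617) (B 5 1 (R 172 854306217) (B 8 1 (R 172 865403217) (B 9 1 (R 172 875403216) (L (M 50443321076 7675))))))) (B 5 1 (B 8 1 (R 172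
  654307218) (L (M 60543321057 4241))) (L (M 64054321037 5251)))) (B 3 1 (B 4 1 (B 9 1 (R 172 742103568) (L (M 16543281047 5320))) (L (M 16540321027 6420))) (L (M
  26540321017 6410)))) (B 3 1 (B 4 1 (B 8 1 (B 10 1 (R 172 862103457) (B 5 1 (R 172 632104578) (L (M 64054321037 5251)))) (L (M 16543281037 6420))) (L (M
  16540321027 6442))) (L (M 26540321017 6441)))) (B 3 1 (B 4 1 (B 5 1 (B 10 1 (B 6 1 (R 172 843215670) (B 8 1 (R 172 863214570) (L (M 16543281037 6420)))) (B 8 1
  (B 9 1 (R 172 763214580) (L (M 65443321057 2010))) (L (M 60543321057 4241)))) (L (M 16543281007 6453))) (L (M 16543201007 6453))) (L (M 16543210007 6453)))) (L
  (M 65443321087 2010))) (L (M 60543321087 4241))) (L (M 64054321087 5251))))))) (B 7 10 (R 0 786543210) (B′ 5 8 (B 5 9 (B 5 10 (L (D 3)) (L (M 62154321087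
  4130))) (L (M 26154321087 4130))) (L (M 21654321087 6430)))))))) (B 6 9 (R 1 867543210) (B 6 10 (R 2 768543210) (B 7 8 (R 0 876453210) (B 7 9 (R 1 867453210) (B
  7 10 (R 3 768453210) (L (M 65243121087 6510))))))))))))) (B′ 6 5 (R 0 876325401) (B′ 4 8 (B′ 4 9 (L (D 2)) (B′ 4 10 (L (D 2)) (B′ 6 8 (R 61 875310642) (B 6 9
  (B′ 6 10 (L (D 4)) (B′ 5 7 (B 5 8 (B′ 5 9 (L (D 3)) (B 5 10 (L (D 3)) (B 7 8 (R 61 874210653) (B 7 10 (B 7 9 (L (D 5)) (B 8 9 (B 8 10 (L (D 6)) (L (M
  60524321087 5341))) (L (M 6543321087 5241)))) (L (M 60154321087 5342)))))) (B′ 7 9 (R 0 867325401) (B′ 5 9 (B′ 5 10 (L (D 3)) (B 7 8 (B 7 10 (L (D 5)) (B 8 9 (B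
  8 10 (L (D 6)) (B 9 10 (L (D 7)) (B 2 1 (B′ 3 1 (B 8 1 (B′ 9 1 (B 4 1 (R 179 762103458) (B 5 1 (R 179 763104258) (B 6 1 (R 179 764103258) (B 7 1 (R 179
  765103248) (B 10 1 (R 179 876103245) (L (S₅ 89354329592 4 2))))))) (B 5 1 (B 6 1 (R 179 643105278) (L (M 65043221037 4131))) (L (M 65043321037 4120)))) (B 4 1
  (B 7 1 (B 9 1 (R 180 752103468) (B 5 1 (R 180 532104678) (L (M 65432211057 4310)))) (L (M 65143221047 5320))) (L (M 65043321027 5341)))) (B 6 1 (B 7 1 (B 4 1 (R
  0 835170642) (B 8 1 (B 5 1 (R 180 654307218) (B 9 1 (R 180 765403218) (L (M 65043321037 4120)))) (L (M 65043321027 5341)))) (L (M 65043221017 5331))) (L (M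
  65043221017 5341)))) (B 4 1 (R 0 853716042) (L (M 65143221007 5341)))))) (B 8 10 (B 9 10 (B 2 1 (B 3 1 (B 8 1 (B 9 1 (B 4 1 (R 181 762103458) (B 5 1 (R 181
  763104258) (B 6 1 (R 181 764103258) (B 7 1 (R 181 765103248) (B 10 1 (R 181 876103245) (L (S₅ 89354329592 4 2))))))) (B 5 1 (B 6 1 (R 181 643105278) (L (M
  16543221037 5420))) (L (M 6544321037 5241)))) (B 4 1 (B 7 1 (B 9 1 (R 181 752103468) (B 5 1 (R 181 532104678) (L (M 6544321037 5241)))) (L (M 16543221047
  6320))) (L (M 6544321027 6341)))) (B 6 1 (B 7 1 (B′ 4 1 (B 5 1 (R 181 543206718) (B 9 1 (R 181 754203618) (L (M 6544321037 5241)))) (B 8 1 (B 5 1 (R 181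
  654307218) (B 9 1 (R 181 765403218) (L (M 6544321037 5241)))) (L (M 6544321027 6341)))) (L (M 6544321017 6352))) (L (M 6544321017 6352)))) (B 4 1 (B 5 1 (B 3 1
  (R 0 867325401) (B 6 1 (B 7 1 (B 8 1 (R 182 654327810) (B 9 1 (R 182 754326810) (B 10 1 (R 182 854326710) (L (S₅ 87699671090 1 0))))) (L (M 65343221017 6520)))
  (L (M 64543221017 6520)))) (L (M 16543221007 6354))) (L (M 16543221007 6354)))) (B′ 2 1 (B 3 1 (B 8 1 (B 9 1 (B 4 1 (R 182 762103458) (B 5 1 (R 182 763104258)
  (B 6 1 (R 182 764103258) (B 7 1 (R 182 765103248) (B 10 1 (R 182 876103245) (L (S₅ 89354329592 4 2))))))) (B 5 1 (B 6 1 (R 182 643105278) (L (M 65043221037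
  4131))) (L (M 65043321037 4120)))) (B 4 1 (B 7 1 (B 9 1 (R 182 752103468) (B 5 1 (R 182 532104678) (L (M 65043321037 4120)))) (L (M 65143221047 5320))) (L (M
  65043321027 5341)))) (B′ 6 1 (B 7 1 (B 4 1 (B 5 1 (R 182 543206718) (B 9 1 (R 182 754203618) (L (M 65043321037 4120)))) (B 8 1 (B 5 1 (R 182 654307218) (B 9 1
  (R 182 765403218) (L (M 65043321037 4120)))) (L (M 65043321027 5341)))) (L (M 65043221017 5331))) (L (M 65043221017 5341)))) (B 3 1 (R 0 876234501) (L (M
  65343221007 4120))))) (B 9 10 (R 0 867452310) (B 2 1 (B 3 1 (B 8 1 (B 9 1 (B 4 1 (R 184 762103458) (B 5 1 (R 184 763104258) (B 6 1 (R 184 764103258) (B 7 1 (R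
  184 765103248) (B 10 1 (R 184 876103245) (L (S₅ 89354329592 4 2))))))) (B 5 1 (B 6 1 (R 184 643105278) (L (M 65432118027 4310))) (L (M 65432211027 4310)))) (B 4
  1 (B 7 1 (B 9 1 (R 184 752103468) (B 5 1 (R 184 532104678) (L (M 65432211027 4310)))) (L (M 65432118037 5210))) (L (M 65430021027 4331)))) (B′ 6 1 (B 7 1 (B 4 1
  (B 5 1 (R 184 543206718) (B 9 1 (R 184 754203618) (L (M 65432211027 4310)))) (B 8 1 (B 5 1 (R 184 654307218) (B 9 1 (R 184 765403218) (L (M 65432211027 4310))))
  (L (M 65430021027 4331)))) (L (M 65430221017 4310))) (L (M 65430221017 4331)))) (B 3 1 (R 0 867325401) (L (M 65432110007 5243)))))))) (B′ 9 8 (B 9 10 (L (D 7))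
  (B 7 10 (B′ 8 10 (B 2 1 (B 3 1 (B′ 8 1 (B′ 9 1 (B 7 1 (R 185 765103248) (B 10 1 (R 185 876103245) (L (M 65143221047 5320)))) (B 5 1 (B 6 1 (R 185 643105278) (L
  (M 65024321047 5341))) (L (M 65024321037 5441)))) (B 4 1 (B 10 1 (B 9 1 (R 186 872103456) (B 5 1 (R 186 832104567) (L (M 65420321057 6410)))) (L (M 60524321057
  4130))) (L (M 65044321027 5341)))) (B 6 1 (B 7 1 (B 8 1 (B 5 1 (R 187 654307218) (B 9 1 (R 187 765403218) (L (M 65024321037 5441)))) (B 4 1 (R 1 835607124) (L
  (M 65044321027 5341)))) (L (M 65044321017 5320))) (L (M 65024321017 5453)))) (B 4 1 (B 5 1 (B 3 1 (B 10 1 (B 6 1 (R 187 843215670) (B 9 1 (R 187 873214560) (L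
  (M 65024321047 5341)))) (B 7 1 (B 8 1 (R 187 653214780) (L (M 60524321057 4130))) (L (M 65143221047 5320)))) (B 6 1 (R 0 835607124) (L (M 65024321017 5453))))
  (L (M 65124321007 5453))) (L (M 65143221007 6453)))) (L (M 60524321087 4130))) (L (M 65143221087 5320)))) (B 7 10 (B 9 10 (R 0 678234501) (B 8 10 (B 2 1 (B 3 1
  (B 8 1 (B′ 9 1 (B 7 1 (R 188 765103248) (B 10 1 (R 188 876103245) (L (M 65143221047 5320)))) (B 5 1 (B 6 1 (R 188 643105278) (L (M 65423121037 6410))) (L (M
  65420321037 6410)))) (B 4 1 (B 10 1 (R 0 678234501) (L (M 65423121047 5310))) (L (M 6543321027 6341)))) (B′ 6 1 (B 7 1 (B 8 1 (B 5 1 (R 189 654307218) (B 9 1 (R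
  189 765403218) (L (M 65420321037 6410)))) (B 4 1 (B 10 1 (R 189 854203617) (L (M 65423121047 5310))) (L (M 6543321027 6341)))) (L (M 6543221017 6331))) (L (M
  65420321017 6453)))) (B 3 1 (R 0 678234501) (L (M 65423121007 6453)))) (L (M 65423121087 5310)))) (L (M 16543221087 6320)))))) (B 7 8 (R 0 867325401) (B 5 10 (B
  7 10 (R 79 764210853) (L (M 65143321087 6520))) (L (M 60524321087 6541))))))) (B 5 8 (R 0 875643120) (B 7 9 (R 0 863725041) (B 8 9 (R 1 853716042) (B 5 9 (B′ 5
  10 (B′ 9 10 (R 81 652140873) (B′ 7 8 (B 7 10 (B 8 10 (R 128 740321865) (B′ 2 1 (B′ 6 1 (B′ 7 1 (B 4 1 (B 5 1 (R 194 543206718) (B 9 1 (R 194 754203618) (L (M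
  65403321037 4210)))) (B 8 1 (B 5 1 (R 194 654307218) (B 9 1 (R 194 765403218) (L (M 65403321037 4210)))) (L (M 65403121027 5332)))) (B 3 1 (B 8 1 (B 5 1 (R 194
  643105278) (B 9 1 (R 194 764103258) (L (M 65403321037 4210)))) (L (M 65423121027 5310))) (L (M 65403221017 5331)))) (B 3 1 (B 4 1 (R 0 867325401) (L (M
  65403121027 5342))) (L (M 65403221017 5310)))) (B 3 1 (R 0 867325401) (L (M 65423121007 5342))))) (B 8 10 (R 0 875643120) (B′ 2 1 (B 6 1 (B 7 1 (B 4 1 (B′ 5 1
  (R 197 543206718) (B 9 1 (R 197 754203618) (L (M 65432211027 4310)))) (B 8 1 (B 5 1 (R 198 654307218) (B 9 1 (R 198 765403218) (L (M 65432211027 4310)))) (L (M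
  65430121027 4320)))) (B 3 1 (B 8 1 (R 0 875643120) (L (M 65432181037 5210))) (L (M 65430221017 4310)))) (B 3 1 (B 4 1 (B 9 1 (B 7 1 (R 198 752103468) (B 8 1 (R
  198 762103458) (L (M 65432181037 5210)))) (L (M 65432181027 4310))) (L (M 65430121027 4342))) (L (M 65430221017 4331)))) (B 3 1 (B 4 1 (B 5 1 (B 6 1 (B 7 1 (R
  198 543216780) (B 8 1 (R 198 643215780) (L (M 65432181037 5210)))) (B 9 1 (B 7 1 (R 198 753214680) (B 8 1 (R 198 763214580) (L (M 65432181037 5210)))) (L (M
  65432181027 4310)))) (L (M 65432181007 5243))) (L (M 65432101007 5243))) (L (M 65432181007 5243)))))) (B 7 10 (B 10 8 (B 2 1 (B 6 1 (B 10 1 (B 3 1 (B 4 1 (R 199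
  842103567) (B 8 1 (R 199 864103257) (L (M 36543210817 6240)))) (B 7 1 (B 4 1 (R 199 854203617) (B 8 1 (R 199 865403217) (L (M 36543210817 6240)))) (L (M
  36543210807 6251)))) (B 7 1 (B 8 1 (B 5 1 (R 199 654307218) (B 9 1 (R 199 765403218) (L (M 65420321037 6410)))) (L (M 65423121047 5310))) (L (M 65143221047
  5320)))) (B 3 1 (B 4 1 (B 9 1 (B 10 1 (R 199 872103456) (B 7 1 (R 199 752103468) (L (M 65143221047 5320)))) (L (M 65423121037 6410))) (L (M 6543121027 6352)))
  (L (M 6543221017 6341)))) (B 3 1 (B 4 1 (B 5 1 (B 10 1 (B 6 1 (R 199 843215670) (B 9 1 (R 199 873214560) (L (M 65423121037 6410)))) (B 7 1 (B 8 1 (R 199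
  653214780) (L (M 65423121047 5310))) (L (M 65143221047 5320)))) (L (M 36543211007 6210))) (L (M 36543201007 6241))) (L (M 36543210007 6251)))) (L (M 65423121087
  5310))) (L (M 65143221087 5320))))) (B 9 10 (R 1 836507214) (B 7 8 (B 7 10 (R 0 867325401) (B 8 10 (R 2 857316402) (B 2 1 (B′ 6 1 (B′ 7 1 (B 4 1 (B′ 5 1 (R 201
  543206718) (B 9 1 (R 201 754203618) (L (M 65430211027 4310)))) (B 8 1 (B 5 1 (R 202 654307218) (B 9 1 (R 202 765403218) (L (M 65430211027 4310)))) (L (M
  65430121027 4320)))) (B 3 1 (B 8 1 (R 0 875643120) (L (M 65432111037 5210))) (L (M 65430221017 4310)))) (B 3 1 (B 4 1 (R 0 867325401) (L (M 65430211017 5243)))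
  (L (M 65430211017 5243)))) (B 3 1 (R 0 867325401) (L (M 65543210007 1031)))))) (B 7 10 (B 8 10 (B 2 1 (B 6 1 (B 7 1 (B 8 1 (B 5 1 (R 204 654307218) (B 9 1 (R
  204 765403218) (L (M 65420321037 6410)))) (B 4 1 (B 10 1 (R 204 854203617) (L (M 65423121047 5310))) (L (M 6543121027 6332)))) (B 3 1 (B 10 1 (B 4 1 (R 204
  842103567) (B 8 1 (R 204 864103257) (L (M 6543121027 6332)))) (L (M 65143221047 5320))) (L (M 6543221017 6331)))) (B 3 1 (B 4 1 (B 9 1 (B 10 1 (R 204 872103456)
  (B 7 1 (R 204 752103468) (L (M 65143221047 5320)))) (L (M 65423121037 6410))) (L (M 65140321027 6453))) (L (M 65420321017 6453)))) (B 3 1 (B 4 1 (B 5 1 (B 10 1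
  (B 6 1 (R 204 843215670) (B 9 1 (R 204 873214560) (L (M 65423121037 6410)))) (B 7 1 (B 8 1 (R 204 653214780) (L (M 65423121047 5310))) (L (M 65143221047
  5320)))) (L (M 65423121007 6453))) (L (M 65143221007 6453))) (L (M 65423121007 6453)))) (L (M 65423121087 5310))) (L (M 65143221087 5320)))))) (B 7 8 (R 0
  867325401) (L (M 6540321087 5241))))))))) (B 6 10 (R 1 786543210) (B′ 5 7 (B 5 8 (B 5 9 (L (D 3)) (B 5 10 (L (D 3)) (L (M 65124321087 6530)))) (B′ 7 8 (B 7 9 (L
  (D 5)) (B 7 10 (L (D 5)) (B 5 9 (R 0 876234501) (B 5 10 (R 16 768452310) (L (M 65024321087 6541)))))) (B 5 9 (B 5 10 (L (D 3)) (L (M 61524321087 6530))) (L (M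
  16524321087 6530))))) (B 5 8 (R 0 875643120) (B 7 8 (B 7 9 (B′ 7 10 (L (D 5)) (B′ 8 9 (R 92 843021765) (L (M 12654321087 6530)))) (B 8 10 (R 0 785643120) (L (M
  21654321087 6530)))) (B 5 9 (B 5 10 (B 7 9 (B 7 10 (B 9 10 (R 94 642150873) (B 9 8 (B 8 10 (R 41 421650873) (R 1 421086537)) (L (M 65423121087 6410)))) (L (M
  62154321087 6330))) (L (M 26154321087 6330))) (L (M 61524321087 6530))) (L (M 16524321087 6530))))))))))) (B 4 9 (R 1 867543210) (B 4 10 (R 2 768543210) (B 6 8
  (R 0 876325401) (B 6 9 (R 1 867325401) (B 6 10 (R 3 768325401) (B 5 7 (B 5 8 (R 0 876452310) (B 5 9 (R 1 867452310) (L (M 16524321087 6530)))) (B 5 8 (B 5 9 (B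
  5 10 (L (D 3)) (B′ 7 8 (B 7 9 (B 7 10 (L (D 5)) (L (M 64054321087 5130))) (L (M 61254321087 6530))) (L (M 62154321087 6530)))) (B′ 5 10 (R 0 786543210) (L (M
  65104321087 6542)))) (B 5 9 (R 0 867543210) (L (M 16504321087 6542))))))))))))) (B 4 7 (R 0 876453210) (B 6 5 (R 0 876235401) (B′ 5 7 (R 1 876452310) (B 4 8 (B′
  4 9 (B′ 4 10 (L (D 2)) (B′ 5 8 (B′ 8 9 (R 100 854130762) (R 0 854137602)) (B 5 9 (R 0 867543210) (B′ 8 9 (R 86 854310762) (B 6 8 (B 6 9 (B′ 6 10 (L (D 4)) (B 8
  7 (R 1 832057614) (B 9 7 (R 6 832056714) (B 8 10 (R 1 531078426) (L (M 65423321087 6510)))))) (B′ 8 7 (R 0 854763120) (B 6 10 (B′ 8 10 (R 106 753021864) (B′ 5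
  10 (B 10 7 (R 7 723056814) (B 10 9 (B 9 7 (B 2 1 (B′ 6 1 (B′ 9 1 (B 3 1 (B 4 1 (R 220 742103568) (B 8 1 (R 220 764103258) (L (M 60540321027 6341)))) (B 7 1 (B 4
  1 (R 220 754203618) (B 8 1 (R 220 765403218) (L (M 60540321027 6341)))) (L (M 60540321017 6352)))) (B 4 1 (B 10 1 (B 7 1 (R 220 854203617) (L (M 65430211037
  6562))) (L (M 65430211057 6253))) (L (M 16540321027 6452)))) (B 3 1 (B 10 1 (R 0 723685041) (L (M 60543211037 6253))) (L (M 20654321017 6451)))) (B 3 1 (R 0
  786325401) (L (M 65432321007 6542)))) (L (M 65430211087 6562))) (L (M 65430211087 6253)))) (L (M 6543211087 6453)))) (B 8 10 (R 1 854763120) (B 7 9 (B 7 10 (R 0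
  867453210) (L (M 60543211087 6253))) (L (M 6543211087 5320))))))) (B 6 9 (R 0 867543210) (B 8 7 (R 0 845763120) (L (M 6543211087 6420))))))))) (B′ 4 10 (R 1
  786543210) (B′ 5 8 (B′ 5 9 (R 0 876542310) (B 5 10 (R 9 786542310) (B 8 6 (B 8 7 (L (D 6)) (B′ 8 9 (L (D 6)) (L (M 6554321087 6441)))) (B 8 7 (R 0 876453210) (L
  (M 60154321087 6564)))))) (B′ 6 8 (B′ 6 9 (R 2 876325401) (B′ 6 10 (R 3 786325401) (B 8 7 (R 0 876325401) (B 8 9 (B 8 10 (L (D 6)) (B′ 5 9 (B 5 10 (R 4
  687542310) (L (M 60554321087 4130))) (L (M 60554321087 6341)))) (B 8 10 (R 0 786543210) (L (M 65423321087 6510))))))) (B 7 8 (R 0 876453210) (B 5 9 (B 5 10 (R 7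
  687542310) (B′ 6 9 (R 1 867542310) (L (M 6154321087 6563)))) (B 5 10 (R 0 786543210) (L (M 60154321087 6564))))))))) (B 4 9 (R 1 867543210) (B 4 10 (R 2
  768543210) (B 5 8 (R 0 876542310) (B 5 9 (R 1 867542310) (B 5 10 (R 3 768542310) (B 6 8 (R 0 876325401) (B 6 9 (R 1 867325401) (L (M 6584321087
  6541)))))))))))))))))) (B′ 3 8 (R 1 875643210) (B′ 3 9 (R 2 865743210) (B′ 3 10 (R 3 765843210) (B′ 4 6 (B′ 4 7 (R 0 876543120) (B′ 4 8 (R 1 875643120) (B 4 9
  (R 2 865743120) (B′ 4 10 (R 3 765843120) (B 6 5 (B 6 7 (L (D 4)) (B 6 8 (L (D 4)) (B 6 9 (L (D 4)) (B 6 10 (L (D 4)) (B 5 7 (R 0 876542130) (B 5 8 (R 1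
  875642130) (B 5 9 (R 2 865742130) (L (M 65404321087 6563))))))))) (B 6 7 (B 6 8 (L (D 4)) (B′ 6 9 (L (D 4)) (B′ 6 10 (L (D 4)) (B′ 5 7 (B 5 8 (R 1 874652130) (B
  5 9 (R 2 864752130) (L (M 46504321087 6530)))) (B 5 8 (B 5 9 (R 2 854762130) (L (M 65404321087 6563))) (L (M 64504321087 6563))))))) (B 6 8 (R 0 875643210) (B 6
  9 (R 1 865743210) (B 6 10 (R 2 765843210) (B′ 5 7 (B 5 8 (R 4 874652130) (B′ 5 9 (R 5 864752130) (L (M 46504321087 6530)))) (B 5 8 (R 0 875643210) (L (M
  64504321087 6563))))))))))))) (B′ 5 6 (R 0 876542310) (B 4 7 (B′ 4 8 (R 9 874653120) (B′ 4 9 (R 10 864753120) (B′ 4 10 (R 11 764853120) (B′ 5 7 (R 1 876451320)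
  (B′ 6 7 (B 6 8 (B′ 6 9 (L (D 4)) (B′ 6 10 (L (D 4)) (B′ 7 8 (R 134 873021654) (B 7 9 (R 10 830726154) (B 7 10 (R 12 730826154) (L (M 65043321087 6542))))))) (B′
  6 9 (R 1 867543210) (B 6 10 (R 2 768543210) (B 7 8 (R 0 876453120) (B 7 9 (R 1 867453120) (L (M 6543321087 6542))))))) (B 5 8 (B 5 9 (R 14 854762130) (B′ 5 10
  (R 15 754862130) (B′ 6 8 (R 0 875642310) (B 7 8 (R 0 874651320) (B 6 9 (B 6 10 (B 7 9 (B 7 10 (B 9 10 (R 139 632051874) (B 9 8 (R 37 320186547) (R 6
  632051874))) (L (M 60542321087 6553))) (L (M 6542321087 6553))) (L (M 60514321087 6553))) (L (M 6514321087 6553))))))) (B 5 9 (R 0 867543210) (B 5 10 (R 1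
  768543210) (B 6 8 (B 6 9 (B 6 10 (L (D 4)) (L (M 65014321087 6554))) (L (M 65014321087 6564))) (L (M 60514321087 6564))))))))))) (B 4 8 (R 1 875643210) (B 4 9
  (R 2 865743210) (B 4 10 (R 3 765843210) (B 5 7 (R 0 876542310) (B 5 8 (R 1 875642310) (B 5 9 (R 2 865742310) (B 5 10 (R 4 765842310) (B′ 6 7 (B 6 8 (B 6 9 (L (D
  4)) (B′ 6 10 (L (D 4)) (L (M 65804321087 6541)))) (B′ 6 9 (R 0 867543210) (L (M 65104321087 6564)))) (B 6 8 (R 0 875643210) (L (M 60514321087
  6564)))))))))))))))))) (B 3 7 (R 1 876453210) (B 3 8 (R 2 875463210) (B 3 9 (R 3 865473210) (B 3 10 (R 4 765483210) (B 4 6 (R 0 876543120) (B 4 7 (R 1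
  876453120) (B 4 8 (R 2 875463120) (B 4 9 (R 3 865473120) (B 4 10 (R 5 765483120) (B 5 6 (R 0 876542130) (B 5 7 (R 1 876452130) (B 5 8 (R 2 875462130) (B 5 9 (R
  3 865472130) (B 5 10 (R 6 765482130) (B 6 7 (B 6 8 (B 6 9 (B 6 10 (L (D 4)) (L (M 65804321087 6554))) (L (M 65804321087 6564))) (L (M 68504321087 6564))) (L (M
  68054321087 6564)))))))))))))))))))))))))) (B′ 2 6 (R 1 876534210) (B′ 2 7 (R 2 876435210) (B′ 2 8 (R 3 875436210) (B′ 2 9 (R 4 865437210) (B′ 2 10 (R 5
  765438210) (B′ 3 4 (B 3 5 (R 0 876543201) (B 3 6 (R 1 876534201) (B 3 7 (R 2 876435201) (B′ 3 8 (R 3 875436201) (B 3 9 (R 4 865437201) (B 3 10 (R 143 765438201)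
  (B 4 5 (R 0 876543102) (B 4 6 (R 1 876534102) (B 4 7 (R 2 876435102) (B 4 8 (R 3 875436102) (B 4 9 (R 4 865437102) (B 4 10 (R 146 765438102) (B 5 6 (B 5 7 (B′ 5
  8 (R 3 872106543) (B′ 5 9 (R 4 862107543) (B′ 5 10 (R 5 762108543) (B′ 6 7 (B 6 8 (R 3 872106534) (B 6 9 (R 4 862107534) (L (M 16504321087 6543)))) (B 6 8 (B 6
  9 (R 4 852107634) (B′ 6 10 (R 6 752108634) (L (M 65104321087 6543)))) (B 6 9 (R 0 867543210) (L (M 16504321087 6543)))))))) (B′ 5 8 (R 1 875643210) (B′ 5 9 (R 2
  865743210) (B 5 10 (R 3 765843210) (B 6 7 (R 0 876534210) (B 6 8 (R 1 875634210) (L (M 10654321087 6543)))))))) (B 5 7 (R 0 876453210) (B 5 8 (R 1 875463210) (B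
  6 7 (R 0 876354210) (L (M 10654321087 6564)))))))))))))))))) (B 3 5 (B′ 3 6 (R 9 876524301) (B′ 3 7 (R 10 876425301) (B′ 3 8 (R 11 875426301) (B′ 3 9 (R 12
  865427301) (B′ 3 10 (R 14 765428301) (B′ 4 5 (B 4 6 (R 9 876514302) (B 4 7 (R 10 876415302) (B 4 8 (R 11 875416302) (B 4 9 (R 12 865417302) (B 4 10 (R 14
  765418302) (B 5 6 (R 9 876504213) (B 5 7 (R 10 876405213) (B 5 8 (R 11 875406213) (B 5 9 (R 12 865407213) (B 5 10 (R 38 765408213) (B 6 7 (B 6 8 (B 6 9 (R 12
  832107654) (L (M 65304321087 6564))) (L (M 63504321087 6564))) (L (M 63054321087 6564))))))))))))) (B 4 6 (B′ 4 7 (R 10 876315402) (B′ 4 8 (R 11 875316402) (B′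
  4 9 (R 12 865317402) (B′ 4 10 (R 14 765318402) (B′ 5 6 (B 5 7 (R 10 876205413) (B 5 8 (R 11 875206413) (B 5 9 (R 12 865207413) (B 5 10 (R 14 765208413) (B 6 7
  (R 10 876105324) (B 6 8 (R 11 875106324) (B 6 9 (R 12 865107324) (L (M 6534321087 6542))))))))) (B 5 7 (B′ 5 8 (R 11 874206513) (B′ 5 9 (R 12 864207513) (B′ 5
  10 (R 14 764208513) (B′ 6 7 (B 6 8 (R 11 873106524) (B 6 9 (R 12 863107524) (L (M 16504321087 6542)))) (B 6 8 (B 6 9 (R 12 853107624) (L (M 65124321087 6564)))
  (L (M 61524321087 6564))))))) (B 5 8 (R 1 875643210) (B 5 9 (R 2 865743210) (B 5 10 (R 3 765843210) (B′ 6 7 (R 0 876534120) (B 6 8 (R 1 875634120) (L (M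
  10654321087 6542))))))))))))) (B 4 7 (R 1 876453210) (B 4 8 (R 2 875463210) (B 4 9 (R 3 865473210) (B 4 10 (R 4 765483210) (B′ 5 6 (R 0 876542301) (B 5 7 (R 1
  876452301) (B 5 8 (R 2 875462301) (B 5 9 (R 3 865472301) (B 5 10 (R 5 765482301) (B 6 7 (B 6 8 (B 6 9 (R 22 832107654) (L (M 65104321087 6564))) (L (M
  61504321087 6564))) (L (M 61054321087 6564))))))))))))))))))) (B 3 6 (R 1 876534210) (B 3 7 (R 2 876435210) (B 3 8 (R 3 875436210) (B 3 9 (R 4 865437210) (B 3
  10 (R 5 765438210) (B′ 4 5 (R 0 876543120) (B 4 6 (R 1 876534120) (B′ 4 7 (R 2 876435120) (B 4 8 (R 3 875436120) (B 4 9 (R 4 865437120) (B 4 10 (R 6 765438120)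
  (B 5 6 (B 5 7 (B′ 5 8 (R 28 872106543) (B′ 5 9 (R 29 862107543) (B′ 5 10 (R 30 762108543) (B′ 6 7 (R 17 876210543) (B 6 8 (R 3 872106543) (B 6 9 (R 4 862107543)
  (L (M 65304321087 6564)))))))) (B′ 5 8 (R 1 875643210) (B′ 5 9 (R 2 865743210) (B 5 10 (R 3 765843210) (B 6 7 (R 0 876534210) (B 6 8 (R 1 875634210) (L (M
  60534321087 6564)))))))) (B 5 7 (R 0 876453210) (B 5 8 (R 1 875463210) (B 6 7 (R 0 876354210) (L (M 80654321087 6564))))))))))))))))))))))))) (B′ 2 5 (R 1
  876542310) (B′ 2 6 (R 2 876532410) (B′ 2 7 (R 3 876432510) (B′ 2 8 (R 4 875432610) (B′ 2 9 (R 5 865432710) (B′ 2 10 (R 6 765432810) (B′ 3 4 (R 0 876543201) (B′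
  3 5 (R 1 876542301) (B′ 3 6 (R 2 876532401) (B 3 7 (R 3 876432501) (B 3 8 (R 4 875432601) (B 3 9 (R 5 865432701) (B 3 10 (R 7 765432801) (B 4 5 (B 4 6 (R 2
  876510432) (B′ 4 7 (R 3 876410532) (B′ 4 8 (R 4 875410632) (B′ 4 9 (R 5 865410732) (B′ 4 10 (R 6 765410832) (B′ 5 6 (R 2 876510423) (B 5 7 (R 3 876410523) (B 5
  8 (R 4 875410623) (B 5 9 (R 5 865410723) (B 5 10 (R 8 765410823) (B 6 7 (B 6 8 (R 4 873210654) (L (M 62504321087 6564))) (L (M 62054321087 6564))))))))))))) (B
  4 6 (R 0 876534210) (B 4 7 (R 1 876435210) (B 4 8 (R 2 875436210) (B 4 9 (R 3 865437210) (B 4 10 (R 4 765438210) (B 5 6 (R 0 876524310) (B 5 7 (R 1 876425310)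
  (B 5 8 (R 2 875426310) (B 6 7 (R 1 876325410) (L (M 80654321087 6564)))))))))))))))))))))))))) (B 2 4 (R 0 876543120) (B 2 5 (R 1 876542130) (B 2 6 (R 2
  876532140) (B 2 7 (R 3 876432150) (B 2 8 (R 4 875432160) (B 2 9 (R 5 865432170) (B 2 10 (R 6 765432180) (B 3 4 (R 0 876543021) (B 3 5 (R 1 876542031) (B 3 6 (R
  2 876532041) (B 3 7 (R 3 876432051) (B 3 8 (R 4 875432061) (B 3 9 (R 5 865432071) (B 3 10 (R 7 765432081) (B 4 5 (R 1 876541032) (B 4 6 (R 2 876531042) (B 4 7
  (R 3 876431052) (B 4 8 (R 4 875431062) (B 4 9 (R 5 865431072) (B 4 10 (R 8 765431082) (B 5 6 (R 2 876521043) (B 5 7 (R 3 876421053) (B 5 8 (R 4 875421063) (B 6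
  7 (R 3 876321054) (L (M 88654321087 6564))))))))))))))))))))))))))

-- rootEntry k records what is known at the start: x is joined to all its neighbours, and y to none of those numbered k and above.
rootEntry : ∀ {d} → ℕ → Fin (2 + d) → Fin (2 + d) → Maybe Bool
rootEntry k zero zero = nothing
rootEntry k zero (suc zero) = just false
rootEntry k zero (suc (suc j)) = just true
rootEntry k (suc zero) zero = just false
rootEntry k (suc zero) (suc zero) = nothing
rootEntry k (suc zero) (suc (suc j)) = if k ≤ᵇ toℕ j then just false else nothing
rootEntry k (suc (suc i)) zero = just true
rootEntry k (suc (suc i)) (suc zero) = if k ≤ᵇ toℕ i then just false else nothing
rootEntry k (suc (suc i)) (suc (suc j)) = nothing

root : ∀ {d} → ℕ → St (2 + d)
root k = tabulate λ i → tabulate (rootEntry k i)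

small-cut-6-accepted : ExtLeaf.accepts 5 small-cut-6 (root 4) [] ≡ true
small-cut-6-accepted = refl

-- `root 4`, refuted by the first certificate, is the one state recorded at the start; so a branch
-- in which `C` turns out to have at most four neighbours in `N(x)` can be closed by renaming.
large-cut-6-accepted : ExtLeaf.accepts 5 large-cut-6 (root (suc 5)) (root 4 ∷ []) ≡ true
large-cut-6-accepted = refl

small-cut-7-accepted : ExtLeaf.accepts 6 small-cut-7 (root 4) [] ≡ true
small-cut-7-accepted = refl

large-cut-7-accepted : ExtLeaf.accepts 6 large-cut-7 (root (suc 6)) (root 4 ∷ []) ≡ true
large-cut-7-accepted = refl

small-cut-8-accepted : ExtLeaf.accepts 7 small-cut-8 (root 4) [] ≡ true
small-cut-8-accepted = refl

large-cut-8-accepted : ExtLeaf.accepts 7 large-cut-8 (root (suc 7)) (root 4 ∷ []) ≡ true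
large-cut-8-accepted = refl

small-cut-9-accepted : ExtLeaf.accepts 8 small-cut-9 (root 4) [] ≡ true
small-cut-9-accepted = refl

large-cut-9-accepted : ExtLeaf.accepts 8 large-cut-9 (root (suc 8)) (root 4 ∷ []) ≡ true
large-cut-9-accepted = refl

-- The edge bound

locate : ∀ {k N} → (Fin k → Fin N) → Fin N → Maybe (Fin k)
locate {zero} q w = nothing
locate {suc k} q w = if q zero == w then just zero else Data.Maybe.map suc (locate (q ∘ suc) w)

locate-sound : ∀ {k N} (q : Fin k → Fin N) w {i} → locate q w ≡ just i → q i ≡ w
locate-sound {suc k} q w h with q zero == w in eq
locate-sound {suc k} q w refl | true = ==⇒≡ eq
... | false with locate (q ∘ suc) w in eq′
locate-sound {suc k} q w refl | false | just i = locate-sound (q ∘ suc) w eq′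

locate-complete : ∀ {k N} (q : Fin k → Fin N) → (∀ i j → q i ≡ q j → i ≡ j) → ∀ i → locate q (q i) ≡ just i
locate-complete {suc k} q inj zero rewrite ==-refl (q zero) = refl
locate-complete {suc k} q inj (suc i) with q zero == q (suc i) in eq
... | true with inj zero (suc i) (==⇒≡ eq)
...   | ()
locate-complete {suc k} q inj (suc i) | false rewrite locate-complete (q ∘ suc) (λ a b h → suc-injective (inj (suc a) (suc b) h)) i = refl

clique⇒minor : ∀ G (q : Fin 8 → Fin (n G)) → (∀ i j → i ≢ j → adj G (q i) (q j) ≡ true) → NoK8=Minor G → ⊥
clique⇒minor G q full free = free zero (suc zero) zero (suc (suc zero)) (λ ()) (λ ()) refl (record
  { branch = locate q
  ; nonempty = λ i → q i , at i
  ; connected = λ i u v hu hv → subst (WalkIn G (λ w → locate q w ≡ just i) u) (trans (≡-sym (locate-sound q u hu)) (locate-sound q v hv)) (here hu)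
  ; edges = λ i j h → q i , q j , at i , at j , full i j (==⇒≢ (not-elim (proj₁ (∧-elim {not (i == j)} h)))) })
  where
  inj : ∀ i j → q i ≡ q j → i ≡ j
  inj i j h with i ≟ j
  ... | yes p = p
  ... | no p = ⊥-elim (true≢false (full i j p) (subst (λ z → adj G (q i) z ≡ false) h (irrefl G (q i))))
  at : ∀ i → locate q (q i) ≡ just i
  at = locate-complete q inj

argmin : ∀ {m} (f : Fin (suc m) → ℕ) → ∃[ i ] (∀ j → f i ≤ f j)
argmin {zero} f = zero , λ { zero → ≤-refl }
argmin {suc m} f with argmin (f ∘ suc)
... | i , h with f zero ≤? f (suc i)
...   | yes p = zero , λ { zero → ≤-refl ; (suc j) → ≤-trans p (h j) }
...   | no p = suc i , λ { zero → <⇒≤ (≰⇒> p) ; (suc j) → h j }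

root-sat : ∀ {d} (A : Fin d → Fin d → Bool) S k → (∀ i → k ≤ toℕ i → S i ≡ false) → local A S ⊨ root k
root-sat {d} A S k h i j b e = go i j (trans (≡-sym (trans (cong (λ r → lookup r j) (lookup∘tabulate {n = 2 + d} (λ i → tabulate (rootEntry k i)) i)) (lookup∘tabulate (rootEntry k i) j))) e)
  where
  out : ∀ i → (if k ≤ᵇ toℕ i then just false else nothing) ≡ just b → S i ≡ b
  out i e with k ≤ᵇ toℕ i in eq
  out i refl | true = h i (≤ᵇ⇒≤ k (toℕ i) (subst T (≡-sym eq) tt))
  go : ∀ i j → rootEntry k i j ≡ just b → local A S i j ≡ b
  go zero (suc zero) refl = refl
  go zero (suc (suc j)) refl = refl
  go (suc zero) zero refl = refl
  go (suc zero) (suc (suc j)) e = out j e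
  go (suc (suc i)) zero refl = refl
  go (suc (suc i)) (suc zero) e = out i e

module Delete (G : Graph) (u v : Fin (n G)) (uv : adj G u v ≡ true) where

  private
    edge : Fin (n G) → Fin (n G) → Bool
    edge a b = ((a == u) ∧ (b == v)) ∨ ((b == u) ∧ (a == v))
    edge-comm : ∀ a b → edge a b ≡ edge b a
    edge-comm a b = ∨-comm ((a == u) ∧ (b == v)) ((b == u) ∧ (a == v))
    u≢v : u ≢ v
    u≢v refl = true≢false uv (irrefl G u)

  deleted : Graph
  deleted = record { n = n G ; adj = λ a b → adj G a b ∧ not (edge a b)
    ; sym = λ a b → cong₂ (λ p q → p ∧ not q) (sym G a b) (edge-comm a b)
    ; irrefl = λ a → cong (_∧ not (edge a a)) (irrefl G a) }

  deleted-free : NoK8=Minor G → NoK8=Minor deleted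
  deleted-free free a b c d ab cd s m = free a b c d ab cd s (minor-trans {L = deleted} {G = G} m (record
    { branch = just ; nonempty = λ i → i , refl ; connected = λ { i u v refl refl → here refl }
    ; edges = λ i j h → i , j , refl , refl , proj₁ (∧-elim {adj G i j} h) }))

  deleted-sum : degree-sum G ≡ degree-sum deleted + 2
  deleted-sum = begin
    degree-sum G ≡⟨ sum₂-cong pt ⟩
    sum₂ (λ a b → [ adj G a b ∧ not (edge a b) ] + ([ a == u ] * [ b == v ] + [ b == u ] * [ a == v ])) ≡⟨ sum₂-+ (λ a b → [ adj G a b ∧ not (edge a b) ]) (λ a b → [ a == u ] * [ b == v ] + [ b == u ] * [ a == v ]) ⟩
    degree-sum deleted + sum₂ (λ a b → [ a == u ] * [ b == v ] + [ b == u ] * [ a == v ]) ≡⟨ cong (degree-sum deleted +_) (trans (sum₂-+ (λ a b → [ a == u ] * [ b == v ]) (λ a b → [ b == u ] * [ a == v ])) (cong₂ _+_ (trans (sum₂-row u _) one) (trans (sum₂-col u _) one))) ⟩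
    degree-sum deleted + 2 ∎
    where
    open ≡-Reasoning
    one : sum (λ b → [ b == v ]) ≡ 1
    one = trans (sum-cong-≗ {n G} {λ b → [ b == v ]} {λ b → [ b == v ] * 1} (λ b → ≡-sym (*-identityʳ _))) (sum-delta v (λ _ → 1))
    pt : ∀ a b → [ adj G a b ] ≡ [ adj G a b ∧ not (edge a b) ] + ([ a == u ] * [ b == v ] + [ b == u ] * [ a == v ])
    pt a b with a ≟ u | b ≟ v
    ... | yes refl | yes refl rewrite uv | ≢⇒== {u = b} {a} (u≢v ∘ ≡-sym) = refl
    ... | yes refl | no _ rewrite ≢⇒== u≢v with b == a | adj G a b
    ...   | true | true = refl
    ...   | true | false = refl
    ...   | false | true = refl
    ...   | false | false = refl
    pt a b | no _ | _ with b ≟ u | a ≟ v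
    ... | yes refl | yes refl rewrite sym G a b | uv = refl
    ... | yes refl | no _ with adj G a b
    ...   | true = refl
    ...   | false = refl
    pt a b | no _ | _ | no _ | _ with adj G a b
    ...   | true = refl
    ...   | false = refl

degree-sum-bound : ∀ G → degree-sum G + n G ≤ n G * n G
degree-sum-bound G = begin
  degree-sum G + n G ≡⟨ cong (degree-sum G +_) (≡-sym (trans (sum₂-diag {n G} (λ _ → 1)) (trans (sum-const (n G) 1) (*-identityʳ _)))) ⟩
  degree-sum G + sum₂ {n G} (λ u v → [ v == u ] * 1) ≡⟨ ≡-sym (sum₂-+ (λ u v → [ adj G u v ]) (λ u v → [ v == u ] * 1)) ⟩
  sum₂ (λ u v → [ adj G u v ] + [ v == u ] * 1) ≤⟨ sum₂-mono pt ⟩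
  sum₂ {n G} (λ u v → 1) ≡⟨ trans (sum-cong-≗ {n G} (λ u → trans (sum-const (n G) 1) (*-identityʳ (n G)))) (sum-const (n G) (n G)) ⟩
  n G * n G ∎
  where
  open ≤-Reasoning
  pt : ∀ u v → [ adj G u v ] + [ v == u ] * 1 ≤ 1
  pt u v with v ≟ u
  ... | yes refl rewrite irrefl G u = ≤-refl
  ... | no _ rewrite +-identityʳ [ adj G u v ] = []≤1 _

-- `dense` and `tight` confine the degree sum to the range from `10n − 26` to `10n − 1`: too large
-- for the bound, yet small enough that some degree is at most 9.
module MinimalDense (G : Graph) (free : NoK8=Minor G) (4≤n : 4 ≤ n G) (dense : 10 * n G ≤ degree-sum G + 26) (tight : degree-sum G < 10 * n G)
  (IH : ∀ (N : Sub G) → 4 ≤ # Sub.V N → # Sub.V N < n G → weight (Sub.V N) (Sub.E N) + 28 ≤ 10 * # Sub.V N) where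

  -- On 4 to 7 vertices even the complete graph is not dense: `n(n − 1)` is below `10n − 26`.
  8≤n : 8 ≤ n G
  8≤n = go (n G) 4≤n (begin
      11 * n G ≡⟨ lem (n G) ⟩
      10 * n G + n G ≤⟨ +-monoˡ-≤ (n G) dense ⟩
      degree-sum G + 26 + n G ≡⟨ lem′ (degree-sum G) (n G) ⟩
      degree-sum G + n G + 26 ≤⟨ +-monoˡ-≤ 26 (degree-sum-bound G) ⟩
      n G * n G + 26 ∎)
    where
    open ≤-Reasoning
    lem : ∀ k → 11 * k ≡ 10 * k + k
    lem = solve-∀
    lem′ : ∀ a b → a + 26 + b ≡ a + b + 26
    lem′ = solve-∀
    go : ∀ k → 4 ≤ k → 11 * k ≤ k * k + 26 → 8 ≤ k
    go 1 (s≤s ()) _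
    go 2 (s≤s (s≤s ())) _
    go 3 (s≤s (s≤s (s≤s ()))) _
    go 4 _ h = ⊥-elim (from-no (44 ≤? 42) h)
    go 5 _ h = ⊥-elim (from-no (55 ≤? 51) h)
    go 6 _ h = ⊥-elim (from-no (66 ≤? 62) h)
    go 7 _ h = ⊥-elim (from-no (77 ≤? 75) h)
    go (suc (suc (suc (suc (suc (suc (suc (suc k)))))))) _ _ = s≤s (s≤s (s≤s (s≤s (s≤s (s≤s (s≤s (s≤s z≤n)))))))

  one-less : ∀ k → suc k ≡ n G → 10 * n G ≡ 10 * k + 10
  one-less k refl = lem k
    where
    lem : ∀ k → 10 * suc k ≡ 10 * k + 10
    lem = solve-∀

  punctured : ∀ v → suc (# (λ w → not (w == v))) ≡ n G
  punctured v = #-missing₁ (λ w → not (w == v)) v (cong not (==-refl v)) (λ u h → cong not (≢⇒== h))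

  punctured-IH : ∀ v (N : Sub G) → Sub.V N ≡ (λ w → not (w == v)) → weight (Sub.V N) (Sub.E N) + 38 ≤ 10 * n G
  punctured-IH v N refl = begin
    weight (Sub.V N) (Sub.E N) + 38 ≡⟨ lem (weight (Sub.V N) (Sub.E N)) ⟩
    weight (Sub.V N) (Sub.E N) + 28 + 10 ≤⟨ +-monoˡ-≤ 10 (IH N (≤-pred (≤-trans (s≤s (s≤s (s≤s (s≤s (s≤s z≤n))))) (subst (8 ≤_) (≡-sym (punctured v)) 8≤n))) (≤-reflexive (punctured v))) ⟩
    10 * # (λ w → not (w == v)) + 10 ≡⟨ ≡-sym (one-less (# (λ w → not (w == v))) (punctured v)) ⟩
    10 * n G ∎
    where
    open ≤-Reasoning
    lem : ∀ a → a + 38 ≡ a + 28 + 10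
    lem = solve-∀

  -- A minor on `n − 1` vertices has degree sum at most `10n − 38`, so at least `38 − 26 = 12` must
  -- be lost on the way to it. Deleting a vertex of degree `t` loses `2t`, contracting an edge in
  -- `t` triangles loses `2t + 2`.
  half : ∀ w t c → w + 38 ≤ 10 * n G → degree-sum G ≤ w + (t + t + c) → 12 ≤ t + t + c
  half w t c h₁ h₂ = +-cancelˡ-≤ (w + 26) 12 (t + t + c) (begin
    w + 26 + 12 ≡⟨ +-assoc w 26 12 ⟩
    w + 38 ≤⟨ h₁ ⟩
    10 * n G ≤⟨ dense ⟩
    degree-sum G + 26 ≤⟨ +-monoˡ-≤ 26 h₂ ⟩
    w + (t + t + c) + 26 ≡⟨ lem w (t + t + c) ⟩
    w + 26 + (t + t + c) ∎)
    where
    open ≤-Reasoning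
    lem : ∀ a b → a + b + 26 ≡ a + 26 + b
    lem = solve-∀

  min-degree : ∀ v → 6 ≤ degree G v
  min-degree v = *-cancelˡ-≤ 2 (subst (12 ≤_) (lem (degree G v)) (half (weight (λ w → not (w == v)) (adj G)) (degree G v) 0 (punctured-IH v (restrict G (λ w → not (w == v))) refl) (≤-trans (delete-bound G v) (≤-reflexive (cong (weight (λ w → not (w == v)) (adj G) +_) (≡-sym (+-identityʳ _)))))))
    where
    lem : ∀ t → t + t + 0 ≡ 2 * t
    lem = solve-∀

  triangles : ∀ u v → adj G u v ≡ true → 5 ≤ # (λ w → adj G u w ∧ adj G v w)
  triangles u v uv = *-cancelˡ-≤ 2 (+-cancelʳ-≤ 2 10 (2 * common) (subst (12 ≤_) (cong (_+ 2) (lem common)) (half (weight (Sub.V contract) (Sub.E contract)) common 2 (punctured-IH v contract refl) contract-bound)))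
    where
    open Contract G u v uv
    lem : ∀ t → t + t ≡ 2 * t
    lem = solve-∀

  module AtMinimum (x : Fin (n G)) (x-min : ∀ v → degree G x ≤ degree G v) where

    degree≤9 : degree G x ≤ 9
    degree≤9 = ≤-pred (*-cancelˡ-< (n G) (degree G x) 10 (begin-strict
      n G * degree G x ≡⟨ ≡-sym (sum-const (n G) (degree G x)) ⟩
      sum {n G} (λ _ → degree G x) ≤⟨ sum-mono x-min ⟩
      degree-sum G <⟨ tight ⟩
      10 * n G ≡⟨ *-comm 10 (n G) ⟩
      n G * 10 ∎))
      where open ≤-Reasoning

    -- If `x` sees every other vertex, the minimum degree is `n − 1`; so `G` is complete, and it has
    -- at least 8 vertices.
    no-outside : (∀ w → w ≢ x → adj G x w ≡ true) → ⊥
    no-outside all = clique⇒minor G (λ i → inject≤ i 8≤n) (λ i j i≢j → full _ _ (i≢j ∘ inject≤-injective 8≤n 8≤n i j)) free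
      where
      open ≤-Reasoning
      high : n G ≤ degree G x + 1
      high = begin
        n G ≡⟨ ≡-sym (trans (sum-const (n G) 1) (*-identityʳ _)) ⟩
        sum {n G} (λ _ → 1) ≤⟨ sum-mono pt ⟩
        sum (λ w → [ adj G x w ] + [ w == x ] * 1) ≡⟨ trans (∑-distrib-+ (λ w → [ adj G x w ]) (λ w → [ w == x ] * 1)) (cong (degree G x +_) (sum-delta x (λ _ → 1))) ⟩
        degree G x + 1 ∎
        where
        pt : ∀ w → 1 ≤ [ adj G x w ] + [ w == x ] * 1
        pt w with w ≟ x
        ... | yes _ = m≤n+m 1 _
        ... | no q rewrite all w q = ≤-refl
      full : ∀ u v → u ≢ v → adj G u v ≡ true
      full u v u≢v with adj G u v in eq
      ... | true = refl
      ... | false = ⊥-elim (<⇒≱ (n<1+n (n G)) (begin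
        suc (n G) ≤⟨ s≤s high ⟩
        suc (degree G x + 1) ≤⟨ s≤s (+-monoˡ-≤ 1 (x-min u)) ⟩
        suc (degree G u + 1) ≡⟨ lem (degree G u) ⟩
        degree G u + (1 + 1) ≡⟨ cong (degree G u +_) (≡-sym (trans (∑-distrib-+ (λ w → [ w == u ] * 1) (λ w → [ w == v ] * 1)) (cong₂ _+_ (sum-delta u (λ _ → 1)) (sum-delta v (λ _ → 1))))) ⟩
        degree G u + sum (λ w → [ w == u ] * 1 + [ w == v ] * 1) ≡⟨ ≡-sym (∑-distrib-+ (λ w → [ adj G u w ]) (λ w → [ w == u ] * 1 + [ w == v ] * 1)) ⟩
        sum (λ w → [ adj G u w ] + ([ w == u ] * 1 + [ w == v ] * 1)) ≤⟨ sum-mono pt ⟩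
        sum {n G} (λ _ → 1) ≡⟨ trans (sum-const (n G) 1) (*-identityʳ _) ⟩
        n G ∎))
        where
        lem : ∀ a → suc (a + 1) ≡ a + (1 + 1)
        lem = solve-∀
        pt : ∀ w → [ adj G u w ] + ([ w == u ] * 1 + [ w == v ] * 1) ≤ 1
        pt w with w ≟ u | w ≟ v
        ... | yes refl | yes q = ⊥-elim (u≢v q)
        ... | yes refl | no _ rewrite irrefl G u = ≤-refl
        ... | no _ | yes refl rewrite eq = ≤-refl
        ... | no _ | no _ rewrite +-identityʳ [ adj G u w ] = []≤1 _

    contradiction : ⊥
    contradiction = by-cases {∃[ c ] (c ≢ x × adj G x c ≡ false)} outside
      λ none → no-outside λ w w≢x → [ (λ h → h) , (λ h → ⊥-elim (none (w , w≢x , h))) ]′ (bool-cases (adj G x w))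
      where
      outside : ∃[ c ] (c ≢ x × adj G x c ≡ false) → ⊥
      outside (c₀ , p) = reachable (λ w → w ≢ x × adj G x w ≡ false) c₀ p λ C Cc₀ conn out closed →
        let close = λ u w cu a w≢x q → closed u w cu a (w≢x , q)
            run : ∀ d′ (sc lc : Cert LeafE) → ExtLeaf.accepts d′ sc (root 4) [] ≡ true →
                  ExtLeaf.accepts d′ lc (root (suc d′)) (root 4 ∷ []) ≡ true → degree G x ≡ suc d′ → ⊥
            run = λ d′ sc lc ok₁ ok₂ deg → finish C c₀ Cc₀ conn out close d′ sc lc ok₁ ok₂ deg
        in cases (degree G x) (min-degree x) degree≤9 (run 5 small-cut-6 large-cut-6 small-cut-6-accepted large-cut-6-accepted) (run 6 small-cut-7 large-cut-7 small-cut-7-accepted large-cut-7-accepted) (run 7 small-cut-8 large-cut-8 small-cut-8-accepted large-cut-8-accepted) (run 8 small-cut-9 large-cut-9 small-cut-9-accepted large-cut-9-accepted)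
        where
        cases : ∀ k → 6 ≤ k → k ≤ 9 → (k ≡ 6 → ⊥) → (k ≡ 7 → ⊥) → (k ≡ 8 → ⊥) → (k ≡ 9 → ⊥) → ⊥
        cases 6 _ _ f _ _ _ = f refl
        cases 7 _ _ _ f _ _ = f refl
        cases 8 _ _ _ _ f _ = f refl
        cases 9 _ _ _ _ _ f = f refl
        cases 1 (s≤s ()) _ _ _ _ _
        cases 2 (s≤s (s≤s ())) _ _ _ _ _
        cases 3 (s≤s (s≤s (s≤s ()))) _ _ _ _ _
        cases 4 (s≤s (s≤s (s≤s (s≤s ())))) _ _ _ _ _
        cases 5 (s≤s (s≤s (s≤s (s≤s (s≤s ()))))) _ _ _ _ _
        cases (suc (suc (suc (suc (suc (suc (suc (suc (suc (suc k)))))))))) _ (s≤s (s≤s (s≤s (s≤s (s≤s (s≤s (s≤s (s≤s (s≤s ()))))))))) _ _ _ _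
        finish : ∀ (C : Fin (n G) → Bool) c₀ → C c₀ ≡ true → _ → _ → _ → ∀ d′ (sc lc : Cert LeafE) → ExtLeaf.accepts d′ sc (root 4) [] ≡ true →
                 ExtLeaf.accepts d′ lc (root (suc d′)) (root 4 ∷ []) ≡ true → degree G x ≡ suc d′ → ⊥
        finish C c₀ Cc₀ conn out close d′ sc lc ok₁ ok₂ deg =
          accepts-sound lc (root (suc d′)) (root 4 ∷ []) ok₂ (accepts-sound sc (root 4) [] ok₁ [] ∷ []) (shape N) (N , λ _ _ → refl)
            -- The index `suc d′` lies past the last neighbour, so this root prescribes nothing
            -- about the attachments of `C`.
            (root-sat _ _ (suc d′) λ i h → ⊥-elim (<⇒≱ (toℕ<n i) h))
          where
          open ExtLeaf.Refute d′ G free dense IH x (triangles x) C c₀ Cc₀ conn out close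
          N = Neighbourhood.numbering G x (suc d′) deg

-- The recursion is on a bound for the number of vertices and, inside `dense⇒⊥`, on a bound for the
-- degree sum as well. A dense graph that stays dense after losing an edge is thinned out, so the
-- local analysis only meets graphs of average degree below 10.
sparse : ∀ k G → n G < k → NoK8=Minor G → 4 ≤ n G → degree-sum G + 28 ≤ 10 * n G
dense⇒⊥ : ∀ k j G → n G ≤ k → degree-sum G ≤ j → NoK8=Minor G → 4 ≤ n G → 10 * n G ≤ degree-sum G + 26 → ⊥

sparse (suc k) G (s≤s h) free 4≤n with even-sum (adj G) (sym G) (irrefl G)
... | e , eq with 10 * n G ≤? degree-sum G + 26
...   | yes p = ⊥-elim (dense⇒⊥ k (degree-sum G) G h ≤-refl free 4≤n p)
...   | no p = subst (λ z → z + 28 ≤ 10 * n G) (≡-sym eq) (even-gap e (n G) (subst (λ z → z + 26 < 10 * n G) eq (≰⇒> p)))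

-- Removing an edge lowers the degree sum by 2, so density is sure to survive if it holds with 24 in
-- place of 26.
dense⇒⊥ k j G h hj free 4≤n dense with 10 * n G ≤? degree-sum G + 24
dense⇒⊥ k j G h hj free 4≤n dense | no p = contradiction
  where
  tight : degree-sum G < 10 * n G
  tight = ≤-trans (s≤s (m≤m+n _ 24)) (≰⇒> p)
  IH : ∀ (N : Sub G) → 4 ≤ # Sub.V N → # Sub.V N < n G → weight (Sub.V N) (Sub.E N) + 28 ≤ 10 * # Sub.V N
  IH N h₁ h₂ = subst (λ z → z + 28 ≤ 10 * # Sub.V N) (sub-degree-sum N) (sparse k (sub-graph N) (≤-trans h₂ h) (sub-free N free) h₁)
  positive : ∀ {k} → 4 ≤ k → ∃[ m ] k ≡ suc m
  positive (s≤s {n = m} _) = m , refl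
  nonempty : ∃[ m ] n G ≡ suc m
  nonempty = positive 4≤n
  minimum : ∀ {k} → k ≡ suc (proj₁ nonempty) → (f : Fin k → ℕ) → ∃[ x ] (∀ v → f x ≤ f v)
  minimum refl f = argmin f
  open MinimalDense G free 4≤n dense tight IH
  open AtMinimum (proj₁ (minimum (proj₂ nonempty) (degree G))) (proj₂ (minimum (proj₂ nonempty) (degree G)))
-- With no edges left this would say `10 · 4 ≤ 24`.
dense⇒⊥ k zero G h hj free 4≤n dense | yes p = from-no (40 ≤? 24) (≤-trans (*-monoʳ-≤ 10 4≤n) (≤-trans p (+-monoˡ-≤ 24 hj)))
dense⇒⊥ k (suc j) G h hj free 4≤n dense | yes p = dense⇒⊥ k j deleted h
    (≤-pred (≤-trans (≤-trans (≤-reflexive (+-comm 1 _)) (+-monoʳ-≤ (degree-sum deleted) (s≤s z≤n))) (subst (_≤ suc j) deleted-sum hj)))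
    (deleted-free free) 4≤n (≤-trans p (≤-reflexive (trans (cong (_+ 24) deleted-sum) (+-assoc (degree-sum deleted) 2 24))))
  where
  some : ∃[ u ] ∃[ v ] adj G u v ≡ true
  some with sum-positive (λ u → degree G u) (+-cancelʳ-≤ 24 1 (degree-sum G) (≤-trans (≤-trans (from-yes (25 ≤? 40)) (*-monoʳ-≤ 10 4≤n)) p))
  ... | u , hu with sum-positive (λ v → [ adj G u v ]) hu
  ...   | v , hv = u , v , []-positive hv
  open Delete G (proj₁ some) (proj₁ (proj₂ some)) (proj₂ (proj₂ some))

-- Colourings of a minimal counterexample

-- Leaves: an independent triple; a 5-clique; a minor; a minor using Kempe chains. In the last case the numbers are
-- two non-adjacent vertices a, b and the digits of a map sending each other vertex to the centre of its star.
data LeafC : Set where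
  T₃ : ℕ → ℕ → ℕ → LeafC
  Q  : ℕ → LeafC
  M  : ℕ → ℕ → LeafC
  K  : ℕ → ℕ → ℕ → ℕ → ℕ → LeafC

-- `g` sends every vertex to the centre of its star; the added edges join each leaf to its centre.
fill : ∀ {d} → (Fin d → Fin d) → Fin d → Fin d → Bool
fill g i j = not (eqF i j) ∧ (eqF (g i) j ∨ eqF (g j) i)

fill₂ : ∀ {d} → (Fin d → Fin d) → Fin (2 + d) → Fin (2 + d) → Bool
fill₂ g (suc (suc i)) (suc (suc j)) = fill g i j
fill₂ g _ _ = false

Fill : ∀ {d} → St (2 + d) → (Fin d → Fin d) → Fin (2 + d) → Fin (2 + d) → Bool
Fill σ g p q = known σ p q ∨ fill₂ g p q

-- Idempotence makes the classes of `g` stars, and `a` and `b` are classes by themselves, so the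
-- colour they share takes part in no chain.
starsOK : ∀ {d} → Fin d → Fin d → (Fin d → Fin d) → Fin d → Bool
starsOK a b g i = eqF (g (g i)) (g i) ∧ (not (eqF i a xor eqF (g i) a) ∧ not (eqF i b xor eqF (g i) b))

cliqueOK : ∀ {d k} → St (2 + d) → Vec (Fin d) k → Bool
cliqueOK σ q = allF λ i → allF λ j → eqF i j ∨ known σ (nb (lookup q i)) (nb (lookup q j))

module ColourLeaf (d′ : ℕ) where
  d m : ℕ
  d = suc d′
  m = 2 + d

  refuses : St m → ℕ → ℕ → Bool
  refuses σ i j = isFalse (get σ (nb (toF d′ i)) (nb (toF d′ j)))

  apart : ℕ → ℕ → Bool
  apart i j = not (eqF (toF d′ i) (toF d′ j))

  stars : ℕ → Fin d → Fin d
  stars g = lookup (digits (toF d′) d g)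

  colourOK : St m → LeafC → Bool
  colourOK σ (T₃ i j k) = refuses σ i j ∧ (refuses σ j k ∧ (refuses σ i k ∧ (apart i j ∧ (apart j k ∧ apart i k))))
  colourOK σ (Q q) = cliqueOK σ (digits (toF d′) 5 q)
  colourOK σ (M c p) = minorCode (known σ) c p
  colourOK σ (K a b g c p) = refuses σ a b ∧ (apart a b ∧ (allF (starsOK (toF d′ a) (toF d′ b) (stars g)) ∧ minorCode (Fill σ (stars g)) c p))

split₄ : ∀ {a b c d} → a ∧ (b ∧ (c ∧ d)) ≡ true → a ≡ true × b ≡ true × c ≡ true × d ≡ true
split₄ {true} {true} {true} h = refl , refl , refl , h

-- Each colour selects a good vertex of that colour, and different colours select different
-- vertices.
count-colours : ∀ {d r} (f : Fin d → Fin r) (good : Fin d → Bool) → (∀ k → ∃[ i ] (f i ≡ k × good i ≡ true)) → r ≤ # good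
count-colours {d} {r} f good h = begin
  r ≡⟨ ≡-sym (trans (sum-const r 1) (*-identityʳ r)) ⟩
  sum {r} (λ _ → 1) ≡⟨ sum-cong-≗ (λ k → ≡-sym (sum-delta (proj₁ (h k)) (λ _ → 1))) ⟩
  sum {r} (λ k → sum (λ i → [ i == proj₁ (h k) ] * 1)) ≡⟨ ∑-comm (λ (k : Fin r) i → [ i == proj₁ (h k) ] * 1) ⟩
  sum (λ i → sum {r} (λ k → [ i == proj₁ (h k) ] * 1)) ≤⟨ sum-mono pt ⟩
  # good ∎
  where
  open ≤-Reasoning
  pt : ∀ i → sum {r} (λ k → [ i == proj₁ (h k) ] * 1) ≤ [ good i ]
  pt i = ≤-trans (sum-mono step₁) (≤-reflexive (sum-delta (f i) (λ _ → [ good i ])))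
    where
    step₁ : ∀ k → [ i == proj₁ (h k) ] * 1 ≤ [ k == f i ] * [ good i ]
    step₁ k with i ≟ proj₁ (h k)
    ... | no _ = z≤n
    ... | yes refl rewrite proj₁ (proj₂ (h k)) | ==-refl k | proj₂ (proj₂ (h k)) = ≤-refl

module Colouring (G : Graph) (free : NoK8=Minor G) (uncolourable : ¬ Colorable 8 G)
  (IH : ∀ H → n H < n G → NoK8=Minor H → Colorable 8 H) where

  ProperOff : Fin (n G) → (Fin (n G) → Fin 8) → Set
  ProperOff x c = ∀ u v → u ≢ x → v ≢ x → adj G u v ≡ true → c u ≢ c v

  -- A colour missing around `x` could be given to `x`, which would colour all of `G`.
  all-colours : ∀ {x c} → ProperOff x c → ∀ k → (∃[ w ] (adj G x w ≡ true × c w ≡ k) → ⊥) → ⊥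
  all-colours {x} {c} proper k none = uncolourable (c′ , proper′)
    where
    c′ : Fin (n G) → Fin 8
    c′ w = if w == x then k else c w
    proper′ : ∀ u v → adj G u v ≡ true → c′ u ≢ c′ v
    proper′ u v a eq with u ≟ x | v ≟ x
    ... | yes refl | yes refl = true≢false a (irrefl G u)
    ... | yes refl | no _ = none (v , a , ≡-sym eq)
    ... | no _ | yes refl = none (u , trans (sym G x u) a , eq)
    ... | no p | no q = proper u v p q a eq

  abstract
    sub-coloured : (N : Sub G) → ∀ v → Sub.V N v ≡ false →
      Σ (Fin (n G) → Fin 8) λ c → (∀ u v → Sub.V N u ≡ true → Sub.V N v ≡ true → Sub.E N u v ≡ true → c u ≢ c v)
    sub-coloured N v h = sub-colouring N (IH (sub-graph N) (#-missing (Sub.V N) v h) (sub-free N free)) zero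

  abstract
    delete-colouring : ∀ x → Σ (Fin (n G) → Fin 8) λ c → ProperOff x c
    delete-colouring x with sub-coloured (restrict G (λ w → not (w == x))) x (cong not (==-refl x))
    ... | c , h = c , λ u v p q a → h u v (not-intro (≢⇒== p)) (not-intro (≢⇒== q)) a

  -- Contracting x together with an independent set I of its neighbours gives a colouring constant on I.
  module Merge (x a : Fin (n G)) (I : Fin (n G) → Bool) (Ia : I a ≡ true) (nbrs : ∀ w → I w ≡ true → adj G x w ≡ true)
    (indep : ∀ u v → I u ≡ true → I v ≡ true → adj G u v ≡ false) where

    private
      x≢I : ∀ w → I w ≡ true → w ≢ x
      x≢I w h refl = true≢false (nbrs w h) (irrefl G x)
      ρ : Fin (n G) → Fin (n G)
      ρ w = if I w then a else w
      V : Fin (n G) → Bool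
      V w = not (w == x) ∧ (not (I w) ∨ (w == a))
      E₁ : (p q u v : Fin (n G)) → Bool
      E₁ p q u v = ((ρ p == u) ∧ (ρ q == v)) ∧ ((not (p == x) ∧ not (q == x)) ∧ adj G p q)
      E : Fin (n G) → Fin (n G) → Bool
      E u v = not (u == v) ∧ anyF λ p → anyF λ q → E₁ p q u v ∨ E₁ p q v u
      -- `I` is independent, so `x` is put into its branch set to connect it.
      br : Fin (n G) → Maybe (Fin (n G))
      br w = if w == x then just a else just (ρ w)
      br-x : br x ≡ just a
      br-x rewrite ==-refl x = refl
      br-ρ : ∀ w → w ≢ x → br w ≡ just (ρ w)
      br-ρ w h rewrite ≢⇒== h = refl
      ρ-I : ∀ w → I w ≡ true → ρ w ≡ a
      ρ-I w h rewrite h = refl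
      ρ-V : ∀ w → V w ≡ true → w ≢ x × ρ w ≡ w
      ρ-V w h with ∧-elim {not (w == x)} h
      ... | p , q with ∨-elim {not (I w)} q
      ...   | inj₁ r rewrite not-elim r = ==⇒≢ (not-elim p) , refl
      ...   | inj₂ r with ==⇒≡ r
      ...     | refl = ==⇒≢ (not-elim p) , ρ-I a Ia
      V-ρ : ∀ w → w ≢ x → V (ρ w) ≡ true
      V-ρ w h with I w in eq
      ... | true = ∧-intro (not-intro (≢⇒== (x≢I a Ia))) (∨-introʳ {not (I a)} (==-refl a))
      ... | false rewrite eq = ∧-intro (not-intro (≢⇒== h)) refl
      anyF-comm : ∀ u v → (anyF λ p → anyF λ q → E₁ p q u v ∨ E₁ p q v u) ≡ (anyF λ p → anyF λ q → E₁ p q v u ∨ E₁ p q u v)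
      anyF-comm u v = anyF-cong λ p → anyF-cong λ q → ∨-comm (E₁ p q u v) (E₁ p q v u)
        where
        anyF-cong : ∀ {m} {f g : Fin m → Bool} → (∀ i → f i ≡ g i) → anyF f ≡ anyF g
        anyF-cong {zero} h = refl
        anyF-cong {suc m} h = cong₂ _∨_ (h zero) (anyF-cong (h ∘ suc))
      witness : ∀ p q u v → E₁ p q u v ≡ true → (br p ≡ just u × br q ≡ just v × adj G p q ≡ true)
      witness p q u v h with ∧-elim {(ρ p == u) ∧ (ρ q == v)} h
      ... | h₁ , h₂ with ∧-elim {ρ p == u} h₁ | ∧-elim {not (p == x) ∧ not (q == x)} h₂
      ...   | e₁ , e₂ | h₃ , e₃ with ∧-elim {not (p == x)} h₃
      ...     | p≢ , q≢ = trans (br-ρ p (==⇒≢ (not-elim p≢))) (cong just (==⇒≡ e₁)) , trans (br-ρ q (==⇒≢ (not-elim q≢))) (cong just (==⇒≡ e₂)) , e₃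

      merged : Sub G
      merged = record { V = V ; E = E
        ; E-sym = λ u v → cong₂ (λ s t → not s ∧ t) (==-sym u v) (anyF-comm u v)
        ; E-irr = λ v → cong (λ s → not s ∧ (anyF λ p → anyF λ q → E₁ p q v v ∨ E₁ p q v v)) (==-refl v)
        ; br = br ; br-rep = λ v h → let p , q = ρ-V v h in trans (br-ρ v p) (cong just q)
        ; br-conn = λ {w} {v} _ h → conn w v h ; real = λ u v _ _ h → real u v h }
        where
        br-a : br a ≡ just a
        br-a = trans (br-ρ a (x≢I a Ia)) (cong just (ρ-I a Ia))
        conn : ∀ w v → br w ≡ just v → WalkIn G (λ z → br z ≡ just v) w v
        conn w v h with w ≟ x
        conn w _ refl | yes refl = step br-x (nbrs a Ia) (here br-a)
        ... | no q with I w in eq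
        conn w _ refl | no q | true = step (trans (br-ρ w q) (cong just (ρ-I w eq))) (trans (sym G w x) (nbrs w eq)) (step br-x (nbrs a Ia) (here br-a))
        conn w _ refl | no q | false = here (trans (br-ρ w q) (cong just (lem w eq)))
          where
          lem : ∀ w → I w ≡ false → ρ w ≡ w
          lem w h rewrite h = refl
        real : ∀ u v → E u v ≡ true → ∃[ p ] ∃[ q ] (br p ≡ just u × br q ≡ just v × adj G p q ≡ true)
        real u v h with anyF-elim (λ p → anyF λ q → E₁ p q u v ∨ E₁ p q v u) (proj₂ (∧-elim {not (u == v)} h))
        ... | p , h′ with anyF-elim (λ q → E₁ p q u v ∨ E₁ p q v u) h′
        ...   | q , h″ with ∨-elim {E₁ p q u v} h″
        ...     | inj₁ r = p , q , witness p q u v r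
        ...     | inj₂ r = let s , t , w = witness p q v u r in q , p , t , s , trans (sym G q p) w

    abstract
      merge-colouring : Σ (Fin (n G) → Fin 8) λ c → (ProperOff x c × (∀ w → I w ≡ true → c w ≡ c a))
      merge-colouring = c ∘ ρ , proper , λ w i → cong c (trans (ρ-I w i) (≡-sym (ρ-I a Ia)))
        where
        coloured : Σ (Fin (n G) → Fin 8) λ c → (∀ u v → V u ≡ true → V v ≡ true → E u v ≡ true → c u ≢ c v)
        coloured = sub-coloured merged x (cong (λ s → not s ∧ (not (I x) ∨ (x == a))) (==-refl x))
        c : Fin (n G) → Fin 8
        c = proj₁ coloured
        different : ∀ u v → u ≢ x → adj G u v ≡ true → ρ u ≢ ρ v
        different u v u≢x a eq with I u in iu | I v in iv
        ... | true | true = true≢false a (indep u v iu iv)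
        ... | true | false = true≢false Ia (trans (cong I eq) iv)
        ... | false | true = true≢false (trans (cong I eq) Ia) iu
        different u .u u≢x a refl | false | false = true≢false a (irrefl G u)
        proper : ProperOff x (c ∘ ρ)
        proper u v u≢x v≢x a = proj₂ coloured (ρ u) (ρ v) (V-ρ u u≢x) (V-ρ v v≢x)
          (∧-intro (not-intro (≢⇒== (different u v u≢x a))) (anyF-intro (λ p → anyF λ q → E₁ p q (ρ u) (ρ v) ∨ E₁ p q (ρ v) (ρ u)) u
            (anyF-intro (λ q → E₁ u q (ρ u) (ρ v) ∨ E₁ u q (ρ v) (ρ u)) v (∨-introˡ
              (∧-intro (∧-intro (==-refl (ρ u)) (==-refl (ρ v))) (∧-intro (∧-intro (not-intro (≢⇒== u≢x)) (not-intro (≢⇒== v≢x))) a))))))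

all-stable : ∀ {m} (X : Fin m → Set) → (∀ i → (X i → ⊥) → ⊥) → ((∀ i → X i) → ⊥) → ⊥
all-stable X h k = decide-all X λ d → k λ i → stable (d i) (h i)
  where
  stable : ∀ {A : Set} → Dec A → ((A → ⊥) → ⊥) → A
  stable (yes a) _ = a
  stable (no ¬a) h = ⊥-elim (h ¬a)

two-missing : ∀ {d} (p : Fin d → Bool) j k → j ≢ k → p j ≡ false → p k ≡ false → # p + 2 ≤ d
two-missing {d} p j k j≢k hj hk = begin
  # p + 2 ≡⟨ cong (# p +_) (≡-sym (trans (∑-distrib-+ (λ i → [ i == j ] * 1) (λ i → [ i == k ] * 1)) (cong₂ _+_ (sum-delta j (λ _ → 1)) (sum-delta k (λ _ → 1))))) ⟩
  # p + sum (λ i → [ i == j ] * 1 + [ i == k ] * 1) ≡⟨ ≡-sym (∑-distrib-+ (λ i → [ p i ]) (λ i → [ i == j ] * 1 + [ i == k ] * 1)) ⟩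
  sum (λ i → [ p i ] + ([ i == j ] * 1 + [ i == k ] * 1)) ≤⟨ sum-mono pt ⟩
  sum {d} (λ _ → 1) ≡⟨ trans (sum-const d 1) (*-identityʳ d) ⟩
  d ∎
  where
  open ≤-Reasoning
  pt : ∀ i → [ p i ] + ([ i == j ] * 1 + [ i == k ] * 1) ≤ 1
  pt i with i ≟ j | i ≟ k
  ... | yes refl | yes q = ⊥-elim (j≢k q)
  ... | yes refl | no _ rewrite hj = ≤-refl
  ... | no _ | yes refl rewrite hk = ≤-refl
  ... | no _ | no _ rewrite +-identityʳ [ p i ] = []≤1 _

module NeighbourColours (G : Graph) (free : NoK8=Minor G) (uncolourable : ¬ Colorable 8 G)
  (IH : ∀ H → n H < n G → NoK8=Minor H → Colorable 8 H) (x : Fin (n G)) (d : ℕ) (N : Neighbourhood.Numbering G x d) where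

  open Colouring G free uncolourable IH
  open Neighbourhood.Numbering N

  abstract
    surj : ∀ {c} → ProperOff x c → ∀ k → ∃[ i ] c (e i) ≡ k
    surj {c} proper k with any? (λ i → c (e i) ≟ k)
    ... | yes p = p
    ... | no q = ⊥-elim (all-colours proper k λ { (w , a , h) → let i , eq = onto a in q (i , trans (cong c eq) h) })

  8≤d : 8 ≤ d
  8≤d with delete-colouring x
  ... | c , proper = ≤-trans (count-colours (c ∘ e) (λ _ → true) λ k → let i , h = surj proper k in i , h , refl) (≤-reflexive (#-all {d} (λ _ → refl)))

  PairColouring : Fin d → Fin d → (Fin (n G) → Fin 8) → Set
  PairColouring a b c = ProperOff x c × c (e a) ≡ c (e b)

  abstract
    pair-colouring : ∀ a b → adj G (e a) (e b) ≡ false → Σ (Fin (n G) → Fin 8) λ c → PairColouring a b c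
    pair-colouring a b nab = let c , proper , const = merge-colouring in c , proper , ≡-sym (const (e b) (∨-introʳ {e b == e a} (==-refl (e b))))
      where
      I : Fin (n G) → Bool
      I w = (w == e a) ∨ (w == e b)
      cases : ∀ w → I w ≡ true → w ≡ e a ⊎ w ≡ e b
      cases w h with ∨-elim {w == e a} h
      ... | inj₁ p = inj₁ (==⇒≡ p)
      ... | inj₂ p = inj₂ (==⇒≡ p)
      nbrs : ∀ w → I w ≡ true → adj G x w ≡ true
      nbrs w h with cases w h
      ... | inj₁ refl = e-nbr a
      ... | inj₂ refl = e-nbr b
      indep : ∀ u v → I u ≡ true → I v ≡ true → adj G u v ≡ false
      indep u v hu hv with cases u hu | cases v hv
      ... | inj₁ refl | inj₁ refl = irrefl G _
      ... | inj₁ refl | inj₂ refl = nab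
      ... | inj₂ refl | inj₁ refl = trans (sym G _ _) nab
      ... | inj₂ refl | inj₂ refl = irrefl G _
      open Merge x (e a) I (∨-introˡ (==-refl (e a))) nbrs indep

  abstract
    triple-colouring : ∀ a b f → adj G (e a) (e b) ≡ false → adj G (e b) (e f) ≡ false → adj G (e a) (e f) ≡ false →
      Σ (Fin (n G) → Fin 8) λ c → (ProperOff x c × c (e b) ≡ c (e a) × c (e f) ≡ c (e a))
    triple-colouring a b f nab nbf naf = let c , proper , const = merge-colouring in c , proper , const (e b) (∨-introʳ {e b == e a} (∨-introˡ (==-refl (e b)))) , const (e f) (∨-introʳ {e f == e a} (∨-introʳ {e f == e b} (==-refl (e f))))
      where
      I : Fin (n G) → Bool
      I w = (w == e a) ∨ ((w == e b) ∨ (w == e f))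
      cases : ∀ w → I w ≡ true → w ≡ e a ⊎ (w ≡ e b ⊎ w ≡ e f)
      cases w h with ∨-elim {w == e a} h
      ... | inj₁ p = inj₁ (==⇒≡ p)
      ... | inj₂ q with ∨-elim {w == e b} q
      ...   | inj₁ p = inj₂ (inj₁ (==⇒≡ p))
      ...   | inj₂ p = inj₂ (inj₂ (==⇒≡ p))
      nbrs : ∀ w → I w ≡ true → adj G x w ≡ true
      nbrs w h with cases w h
      ... | inj₁ refl = e-nbr a
      ... | inj₂ (inj₁ refl) = e-nbr b
      ... | inj₂ (inj₂ refl) = e-nbr f
      indep : ∀ u v → I u ≡ true → I v ≡ true → adj G u v ≡ false
      indep u v hu hv with cases u hu | cases v hv
      ... | inj₁ refl | inj₁ refl = irrefl G _
      ... | inj₁ refl | inj₂ (inj₁ refl) = nab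
      ... | inj₁ refl | inj₂ (inj₂ refl) = naf
      ... | inj₂ (inj₁ refl) | inj₁ refl = trans (sym G _ _) nab
      ... | inj₂ (inj₁ refl) | inj₂ (inj₁ refl) = irrefl G _
      ... | inj₂ (inj₁ refl) | inj₂ (inj₂ refl) = nbf
      ... | inj₂ (inj₂ refl) | inj₁ refl = trans (sym G _ _) naf
      ... | inj₂ (inj₂ refl) | inj₂ (inj₁ refl) = trans (sym G _ _) nbf
      ... | inj₂ (inj₂ refl) | inj₂ (inj₂ refl) = irrefl G _
      open Merge x (e a) I (∨-introˡ (==-refl (e a))) nbrs indep

  -- Dropping `j` and `k` loses no colour around `x`, so eight colours appear on at most `d − 2`
  -- neighbours.
  redundant₂ : ∀ {c} → ProperOff x c → ∀ j k j′ k′ → j ≢ k → j′ ≢ j → j′ ≢ k → k′ ≢ j → k′ ≢ k →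
    c (e j) ≡ c (e j′) → c (e k) ≡ c (e k′) → 10 ≤ d
  redundant₂ {c} proper j k j′ k′ j≢k p₁ p₂ q₁ q₂ hj hk =
    ≤-trans (+-monoˡ-≤ 2 (count-colours (c ∘ e) good choose)) (two-missing good j k j≢k good-j good-k)
    where
    good : Fin d → Bool
    good i = not (i == j) ∧ not (i == k)
    good-j : good j ≡ false
    good-j rewrite ==-refl j = refl
    good-k : good k ≡ false
    good-k rewrite ==-refl k | ≢⇒== (j≢k ∘ ≡-sym) = refl
    is-good : ∀ i → i ≢ j → i ≢ k → good i ≡ true
    is-good i a b = ∧-intro (not-intro (≢⇒== a)) (not-intro (≢⇒== b))
    choose : ∀ q → ∃[ i ] (c (e i) ≡ q × good i ≡ true)
    choose q with surj proper q
    ... | i , h with i ≟ j | i ≟ k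
    ...   | yes refl | _ = j′ , trans (≡-sym hj) h , is-good j′ p₁ p₂
    ...   | no _ | yes refl = k′ , trans (≡-sym hk) h , is-good k′ q₁ q₂
    ...   | no a | no b = i , h , is-good i a b

  -- Two non-adjacent neighbours could be given the same colour, and then eight neighbours would
  -- show at most seven colours. So `N(x)` would be a `K₈`.
  clique-at-8 : d ≡ 8 → ⊥
  clique-at-8 refl = clique⇒minor G e full free
    where
    full : ∀ i j → i ≢ j → adj G (e i) (e j) ≡ true
    full i j i≢j with adj G (e i) (e j) in eq
    ... | true = refl
    ... | false with pair-colouring i j eq
    ...   | c , proper , same = ⊥-elim (<⇒≱ (#-missing good j (cong not (==-refl j))) (count-colours (c ∘ e) good choose))
      where
      good : Fin d → Bool
      good k = not (k == j)
      choose : ∀ q → ∃[ k ] (c (e k) ≡ q × good k ≡ true)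
      choose q with surj proper q
      ... | k , h with k ≟ j
      ...   | yes refl = i , trans same h , not-intro (≢⇒== i≢j)
      ...   | no p = k , h , not-intro (≢⇒== p)

  module _ (d≤9 : d ≤ 9) where

    -- A colouring constant on three neighbours makes two of them redundant, which requires degree
    -- at least 10.
    no-triple : ∀ a b f → a ≢ b → b ≢ f → a ≢ f → adj G (e a) (e b) ≡ false → adj G (e b) (e f) ≡ false → adj G (e a) (e f) ≡ false → ⊥
    no-triple a b f a≢b b≢f a≢f nab nbf naf with triple-colouring a b f nab nbf naf
    ... | c , proper , hb , hf = <⇒≱ (s≤s d≤9) (redundant₂ proper b f a a b≢f a≢b a≢f a≢b a≢f hb hf)

    module Chains (a b : Fin d) (a≢b : a ≢ b) (c : Fin (n G) → Fin 8) (proper : ProperOff x c) (same : c (e a) ≡ c (e b)) where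

      -- The pair `a`, `b` already uses up the single repetition that at most nine neighbours in
      -- eight colours allow.
      unique : ∀ i j → i ≢ a → i ≢ b → c (e i) ≡ c (e j) → i ≡ j
      unique i j i≢a i≢b h with i ≟ j
      ... | yes p = p
      ... | no i≢j with j ≟ b
      ...   | yes refl = ⊥-elim (<⇒≱ (s≤s d≤9) (redundant₂ proper b i a a (i≢b ∘ ≡-sym) a≢b (i≢a ∘ ≡-sym) a≢b (i≢a ∘ ≡-sym) (≡-sym same) (trans h (≡-sym same))))
      ...   | no j≢b = ⊥-elim (<⇒≱ (s≤s d≤9) (redundant₂ proper b i a j (i≢b ∘ ≡-sym) a≢b (i≢a ∘ ≡-sym) j≢b (i≢j ∘ ≡-sym) (≡-sym same) h))

      Two : Fin d → Fin d → Fin (n G) → Set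
      Two i j w = w ≢ x × (c w ≡ c (e i) ⊎ c w ≡ c (e j))

      -- If `e j` were not in the two-coloured component of `e i`, exchanging the two colours on
      -- that component would free the colour of `e i` around `x`. This relies on `e i` and `e j`
      -- being the only neighbours with their colours.
      chain : ∀ i j → i ≢ a → i ≢ b → j ≢ a → j ≢ b → i ≢ j → (WalkIn G (Two i j) (e i) (e j) → ⊥) → ⊥
      chain i j i≢a i≢b j≢a j≢b i≢j none = reachable (Two i j) (e i) (x≢e i ∘ ≡-sym , inj₁ refl) λ W Ri conn sound closed →
        let walk : ∀ w → W w ≡ true → WalkIn G (Two i j) (e i) w
            walk = λ w r → walk-map (λ {z} → sound z) (conn w r)
        in swap W Ri sound closed (¬true⇒false λ r → none (walk (e j) r))
        where
        α β : Fin 8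
        α = c (e i)
        β = c (e j)
        α≢β : α ≢ β
        α≢β h = i≢j (unique i j i≢a i≢b h)
        swap : (W : Fin (n G) → Bool) → W (e i) ≡ true → (∀ w → W w ≡ true → Two i j w) →
          (∀ u w → W u ≡ true → adj G u w ≡ true → Two i j w → W w ≡ true) → W (e j) ≡ false → ⊥
        swap W Ri sound closed Rj = all-colours {x} {c′} proper′ α missing′
          where
          other : Fin 8 → Fin 8
          other k = if k == α then β else α
          c′ : Fin (n G) → Fin 8
          c′ w = if W w then other (c w) else c w
          other-α : other α ≡ β
          other-α rewrite ==-refl α = refl
          other-β : other β ≡ α
          other-β rewrite ≢⇒== (α≢β ∘ ≡-sym) = refl
          other-cases : ∀ k → other k ≡ α ⊎ other k ≡ β
          other-cases k with k == α
          ... | true = inj₂ refl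
          ... | false = inj₁ refl
          proper′ : ProperOff x c′
          proper′ u v u≢x v≢x a eq with W u in ru | W v in rv
          ... | false | false = proper u v u≢x v≢x a eq
          ... | true | true with proj₂ (sound u ru) | proj₂ (sound v rv)
          ...   | inj₁ p | inj₁ q = proper u v u≢x v≢x a (trans p (≡-sym q))
          ...   | inj₂ p | inj₂ q = proper u v u≢x v≢x a (trans p (≡-sym q))
          ...   | inj₁ p | inj₂ q = α≢β (≡-sym (trans (≡-sym (trans (cong other p) other-α)) (trans eq (trans (cong other q) other-β))))
          ...   | inj₂ p | inj₁ q = α≢β (trans (≡-sym (trans (cong other p) other-β)) (trans eq (trans (cong other q) other-α)))
          proper′ u v u≢x v≢x a eq | true | false with other-cases (c u)
          ...   | inj₁ p = true≢false (closed u v ru a (v≢x , inj₁ (trans (≡-sym eq) p))) rv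
          ...   | inj₂ p = true≢false (closed u v ru a (v≢x , inj₂ (trans (≡-sym eq) p))) rv
          proper′ u v u≢x v≢x a eq | false | true with other-cases (c v)
          ...   | inj₁ p = true≢false (closed v u rv (trans (sym G v u) a) (u≢x , inj₁ (trans eq p))) ru
          ...   | inj₂ p = true≢false (closed v u rv (trans (sym G v u) a) (u≢x , inj₂ (trans eq p))) ru
          missing′ : ∃[ w ] (adj G x w ≡ true × c′ w ≡ α) → ⊥
          missing′ (w , aw , h) with onto aw
          ... | k , refl with W (e k) in rk
          ...   | false = true≢false (subst (λ z → W (e z) ≡ true) (unique i k i≢a i≢b (≡-sym h)) Ri) rk
          ...   | true with proj₂ (sound (e k) rk)
          ...     | inj₁ p = α≢β (≡-sym (trans (≡-sym (trans (cong other p) other-α)) h))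
          ...     | inj₂ p = true≢false (subst (λ z → W (e z) ≡ true) (≡-sym (unique j k j≢a j≢b (≡-sym p))) rk) Rj

      colour-index : Fin 8 → Fin d
      colour-index k = proj₁ (surj proper k)

      index-of : ∀ i → i ≢ a → i ≢ b → ∀ {k} → k ≡ c (e i) → colour-index k ≡ i
      index-of i i≢a i≢b refl = ≡-sym (unique i _ i≢a i≢b (≡-sym (proj₂ (surj proper (c (e i))))))

      -- Different stars use disjoint sets of colours, so their chains are disjoint. Chains of one
      -- star share the colour of the centre and may cross, but all of them go into the branch set
      -- of that centre.
      module Stars (g : Fin d → Fin d) (g-idem : ∀ i → g (g i) ≡ g i) (g-a : ∀ i → g i ≡ a → i ≡ a) (g-b : ∀ i → g i ≡ b → i ≡ b)
        (ga : g a ≡ a) (gb : g b ≡ b) where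

        leaf-ok : ∀ l → l ≢ g l → (l ≢ a × l ≢ b) × (g l ≢ a × g l ≢ b)
        leaf-ok l h = (l≢a , l≢b) , (l≢a ∘ g-a l , l≢b ∘ g-b l)
          where
          l≢a : l ≢ a
          l≢a refl = h (≡-sym ga)
          l≢b : l ≢ b
          l≢b refl = h (≡-sym gb)

        -- Where the part of the chain for the leaf `l` that is absorbed into the centre may run:
        -- the centre itself and vertices outside `N(x)`, never the leaf.
        Z : Fin d → Fin (n G) → Set
        Z l z = z ≡ e (g l) ⊎ (adj G x z ≡ false × Two (g l) l z)

        In : Fin d → Fin (n G) → Set
        In s w = ∃[ l ] (g l ≡ s × l ≢ g l × WalkIn G (Z l) (e (g l)) w)

        -- The star owning the colour of `w`. It depends on the colour alone, which is why branch
        -- sets of different stars cannot overlap.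
        centre : Fin (n G) → Fin d
        centre w = g (colour-index (c w))

        centre-of : ∀ l w → l ≢ g l → Two (g l) l w → centre w ≡ g l
        centre-of l w h (_ , inj₁ p) = trans (cong g (index-of (g l) (proj₁ (proj₂ (leaf-ok l h))) (proj₂ (proj₂ (leaf-ok l h))) p)) (g-idem l)
        centre-of l w h (_ , inj₂ p) = cong g (index-of l (proj₁ (proj₁ (leaf-ok l h))) (proj₂ (proj₁ (leaf-ok l h))) p)

        filled : Fin (2 + d) → Fin (2 + d) → Bool
        filled = local (λ i j → adj G (e i) (e j) ∨ fill g i j) (λ _ → false)

        filled-sym : ∀ p q → filled p q ≡ filled q p
        filled-sym = local-sym λ i j → cong₂ _∨_ (sym G _ _) (fill-sym i j)
          where
          eqF-sym : ∀ {k} (i j : Fin k) → eqF i j ≡ eqF j i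
          eqF-sym zero zero = refl
          eqF-sym zero (suc j) = refl
          eqF-sym (suc i) zero = refl
          eqF-sym (suc i) (suc j) = eqF-sym i j
          fill-sym : ∀ i j → fill g i j ≡ fill g j i
          fill-sym i j = cong₂ (λ s t → not s ∧ t) (eqF-sym i j) (∨-comm (eqF (g i) j) (eqF (g j) i))

        filled-irr : ∀ p → filled p p ≡ false
        filled-irr zero = refl
        filled-irr (suc zero) = refl
        filled-irr (suc (suc i)) rewrite irrefl G (e i) | eqF-refl i = refl

        filled-graph : Graph
        filled-graph = record { n = 2 + d ; adj = filled ; sym = filled-sym ; irrefl = filled-irr }

        -- Each chain exists only under a double negation, and so does the set of vertices that the
        -- chains reach; both are finite families and can be collected when refuting.
        filled-pre : (Pre filled G → ⊥) → ⊥
        filled-pre k = all-stable (λ l → l ≢ g l → WalkIn G (Two (g l) l) (e (g l)) (e l))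
          (λ l none → by-cases {l ≡ g l} (λ eq → none λ ne → ⊥-elim (ne eq)) λ ne →
            let (p , q) , (r , s) = leaf-ok l ne in chain (g l) l r s p q (ne ∘ ≡-sym) (λ w → none λ _ → w))
          λ chains → decide-subset (λ w → In (centre w) w) λ inb sound complete → k (build chains inb sound complete)
          where
          build : (∀ l → l ≢ g l → WalkIn G (Two (g l) l) (e (g l)) (e l)) → (inb : Fin (n G) → Bool) →
            (∀ w → inb w ≡ true → In (centre w) w) → (∀ w → In (centre w) w → inb w ≡ true) → Pre filled G
          build chains inb sound complete = record { branch = br ; connected = conn ; edges = edge }
            where
            outer : Fin (n G) → Maybe (Fin (2 + d))
            outer w = if inb w then just (nb (centre w)) else nothing
            br : Fin (n G) → Maybe (Fin (2 + d))
            br w = if w == x then just zero else maybe′ (λ i → just (nb i)) (outer w) (ix w)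
            br-x : br x ≡ just zero
            br-x rewrite ==-refl x = refl
            br-e : ∀ i → br (e i) ≡ just (nb i)
            br-e i rewrite ≢⇒== (x≢e i ∘ ≡-sym) | ix-e i = refl
            ix-out : ∀ w → adj G x w ≡ false → ix w ≡ nothing
            ix-out w h with ix w in eq
            ... | nothing = refl
            ... | just i = ⊥-elim (true≢false (subst (λ z → adj G x z ≡ true) (e-ix eq) (e-nbr i)) h)
            br-reached : ∀ l w → l ≢ g l → WalkIn G (Z l) (e (g l)) w → br w ≡ just (nb (g l))
            br-reached l w ne walk with walk-end walk
            ... | inj₁ refl = br-e (g l)
            ... | inj₂ (out , two) rewrite ≢⇒== (proj₁ two) | ix-out w out
                | complete w (l , ≡-sym (centre-of l w ne two) , ne , walk) | centre-of l w ne two = refl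
            inside-class : ∀ l → l ≢ g l → ∀ {u w} → WalkIn G (Z l) (e (g l)) u → WalkIn G (Z l) u w → WalkIn G (λ z → br z ≡ just (nb (g l))) u w
            inside-class l ne pre (here p) = here (br-reached l _ ne pre)
            inside-class l ne pre (step p a w) = step (br-reached l _ ne pre) a (inside-class l ne (walk-snoc pre a (walk-start w)) w)
            data Kind (w : Fin (n G)) : Fin (2 + d) → Set where
              is-x  : w ≡ x → Kind w zero
              to-e  : ∀ i → WalkIn G (λ z → br z ≡ just (nb i)) w (e i) → Kind w (nb i)
            kind : ∀ w p → br w ≡ just p → Kind w p
            kind w p h with w ≟ x
            kind w _ refl | yes q = is-x q
            ... | no q with ix w in eq
            kind w _ refl | no q | just i with e-ix eq
            ...   | refl = to-e i (here (br-e i))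
            kind w p h | no q | nothing with inb w in iw
            kind w _ refl | no q | nothing | true with sound w iw
            ...   | l , cl , ne , walk = subst (λ s → Kind w (nb s)) cl (to-e (g l) (walk-rev (inside-class l ne (here (inj₁ refl)) walk)))
            conn : ∀ p u v → br u ≡ just p → br v ≡ just p → WalkIn G (λ w → br w ≡ just p) u v
            conn p u v hu hv with kind u p hu | kind v p hv
            ... | is-x refl | is-x refl = here hu
            ... | to-e i w₁ | to-e .i w₂ = walk-++ w₁ (walk-rev w₂)
            -- The chain meets `N(x)` only in the centre and the leaf, whose colours occur nowhere
            -- else there. The search restarts at each return to the centre, so that it ends with a
            -- stretch outside `N(x)` and a step into the leaf.
            last-step : ∀ l → l ≢ g l → ∀ {u} → WalkIn G (Z l) (e (g l)) u → WalkIn G (Two (g l) l) u (e l) →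
              ∃[ z ] (br z ≡ just (nb (g l)) × adj G z (e l) ≡ true)
            last-step l ne pre (here _) with walk-end pre
            ... | inj₁ eq = ⊥-elim (ne (e-inj eq))
            ... | inj₂ (out , _) = ⊥-elim (true≢false (e-nbr l) out)
            last-step l ne pre (step {w = w} _ a walk) with adj G x w in axw
            ... | false = last-step l ne (walk-snoc pre a (inj₂ (axw , walk-start walk))) walk
            ... | true with onto axw
            ...   | k , refl with proj₂ (walk-start walk)
            ...     | inj₁ p with unique (g l) k (proj₁ (proj₂ (leaf-ok l ne))) (proj₂ (proj₂ (leaf-ok l ne))) (≡-sym p)
            ...       | refl = last-step l ne (here (inj₁ refl)) walk
            last-step l ne pre (step {w = w} _ a walk) | true | k , refl | inj₂ p with unique l k (proj₁ (proj₁ (leaf-ok l ne))) (proj₂ (proj₁ (leaf-ok l ne))) (≡-sym p)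
            ...       | refl = _ , br-reached l _ ne pre , a
            spoke : ∀ l → l ≢ g l → ∃[ z ] (br z ≡ just (nb (g l)) × adj G z (e l) ≡ true)
            spoke l ne = last-step l ne (here (inj₁ refl)) (chains l ne)
            edge : ∀ p q → filled p q ≡ true → ∃[ u ] ∃[ v ] (br u ≡ just p × br v ≡ just q × adj G u v ≡ true)
            edge zero (suc (suc j)) _ = x , e j , br-x , br-e j , e-nbr j
            edge (suc (suc i)) zero _ = e i , x , br-e i , br-x , trans (sym G _ _) (e-nbr i)
            edge (suc zero) (suc zero) ()
            edge (suc (suc i)) (suc zero) ()
            edge (suc (suc i)) (suc (suc j)) h with ∨-elim {adj G (e i) (e j)} h
            ... | inj₁ a = e i , e j , br-e i , br-e j , a
            ... | inj₂ f with ∧-elim {not (eqF i j)} f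
            ...   | i≢j , f′ with ∨-elim {eqF (g i) j} f′
            ...     | inj₁ q with eqF⇒≡ (g i) j q
            ...       | refl with spoke i (λ eq → true≢false (trans (cong (eqF i) (≡-sym eq)) (eqF-refl i)) (not-elim i≢j))
            ...         | z , hz , az = e i , z , br-e i , hz , trans (sym G _ _) az
            edge (suc (suc i)) (suc (suc j)) h | inj₂ f | i≢j , f′ | inj₂ q with eqF⇒≡ (g j) i q
            ...       | refl with spoke j (λ eq → true≢false (trans (cong (λ z → eqF z j) (≡-sym eq)) (eqF-refl j)) (not-elim i≢j))
            ...         | z , hz , az = z , e j , hz , br-e j , az

colour-cert : Cert LeafC
colour-cert =
  B 2 3 (B 2 4 (B′ 2 5 (B 2 6 (B 2 7 (B 2 8 (B 2 9 (B 2 10 (B 3 4 (L (T₃ 1 0 2)) (B 3 5 (L (T₃ 1 0 3)) (B 3 6 (L (T₃ 1 0 4)) (B 3 7 (L (T₃ 1 0 5)) (B 3 8 (L (T₃ 1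
  0 6)) (B 3 9 (L (T₃ 1 0 7)) (B 3 10 (L (T₃ 1 0 8)) (B 4 5 (L (T₃ 2 0 3)) (B 4 6 (L (T₃ 2 0 4)) (B 4 7 (L (T₃ 2 0 5)) (B 4 8 (L (T₃ 2 0 6)) (B 4 9 (L (T₃ 2 0 7))
  (B 4 10 (L (T₃ 2 0 8)) (B 5 6 (L (T₃ 3 0 4)) (B 5 7 (L (T₃ 3 0 5)) (B 5 8 (L (T₃ 3 0 6)) (B 5 9 (L (T₃ 3 0 7)) (B 5 10 (L (T₃ 3 0 8)) (B 6 7 (L (T₃ 4 0 5)) (L
  (Q 12345))))))))))))))))))))) (B′ 3 4 (L (T₃ 1 0 2)) (B 3 5 (L (T₃ 1 0 3)) (B 3 6 (L (T₃ 1 0 4)) (B 3 7 (L (T₃ 1 0 5)) (B 3 8 (L (T₃ 1 0 6)) (B 3 9 (L (T₃ 1 0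
  7)) (B 4 5 (L (T₃ 2 0 3)) (B 4 6 (L (T₃ 2 0 4)) (B 4 7 (L (T₃ 2 0 5)) (B 4 8 (L (T₃ 2 0 6)) (B 4 9 (L (T₃ 2 0 7)) (B 5 6 (L (T₃ 3 0 4)) (B 5 7 (L (T₃ 3 0 5)) (B
  5 8 (L (T₃ 3 0 6)) (B 5 9 (L (T₃ 3 0 7)) (B 6 7 (L (T₃ 4 0 5)) (L (Q 12345))))))))))))))))))) (B′ 2 10 (R 0 786543210) (B′ 3 4 (L (T₃ 1 0 2)) (B 3 5 (L (T₃ 1 0
  3)) (B 3 6 (L (T₃ 1 0 4)) (B 3 7 (L (T₃ 1 0 5)) (B 3 8 (L (T₃ 1 0 6)) (B 4 5 (L (T₃ 2 0 3)) (B 4 6 (L (T₃ 2 0 4)) (B 4 7 (L (T₃ 2 0 5)) (B 4 8 (L (T₃ 2 0 6)) (B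
  5 6 (L (T₃ 3 0 4)) (B 5 7 (L (T₃ 3 0 5)) (B 5 8 (L (T₃ 3 0 6)) (B 6 7 (L (T₃ 4 0 5)) (L (Q 12345))))))))))))))))) (B′ 2 9 (R 0 867543210) (B′ 2 10 (R 1
  768543210) (B′ 3 4 (L (T₃ 1 0 2)) (B 3 5 (L (T₃ 1 0 3)) (B 3 6 (L (T₃ 1 0 4)) (B 3 7 (L (T₃ 1 0 5)) (B′ 4 5 (L (T₃ 2 0 3)) (B′ 4 6 (L (T₃ 2 0 4)) (B′ 4 7 (L (T₃
  2 0 5)) (B′ 5 6 (L (T₃ 3 0 4)) (B′ 5 7 (L (T₃ 3 0 5)) (B′ 6 7 (L (T₃ 4 0 5)) (L (Q 12345))))))))))))))) (B′ 2 8 (R 0 875643210) (B′ 2 9 (R 1 865743210) (B′ 2 10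
  (R 2 765843210) (B′ 3 4 (L (T₃ 1 0 2)) (B 3 5 (L (T₃ 1 0 3)) (B 3 6 (L (T₃ 1 0 4)) (B′ 4 5 (L (T₃ 2 0 3)) (B′ 4 6 (L (T₃ 2 0 4)) (B′ 5 6 (L (T₃ 3 0 4)) (B 3 7
  (B′ 3 8 (B′ 3 9 (B′ 3 10 (R 3 432876501) (B′ 4 7 (B′ 4 8 (B′ 4 9 (B′ 4 10 (R 3 431876502) (B 7 8 (L (T₃ 5 1 6)) (B 7 9 (L (T₃ 5 1 7)) (B 8 9 (L (T₃ 6 1 7)) (B 7
  5 (B′ 7 6 (B′ 7 10 (R 7 760843215) (B 5 8 (B 5 9 (B′ 5 10 (R 7 421876503) (B 8 6 (B 8 10 (R 8 750843216) (B 6 9 (B 6 10 (R 8 321876504) (L (Q 12348))) (L (K 4 0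
  771545510 64154321087 3020)))) (L (K 4 0 616545510 61454321087 3020)))) (B′ 8 6 (R 0 843276501) (L (K 3 0 446443660 3654321087 5251)))) (B 5 9 (R 0 867543210)
  (L (K 1 0 322443210 6544321087 6151))))) (B′ 7 10 (B 5 8 (B 5 9 (B′ 5 10 (R 8 421876503) (B 8 6 (R 0 875643210) (L (K 1 0 432243210 3654321087 6151)))) (L (K 3
  0 444543550 3654321087 6261))) (L (K 3 0 444543550 6354321087 6261))) (B 5 8 (B 5 9 (B′ 5 10 (R 11 421876503) (L (K 4 0 616146610 61544321087 3020))) (L (K 1 0
  772373210 16254321087 4030))) (L (K 1 0 626363210 12654321087 4030))))) (B 7 6 (R 1 876534210) (B 8 5 (R 0 875643210) (L (K 1 0 772277210 6543210087
  6153))))))))) (B′ 4 10 (B 7 8 (L (T₃ 5 1 6)) (B 7 5 (B 7 6 (B 7 9 (R 9 860743215) (B 7 10 (R 13 760843215) (B 5 8 (B 8 6 (B 8 9 (R 9 850743216) (R 4 843276501))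
  (L (K 6 1 776277212 16454321087 5330))) (L (K 6 1 776277212 16354321087 5440))))) (B′ 7 9 (L (T₃ 5 1 7)) (B 7 10 (L (T₃ 5 2 8)) (L (K 7 1 676363613 12654321087
  6340))))) (B 7 6 (R 0 876534210) (B 7 9 (L (T₃ 5 1 7)) (L (K 2 0 666166210 12654321087 4030)))))) (B′ 7 8 (L (T₃ 5 1 6)) (B 7 5 (B 7 6 (B 7 9 (R 10 860743215)
  (B 7 10 (R 16 760843215) (B 5 8 (B 8 6 (B 8 9 (R 10 850743216) (R 4 843276501)) (L (K 6 1 776277212 16454321087 5330))) (L (K 6 1 776277212 16354321087
  5440))))) (B′ 7 9 (L (T₃ 5 1 7)) (B 7 10 (B 5 8 (B 5 9 (R 1 876542310) (L (K 1 0 443243210 6354321087 6151))) (L (K 2 0 366363260 2654321087 5140))) (L (K 5 2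
  333503200 62354321087 6451))))) (B 7 6 (R 0 876534210) (B 7 9 (L (T₃ 5 1 7)) (L (K 2 0 666166210 12654321087 4030)))))))) (B′ 4 9 (R 1 867543210) (B′ 7 5 (B 7 6
  (B 7 8 (R 13 870643215) (B 7 9 (R 14 860743215) (B 7 10 (R 18 760843215) (B 5 8 (R 0 876542310) (L (K 6 1 776277212 16354321087 5440)))))) (B′ 7 8 (L (T₃ 5 1
  6)) (B 7 9 (L (T₃ 5 1 7)) (B 7 10 (B 4 10 (L (T₃ 5 2 8)) (B 5 8 (R 0 876542310) (L (K 1 0 777277210 6543210087 5342)))) (L (K 6 1 776373313 16254321087
  6340)))))) (B′ 7 6 (R 0 876534210) (B′ 7 8 (L (T₃ 5 1 6)) (L (K 2 0 656566250 12654321087 4030))))))) (B 4 8 (R 1 875643210) (B 4 9 (R 2 865743210) (B 5 7 (R 0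
  876542310) (B 5 8 (R 1 875642310) (B 5 9 (R 3 865742310) (B 6 7 (R 0 876532410) (L (K 1 0 844848810 65041321087 6554)))))))))) (B′ 3 10 (R 1 786543210) (B′ 4 7
  (B′ 4 8 (B′ 4 9 (R 0 876543120) (B 4 10 (R 10 786543120) (B 7 8 (L (T₃ 5 1 6)) (B 7 5 (B′ 7 6 (B 7 9 (R 22 860743215) (B 7 10 (R 28 760843215) (B 5 8 (B 8 6 (B
  8 9 (R 22 850743216) (L (K 1 0 333553510 6544321087 5251))) (L (K 1 0 442343210 65034321087 6510))) (L (K 1 0 332443210 65044321087 6510))))) (B′ 7 9 (B 7 10 (R
  27 640873215) (L (K 1 0 343243210 60354321087 6451))) (L (K 1 0 433243210 6354321087 6451)))) (B 7 6 (R 1 876534210) (B 8 5 (R 0 875643210) (L (K 1 0 636263210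
  60654321087 5140)))))))) (B′ 7 5 (B 7 6 (B 7 8 (R 24 870643215) (B 7 9 (R 25 860743215) (B 7 10 (R 29 760843215) (B 5 8 (R 0 876542310) (B 6 8 (R 0 876532410)
  (L (K 1 0 626555210 12654321087 4030))))))) (B′ 7 8 (L (T₃ 5 1 6)) (B 7 9 (B 7 10 (R 28 640873215) (B′ 4 9 (L (T₃ 5 2 7)) (B 5 8 (R 0 876542310) (L (K 1 0
  888888810 60544321087 5130))))) (B 7 10 (R 0 786543210) (L (K 6 1 376373713 16254321087 6340)))))) (B′ 7 6 (R 0 876534210) (B 7 8 (L (T₃ 5 1 6)) (B 4 9 (B 4 10
  (R 11 687543120) (L (K 1 0 666266210 61504321087 6463))) (L (K 1 0 666266210 16504321087 6463))))))) (B 4 8 (R 1 875643210) (B 5 7 (R 0 876542310) (B 5 8 (R 2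
  875642310) (B 6 7 (R 0 876532410) (L (K 1 0 777777710 6504321087 5451))))))))) (B′ 3 9 (R 1 867543210) (B′ 3 10 (R 2 768543210) (B′ 4 7 (B 7 5 (B 7 6 (B 7 8 (R
  32 870643215) (B 7 9 (R 33 860743215) (B 7 10 (R 37 760843215) (B 4 8 (R 0 876543120) (B 4 9 (R 1 867543120) (L (K 1 0 333553510 65044321087 6562))))))) (B′ 7 8
  (B 7 9 (R 33 840763215) (B′ 7 10 (R 36 740863215) (B′ 4 8 (R 0 876543120) (B 5 8 (R 0 876542130) (L (K 1 0 777777710 65044321087 6362)))))) (B 7 9 (R 0
  867543210) (B 7 10 (R 1 768543210) (B 4 8 (R 2 876543120) (L (K 5 1 333503010 60544321087 6562))))))) (B′ 7 6 (R 0 876534210) (B′ 4 8 (R 3 876543120) (B 4 9 (R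
  4 867543120) (L (K 1 0 888888810 65004321087 5453)))))) (B′ 5 7 (R 0 876542310) (B 6 7 (R 1 876532410) (B 4 8 (B 4 9 (R 6 857643120) (L (K 1 0 666666610
  6504321087 6463))) (L (K 1 0 777777710 6504321087 5453))))))))) (B 3 8 (R 1 875643210) (B 3 9 (R 2 865743210) (B 3 10 (R 3 765843210) (B 4 7 (R 0 876543120) (B
  4 8 (R 1 875643120) (B 4 9 (R 2 865743120) (B 4 10 (R 4 765843120) (B 5 7 (R 0 876542130) (L (K 1 0 433443310 6054321087 6564))))))))))))))))))))) (B′ 2 7 (R 0
  876453210) (B′ 2 8 (R 1 875463210) (B′ 2 9 (R 2 865473210) (B′ 2 10 (R 3 765483210) (B′ 3 4 (L (T₃ 1 0 2)) (B 3 5 (L (T₃ 1 0 3)) (B′ 4 5 (L (T₃ 2 0 3)) (B 3 6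
  (B′ 3 7 (B′ 3 8 (R 1 873265401) (B′ 3 9 (R 2 863275401) (B′ 3 10 (R 4 763285401) (B′ 4 6 (B′ 4 7 (B′ 4 8 (R 1 873165402) (B 4 9 (R 2 863175402) (B 4 10 (R 4
  763185402) (B 6 7 (L (T₃ 4 1 5)) (B 6 5 (B′ 6 8 (R 1 875063214) (B 6 9 (R 2 865073214) (L (K 1 0 333323210 6534321087 6541)))) (B 7 5 (R 0 876453210) (B 6 8 (B
  6 9 (R 3 853076214) (L (K 1 0 433243210 46054321087 6551))) (L (K 1 0 433243210 40654321087 6551))))))))) (B′ 6 5 (B 6 7 (R 2 876053214) (R 0 876325401)) (B′ 6
  7 (L (T₃ 4 1 5)) (B 4 8 (B′ 4 9 (R 4 853176402) (B′ 4 10 (R 6 753186402) (B′ 6 8 (L (T₃ 4 2 6)) (B 6 9 (B 6 10 (R 8 653087214) (L (K 1 0 666666610 60543321087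
  6441))) (L (K 1 0 666666610 6543321087 6441)))))) (B 4 9 (R 1 867543210) (B 4 10 (R 2 768543210) (B 6 8 (R 0 876325401) (L (K 1 0 777777710 6543321087
  5441))))))))) (B 4 7 (R 1 876453210) (B′ 5 6 (R 0 876542310) (B 5 7 (R 2 876452310) (B 6 7 (L (T₃ 4 1 5)) (B 4 8 (B 4 9 (B 4 10 (R 12 543187602) (B′ 5 8 (R 0
  854761320) (L (K 1 0 777777710 6054321087 5141)))) (B′ 4 10 (R 0 786543210) (L (K 1 0 666666610 60543121087 6463)))) (B 4 9 (R 0 867543210) (L (K 1 0 888888810
  65043121087 5453)))))))))))) (B′ 3 8 (R 1 875643210) (B′ 3 9 (R 2 865743210) (B′ 3 10 (R 3 765843210) (B′ 4 6 (B 6 5 (B 6 7 (R 15 876053214) (B 6 8 (R 16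
  875063214) (B 6 9 (R 17 865073214) (B 6 10 (R 20 765083214) (B 4 7 (R 0 876543120) (B 4 8 (R 1 875643120) (L (K 1 0 323323210 46504321087 6563)))))))) (B′ 4 7
  (R 0 876543120) (B′ 4 8 (R 1 875643120) (B 4 9 (R 2 865743120) (B 4 10 (R 9 765843120) (B 6 7 (B 6 8 (R 16 873065214) (L (K 1 0 555555510 60543321087 6563))) (L
  (K 1 0 666666610 60543321087 6463)))))))) (B′ 5 6 (R 0 876542310) (B 4 7 (B′ 4 8 (R 3 874653120) (B′ 4 9 (R 4 864753120) (B′ 4 10 (R 6 764853120) (B′ 5 7 (R 1
  876451320) (B 6 7 (B 6 8 (B 6 9 (R 19 832076514) (L (K 1 0 555555510 65043121087 6563))) (L (K 1 0 555555510 60543121087 6563))) (L (K 1 0 433243210 16054321087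
  6564))))))) (B 4 8 (R 1 875643210) (B 4 9 (R 2 865743210) (B 4 10 (R 3 765843210) (B 5 7 (R 0 876542310) (L (K 1 0 666666610 60540321087 6463))))))))))))) (B 3
  7 (R 1 876453210) (B 3 8 (R 2 875463210) (B 3 9 (R 3 865473210) (B 3 10 (R 4 765483210) (B 4 6 (R 0 876543120) (B 4 7 (R 1 876453120) (B 4 8 (R 2 875463120) (B
  4 9 (R 3 865473120) (B 4 10 (R 5 765483120) (B 5 6 (R 0 876542130) (B 5 7 (R 1 876452130) (L (K 1 0 666666610 68540321087 6463)))))))))))))))))))))) (B′ 2 6 (R
  0 876534210) (B′ 2 7 (R 1 876435210) (B′ 2 8 (R 2 875436210) (B′ 2 9 (R 3 865437210) (B′ 2 10 (R 4 765438210) (B′ 3 4 (L (T₃ 1 0 2)) (B 3 5 (B′ 3 6 (R 0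
  876524301) (B′ 3 7 (R 1 876425301) (B′ 3 8 (R 2 875426301) (B′ 3 9 (R 3 865427301) (B′ 3 10 (R 5 765428301) (B′ 4 5 (B 4 6 (R 0 876514302) (B 4 7 (R 1
  876415302) (B 4 8 (R 2 875416302) (B 4 9 (R 3 865417302) (B 4 10 (R 5 765418302) (B 5 6 (R 0 876504213) (B 5 7 (R 1 876405213) (L (K 1 0 666666610 60543321087
  6463))))))))) (B 4 6 (B′ 4 7 (R 1 876315402) (B′ 4 8 (R 2 875316402) (B′ 4 9 (R 3 865317402) (B′ 4 10 (R 5 765318402) (B′ 5 6 (B 5 7 (R 1 876205413) (B 5 8 (R 2
  875206413) (L (K 1 0 444444410 60514321087 6563)))) (B 5 7 (B 5 8 (R 2 874206513) (L (K 1 0 555555510 60541321087 6563))) (L (K 1 0 666666610 60541321087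
  6463)))))))) (B 4 7 (R 1 876453210) (B 4 8 (R 2 875463210) (B 4 9 (R 3 865473210) (B 4 10 (R 4 765483210) (B′ 5 6 (R 0 876542301) (B 5 7 (R 1 876452301) (L (K 1
  0 666666610 60541321087 6463))))))))))))))) (B 3 6 (R 1 876534210) (B 3 7 (R 2 876435210) (B 3 8 (R 3 875436210) (B 3 9 (R 4 865437210) (B 3 10 (R 5 765438210)
  (B′ 4 5 (R 0 876543120) (B 4 6 (R 1 876534120) (B 4 7 (R 2 876435120) (B 4 8 (R 3 875436120) (B 4 9 (R 4 865437120) (B 4 10 (R 6 765438120) (B 5 6 (B 5 7 (B 5 8
  (R 14 872106543) (L (K 1 0 444444410 68504321087 6563))) (L (K 1 0 444444410 68054321087 6563))) (L (K 1 0 555555510 68054321087 6463)))))))))))))))))))))) (B′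
  2 5 (R 1 876542310) (B′ 2 6 (R 2 876532410) (B′ 2 7 (R 3 876432510) (B′ 2 8 (R 4 875432610) (B′ 2 9 (R 5 865432710) (B′ 2 10 (R 6 765432810) (B′ 3 4 (R 0
  876543201) (B′ 3 5 (R 1 876542301) (B′ 3 6 (R 2 876532401) (B 3 7 (R 3 876432501) (B 3 8 (R 4 875432601) (B 3 9 (R 5 865432701) (B 3 10 (R 7 765432801) (B 4 5
  (B 4 6 (R 2 876510432) (B′ 4 7 (R 3 876410532) (B′ 4 8 (R 4 875410632) (B′ 4 9 (R 5 865410732) (B′ 4 10 (R 6 765410832) (B′ 5 6 (R 2 876510423) (B 5 7 (R 3
  876410523) (L (K 1 0 666666610 60542321087 6463))))))))) (B 4 6 (R 0 876534210) (B 4 7 (R 1 876435210) (B 4 8 (R 2 875436210) (B 4 9 (R 3 865437210) (B 4 10 (R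
  4 765438210) (B 5 6 (R 0 876524310) (L (K 1 0 555555510 68054321087 6463))))))))))))))))))))))) (B 2 4 (R 0 876543120) (B 2 5 (R 1 876542130) (B 2 6 (R 2
  876532140) (B 2 7 (R 3 876432150) (B 2 8 (R 4 875432160) (B 2 9 (R 5 865432170) (B 2 10 (R 6 765432180) (B 3 4 (R 0 876543021) (B 3 5 (R 1 876542031) (B 3 6 (R
  2 876532041) (B 3 7 (R 3 876432051) (B 3 8 (R 4 875432061) (B 3 9 (R 5 865432071) (B 3 10 (R 7 765432081) (B 4 5 (R 1 876541032) (B 4 6 (R 2 876531042) (B 4 7
  (R 3 876431052) (B 4 8 (R 4 875431062) (B 4 9 (R 5 865431072) (B 4 10 (R 8 765431082) (B 5 6 (R 2 876521043) (L (Q 1234)))))))))))))))))))))))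

-- The checker is reused with `y` as an isolated dummy: `root 0` declares it adjacent to no
-- neighbour of `x`.
colour-accepted : Checker.accepts 8 LeafC (ColourLeaf.colourOK 8) colour-cert (root 0) [] ≡ true
colour-accepted = refl

module ColourRefute (d′ : ℕ) (d≤9 : suc d′ ≤ 9) (G : Graph) (free : NoK8=Minor G) (uncolourable : ¬ Colorable 8 G)
  (IH : ∀ H → n H < n G → NoK8=Minor H → Colorable 8 H) (x : Fin (n G))
  (no-clique : ∀ (q : Fin 5 → Fin (n G)) → (∀ i → adj G x (q i) ≡ true) → (∀ i j → i ≢ j → adj G (q i) (q j) ≡ true) → ⊥) where

  open ColourLeaf d′
  open Neighbourhood G x d
  open Neighbourhood.Numbering

  shape : Numbering → Fin m → Fin m → Bool
  shape N = local (λ i j → adj G (e N i) (e N j)) (λ _ → false)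

  Valid : (Fin m → Fin m → Bool) → Set
  Valid A = Σ Numbering λ N → ∀ i j → A i j ≡ shape N i j

  shape-sym : ∀ N i j → shape N i j ≡ shape N j i
  shape-sym N = local-sym λ i j → sym G _ _

  Valid-sym : ∀ {A} → Valid A → ∀ i j → A i j ≡ A j i
  Valid-sym (N , h) i j = trans (h i j) (trans (shape-sym N i j) (≡-sym (h j i)))

  Valid-perm : ∀ {A} (π π⁻¹ : Fin d → Fin d) → (∀ i → π⁻¹ (π i) ≡ i) → (∀ j → π (π⁻¹ j) ≡ j) →
               Valid A → Valid (λ i j → A (lift₂ π i) (lift₂ π j))
  Valid-perm π π⁻¹ l r (N , h) = renumber π π⁻¹ l r N , λ i j → trans (h _ _) (local-lift _ _ π i j)

  module _ (N : Numbering) (σ : St m) (sat : shape N ⊨ σ) where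
    open NeighbourColours G free uncolourable IH x d N

    known⇒ : ∀ p q → known σ p q ≡ true → shape N p q ≡ true
    known⇒ p q h = sat p q true (isTrue⇒ _ h)

    refused : ∀ i j → isFalse (get σ (nb i) (nb j)) ≡ true → adj G (e N i) (e N j) ≡ false
    refused i j h = sat (nb i) (nb j) false (isFalse⇒ _ h)

    distinct : ∀ {i j : Fin d} → not (eqF i j) ≡ true → i ≢ j
    distinct {i} h refl = true≢false (eqF-refl i) (not-elim h)

    module StarLeaf (a b : Fin d) (g : Fin d → Fin d) (a≢b : a ≢ b) (ok : ∀ i → starsOK a b g i ≡ true) (col : Fin (n G) → Fin 8)
      (proper : Colouring.ProperOff G free uncolourable IH x col) (same : col (e N a) ≡ col (e N b)) where
      idem : ∀ i → g (g i) ≡ g i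
      idem i = eqF⇒≡ _ _ (proj₁ (∧-elim {eqF (g (g i)) (g i)} (ok i)))
      same-a : ∀ i → not (eqF i a xor eqF (g i) a) ≡ true
      same-a i = proj₁ (∧-elim {not (eqF i a xor eqF (g i) a)} (proj₂ (∧-elim {eqF (g (g i)) (g i)} (ok i))))
      same-b : ∀ i → not (eqF i b xor eqF (g i) b) ≡ true
      same-b i = proj₂ (∧-elim {not (eqF i a xor eqF (g i) a)} (proj₂ (∧-elim {eqF (g (g i)) (g i)} (ok i))))
      xor-eq : ∀ s t → not (s xor t) ≡ true → s ≡ t
      xor-eq true true _ = refl
      xor-eq false false _ = refl
      back : ∀ (z : Fin d) i → eqF i z ≡ eqF (g i) z → g i ≡ z → i ≡ z
      back z i h refl = eqF⇒≡ i (g i) (trans h (eqF-refl (g i)))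
      fix : ∀ (z : Fin d) → eqF z z ≡ eqF (g z) z → g z ≡ z
      fix z h = eqF⇒≡ (g z) z (trans (≡-sym h) (eqF-refl z))
      open Chains d≤9 a b a≢b col proper same
      open Stars g idem (λ i → back a i (xor-eq _ _ (same-a i))) (λ i → back b i (xor-eq _ _ (same-b i))) (fix a (xor-eq _ _ (same-a a))) (fix b (xor-eq _ _ (same-b b)))
      fill⇒ : ∀ p q → Fill σ g p q ≡ true → filled p q ≡ true
      fill⇒ p q h with ∨-elim {known σ p q} h
      ... | inj₁ k = weaken p q (known⇒ p q k)
        where
        weaken : ∀ p q → shape N p q ≡ true → filled p q ≡ true
        weaken zero (suc (suc j)) h = refl
        weaken (suc (suc i)) zero h = refl
        weaken (suc zero) zero ()
        weaken (suc zero) (suc zero) ()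
        weaken (suc zero) (suc (suc j)) ()
        weaken (suc (suc i)) (suc zero) ()
        weaken (suc (suc i)) (suc (suc j)) h = ∨-introˡ h
      ... | inj₂ f = added p q f
        where
        added : ∀ p q → fill₂ g p q ≡ true → filled p q ≡ true
        added (suc (suc i)) (suc (suc j)) f = ∨-introʳ {adj G (e N i) (e N j)} f

      finish : ∀ c p → minorCode (Fill σ g) c p ≡ true → ⊥
      finish c p h = filled-pre λ pre → minorCode-sound (Fill σ g) c p h filled-graph refl fill⇒ pre free

    stars-leaf : ∀ a b g c p → isFalse (get σ (nb a) (nb b)) ≡ true → not (eqF a b) ≡ true → (∀ i → starsOK a b g i ≡ true) →
      minorCode (Fill σ g) c p ≡ true → ⊥
    stars-leaf a b g c p nab a≢b ok h =
      let col , proper , same = pair-colouring a b (refused a b nab)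
      in StarLeaf.finish a b g (distinct a≢b) ok col proper same c p h

    irr : ∀ p → shape N p p ≡ false
    irr zero = refl
    irr (suc zero) = refl
    irr (suc (suc i)) = irrefl G (e N i)
    ψ : Fin (n G) → Maybe (Fin m)
    ψ w = if w == x then just zero else Data.Maybe.map nb (ix N w)
    ψ-x : ψ x ≡ just zero
    ψ-x rewrite ==-refl x = refl
    ψ-e : ∀ i → ψ (e N i) ≡ just (nb i)
    ψ-e i rewrite ≢⇒== (x≢e N i ∘ ≡-sym) | ix-e N i = refl
    ψ-inj : ∀ u v p → ψ u ≡ just p → ψ v ≡ just p → u ≡ v
    ψ-inj u v p hu hv with u ≟ x | v ≟ x
    ... | yes refl | yes refl = refl
    ψ-inj u v p refl hv | yes refl | no _ with ix N v
    ψ-inj u v p refl () | yes refl | no _ | just _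
    ψ-inj u v p refl () | yes refl | no _ | nothing
    ψ-inj u v p hu refl | no _ | yes refl with ix N u
    ψ-inj u v p () refl | no _ | yes refl | just _
    ψ-inj u v p () refl | no _ | yes refl | nothing
    ψ-inj u v p hu hv | no _ | no _ with ix N u in iu | ix N v in iv
    ψ-inj u v _ refl refl | no _ | no _ | just i | just .i = trans (≡-sym (e-ix N iu)) (e-ix N iv)
    -- The dummy `y` gets an empty branch set, and every other branch set is a single vertex.
    pre : Pre (shape N) G
    pre = record { branch = ψ ; connected = λ p u v hu hv → subst (WalkIn G (λ w → ψ w ≡ just p) u) (ψ-inj u v p hu hv) (here hu) ; edges = edge }
      where
      edge : ∀ p q → shape N p q ≡ true → ∃[ u ] ∃[ v ] (ψ u ≡ just p × ψ v ≡ just q × adj G u v ≡ true)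
      edge zero (suc (suc j)) _ = x , e N j , ψ-x , ψ-e j , e-nbr N j
      edge (suc (suc i)) zero _ = e N i , x , ψ-e i , ψ-x , trans (sym G _ _) (e-nbr N i)
      edge (suc zero) zero ()
      edge (suc zero) (suc zero) ()
      edge (suc zero) (suc (suc j)) ()
      edge (suc (suc i)) (suc zero) ()
      edge (suc (suc i)) (suc (suc j)) h = e N i , e N j , ψ-e i , ψ-e j , h

    minor-leaf : ∀ c p → minorCode (known σ) c p ≡ true → ⊥
    minor-leaf c p h = minorCode-sound (known σ) c p h (record { n = m ; adj = shape N ; sym = shape-sym N ; irrefl = irr }) refl known⇒ pre free

    clique-leaf : ∀ (q : Vec (Fin d) 5) → cliqueOK σ q ≡ true → ⊥
    clique-leaf q h = no-clique (λ i → e N (lookup q i)) (λ i → e-nbr N (lookup q i)) full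
      where
      full : ∀ i j → i ≢ j → adj G (e N (lookup q i)) (e N (lookup q j)) ≡ true
      full i j i≢j with ∨-elim {eqF i j} (allF-elim (λ j → eqF i j ∨ known σ (nb (lookup q i)) (nb (lookup q j))) (allF-elim (λ i → allF λ j → eqF i j ∨ known σ (nb (lookup q i)) (nb (lookup q j))) h i) j)
      ... | inj₁ eq = ⊥-elim (i≢j (eqF⇒≡ i j eq))
      ... | inj₂ k = known⇒ _ _ k

    leaf : ∀ l → colourOK σ l ≡ true → ⊥
    leaf (T₃ i j k) h =
      let p₁ , p₂ , p₃ , h′ = split₄ {refuses σ i j} {refuses σ j k} {refuses σ i k} {apart i j ∧ (apart j k ∧ apart i k)} h
          d₁ , d₂ , d₃ , _ = split₄ {apart i j} {apart j k} {apart i k} {true} (trans (cong (λ z → apart i j ∧ (apart j k ∧ z)) (∧-identityʳ (apart i k))) h′)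
      in no-triple d≤9 (toF d′ i) (toF d′ j) (toF d′ k) (distinct d₁) (distinct d₂) (distinct d₃) (refused _ _ p₁) (refused _ _ p₂) (refused _ _ p₃)
    leaf (Q q) h = clique-leaf (digits (toF d′) 5 q) h
    leaf (M c p) h = minor-leaf c p h
    leaf (K a b g c p) h =
      let h₁ , h₂ , h₃ , h₄ = split₄ {refuses σ a b} {apart a b} {allF (starsOK (toF d′ a) (toF d′ b) (stars g))} {minorCode (Fill σ (stars g)) c p} h
      in stars-leaf (toF d′ a) (toF d′ b) (stars g) c p h₁ h₂ (allF-elim (starsOK (toF d′ a) (toF d′ b) (stars g)) h₃) h₄

  leaf-sound : ∀ σ l → colourOK σ l ≡ true → ∀ A → Valid A → A ⊨ σ → ⊥
  leaf-sound σ l h A (N , v) s = leaf N σ (λ i j b e → trans (≡-sym (v i j)) (s i j b e)) l h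

  open Checker.Sound d′ LeafC colourOK Valid Valid-sym Valid-perm leaf-sound public

module DegreeNine (G : Graph) (free : NoK8=Minor G) (uncolourable : ¬ Colorable 8 G)
  (IH : ∀ H → n H < n G → NoK8=Minor H → Colorable 8 H) (x : Fin (n G)) (deg : degree G x ≡ 9)
  (no-clique : ∀ (q : Fin 5 → Fin (n G)) → (∀ i → adj G x (q i) ≡ true) → (∀ i j → i ≢ j → adj G (q i) (q j) ≡ true) → ⊥) where

  open ColourRefute 8 ≤-refl G free uncolourable IH x no-clique

  impossible : ⊥
  impossible = accepts-sound colour-cert (root 0) [] colour-accepted [] (shape N) (N , λ _ _ → refl) (root-sat _ _ 0 λ _ _ → refl)
    where
    N = Neighbourhood.numbering G x 9 deg

-- Menger's theorem

Avoids : (G : Graph) → (Fin (n G) → Bool) → Fin (n G) → Fin (n G) → Set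
Avoids G Z = WalkIn G (λ w → Z w ≡ false)

-- A single vertex counts as a walk, so a separator contains `A ∩ X`.
Separates : (G : Graph) → (A X Z : Fin (n G) → Bool) → Set
Separates G A X Z = ∀ a t → A a ≡ true → X t ≡ true → Avoids G Z a t → ⊥

-- Disjoint paths from A to X, one for each vertex t of X; the path to t runs inside the vertices labelled t.
record Linkage (G : Graph) (A X : Fin (n G) → Bool) : Set where
  field
    lab  : Fin (n G) → Maybe (Fin (n G))
    path : ∀ t → X t ≡ true → ∃[ a ] (A a ≡ true × WalkIn G (λ w → lab w ≡ just t) a t)

  lab-end : ∀ t → X t ≡ true → lab t ≡ just t
  lab-end t h = walk-end (proj₂ (proj₂ (path t h)))

just-inj : ∀ {A : Set} {a b : A} → just a ≡ just b → a ≡ b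
just-inj refl = refl

reach-from : ∀ (G : Graph) (A Z : Fin (n G) → Bool) →
  ((U : Fin (n G) → Bool) → (∀ w → U w ≡ true → ∃[ a ] (A a ≡ true × Avoids G Z a w)) →
    (∀ a → A a ≡ true → Z a ≡ false → U a ≡ true) →
    (∀ u w → U u ≡ true → adj G u w ≡ true → Z w ≡ false → U w ≡ true) → ⊥) → ⊥
reach-from G A Z k = decide-subset (λ w → ∃[ a ] (A a ≡ true × Avoids G Z a w)) λ U sound complete →
  k U sound (λ a h z → complete a (a , h , here z))
    (λ u w h e z → let a , q , walk = sound u h in complete w (a , q , walk-snoc walk e z))

-- G is H plus the edge pq; Z separates A from X in H, and U is the part of H reachable from A outside Z.
module MengerStep (G : Graph) (u₀ v₀ : Fin (n G)) (uv : adj G u₀ v₀ ≡ true) (A X : Fin (n G) → Bool) (Z U : Fin (n G) → Bool)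
  (U-sound : ∀ w → U w ≡ true → ∃[ a ] (A a ≡ true × Avoids (Delete.deleted G u₀ v₀ uv) Z a w))
  (U-start : ∀ a → A a ≡ true → Z a ≡ false → U a ≡ true)
  (U-closed : ∀ u w → U u ≡ true → adj (Delete.deleted G u₀ v₀ uv) u w ≡ true → Z w ≡ false → U w ≡ true)
  (Z-sep : Separates (Delete.deleted G u₀ v₀ uv) A X Z)
  (p q : Fin (n G)) (Up : U p ≡ true) (Uq : U q ≡ false)
  (the-edge : ∀ a b → adj G a b ≡ true → adj (Delete.deleted G u₀ v₀ uv) a b ≡ false → (a ≡ p × b ≡ q) ⊎ (a ≡ q × b ≡ p))
  (pq : adj G p q ≡ true) where

  H : Graph
  H = Delete.deleted G u₀ v₀ uv

  H⊆G : ∀ a b → adj H a b ≡ true → adj G a b ≡ true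
  H⊆G a b h = proj₁ (∧-elim {adj G a b} h)

  up : ∀ {P : Fin (n G) → Set} {a b} → WalkIn H P a b → WalkIn G P a b
  up (here x) = here x
  up (step x e w) = step x (H⊆G _ _ e) (up w)

  Z∩U : ∀ w → Z w ≡ true → U w ≡ false
  Z∩U w h = ¬true⇒false λ u → let _ , _ , walk = U-sound w u in true≢false h (walk-end walk)

  X∩U : ∀ t → X t ≡ true → U t ≡ false
  X∩U t h = ¬true⇒false λ u → let a , ha , walk = U-sound t u in Z-sep a t ha h walk

  -- The separator of `H` enlarged by one end of the deleted edge or the other; `p` is the end on
  -- the side of `A`.
  P Y : Fin (n G) → Bool
  P w = Z w ∨ (w == p)
  Y w = Z w ∨ (w == q)

  Y-U : ∀ w → Y w ≡ true → U w ≡ false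
  Y-U w h with ∨-elim {Z w} h
  ... | inj₁ z = Z∩U w z
  ... | inj₂ e = subst (λ z → U z ≡ false) (≡-sym (==⇒≡ e)) Uq

  #P≤ : # P ≤ # Z + 1
  #P≤ = ≤-trans (sum-mono pt) (≤-reflexive (trans (∑-distrib-+ (λ w → [ Z w ]) (λ w → [ w == p ] * 1)) (cong (# Z +_) (sum-delta p (λ _ → 1)))))
    where
    pt : ∀ w → [ P w ] ≤ [ Z w ] + [ w == p ] * 1
    pt w with Z w | w == p
    ... | true | _ = s≤s z≤n
    ... | false | true = ≤-refl
    ... | false | false = ≤-refl

  -- A walk of `G` from `A` to `X` has to leave `U`, either into `Z` or over the deleted edge, whose
  -- end in `U` is `p`. Up to there it is a walk of `H` from `A` to `P`, which `W` meets.
  sep-P : ∀ W → Separates H A P W → Separates G A X W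
  sep-P W sep a t ha ht walk with Z a in za
  ... | true = sep a a ha (∨-introˡ za) (here (walk-start walk))
  ... | false = go (here (walk-start walk)) (U-start a ha za) walk
    where
    go : ∀ {u} → Avoids H W a u → U u ≡ true → Avoids G W u t → ⊥
    go pre uu (here _) = true≢false uu (X∩U t ht)
    go {u} pre uu (step {w = w} _ e rest) with u ≟ p
    ... | yes refl = sep a p ha (∨-introʳ {Z p} (==-refl p)) pre
    ... | no u≢p with adj H u w in hw
    ...   | false with the-edge u w e hw
    ...     | inj₁ (u≡p , _) = u≢p u≡p
    ...     | inj₂ (refl , _) = true≢false uu Uq
    go {u} pre uu (step {w = w} _ e rest) | no u≢p | true with Z w in zw
    ...     | true = sep a w ha (∨-introˡ zw) (walk-snoc pre hw (walk-start rest))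
    ...     | false = go (walk-snoc pre hw (walk-start rest)) (U-closed u w uu hw zw) rest

  -- The mirror image, reading the walk backwards from `X`: what remains after its last visit to
  -- `U`, or the whole walk if it starts in `Z`, contains a walk of `H` from `Y` to `X`.
  sep-Y : ∀ W → Separates H Y X W → Separates G A X W
  sep-Y W sep a t ha ht walk with go walk
    where
    go : ∀ {w} → Avoids G W w t → (∃[ r ] (Y r ≡ true × Avoids H W r t)) ⊎ (U w ≡ false × Avoids H W w t)
    go (here x) = inj₂ (X∩U t ht , here x)
    go (step {u = w} {w = w′} x e rest) with go rest
    ... | inj₁ r = inj₁ r
    ... | inj₂ (nu , walk) with adj H w w′ in hw
    ...   | false with the-edge w w′ e hw
    ...     | inj₁ (_ , refl) = inj₁ (q , ∨-introʳ {Z q} (==-refl q) , walk)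
    ...     | inj₂ (_ , refl) = ⊥-elim (true≢false Up nu)
    go (step {u = w} {w = w′} x e rest) | inj₂ (nu , walk) | true with U w in uw
    ...     | false = inj₂ (refl , step x hw walk)
    ...     | true with Z w′ in zw
    ...       | true = inj₁ (w′ , ∨-introˡ zw , walk)
    ...       | false = ⊥-elim (true≢false (U-closed w w′ uw hw zw) nu)
  ... | inj₁ (r , hr , w) = sep r t hr ht w
  ... | inj₂ (nu , w) with Z a in za
  ...   | true = sep a t (∨-introˡ za) ht w
  ...   | false = true≢false (U-start a ha za) nu

  module Combine (L₁ : Linkage H A P) (L₂ : Linkage H Y X) where
    private
      module L₁ = Linkage L₁
      module L₂ = Linkage L₂
      -- Joins the labels at the cut: a path of `L₁` ending in `z` continues along the path of `L₂`
      -- through `z`, except that the one ending in `p` crosses the deleted edge to `q`.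
      next : Fin (n G) → Maybe (Fin (n G))
      next z = if z == p then L₂.lab q else L₂.lab z
      lab : Fin (n G) → Maybe (Fin (n G))
      lab w = if U w then (L₁.lab w >>= next) else L₂.lab w
      lab-U : ∀ {w z} → U w ≡ true → L₁.lab w ≡ just z → lab w ≡ next z
      lab-U h k rewrite h | k = refl
      lab-out : ∀ {w} → U w ≡ false → lab w ≡ L₂.lab w
      lab-out h rewrite h = refl
      next-p : next p ≡ L₂.lab q
      next-p rewrite ==-refl p = refl
      next-Z : ∀ z → Z z ≡ true → next z ≡ L₂.lab z
      next-Z z h rewrite ≢⇒== {u = z} {p} (λ { refl → true≢false Up (Z∩U p h) }) = refl

      -- Cut at its last vertex of `Y`, the path stays outside `U`: leaving `U` inside `H` is
      -- possible only through `Z`, which is part of `Y`.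
      tail : ∀ t → X t ≡ true → ∃[ r ] (Y r ≡ true × WalkIn G (λ w → L₂.lab w ≡ just t × U w ≡ false) r t)
      tail t ht with L₂.path t ht
      ... | r₀ , hr₀ , walk with go walk
        where
        Good : Fin (n G) → Set
        Good w = L₂.lab w ≡ just t × U w ≡ false
        go : ∀ {w} → WalkIn H (λ w → L₂.lab w ≡ just t) w t →
             (∃[ r ] (Y r ≡ true × WalkIn G Good r t)) ⊎ (Y w ≡ false × WalkIn G Good w t)
        go (here x) with Y t in yt
        ... | true = inj₁ (t , yt , here (x , X∩U t ht))
        ... | false = inj₂ (refl , here (x , X∩U t ht))
        go (step {u = w} {w = w′} x e rest) with go rest
        ... | inj₁ r = inj₁ r
        ... | inj₂ (ny , walk) with Y w in yw
        ...   | true = inj₁ (w , yw , step (x , Y-U w yw) (H⊆G _ _ e) walk)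
        ...   | false with U w in uw
        ...     | false = inj₂ (refl , step (x , uw) (H⊆G _ _ e) walk)
        ...     | true = ⊥-elim (true≢false (U-closed w w′ uw e (¬true⇒false λ z → true≢false (∨-introˡ z) ny)) (proj₂ (walk-start walk)))
      ...   | inj₁ r = r
      ...   | inj₂ (ny , _) = ⊥-elim (true≢false hr₀ ny)

      -- The path to z, cut at its first vertex outside U.
      Head : Fin (n G) → Set
      Head z = ∃[ a ] (A a ≡ true × (a ≡ z ⊎ ∃[ u ] (WalkIn G (λ w → L₁.lab w ≡ just z × U w ≡ true) a u × (u ≡ z ⊎ adj G u z ≡ true))))

      head : ∀ z → P z ≡ true → Head z
      head z hz with L₁.path z hz
      ... | a , ha , walk with Z a in za
      ...   | true = a , ha , inj₁ (just-inj (trans (≡-sym (L₁.lab-end a (∨-introˡ za))) (walk-start walk)))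
      ...   | false = a , ha , inj₂ (go (here (walk-start walk , U-start a ha za)) walk)
        where
        go : ∀ {u} → WalkIn G (λ w → L₁.lab w ≡ just z × U w ≡ true) a u → WalkIn H (λ w → L₁.lab w ≡ just z) u z →
             ∃[ u ] (WalkIn G (λ w → L₁.lab w ≡ just z × U w ≡ true) a u × (u ≡ z ⊎ adj G u z ≡ true))
        go pre (here _) = z , pre , inj₁ refl
        go {u} pre (step {w = w} _ e rest) with Z w in zw
        ... | true = u , pre , inj₂ (subst (λ y → adj G u y ≡ true) (just-inj (trans (≡-sym (L₁.lab-end w (∨-introˡ zw))) (walk-start rest))) (H⊆G _ _ e))
        ... | false = go (walk-snoc pre (H⊆G _ _ e) (walk-start rest , U-closed u w (proj₂ (walk-end pre)) e zw)) rest

      -- The link is trivial when the cut vertex lies in `Z` and is the deleted edge when the cut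
      -- vertex is `p`. The front part is trivial when `a` itself is the cut vertex.
      attach : ∀ t z → next z ≡ just t → Head z → ∀ {r} → (z ≡ r ⊎ (U z ≡ true × adj G z r ≡ true)) → (Z z ≡ true ⊎ z ≡ p) →
        WalkIn G (λ w → L₂.lab w ≡ just t × U w ≡ false) r t → ∃[ a ] (A a ≡ true × WalkIn G (λ w → lab w ≡ just t) a t)
      attach t z nz (a , ha , front) {r} link kind rest = a , ha , first front link
        where
        rest′ : WalkIn G (λ w → lab w ≡ just t) r t
        rest′ = walk-map (λ (l , u) → trans (lab-out u) l) rest
        inU : ∀ {w} → L₁.lab w ≡ just z × U w ≡ true → lab w ≡ just t
        inU (l , u) = trans (lab-U u l) nz
        z-lab : (Z z ≡ true ⊎ z ≡ p) → U z ≡ true → lab z ≡ just t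
        z-lab (inj₁ hz) uz = ⊥-elim (true≢false uz (Z∩U z hz))
        z-lab (inj₂ eq) uz = inU (L₁.lab-end z (∨-introʳ {Z z} (subst (λ y → (z == y) ≡ true) eq (==-refl z))) , uz)
        last : (z ≡ r ⊎ (U z ≡ true × adj G z r ≡ true)) → WalkIn G (λ w → lab w ≡ just t) z t
        last (inj₁ eq) = subst (λ y → WalkIn G (λ w → lab w ≡ just t) y t) (≡-sym eq) rest′
        last (inj₂ (uz , e)) = step (z-lab kind uz) e rest′
        first : (a ≡ z ⊎ ∃[ u ] (WalkIn G (λ w → L₁.lab w ≡ just z × U w ≡ true) a u × (u ≡ z ⊎ adj G u z ≡ true))) →
          (z ≡ r ⊎ (U z ≡ true × adj G z r ≡ true)) → WalkIn G (λ w → lab w ≡ just t) a t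
        first (inj₁ eq) l = subst (λ y → WalkIn G (λ w → lab w ≡ just t) y t) (≡-sym eq) (last l)
        first (inj₂ (u , walk , inj₁ refl)) l = walk-++ (walk-map inU walk) (last l)
        first (inj₂ (u , walk , inj₂ e)) l = walk-++ (walk-snoc (walk-map inU walk) e (walk-start (last l))) (last l)

    combined : Linkage G A X
    combined = record { lab = lab ; path = build }
      where
      build : ∀ t → X t ≡ true → ∃[ a ] (A a ≡ true × WalkIn G (λ w → lab w ≡ just t) a t)
      build t ht with tail t ht
      ... | r , hr , rest with ∨-elim {Z r} hr
      ...   | inj₁ zr = attach t r (trans (next-Z r zr) (proj₁ (walk-start rest))) (head r (∨-introˡ zr)) (inj₁ refl) (inj₁ zr) rest
      ...   | inj₂ e with ==⇒≡ e
      ...     | refl = attach t p (trans next-p (proj₁ (walk-start rest))) (head p (∨-introʳ {Z p} (==-refl p))) (inj₂ (Up , pq)) (inj₂ refl) rest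

-- Induction on the number of edges. If deleting an edge creates no separator smaller than `X`, a
-- linkage of the smaller graph suffices. Otherwise such a `Z`, enlarged by one end of the edge or
-- the other, is linked to `A` and to `X`, and the two linkages are cut so as to meet only there.
-- Comparing separators with `# X` makes a linkage cover all of `X`, so that paths can be named by
-- their last vertices.
menger : ∀ k (G : Graph) (A X : Fin (n G) → Bool) → degree-sum G ≤ k →
  (∀ Z → Separates G A X Z → # X ≤ # Z) → (Linkage G A X → ⊥) → ⊥
menger k G A X hk min none = by-cases {∃[ u ] ∃[ v ] adj G u v ≡ true} (with-edge k hk) no-edge
  where
  no-edge : (∃[ u ] ∃[ v ] adj G u v ≡ true → ⊥) → ⊥
  no-edge ne = none (record { lab = just ; path = λ t ht → t , X⊆A t ht , here refl })
    where
    trivial : ∀ {P : Fin (n G) → Set} {a t} → WalkIn G P a t → a ≡ t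
    trivial (here _) = refl
    trivial (step _ e _) = ⊥-elim (ne (_ , _ , e))
    -- Without edges `A ∩ X` separates, so minimality forces it to be all of `X`.
    both : Fin (n G) → Bool
    both w = A w ∧ X w
    sep : Separates G A X both
    sep a t ha ht walk with trivial walk
    ... | refl = true≢false (∧-intro ha ht) (walk-end walk)
    X⊆A : ∀ t → X t ≡ true → A t ≡ true
    X⊆A t ht with A t in at
    ... | true = refl
    ... | false = ⊥-elim (<⇒≱ bound (min both sep))
      where
      pt : ∀ w → [ both w ] + [ w == t ] * 1 ≤ [ X w ]
      pt w with w ≟ t
      ... | yes refl rewrite at | ht = ≤-refl
      ... | no _ rewrite +-identityʳ [ A w ∧ X w ] with A w
      ...   | true = ≤-refl
      ...   | false = z≤n
      bound : # both < # X
      bound = ≤-trans (≤-reflexive (trans (+-comm 1 (# both)) (trans (cong (# both +_) (≡-sym (sum-delta t (λ _ → 1)))) (≡-sym (∑-distrib-+ (λ w → [ both w ]) (λ w → [ w == t ] * 1)))))) (sum-mono pt)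

  with-edge : ∀ k → degree-sum G ≤ k → ∃[ u ] ∃[ v ] adj G u v ≡ true → ⊥
  with-edge zero h (u , v , uv) = <⇒≱ (≤-trans (≤-trans (subst (λ z → 1 ≤ [ z ]) (≡-sym uv) ≤-refl) (term≤sum (λ w → [ adj G u w ]) v)) (term≤sum (λ w → degree G w) u)) h
  with-edge (suc k′) h (u , v , uv) = by-cases {∃[ Z ] (Separates H A X Z × # Z < # X)} smaller same
    where
    H : Graph
    H = Delete.deleted G u v uv
    hk′ : degree-sum H ≤ k′
    hk′ = ≤-pred (≤-trans (≤-trans (≤-reflexive (+-comm 1 _)) (+-monoʳ-≤ (degree-sum H) (s≤s z≤n))) (subst (_≤ suc k′) (Delete.deleted-sum G u v uv) h))
    H⊆G : ∀ a b → adj H a b ≡ true → adj G a b ≡ true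
    H⊆G a b e = proj₁ (∧-elim {adj G a b} e)
    up : ∀ {P : Fin (n G) → Set} {a b} → WalkIn H P a b → WalkIn G P a b
    up (here x) = here x
    up (step x e w) = step x (H⊆G _ _ e) (up w)
    same : ¬ (∃[ Z ] (Separates H A X Z × # Z < # X)) → ⊥
    same no-small = menger k′ H A X hk′ (λ Z sep → ≮⇒≥ λ lt → no-small (Z , sep , lt))
      λ l → none (record { lab = Linkage.lab l ; path = λ t ht → let a , ha , w = Linkage.path l t ht in a , ha , up w })
    smaller : ∃[ Z ] (Separates H A X Z × # Z < # X) → ⊥
    smaller (Z , sep , lt) = reach-from H A Z λ U sound start closed →
      <⇒≱ lt (min Z λ a t ha ht walk → cross U sound start closed a t ha ht walk)
      where
      module _ (U : Fin (n G) → Bool) (sound : ∀ w → U w ≡ true → ∃[ a ] (A a ≡ true × Avoids H Z a w))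
        (start : ∀ a → A a ≡ true → Z a ≡ false → U a ≡ true)
        (closed : ∀ u w → U u ≡ true → adj H u w ≡ true → Z w ≡ false → U w ≡ true) where
        finish : ∀ p q → U p ≡ true → U q ≡ false → adj G p q ≡ true → adj H p q ≡ false → ⊥
        -- `P` may take the place of `X` because `# P ≤ # Z + 1 ≤ # X`, and every `W` separating `A`
        -- from `P` in `H` separates `A` from `X` in `G`.
        finish p q Up Uq pq hpq = menger k′ H A P hk′ (λ W s → ≤-trans #P≤ (≤-trans (≤-reflexive (+-comm (# Z) 1)) (≤-trans lt (min W (sep-P W s)))))
          λ L₁ → menger k′ H Y X hk′ (λ W s → min W (sep-Y W s)) λ L₂ → none (Combine.combined L₁ L₂)
          where
          ends : ∀ a b → adj G a b ≡ true → adj H a b ≡ false → (a ≡ u × b ≡ v) ⊎ (a ≡ v × b ≡ u)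
          ends a b ab h with ∨-elim {(a == u) ∧ (b == v)} {(b == u) ∧ (a == v)} (lem ab h)
            where
            lem : ∀ {s t} → s ≡ true → s ∧ not t ≡ false → t ≡ true
            lem {t = true} refl _ = refl
          ... | inj₁ e = inj₁ (==⇒≡ (proj₁ (∧-elim {a == u} e)) , ==⇒≡ (proj₂ (∧-elim {a == u} e)))
          ... | inj₂ e = inj₂ (==⇒≡ (proj₂ (∧-elim {b == u} e)) , ==⇒≡ (proj₁ (∧-elim {b == u} e)))
          the-edge : ∀ a b → adj G a b ≡ true → adj H a b ≡ false → (a ≡ p × b ≡ q) ⊎ (a ≡ q × b ≡ p)
          the-edge a b ab h with ends a b ab h | ends p q pq hpq
          ... | inj₁ (a₁ , b₁) | inj₁ (a₂ , b₂) = inj₁ (trans a₁ (≡-sym a₂) , trans b₁ (≡-sym b₂))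
          ... | inj₁ (a₁ , b₁) | inj₂ (a₂ , b₂) = inj₂ (trans a₁ (≡-sym b₂) , trans b₁ (≡-sym a₂))
          ... | inj₂ (a₁ , b₁) | inj₁ (a₂ , b₂) = inj₂ (trans a₁ (≡-sym b₂) , trans b₁ (≡-sym a₂))
          ... | inj₂ (a₁ , b₁) | inj₂ (a₂ , b₂) = inj₁ (trans a₁ (≡-sym a₂) , trans b₁ (≡-sym b₂))
          open MengerStep G u v uv A X Z U sound start closed sep p q Up Uq the-edge pq hiding (H; H⊆G; up)
        -- If `Z` does not separate in `G`, some walk avoiding `Z` leaves `U`, which is possible
        -- only over the deleted edge. The direction of that step decides which end is called `p`.
        cross : ∀ a t → A a ≡ true → X t ≡ true → Avoids G Z a t → ⊥
        cross a t ha ht walk = go walk (start a ha (walk-start walk))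
          where
          go : ∀ {w} → Avoids G Z w t → U w ≡ true → ⊥
          go (here _) uw = let a , ha , s = sound t uw in sep a t ha ht s
          go (step {u = w} {w = w′} _ e rest) uw with U w′ in uw′
          ... | true = go rest uw′
          ... | false with adj H w w′ in hw
          ...   | true = true≢false (closed w w′ uw hw (walk-start rest)) uw′
          ...   | false = finish w w′ uw uw′ e hw

-- Gluing along a separator

image : ∀ {k N} → (Fin k → Fin N) → Fin N → Bool
image q w = anyF λ i → q i == w

#-image : ∀ {k N} (q : Fin k → Fin N) → (∀ i j → q i ≡ q j → i ≡ j) → # image q ≡ k
#-image {zero} {N} q inj = trans (sum-const N 0) (*-zeroʳ N)
#-image {suc k} {N} q inj = begin
  # image q ≡⟨ sum-cong-≗ pt ⟩
  sum (λ w → [ w == q zero ] * 1 + [ image (q ∘ suc) w ]) ≡⟨ ∑-distrib-+ (λ w → [ w == q zero ] * 1) (λ w → [ image (q ∘ suc) w ]) ⟩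
  sum (λ w → [ w == q zero ] * 1) + # image (q ∘ suc) ≡⟨ cong₂ _+_ (sum-delta (q zero) (λ _ → 1)) (#-image (q ∘ suc) (λ i j h → suc-injective (inj (suc i) (suc j) h))) ⟩
  suc k ∎
  where
  open ≡-Reasoning
  pt : ∀ w → [ image q w ] ≡ [ w == q zero ] * 1 + [ image (q ∘ suc) w ]
  pt w rewrite ==-sym (q zero) w with w ≟ q zero
  ... | no _ = refl
  ... | yes refl with image (q ∘ suc) w in eq
  ...   | false = refl
  ...   | true with anyF-elim (λ i → q (suc i) == q zero) eq
  ...     | i , h with inj (suc i) zero (==⇒≡ h)
  ...       | ()

image-elim : ∀ {k N} (q : Fin k → Fin N) w → image q w ≡ true → ∃[ i ] q i ≡ w
image-elim q w h = let i , e = anyF-elim (λ i → q i == w) h in i , ==⇒≡ e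

image-intro : ∀ {k N} (q : Fin k → Fin N) i → image q (q i) ≡ true
image-intro q i = anyF-intro (λ j → q j == q i) i (==-refl (q i))

extra : ∀ {m} (p z : Fin m → Bool) → # z < # p → ∃[ a ] (p a ≡ true × z a ≡ false)
extra p z lt with any? (λ a → (p a ∧ not (z a)) ≟ᵇ true)
... | yes (a , h) = a , proj₁ (∧-elim {p a} h) , not-elim (proj₂ (∧-elim {p a} h))
... | no none = ⊥-elim (<⇒≱ lt (sum-mono pt))
  where
  pt : ∀ a → [ p a ] ≤ [ z a ]
  pt a with p a in pa | z a in za
  ... | false | _ = z≤n
  ... | true | true = ≤-refl
  ... | true | false = ⊥-elim (none (a , cong₂ (λ s t → s ∧ not t) pa za))

swapF : ∀ {r} → Fin r → Fin r → Fin r → Fin r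
swapF a b x = if x == a then b else (if x == b then a else x)

swapF-invol : ∀ {r} (a b x : Fin r) → swapF a b (swapF a b x) ≡ x
swapF-invol a b x with x ≟ a
... | yes refl with b ≟ a
...   | yes refl = refl
...   | no _ rewrite ==-refl b = refl
swapF-invol a b x | no x≢a with x ≟ b
...   | yes refl rewrite ==-refl a = refl
...   | no x≢b rewrite ≢⇒== x≢a | ≢⇒== x≢b = refl

swapF-left : ∀ {r} (a b : Fin r) → swapF a b a ≡ b
swapF-left a b rewrite ==-refl a = refl

swapF-other : ∀ {r} (a b x : Fin r) → x ≢ a → x ≢ b → swapF a b x ≡ x
swapF-other a b x p q rewrite ≢⇒== p | ≢⇒== q = refl

InjOn : ∀ {m r} → (Fin m → Bool) → (Fin m → Fin r) → Set
InjOn p f = ∀ u v → p u ≡ true → p v ≡ true → f u ≡ f v → u ≡ v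

-- A partial matching of colours is extended to a permutation, one vertex at a time: a transposition
-- corrects the image of the new colour and leaves the earlier ones alone, because both colourings
-- are injective on `p`.
align : ∀ {m r} (p : Fin m → Bool) (f g : Fin m → Fin r) → InjOn p f → InjOn p g →
  Σ (Fin r → Fin r) λ π → (∀ x y → π x ≡ π y → x ≡ y) × (∀ z → p z ≡ true → π (f z) ≡ g z)
align {zero} p f g if ig = id , (λ _ _ h → h) , λ ()
align {suc m} p f g if ig with align (p ∘ suc) (f ∘ suc) (g ∘ suc) (λ u v hu hv h → suc-injective (if _ _ hu hv h)) (λ u v hu hv h → suc-injective (ig _ _ hu hv h))
... | π , inj , h with p zero in pz
...   | false = π , inj , λ { zero q → ⊥-elim (true≢false q pz) ; (suc z) q → h z q }
...   | true = τ ∘ π , (λ x y e → inj x y (trans (≡-sym (swapF-invol _ _ (π x))) (trans (cong τ e) (swapF-invol _ _ (π y))))) , agree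
  where
  τ : Fin _ → Fin _
  τ = swapF (π (f zero)) (g zero)
  agree : ∀ z → p z ≡ true → τ (π (f z)) ≡ g z
  agree zero _ = swapF-left (π (f zero)) (g zero)
  agree (suc z) q = trans (cong τ (h z q)) (swapF-other _ _ _ (λ e → no-eq (if (suc z) zero q pz (inj _ _ (trans (h z q) e)))) (λ e → no-eq (ig (suc z) zero q pz e)))
    where
    no-eq : suc z ≢ zero
    no-eq ()

sep-sym : ∀ {G : Graph} {A X Z} → Separates G A X Z → Separates G X A Z
sep-sym sep t a ht ha walk = sep a t ha ht (walk-rev walk)

-- A walk from `A` to `X` meets `Z`, and the part up to its first vertex of `Z` meets `W`. So a
-- smallest separator `Z` satisfies the hypothesis of `menger` between `A` and `Z`.
sep-trans : ∀ (G : Graph) (A X Z W : Fin (n G) → Bool) → Separates G A X Z → Separates G A Z W → Separates G A X W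
sep-trans G A X Z W sep₁ sep₂ a t ha ht walk with Z a in za
... | true = sep₂ a a ha za (here (walk-start walk))
... | false = go (here (walk-start walk)) (here za) walk
  where
  go : ∀ {u} → Avoids G W a u → Avoids G Z a u → Avoids G W u t → ⊥
  go pre₁ pre₂ (here _) = sep₁ a t ha ht pre₂
  go pre₁ pre₂ (step {w = w} _ e rest) with Z w in zw
  ... | true = sep₂ a w ha zw (walk-snoc pre₁ e (walk-start rest))
  ... | false = go (walk-snoc pre₁ e (walk-start rest)) (walk-snoc pre₂ e zw) rest

-- Minors from joined 6-cliques

record Clique₆ (G : Graph) : Set where
  field
    set  : Fin (n G) → Bool
    size : # set ≡ 6
    full : ∀ u v → set u ≡ true → set v ≡ true → u ≢ v → adj G u v ≡ true

Ed : (G : Graph) → (Fin (n G) → Maybe (Fin 8)) → Fin 8 → Fin 8 → Set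
Ed G br i j = ∃[ u ] ∃[ v ] (br u ≡ just i × br v ≡ just j × adj G u v ≡ true)

flipE : ∀ (G : Graph) {br i j} → Ed G br i j → Ed G br j i
flipE G (u , v , hu , hv , e) = v , u , hv , hu , trans (sym G v u) e

-- Two 6-cliques joined by six disjoint paths, two of which have distinct ends.
module TwoCliques (G : Graph) (free : NoK8=Minor G) (A X : Clique₆ G) (link : Linkage G (Clique₆.set A) (Clique₆.set X))
  (b b′ : Fin (n G)) (b≢b′ : b ≢ b′) (Xb : Clique₆.set X b ≡ true) (Xb′ : Clique₆.set X b′ ≡ true)
  (Ab : Clique₆.set A b ≡ false) (Ab′ : Clique₆.set A b′ ≡ false) where

  private
    module A = Clique₆ A
    module X = Clique₆ X
  open Linkage link

  rest : Fin (n G) → Bool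
  rest w = X.set w ∧ (not (w == b) ∧ not (w == b′))

  rest-elim : ∀ w → rest w ≡ true → X.set w ≡ true × (w ≢ b × w ≢ b′)
  rest-elim w h =
    let p , q = ∧-elim {X.set w} h
        r , s = ∧-elim {not (w == b)} q
    in p , ==⇒≢ (not-elim r) , ==⇒≢ (not-elim s)

  abstract
    #rest : # rest ≡ 4
    #rest = +-cancelʳ-≡ 2 (# rest) 4 (trans (≡-sym (begin
      # X.set ≡⟨ sum-cong-≗ pt ⟩
      sum (λ w → [ rest w ] + ([ w == b ] * 1 + [ w == b′ ] * 1)) ≡⟨ ∑-distrib-+ (λ w → [ rest w ]) (λ w → [ w == b ] * 1 + [ w == b′ ] * 1) ⟩
      # rest + sum (λ w → [ w == b ] * 1 + [ w == b′ ] * 1) ≡⟨ cong (# rest +_) (trans (∑-distrib-+ (λ w → [ w == b ] * 1) (λ w → [ w == b′ ] * 1)) (cong₂ _+_ (sum-delta b (λ _ → 1)) (sum-delta b′ (λ _ → 1)))) ⟩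
      # rest + 2 ∎)) X.size)
      where
      open ≡-Reasoning
      pt : ∀ w → [ X.set w ] ≡ [ rest w ] + ([ w == b ] * 1 + [ w == b′ ] * 1)
      pt w with w ≟ b | w ≟ b′
      ... | yes refl | yes e = ⊥-elim (b≢b′ e)
      ... | yes refl | no _ rewrite Xb = refl
      ... | no _ | yes refl rewrite Xb′ = refl
      ... | no _ | no _ with X.set w
      ...   | true = refl
      ...   | false = refl

  private
    module N = Enum (subst (Enum rest) #rest (enum rest))

  src : ∀ t → X.set t ≡ true → Fin (n G)
  src t h = proj₁ (path t h)

  blocked : Fin (n G) → Bool
  blocked w = (w == b) ∨ (w == b′)

  -- Paths are followed from their sources and stopped before `b` and `b′`. A label class need not
  -- be connected, so the branch sets consist of what is reached in this way.
  Run : Fin (n G) → Fin (n G) → Set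
  Run t z = lab z ≡ just t × blocked z ≡ false

  In : Fin (n G) → Set
  In w = ∃[ t ] Σ (X.set t ≡ true) λ h → WalkIn G (Run t) (src t h) w

  module _ (inb : Fin (n G) → Bool) (sound : ∀ w → inb w ≡ true → In w) (complete : ∀ w → In w → inb w ≡ true) where

    -- Sets 0 and 2 come from the paths to `b` and `b′` without these last vertices, which form the
    -- sets 1 and 3; the other four paths give the sets 4 to 7.
    cls : Fin (n G) → Maybe (Fin 8)
    cls t = if t == b then just zero else (if t == b′ then just (suc (suc zero)) else Data.Maybe.map (λ k → suc (suc (suc (suc k)))) (N.from t))

    cls-b : cls b ≡ just zero
    cls-b rewrite ==-refl b = refl
    cls-b′ : cls b′ ≡ just (suc (suc zero))
    cls-b′ rewrite ≢⇒== (b≢b′ ∘ ≡-sym) | ==-refl b′ = refl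
    cls-rest : ∀ k → cls (N.to k) ≡ just (suc (suc (suc (suc k))))
    cls-rest k with rest-elim (N.to k) (N.to-sat k)
    ... | _ , p , q rewrite ≢⇒== p | ≢⇒== q | N.from-to k = refl

    cls-inj : ∀ t t′ p → cls t ≡ just p → cls t′ ≡ just p → t ≡ t′
    cls-inj t t′ p h h′ with back t p h | back t′ p h′
      where
      back : ∀ t p → cls t ≡ just p → (p ≡ zero × t ≡ b) ⊎ ((p ≡ suc (suc zero) × t ≡ b′) ⊎ ∃[ k ] (p ≡ suc (suc (suc (suc k))) × N.to k ≡ t))
      back t p h with t ≟ b
      back t _ refl | yes e = inj₁ (refl , e)
      ... | no _ with t ≟ b′
      back t _ refl | no _ | yes e = inj₂ (inj₁ (refl , e))
      ... | no _ with N.from t in eq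
      back t _ refl | no _ | no _ | just k = inj₂ (inj₂ (k , refl , N.to-from eq))
    ... | inj₁ (refl , e) | inj₁ (_ , e′) = trans e (≡-sym e′)
    ... | inj₁ (refl , e) | inj₂ (inj₁ (() , _))
    ... | inj₁ (refl , e) | inj₂ (inj₂ (_ , () , _))
    ... | inj₂ (inj₁ (refl , e)) | inj₂ (inj₁ (_ , e′)) = trans e (≡-sym e′)
    ... | inj₂ (inj₁ (refl , e)) | inj₁ (() , _)
    ... | inj₂ (inj₁ (refl , e)) | inj₂ (inj₂ (_ , () , _))
    ... | inj₂ (inj₂ (k , refl , e)) | inj₂ (inj₂ (.k , refl , e′)) = trans (≡-sym e) e′
    ... | inj₂ (inj₂ (k , refl , e)) | inj₁ (() , _)
    ... | inj₂ (inj₂ (k , refl , e)) | inj₂ (inj₁ (() , _))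

    br : Fin (n G) → Maybe (Fin 8)
    br w = if w == b then just (suc zero) else (if w == b′ then just (suc (suc (suc zero))) else (if inb w then lab w >>= cls else nothing))

    br-b : br b ≡ just (suc zero)
    br-b rewrite ==-refl b = refl
    br-b′ : br b′ ≡ just (suc (suc (suc zero)))
    br-b′ rewrite ≢⇒== (b≢b′ ∘ ≡-sym) | ==-refl b′ = refl
    br-run : ∀ {t} (h : X.set t ≡ true) {w} → WalkIn G (Run t) (src t h) w → br w ≡ cls t
    br-run {t} h {w} walk with walk-end walk
    ... | l , nb′ with w ≟ b | w ≟ b′
    ...   | no _ | no _ rewrite complete w (t , h , walk) | l = refl
    br-run {t} h {w} walk | l , () | yes _ | _
    br-run {t} h {w} walk | l , () | no _ | yes _

    inside-run : ∀ {t} (h : X.set t ≡ true) {u w p} → cls t ≡ just p → WalkIn G (Run t) (src t h) u → WalkIn G (Run t) u w → WalkIn G (λ z → br z ≡ just p) u w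
    inside-run h c pre (here x) = here (trans (br-run h pre) c)
    inside-run h c pre (step x e w) = step (trans (br-run h pre) c) e (inside-run h c (walk-snoc pre e (walk-start w)) w)

    unblocked : ∀ t (h : X.set t ≡ true) → blocked (src t h) ≡ false
    unblocked t h = ¬true⇒false bad
      where
      As : A.set (src t h) ≡ true
      As = proj₁ (proj₂ (path t h))
      bad : blocked (src t h) ≡ true → ⊥
      bad q with ∨-elim {src t h == b} q
      ... | inj₁ e = true≢false As (subst (λ z → A.set z ≡ false) (≡-sym (==⇒≡ e)) Ab)
      ... | inj₂ e = true≢false As (subst (λ z → A.set z ≡ false) (≡-sym (==⇒≡ e)) Ab′)

    start : ∀ t (h : X.set t ≡ true) → WalkIn G (Run t) (src t h) (src t h)
    start t h = here (walk-start (proj₂ (proj₂ (path t h))) , unblocked t h)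

    br-src : ∀ t (h : X.set t ≡ true) → br (src t h) ≡ cls t
    br-src t h = br-run h (start t h)

    conn : ∀ p u v → br u ≡ just p → br v ≡ just p → WalkIn G (λ w → br w ≡ just p) u v
    conn p u v hu hv with kind u p hu | kind v p hv
      where
      kind : ∀ w p → br w ≡ just p → (w ≡ b × p ≡ suc zero) ⊎ ((w ≡ b′ × p ≡ suc (suc (suc zero))) ⊎ ∃[ t ] Σ (X.set t ≡ true) λ h → cls t ≡ just p × WalkIn G (Run t) (src t h) w)
      kind w p h with w ≟ b
      kind w _ refl | yes e = inj₁ (e , refl)
      ... | no _ with w ≟ b′
      kind w _ refl | no _ | yes e = inj₂ (inj₁ (e , refl))
      ... | no _ with inb w in iw
      ...   | true with sound w iw
      ...     | t , ht , walk = inj₂ (inj₂ (t , ht , trans (≡-sym (cong (_>>= cls) (proj₁ (walk-end walk)))) h , walk))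
    ... | inj₁ (refl , _) | inj₁ (refl , _) = here hu
    ... | inj₂ (inj₁ (refl , _)) | inj₂ (inj₁ (refl , _)) = here hu
    ... | inj₂ (inj₂ (t , ht , c , w₁)) | inj₂ (inj₂ (t′ , ht′ , c′ , w₂)) = walk-++ (walk-rev (inside-run ht c (start t ht) w₁)) w₂′
      where
      w₂′ : WalkIn G (λ w → br w ≡ just p) (src t ht) v
      w₂′ with cls-inj t′ t p c′ c
      ... | refl = subst (λ s → WalkIn G (λ w → br w ≡ just p) s v) (cong (src t) (bool-irr ht′ ht)) (inside-run ht′ c′ (start t ht′) w₂)
        where
        bool-irr : ∀ {s : Bool} (x y : s ≡ true) → x ≡ y
        bool-irr refl refl = refl
    ... | inj₁ (refl , refl) | inj₂ (inj₁ (_ , ()))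
    ... | inj₂ (inj₁ (refl , refl)) | inj₁ (_ , ())
    ... | inj₁ (refl , refl) | inj₂ (inj₂ (t , ht , c , _)) = ⊥-elim (not-b t c)
      where
      not-b : ∀ t → cls t ≡ just (suc zero) → ⊥
      not-b t c with t == b | t == b′ | N.from t
      not-b t () | false | false | just _
    ... | inj₂ (inj₂ (t , ht , c , _)) | inj₁ (refl , refl) = ⊥-elim (not-b t c)
      where
      not-b : ∀ t → cls t ≡ just (suc zero) → ⊥
      not-b t c with t == b | t == b′ | N.from t
      not-b t () | false | false | just _
    ... | inj₂ (inj₁ (refl , refl)) | inj₂ (inj₂ (t , ht , c , _)) = ⊥-elim (not-b′ t c)
      where
      not-b′ : ∀ t → cls t ≡ just (suc (suc (suc zero))) → ⊥
      not-b′ t c with t == b | t == b′ | N.from t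
      not-b′ t () | false | false | just _
    ... | inj₂ (inj₂ (t , ht , c , _)) | inj₂ (inj₁ (refl , refl)) = ⊥-elim (not-b′ t c)
      where
      not-b′ : ∀ t → cls t ≡ just (suc (suc (suc zero))) → ⊥
      not-b′ t c with t == b | t == b′ | N.from t
      not-b′ t () | false | false | just _

    sources : ∀ t t′ (h : X.set t ≡ true) (h′ : X.set t′ ≡ true) → t ≢ t′ → ∀ {i j} → cls t ≡ just i → cls t′ ≡ just j → Ed G br i j
    sources t t′ h h′ ne c c′ = src t h , src t′ h′ , trans (br-src t h) c , trans (br-src t′ h′) c′ ,
      A.full _ _ (proj₁ (proj₂ (path t h))) (proj₁ (proj₂ (path t′ h′))) λ e →
        ne (just-inj (trans (≡-sym (walk-start (proj₂ (proj₂ (path t h))))) (trans (cong lab e) (walk-start (proj₂ (proj₂ (path t′ h′)))))))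

    far : ∀ k → br (N.to k) ≡ just (suc (suc (suc (suc k))))
    far k with rest-elim (N.to k) (N.to-sat k)
    ... | h , p , q = trans (br-run h (walk-map run (proj₂ (proj₂ (path (N.to k) h))))) (cls-rest k)
      where
      run : ∀ {z} → lab z ≡ just (N.to k) → Run (N.to k) z
      run {z} l = l , ¬true⇒false bad
        where
        bad : blocked z ≡ true → ⊥
        bad q′ with ∨-elim {z == b} q′
        ... | inj₁ e = p (just-inj (trans (≡-sym l) (trans (cong lab (==⇒≡ e)) (lab-end b Xb))))
        ... | inj₂ e = q (just-inj (trans (≡-sym l) (trans (cong lab (==⇒≡ e)) (lab-end b′ Xb′))))

    -- The path to `t` can enter `b` or `b′` only at `t` itself, since the other one carries its own
    -- label; the vertex before it still belongs to the run.
    last : ∀ t (h : X.set t ≡ true) → blocked t ≡ true → ∃[ u ] (br u ≡ cls t × adj G u t ≡ true)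
    last t h bt = go (start t h) (proj₂ (proj₂ (path t h)))
      where
      own : ∀ w {c} → w ≡ c → X.set c ≡ true → lab w ≡ just t → w ≡ t
      own w refl xc l = just-inj (trans (≡-sym (lab-end w xc)) l)
      go : ∀ {u} → WalkIn G (Run t) (src t h) u → WalkIn G (λ w → lab w ≡ just t) u t → ∃[ u ] (br u ≡ cls t × adj G u t ≡ true)
      go pre (here _) = ⊥-elim (true≢false bt (proj₂ (walk-end pre)))
      go {u} pre (step {w = w} _ e walk) with blocked w in bw
      ... | false = go (walk-snoc pre e (walk-start walk , bw)) walk
      ... | true with ∨-elim {w == b} bw
      ...   | inj₁ q = u , br-run h pre , subst (λ z → adj G u z ≡ true) (own w (==⇒≡ q) Xb (walk-start walk)) e
      ...   | inj₂ q = u , br-run h pre , subst (λ z → adj G u z ≡ true) (own w (==⇒≡ q) Xb′ (walk-start walk)) e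

    tips : ∀ {u v i j} → br u ≡ just i → br v ≡ just j → X.set u ≡ true → X.set v ≡ true → u ≢ v → Ed G br i j
    tips {u} {v} hu hv xu xv ne = u , v , hu , hv , X.full u v xu xv ne

    X-to : ∀ k → X.set (N.to k) ≡ true × (N.to k ≢ b × N.to k ≢ b′)
    X-to k = rest-elim (N.to k) (N.to-sat k)

    e₀₁ : Ed G br zero (suc zero)
    e₀₁ = let u , hu , e = last b Xb (∨-introˡ (==-refl b)) in u , b , trans hu cls-b , br-b , e
    e₂₃ : Ed G br (suc (suc zero)) (suc (suc (suc zero)))
    e₂₃ = let u , hu , e = last b′ Xb′ (∨-introʳ {b′ == b} (==-refl b′)) in u , b′ , trans hu cls-b′ , br-b′ , e
    e₀₂ : Ed G br zero (suc (suc zero))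
    e₀₂ = sources b b′ Xb Xb′ b≢b′ cls-b cls-b′
    e₁₃ : Ed G br (suc zero) (suc (suc (suc zero)))
    e₁₃ = tips br-b br-b′ Xb Xb′ b≢b′
    e₀ₖ : ∀ k → Ed G br zero (suc (suc (suc (suc k))))
    e₀ₖ k = sources b (N.to k) Xb (proj₁ (X-to k)) (proj₁ (proj₂ (X-to k)) ∘ ≡-sym) cls-b (cls-rest k)
    e₂ₖ : ∀ k → Ed G br (suc (suc zero)) (suc (suc (suc (suc k))))
    e₂ₖ k = sources b′ (N.to k) Xb′ (proj₁ (X-to k)) (proj₂ (proj₂ (X-to k)) ∘ ≡-sym) cls-b′ (cls-rest k)
    e₁ₖ : ∀ k → Ed G br (suc zero) (suc (suc (suc (suc k))))
    e₁ₖ k = tips br-b (far k) Xb (proj₁ (X-to k)) (proj₁ (proj₂ (X-to k)) ∘ ≡-sym)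
    e₃ₖ : ∀ k → Ed G br (suc (suc (suc zero))) (suc (suc (suc (suc k))))
    e₃ₖ k = tips br-b′ (far k) Xb′ (proj₁ (X-to k)) (proj₂ (proj₂ (X-to k)) ∘ ≡-sym)
    eₖₗ : ∀ k l → k ≢ l → Ed G br (suc (suc (suc (suc k)))) (suc (suc (suc (suc l))))
    eₖₗ k l ne = tips (far k) (far l) (proj₁ (X-to k)) (proj₁ (X-to l)) (ne ∘ N.to-inj)

    -- Sets 0, 2 and 4 to 7 are pairwise joined inside `A`, and sets 1, 3 and 4 to 7 inside `X`; the
    -- last steps of the paths to `b` and `b′` join 0 to 1 and 2 to 3. Only the disjoint pairs 03
    -- and 12 are missing.
    edges : ∀ i j → K8minus2 zero (suc (suc (suc zero))) (suc (suc zero)) (suc zero) i j ≡ true → Ed G br i j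
    edges zero zero ()
    edges zero (suc zero) h = e₀₁
    edges zero (suc (suc zero)) h = e₀₂
    edges zero (suc (suc (suc zero))) ()
    edges zero (suc (suc (suc (suc k)))) h = e₀ₖ k
    edges (suc zero) zero h = flipE G e₀₁
    edges (suc zero) (suc zero) ()
    edges (suc zero) (suc (suc zero)) ()
    edges (suc zero) (suc (suc (suc zero))) h = e₁₃
    edges (suc zero) (suc (suc (suc (suc k)))) h = e₁ₖ k
    edges (suc (suc zero)) zero h = flipE G e₀₂
    edges (suc (suc zero)) (suc zero) ()
    edges (suc (suc zero)) (suc (suc zero)) ()
    edges (suc (suc zero)) (suc (suc (suc zero))) h = e₂₃
    edges (suc (suc zero)) (suc (suc (suc (suc k)))) h = e₂ₖ k
    edges (suc (suc (suc zero))) zero ()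
    edges (suc (suc (suc zero))) (suc zero) h = flipE G e₁₃
    edges (suc (suc (suc zero))) (suc (suc zero)) h = flipE G e₂₃
    edges (suc (suc (suc zero))) (suc (suc (suc zero))) ()
    edges (suc (suc (suc zero))) (suc (suc (suc (suc k)))) h = e₃ₖ k
    edges (suc (suc (suc (suc k)))) zero h = flipE G (e₀ₖ k)
    edges (suc (suc (suc (suc k)))) (suc zero) h = flipE G (e₁ₖ k)
    edges (suc (suc (suc (suc k)))) (suc (suc zero)) h = flipE G (e₂ₖ k)
    edges (suc (suc (suc (suc k)))) (suc (suc (suc zero))) h = flipE G (e₃ₖ k)
    edges (suc (suc (suc (suc k)))) (suc (suc (suc (suc l)))) h = eₖₗ k l λ { refl → true≢false (==-refl (suc (suc (suc (suc k))))) (not-elim (proj₁ (∧-elim {not (suc (suc (suc (suc k))) == suc (suc (suc (suc l))))} h))) }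

    nonempty : ∀ i → ∃[ v ] br v ≡ just i
    nonempty zero = let u , _ , h , _ = e₀₁ in u , h
    nonempty (suc zero) = b , br-b
    nonempty (suc (suc zero)) = let u , _ , h , _ = e₂₃ in u , h
    nonempty (suc (suc (suc zero))) = b′ , br-b′
    nonempty (suc (suc (suc (suc k)))) = N.to k , far k

    model-⊥ : ⊥
    model-⊥ = free zero (suc (suc (suc zero))) (suc (suc zero)) (suc zero) (λ ()) (λ ()) refl (record { branch = br ; nonempty = nonempty ; connected = conn ; edges = edges })

  impossible₁ : ⊥
  impossible₁ = decide-subset In model-⊥

-- Three vertices joined to a 5-clique F, with a path outside F between two of them.
module ThreeAtFive (G : Graph) (free : NoK8=Minor G) (f : Fin 5 → Fin (n G)) (f-full : ∀ i j → i ≢ j → adj G (f i) (f j) ≡ true)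
  (u y z : Fin (n G)) (fu : ∀ i → adj G (f i) u ≡ true) (fy : ∀ i → adj G (f i) y ≡ true) (fz : ∀ i → adj G (f i) z ≡ true)
  (y≢z : y ≢ z) (reach : Fin (n G) → Bool) (reach-u : reach u ≡ true)
  (reach-conn : ∀ w → reach w ≡ true → WalkIn G (λ v → reach v ≡ true) u w)
  (reach-f : ∀ i → reach (f i) ≡ false) (reach-y : reach y ≡ false) (reach-z : reach z ≡ false)
  (t : Fin (n G)) (reach-t : reach t ≡ true) (ty : adj G t y ≡ true) where

  private
    no-loop : ∀ i {w} → adj G (f i) w ≡ true → f i ≢ w
    no-loop i h refl = true≢false h (irrefl G (f i))
    f-inj : ∀ i j → f i ≡ f j → i ≡ j
    f-inj i j h with i ≟ j
    ... | yes e = e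
    ... | no ne = ⊥-elim (no-loop i (f-full i j ne) h)

    -- Set 0 is the whole reached part around `u`, sets 1 and 2 are `y` and `z`, and the vertices of
    -- the 5-clique form the sets 3 to 7.
    br : Fin (n G) → Maybe (Fin 8)
    br w = if reach w then just zero else (if w == y then just (suc zero) else (if w == z then just (suc (suc zero)) else
      Data.Maybe.map (λ k → suc (suc (suc k))) (locate f w)))

    br-r : ∀ {w} → reach w ≡ true → br w ≡ just zero
    br-r h rewrite h = refl
    br-y : br y ≡ just (suc zero)
    br-y rewrite reach-y | ==-refl y = refl
    br-z : br z ≡ just (suc (suc zero))
    br-z rewrite reach-z | ≢⇒== (y≢z ∘ ≡-sym) | ==-refl z = refl
    br-f : ∀ i → br (f i) ≡ just (suc (suc (suc i)))
    br-f i rewrite reach-f i | ≢⇒== (no-loop i (fy i)) | ≢⇒== (no-loop i (fz i)) | locate-complete f f-inj i = refl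

    data Kind (w : Fin (n G)) : Fin 8 → Set where
      k₀ : reach w ≡ true → Kind w zero
      k₁ : w ≡ y → Kind w (suc zero)
      k₂ : w ≡ z → Kind w (suc (suc zero))
      kᵢ : ∀ i → w ≡ f i → Kind w (suc (suc (suc i)))

    kind : ∀ w p → br w ≡ just p → Kind w p
    kind w p h with reach w in rw
    kind w _ refl | true = k₀ rw
    ... | false with w ≟ y
    kind w _ refl | false | yes e = k₁ e
    ... | no _ with w ≟ z
    kind w _ refl | false | no _ | yes e = k₂ e
    ... | no _ with locate f w in lw
    kind w _ refl | false | no _ | no _ | just i = kᵢ i (≡-sym (locate-sound f w lw))

    conn : ∀ p a b → br a ≡ just p → br b ≡ just p → WalkIn G (λ w → br w ≡ just p) a b
    conn p a b ha hb with kind a p ha | kind b p hb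
    ... | k₀ ra | k₀ rb = walk-map br-r (walk-++ (walk-rev (reach-conn a ra)) (reach-conn b rb))
    ... | k₁ refl | k₁ refl = here ha
    ... | k₂ refl | k₂ refl = here ha
    ... | kᵢ i refl | kᵢ .i refl = here ha

    e₀₁ : Ed G br zero (suc zero)
    e₀₁ = t , y , br-r reach-t , br-y , ty
    e₀ᵢ : ∀ i → Ed G br (suc (suc (suc i))) zero
    e₀ᵢ i = f i , u , br-f i , br-r reach-u , fu i
    e₁ᵢ : ∀ i → Ed G br (suc (suc (suc i))) (suc zero)
    e₁ᵢ i = f i , y , br-f i , br-y , fy i
    e₂ᵢ : ∀ i → Ed G br (suc (suc (suc i))) (suc (suc zero))
    e₂ᵢ i = f i , z , br-f i , br-z , fz i

    -- The edge from `t` to `y` joins the sets 0 and 1. The two missing pairs, 02 and 12, both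
    -- contain the set of `z`.
    edges : ∀ i j → K8minus2 zero (suc (suc zero)) (suc zero) (suc (suc zero)) i j ≡ true → Ed G br i j
    edges zero zero ()
    edges zero (suc zero) h = e₀₁
    edges zero (suc (suc zero)) ()
    edges zero (suc (suc (suc j))) h = flipE G (e₀ᵢ j)
    edges (suc zero) zero h = flipE G e₀₁
    edges (suc zero) (suc zero) ()
    edges (suc zero) (suc (suc zero)) ()
    edges (suc zero) (suc (suc (suc j))) h = flipE G (e₁ᵢ j)
    edges (suc (suc zero)) zero ()
    edges (suc (suc zero)) (suc zero) ()
    edges (suc (suc zero)) (suc (suc zero)) ()
    edges (suc (suc zero)) (suc (suc (suc j))) h = flipE G (e₂ᵢ j)
    edges (suc (suc (suc i))) zero h = e₀ᵢ i
    edges (suc (suc (suc i))) (suc zero) h = e₁ᵢ i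
    edges (suc (suc (suc i))) (suc (suc zero)) h = e₂ᵢ i
    edges (suc (suc (suc i))) (suc (suc (suc j))) h = f i , f j , br-f i , br-f j ,
      f-full i j λ { refl → true≢false (==-refl (suc (suc (suc i)))) (not-elim (proj₁ (∧-elim {not (suc (suc (suc i)) == suc (suc (suc j)))} h))) }

  impossible₂ : ⊥
  impossible₂ = free zero (suc (suc zero)) (suc zero) (suc (suc zero)) (λ ()) (λ ()) refl (record
    { branch = br
    ; nonempty = λ { zero → u , br-r reach-u ; (suc zero) → y , br-y ; (suc (suc zero)) → z , br-z ; (suc (suc (suc i))) → f i , br-f i }
    ; connected = conn ; edges = edges })

-- The minimal counterexample

module Counterexample (G : Graph) (free : NoK8=Minor G) (uncolourable : ¬ Colorable 8 G)
  (IH : ∀ H → n H < n G → NoK8=Minor H → Colorable 8 H) where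

  open Colouring G free uncolourable IH

  -- Contracting the side U of the clique A along the linkage makes the separator Z complete.
  module Side (A Z U : Fin (n G) → Bool) (A-full : ∀ u v → A u ≡ true → A v ≡ true → u ≢ v → adj G u v ≡ true)
    (link : Linkage G A Z) (sound : ∀ w → U w ≡ true → ∃[ a ] (A a ≡ true × Avoids G Z a w))
    (start : ∀ a → A a ≡ true → Z a ≡ false → U a ≡ true)
    (closed : ∀ u w → U u ≡ true → adj G u w ≡ true → Z w ≡ false → U w ≡ true) where

    open Linkage link

    Z∩U : ∀ w → Z w ≡ true → U w ≡ false
    Z∩U w h = ¬true⇒false λ u → let _ , _ , walk = sound w u in true≢false h (walk-end walk)

    Tail : Fin (n G) → Fin (n G) → Set
    Tail z w = ∃[ u ] (WalkIn G (λ v → lab v ≡ just z × U v ≡ true) w u × adj G u z ≡ true)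

    head : ∀ z → Z z ≡ true → ∃[ a ] (A a ≡ true × (a ≡ z ⊎ Tail z a))
    head z hz with path z hz
    ... | a , ha , walk with Z a in za
    ...   | true = a , ha , inj₁ (just-inj (trans (≡-sym (lab-end a za)) (walk-start walk)))
    ...   | false = a , ha , inj₂ (go (here (walk-start walk , start a ha za)) walk)
      where
      go : ∀ {u} → WalkIn G (λ v → lab v ≡ just z × U v ≡ true) a u → WalkIn G (λ w → lab w ≡ just z) u z → Tail z a
      go pre (here _) = ⊥-elim (true≢false (proj₂ (walk-end pre)) (Z∩U z hz))
      go {u} pre (step {w = w} _ e rest) with Z w in zw
      ... | true = u , pre , subst (λ y → adj G u y ≡ true) (just-inj (trans (≡-sym (lab-end w zw)) (walk-start rest))) e
      ... | false = go (walk-snoc pre e (walk-start rest , closed u w (proj₂ (walk-end pre)) e zw)) rest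

    -- Only those vertices of `U` are contracted from which a path of the linkage runs through `U`
    -- to its end in `Z`; the rest of `U` is discarded.
    In : Fin (n G) → Set
    In w = ∃[ z ] (Z z ≡ true × Tail z w)

    module _ (inb : Fin (n G) → Bool) (in-sound : ∀ w → inb w ≡ true → In w) (in-complete : ∀ w → In w → inb w ≡ true) where

      private
        E : Fin (n G) → Fin (n G) → Bool
        E a b = adj G a b ∨ (Z a ∧ (Z b ∧ not (a == b)))
        br : Fin (n G) → Maybe (Fin (n G))
        br w = if U w then (if inb w then lab w else nothing) else just w
        br-out : ∀ w → U w ≡ false → br w ≡ just w
        br-out w h rewrite h = refl
        br-tail : ∀ z → Z z ≡ true → ∀ w → Tail z w → br w ≡ just z
        br-tail z hz w tail with walk-start (proj₁ (proj₂ tail))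
        ... | l , u rewrite u | in-complete w (z , hz , tail) = l
        tail-walk : ∀ z → Z z ≡ true → ∀ {w} → Tail z w → WalkIn G (λ v → br v ≡ just z) w z
        tail-walk z hz (u , walk , e) = go walk
          where
          go : ∀ {w} → WalkIn G (λ v → lab v ≡ just z × U v ≡ true) w u → WalkIn G (λ v → br v ≡ just z) w z
          go (here x) = step (br-tail z hz _ (u , here x , e)) e (here (br-out z (Z∩U z hz)))
          go (step x e′ w) = step (br-tail z hz _ (u , step x e′ w , e)) e′ (go w)
        conn : ∀ w v → br w ≡ just v → WalkIn G (λ y → br y ≡ just v) w v
        conn w v h with U w in uw
        conn w _ refl | false = here (br-out w uw)
        ... | true with inb w in iw
        ...   | true with in-sound w iw
        ...     | z , hz , tail with just-inj (trans (≡-sym h) (proj₁ (walk-start (proj₁ (proj₂ tail)))))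
        ...       | refl = tail-walk z hz tail
        anchor : ∀ z → Z z ≡ true → ∃[ a ] (A a ≡ true × br a ≡ just z)
        anchor z hz with head z hz
        ... | a , ha , inj₁ refl = a , ha , br-out a (Z∩U a hz)
        ... | a , ha , inj₂ tail = a , ha , br-tail z hz a tail
        real : ∀ u v → not (U u) ≡ true → not (U v) ≡ true → E u v ≡ true → ∃[ a ] ∃[ b ] (br a ≡ just u × br b ≡ just v × adj G a b ≡ true)
        real u v hu hv h with ∨-elim {adj G u v} h
        ... | inj₁ e = u , v , br-out u (not-elim hu) , br-out v (not-elim hv) , e
        ... | inj₂ q with ∧-elim {Z u} q
        ...   | zu , q′ with ∧-elim {Z v} q′
        ...     | zv , ne with anchor u zu | anchor v zv
        ...       | a , ha , ba | b , hb , bb = a , b , ba , bb ,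
          A-full a b ha hb λ { refl → ==⇒≢ (not-elim ne) (just-inj (trans (≡-sym ba) bb)) }
        flip₃ : ∀ s t r → s ∧ (t ∧ r) ≡ t ∧ (s ∧ r)
        flip₃ true t r = refl
        flip₃ false true r = refl
        flip₃ false false r = refl
        E-irr : ∀ a → E a a ≡ false
        E-irr a rewrite irrefl G a | ==-refl a with Z a
        ... | true = refl
        ... | false = refl

      contracted : Sub G
      contracted = record { V = λ w → not (U w) ; E = E
        ; E-sym = λ a b → cong₂ _∨_ (sym G a b) (trans (cong (λ s → Z a ∧ (Z b ∧ not s)) (==-sym a b)) (flip₃ (Z a) (Z b) (not (b == a))))
        ; E-irr = E-irr ; br = br ; br-rep = λ w h → br-out w (not-elim h) ; br-conn = λ {w} {v} _ → conn w v ; real = real }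

      -- Completing `Z` forces its vertices to have different colours, which makes the colourings of
      -- the two sides comparable. A vertex of `A` outside `Z` lies in `U` and disappears, so the
      -- minor is smaller than `G`.
      side-colouring : ∀ a → A a ≡ true → Z a ≡ false →
        Σ (Fin (n G) → Fin 8) λ c → (∀ u v → U u ≡ false → U v ≡ false → adj G u v ≡ true → c u ≢ c v) × InjOn Z c
      side-colouring a ha za = c , (λ u v hu hv e → proj₂ col u v (not-intro hu) (not-intro hv) (∨-introˡ e)) , inj
        where
        col : Σ (Fin (n G) → Fin 8) λ c → ∀ u v → not (U u) ≡ true → not (U v) ≡ true → E u v ≡ true → c u ≢ c v
        col = sub-coloured contracted a (cong not (start a ha za))
        c : Fin (n G) → Fin 8
        c = proj₁ col
        inj : InjOn Z c
        inj u v hu hv eq with u ≟ v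
        ... | yes e = e
        ... | no ne = ⊥-elim (proj₂ col u v (not-intro (Z∩U u hu)) (not-intro (Z∩U v hv))
          (∨-introʳ {adj G u v} (∧-intro hu (∧-intro hv (not-intro (≢⇒== ne))))) eq)

  -- A smallest separator of two 6-cliques with fewer than 6 vertices would allow colourings of both sides to be glued.
  no-separator : ∀ k (A X : Clique₆ G) (Z : Fin (n G) → Bool) → # Z < k → # Z < 6 → Separates G (Clique₆.set A) (Clique₆.set X) Z → ⊥
  no-separator (suc k) A X Z (s≤s hk) h6 sep =
    -- Descent on the size of `Z`: a smaller separator between `A` and `Z` would also separate `A`
    -- from `X`. The same holds for `X`, so both cliques are linked to all of `Z`.
    menger (degree-sum G) G A.set Z ≤-refl (λ W s → ≮⇒≥ λ lt → no-separator k A X W (≤-trans lt hk) (<-trans lt h6) (sep-trans G A.set X.set Z W sep s)) λ L₁ →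
    menger (degree-sum G) G X.set Z ≤-refl (λ W s → ≮⇒≥ λ lt → no-separator k A X W (≤-trans lt hk) (<-trans lt h6) (sep-sym (sep-trans G X.set A.set Z W (sep-sym sep) s))) λ L₂ →
    reach-from G A.set Z λ U sound start closed → reach-from G X.set Z λ U′ sound′ start′ closed′ →
    decide-subset (Side.In A.set Z U A.full L₁ sound start closed) λ in₁ s₁ c₁ →
    decide-subset (Side.In X.set Z U′ X.full L₂ sound′ start′ closed′) λ in₂ s₂ c₂ →
    let a , Aa , Za = extra A.set Z (subst (# Z <_) (≡-sym A.size) h6)
        x , Xx , Zx = extra X.set Z (subst (# Z <_) (≡-sym X.size) h6)
        col , proper , inj = Side.side-colouring A.set Z U A.full L₁ sound start closed in₁ s₁ c₁ a Aa Za
        col′ , proper′ , inj′ = Side.side-colouring X.set Z U′ X.full L₂ sound′ start′ closed′ in₂ s₂ c₂ x Xx Zx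
    in glue U U′ closed (Side.Z∩U A.set Z U A.full L₁ sound start closed) (Side.Z∩U X.set Z U′ X.full L₂ sound′ start′ closed′)
         (λ w u → ¬true⇒false λ u′ → let p , Ap , w₁ = sound w u ; q , Xq , w₂ = sound′ w u′ in sep p q Ap Xq (walk-++ w₁ (walk-rev w₂)))
         col proper inj col′ proper′ inj′
    where
    module A = Clique₆ A
    module X = Clique₆ X
    -- `U` and `U′` are disjoint and all edges leaving `U` end in `Z`. So once a permutation of
    -- colours makes `c′` agree with `c` on `Z`, it can be used on `U` and `c` everywhere else.
    glue : (U U′ : Fin (n G) → Bool) → (∀ u w → U u ≡ true → adj G u w ≡ true → Z w ≡ false → U w ≡ true) →
      (∀ w → Z w ≡ true → U w ≡ false) → (∀ w → Z w ≡ true → U′ w ≡ false) → (∀ w → U w ≡ true → U′ w ≡ false) →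
      (c : Fin (n G) → Fin 8) → (∀ u v → U u ≡ false → U v ≡ false → adj G u v ≡ true → c u ≢ c v) → InjOn Z c →
      (c′ : Fin (n G) → Fin 8) → (∀ u v → U′ u ≡ false → U′ v ≡ false → adj G u v ≡ true → c′ u ≢ c′ v) → InjOn Z c′ → ⊥
    glue U U′ closed zu zu′ uu′ c proper inj c′ proper′ inj′ with align Z c′ c inj′ inj
    ... | π , π-inj , π-z = uncolourable (d , ok)
      where
      d : Fin (n G) → Fin 8
      d w = if U w then π (c′ w) else c w
      in-Z : ∀ u v → U u ≡ true → U v ≡ false → adj G u v ≡ true → Z v ≡ true
      in-Z u v hu hv e with Z v in zv
      ... | true = refl
      ... | false = ⊥-elim (true≢false (closed u v hu e zv) hv)
      mixed : ∀ u v → U u ≡ true → U v ≡ false → adj G u v ≡ true → π (c′ u) ≢ c v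
      mixed u v hu hv e eq = proper′ u v (uu′ u hu) (zu′ v zv) e (π-inj _ _ (trans eq (≡-sym (π-z v zv))))
        where
        zv : Z v ≡ true
        zv = in-Z u v hu hv e
      ok : ∀ u v → adj G u v ≡ true → d u ≢ d v
      ok u v e eq with U u in hu | U v in hv
      ... | true | true = proper′ u v (uu′ u hu) (uu′ v hv) e (π-inj _ _ eq)
      ... | false | false = proper u v hu hv e eq
      ... | true | false = mixed u v hu hv e eq
      ... | false | true = mixed v u hv hu (trans (sym G v u) e) (≡-sym eq)

  -- The hypothesis of `menger` could fail only through a separator of fewer than six vertices,
  -- which the gluing excludes.
  linked : (A X : Clique₆ G) → (Linkage G (Clique₆.set A) (Clique₆.set X) → ⊥) → ⊥
  linked A X = menger (degree-sum G) G (Clique₆.set A) (Clique₆.set X) ≤-refl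
    λ Z sep → ≮⇒≥ λ lt → no-separator (suc (# Z)) A X Z ≤-refl (subst (# Z <_) (Clique₆.size X) lt) sep

  meet : (A X : Clique₆ G) → Fin (n G) → Bool
  meet A X w = Clique₆.set A w ∧ Clique₆.set X w

  -- With at most four common vertices, `X` has two vertices outside `A`, and the paths of the
  -- linkage that end there are non-trivial.
  shares-five : (A X : Clique₆ G) → (5 ≤ # meet A X → ⊥) → ⊥
  shares-five A X small = linked A X λ l → TwoCliques.impossible₁ G free A X l (at zero) (at (suc zero)) (λ eq → zero≢one (N.to-inj eq))
      (proj₁ (ends zero)) (proj₁ (ends (suc zero))) (proj₂ (ends zero)) (proj₂ (ends (suc zero)))
    where
    module A = Clique₆ A
    module X = Clique₆ X
    new : Fin (n G) → Bool
    new w = X.set w ∧ not (A.set w)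
    split : # new + # meet A X ≡ 6
    split = trans (≡-sym (∑-distrib-+ (λ w → [ new w ]) (λ w → [ meet A X w ]))) (trans (sum-cong-≗ pt) X.size)
      where
      pt : ∀ w → [ new w ] + [ meet A X w ] ≡ [ X.set w ]
      pt w with A.set w | X.set w
      ... | true | true = refl
      ... | true | false = refl
      ... | false | true = refl
      ... | false | false = refl
    2≤new : 2 ≤ # new
    2≤new = +-cancelʳ-≤ 4 2 (# new) (≤-trans (≤-reflexive (≡-sym split)) (+-monoʳ-≤ (# new) (≤-pred (≰⇒> small))))
    module N = Enum (enum new)
    at : Fin 2 → Fin (n G)
    at i = N.to (inject≤ i 2≤new)
    zero≢one : inject≤ (zero {1}) 2≤new ≢ inject≤ (suc zero) 2≤new
    zero≢one eq with inject≤-injective 2≤new 2≤new zero (suc zero) eq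
    ... | ()
    ends : ∀ i → X.set (at i) ≡ true × A.set (at i) ≡ false
    ends i = let p , q = ∧-elim {X.set (at i)} (N.to-sat (inject≤ i 2≤new)) in p , not-elim q

  -- All eight colours occur around `x`, and degree exactly 8 would give a `K₈`.
  degree≥9 : ∀ x → 9 ≤ degree G x
  degree≥9 x = ≤∧≢⇒< (NeighbourColours.8≤d G free uncolourable IH x (degree G x) N) λ eq → NeighbourColours.clique-at-8 G free uncolourable IH x (degree G x) N (≡-sym eq)
    where
    N = Neighbourhood.numbering G x (degree G x) refl

  -- Since the degree sum is at most 10n − 28, there are many vertices of degree 9.
  low-vertex : ∀ (Y : Fin (n G) → Bool) → # Y ≤ 7 → ((v : Fin (n G)) → Y v ≡ false → degree G v ≡ 9 → ⊥) → ⊥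
  low-vertex Y hY none = by-cases {Fin (n G)} nonempty λ empty → uncolourable ((λ w → ⊥-elim (empty w)) , λ u → ⊥-elim (empty u))
    where
    nonempty : Fin (n G) → ⊥
    nonempty x = from-no (28 ≤? 7) (+-cancelˡ-≤ (degree-sum G) 28 7 (begin
      degree-sum G + 28 ≤⟨ sparse (suc (n G)) G ≤-refl free (≤-trans (from-yes (4 ≤? 9)) (≤-trans (degree≥9 x) (#≤ (adj G x)))) ⟩
      10 * n G ≡⟨ trans (*-comm 10 (n G)) (≡-sym (sum-const (n G) 10)) ⟩
      sum {n G} (λ _ → 10) ≤⟨ sum-mono pt ⟩
      sum (λ v → degree G v + [ Y v ]) ≡⟨ ∑-distrib-+ (λ v → degree G v) (λ v → [ Y v ]) ⟩
      degree-sum G + # Y ≤⟨ +-monoʳ-≤ (degree-sum G) hY ⟩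
      degree-sum G + 7 ∎))
      where
      open ≤-Reasoning
      pt : ∀ v → 10 ≤ degree G v + [ Y v ]
      pt v with Y v in yv
      ... | true = ≤-trans (s≤s (degree≥9 v)) (≤-reflexive (+-comm 1 (degree G v)))
      ... | false = ≤-trans (≤∧≢⇒< (degree≥9 v) (λ eq → none v yv (≡-sym eq))) (≤-reflexive (≡-sym (+-identityʳ (degree G v))))

  clique-at : ∀ v → degree G v ≡ 9 → ((A : Clique₆ G) → Clique₆.set A v ≡ true → ⊥) → ⊥
  clique-at v deg k = DegreeNine.impossible G free uncolourable IH v deg λ q nbr full →
    let Q₆ : Fin 6 → Fin (n G)
        Q₆ = λ { zero → v ; (suc i) → q i }
    in build Q₆ (λ { zero zero ne → ⊥-elim (ne refl) ; zero (suc j) _ → nbr j ; (suc i) zero _ → trans (sym G _ _) (nbr i) ; (suc i) (suc j) ne → full i j (ne ∘ cong suc) }) refl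
    where
    build : (q : Fin 6 → Fin (n G)) → (∀ i j → i ≢ j → adj G (q i) (q j) ≡ true) → q zero ≡ v → ⊥
    build q full refl = k (record { set = image q ; size = #-image q inj ; full = full′ }) (image-intro q zero)
      where
      inj : ∀ i j → q i ≡ q j → i ≡ j
      inj i j h with i ≟ j
      ... | yes e = e
      ... | no ne = ⊥-elim (true≢false (full i j ne) (subst (λ w → adj G (q i) w ≡ false) h (irrefl G (q i))))
      full′ : ∀ u w → image q u ≡ true → image q w ≡ true → u ≢ w → adj G u w ≡ true
      full′ u w hu hw ne with image-elim q u hu | image-elim q w hw
      ... | i , refl | j , refl = full i j λ { refl → ne refl }

  -- Five common vertices leave room for just one vertex of `X` outside `A`.
  only-outside : (A X : Clique₆ G) → 5 ≤ # meet A X → ∀ v w → Clique₆.set X v ≡ true → Clique₆.set X w ≡ true → Clique₆.set A v ≡ false → w ≢ v → Clique₆.set A w ≡ true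
  only-outside A X h v w Xv Xw Av w≢v with Clique₆.set A w in Aw
  ... | true = refl
  ... | false = ⊥-elim (from-no (7 ≤? 6) (≤-trans (+-monoˡ-≤ 2 h) (≤-trans total (≤-reflexive (Clique₆.size X)))))
    where
    open ≤-Reasoning
    pt : ∀ z → [ meet A X z ] + ([ z == v ] * 1 + [ z == w ] * 1) ≤ [ Clique₆.set X z ]
    pt z with z ≟ v | z ≟ w
    ... | yes refl | yes e = ⊥-elim (w≢v (≡-sym e))
    ... | yes refl | no _ rewrite Av | Xv = ≤-refl
    ... | no _ | yes refl rewrite Aw | Xw = ≤-refl
    ... | no _ | no _ with Clique₆.set A z
    ...   | true = ≤-reflexive (+-identityʳ _)
    ...   | false = z≤n
    total : # meet A X + 2 ≤ # Clique₆.set X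
    total = begin
      # meet A X + 2 ≡⟨ cong (# meet A X +_) (≡-sym (trans (∑-distrib-+ (λ z → [ z == v ] * 1) (λ z → [ z == w ] * 1)) (cong₂ _+_ (sum-delta v (λ _ → 1)) (sum-delta w (λ _ → 1))))) ⟩
      # meet A X + sum (λ z → [ z == v ] * 1 + [ z == w ] * 1) ≡⟨ ≡-sym (∑-distrib-+ (λ z → [ meet A X z ]) (λ z → [ z == v ] * 1 + [ z == w ] * 1)) ⟩
      sum (λ z → [ meet A X z ] + ([ z == v ] * 1 + [ z == w ] * 1)) ≤⟨ sum-mono pt ⟩
      # Clique₆.set X ∎

  -- The cliques consist of a common 5-clique `F` and one further vertex each: `src` in `A`, `v` in
  -- `X`, `w` in `Y`. The linkage labels every vertex of `F` by itself, so the path ending in `v`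
  -- avoids `F` and starts at the remaining vertex of `A`.
  module Sunflower (A X Y : Clique₆ G) (v w : Fin (n G)) (Xv : Clique₆.set X v ≡ true) (Yw : Clique₆.set Y w ≡ true)
    (Av : Clique₆.set A v ≡ false) (Aw : Clique₆.set A w ≡ false) (w≢v : w ≢ v)
    (AX : 5 ≤ # meet A X) (AY : 5 ≤ # meet A Y) (XY : 5 ≤ # meet X Y) (link : Linkage G (Clique₆.set A) (Clique₆.set X)) where

    private
      module A = Clique₆ A
      module X = Clique₆ X
      module Y = Clique₆ Y
    open Linkage link

    F : Fin (n G) → Bool
    F = meet A X

    #F : # F ≡ 5
    #F = ≤-antisym (≤-pred (subst (# F <_) X.size (begin-strict
        # F <⟨ ≤-reflexive (+-comm 1 (# F)) ⟩
        # F + 1 ≡⟨ cong (# F +_) (≡-sym (sum-delta v (λ _ → 1))) ⟩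
        # F + sum (λ z → [ z == v ] * 1) ≡⟨ ≡-sym (∑-distrib-+ (λ z → [ F z ]) (λ z → [ z == v ] * 1)) ⟩
        sum (λ z → [ F z ] + [ z == v ] * 1) ≤⟨ sum-mono pt ⟩
        # X.set ∎))) AX
      where
      open ≤-Reasoning
      pt : ∀ z → [ F z ] + [ z == v ] * 1 ≤ [ X.set z ]
      pt z with z ≟ v
      ... | yes refl rewrite Av | Xv = ≤-refl
      ... | no _ with A.set z
      ...   | true = ≤-reflexive (+-identityʳ _)
      ...   | false = z≤n

    Xw : X.set w ≡ false
    Xw = ¬true⇒false λ h → true≢false (only-outside A X AX v w Xv h Av w≢v) Aw

    -- `Y` without `w` lies in `A` and in `X`, hence in `F`, and both sets have five vertices.
    F⊆Y : ∀ z → F z ≡ true → Y.set z ≡ true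
    F⊆Y z hz with Y.set z in Yz
    ... | true = refl
    ... | false = ⊥-elim (from-no (7 ≤? 6) (begin
        7 ≡⟨ cong (_+ 1) (≡-sym Y.size) ⟩
        # Y.set + 1 ≡⟨ cong (# Y.set +_) (≡-sym (sum-delta z (λ _ → 1))) ⟩
        # Y.set + sum (λ a → [ a == z ] * 1) ≡⟨ ≡-sym (∑-distrib-+ (λ a → [ Y.set a ]) (λ a → [ a == z ] * 1)) ⟩
        sum (λ a → [ Y.set a ] + [ a == z ] * 1) ≤⟨ sum-mono pt ⟩
        sum (λ a → [ F a ] + [ a == w ] * 1) ≡⟨ trans (∑-distrib-+ (λ a → [ F a ]) (λ a → [ a == w ] * 1)) (cong₂ _+_ #F (sum-delta w (λ _ → 1))) ⟩
        6 ∎))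
      where
      open ≤-Reasoning
      pt : ∀ a → [ Y.set a ] + [ a == z ] * 1 ≤ [ F a ] + [ a == w ] * 1
      pt a with a ≟ z | a ≟ w
      ... | yes refl | _ rewrite Yz | hz = s≤s z≤n
      ... | no _ | yes refl rewrite Yw | Aw = ≤-refl
      ... | no _ | no a≢w with Y.set a in Ya
      ...   | false = z≤n
      ...   | true rewrite only-outside A Y AY w a Yw Ya Aw a≢w | only-outside X Y XY w a Yw Ya Xw a≢w = ≤-refl

    private
      module N = Enum (subst (Enum F) #F (enum F))
      src : Fin (n G)
      src = proj₁ (path v Xv)
      A-src : A.set src ≡ true
      A-src = proj₁ (proj₂ (path v Xv))
      walk-v : WalkIn G (λ z → lab z ≡ just v) src v
      walk-v = proj₂ (proj₂ (path v Xv))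
      F-A : ∀ z → F z ≡ true → A.set z ≡ true
      F-A z h = proj₁ (∧-elim {A.set z} h)
      F-X : ∀ z → F z ≡ true → X.set z ≡ true
      F-X z h = proj₂ (∧-elim {A.set z} h)
      off-F : ∀ z → lab z ≡ just v → F z ≡ false
      off-F z l = ¬true⇒false λ h → true≢false (F-A z h) (subst (λ a → A.set a ≡ false) (≡-sym (just-inj (trans (≡-sym (lab-end z (F-X z h))) l))) Av)
      differs : ∀ {p : Fin (n G) → Bool} {a b} → p a ≡ true → p b ≡ false → a ≢ b
      differs h h′ refl = true≢false h h′
      f : Fin 5 → Fin (n G)
      f = N.to
      f-full : ∀ i j → i ≢ j → adj G (f i) (f j) ≡ true
      f-full i j ne = A.full (f i) (f j) (F-A _ (N.to-sat i)) (F-A _ (N.to-sat j)) (ne ∘ N.to-inj)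
      f-src : ∀ i → adj G (f i) src ≡ true
      f-src i = A.full (f i) src (F-A _ (N.to-sat i)) A-src (differs {F} (N.to-sat i) (off-F src (walk-start walk-v)))
      f-v : ∀ i → adj G (f i) v ≡ true
      f-v i = X.full (f i) v (F-X _ (N.to-sat i)) Xv (differs {A.set} (F-A _ (N.to-sat i)) Av)
      f-w : ∀ i → adj G (f i) w ≡ true
      f-w i = Y.full (f i) w (F⊆Y _ (N.to-sat i)) Yw (differs {A.set} (F-A _ (N.to-sat i)) Aw)
      Free : Fin (n G) → Set
      Free z = F z ≡ false × (z ≢ v × z ≢ w)

    impossible₃ : ⊥
    impossible₃ = reachable Free src (off-F src (walk-start walk-v) , differs {A.set} A-src Av , differs {A.set} A-src Aw) λ r r-src conn sound closed →
      finish r r-src conn sound closed (search r closed r-src walk-v)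
      where
      module _ (r : Fin (n G) → Bool) where
        -- The path from `src` to `v` may run into `w` first. The first of `v` and `w` that it meets
        -- is joined to `src` by a path avoiding the other one and `F`, which is all that the minor
        -- requires.
        search : (∀ u z → r u ≡ true → adj G u z ≡ true → Free z → r z ≡ true) → ∀ {u} → r u ≡ true → WalkIn G (λ z → lab z ≡ just v) u v →
          (r v ≡ true) ⊎ ∃[ t ] (r t ≡ true × (adj G t v ≡ true ⊎ adj G t w ≡ true))
        search closed ru (here _) = inj₁ ru
        search closed {u} ru (step {w = z} _ e rest) with z ≟ v | z ≟ w
        ... | yes refl | _ = inj₂ (u , ru , inj₁ e)
        ... | no _ | yes refl = inj₂ (u , ru , inj₂ e)
        ... | no z≢v | no z≢w = search closed (closed u z ru e (off-F z (walk-start rest) , z≢v , z≢w)) rest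
        finish : r src ≡ true → (∀ z → r z ≡ true → WalkIn G (λ y → r y ≡ true) src z) → (∀ z → r z ≡ true → Free z) → _ →
          (r v ≡ true) ⊎ ∃[ t ] (r t ≡ true × (adj G t v ≡ true ⊎ adj G t w ≡ true)) → ⊥
        finish r-src conn sound closed (inj₁ rv) = proj₁ (proj₂ (sound v rv)) refl
        finish r-src conn sound closed (inj₂ (t , rt , inj₁ e)) = ThreeAtFive.impossible₂ G free f f-full src v w f-src f-v f-w (w≢v ∘ ≡-sym) r r-src conn
          (λ i → ¬true⇒false λ h → true≢false (N.to-sat i) (proj₁ (sound _ h))) (¬true⇒false λ h → proj₁ (proj₂ (sound v h)) refl) (¬true⇒false λ h → proj₂ (proj₂ (sound w h)) refl) t rt e
        finish r-src conn sound closed (inj₂ (t , rt , inj₂ e)) = ThreeAtFive.impossible₂ G free f f-full src w v f-src f-w f-v w≢v r r-src conn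
          (λ i → ¬true⇒false λ h → true≢false (N.to-sat i) (proj₁ (sound _ h))) (¬true⇒false λ h → proj₂ (proj₂ (sound w h)) refl) (¬true⇒false λ h → proj₁ (proj₂ (sound v h)) refl) t rt e

  absurd : ⊥
  absurd =
    low-vertex (λ _ → false) (≤-trans (≤-reflexive (trans (sum-const (n G) 0) (*-zeroʳ (n G)))) z≤n) λ u _ du →
    clique-at u du λ A _ →
    low-vertex (Clique₆.set A) (≤-trans (≤-reflexive (Clique₆.size A)) (from-yes (6 ≤? 7))) λ v Av dv →
    clique-at v dv λ X Xv →
    -- Avoiding `v` as well as `A` makes `w` different from `v`; these are at most `6 + 1 = 7`
    -- vertices, the number that `low-vertex` allows.
    low-vertex (λ z → Clique₆.set A z ∨ (z == v)) (seven A v) λ w Aw dw →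
    clique-at w dw λ Y Yw →
    shares-five A X λ AX → shares-five A Y λ AY → shares-five X Y λ XY → linked A X λ l →
    Sunflower.impossible₃ A X Y v w Xv Yw Av (¬true⇒false λ h → true≢false (∨-introˡ h) Aw)
      (λ e → true≢false (∨-introʳ {Clique₆.set A w} (subst (λ z → (w == z) ≡ true) e (==-refl w))) Aw) AX AY XY l
    where
    seven : ∀ (A : Clique₆ G) v → # (λ z → Clique₆.set A z ∨ (z == v)) ≤ 7
    seven A v = ≤-trans (sum-mono pt) (≤-reflexive (trans (∑-distrib-+ (λ z → [ Clique₆.set A z ]) (λ z → [ z == v ] * 1)) (cong₂ _+_ (Clique₆.size A) (sum-delta v (λ _ → 1)))))
      where
      pt : ∀ z → [ Clique₆.set A z ∨ (z == v) ] ≤ [ Clique₆.set A z ] + [ z == v ] * 1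
      pt z with Clique₆.set A z | z == v
      ... | true | _ = s≤s z≤n
      ... | false | true = ≤-refl
      ... | false | false = ≤-refl

-- Trying all vectors of colours decides colourability, so a colouring can be obtained by
-- contradiction although the counterexample argument yields only `⊥`.
colorable? : ∀ k G → Dec (Colorable k G)
colorable? k G = map′ (λ (c , h) → lookup c , h) (λ (c , h) → tabulate c , λ u v e eq → h u v e (trans (≡-sym (lookup∘tabulate c u)) (trans eq (lookup∘tabulate c v))))
  (exists (λ c → ∀ u v → adj G u v ≡ true → lookup c u ≢ lookup c v) λ c → all? λ u → all? λ v → (adj G u v ≟ᵇ true) →-dec ¬? (lookup c u ≟ lookup c v))
  where
  exists : ∀ {m} (P : Vec (Fin k) m → Set) → (∀ c → Dec (P c)) → Dec (∃ P)
  exists {zero} P d with d []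
  ... | yes p = yes ([] , p)
  ... | no q = no λ { ([] , p) → q p }
  exists {suc m} P d = map′ (λ (i , c , p) → i ∷ c , p) (λ { (i ∷ c , p) → i , c , p }) (any? λ i → exists (λ c → P (i ∷ c)) λ c → d (i ∷ c))

theorem : ∀ k G → n G < k → NoK8=Minor G → Colorable 8 G
theorem (suc k) G (s≤s h) free with colorable? 8 G
... | yes c = c
... | no none = ⊥-elim (Counterexample.absurd G free none λ H lt → theorem k H (≤-trans lt h))

theorem1p5 : (G : Graph) → NoK8=Minor G → Colorable 8 G
theorem1p5 G = theorem (suc (n G)) G ≤-refl
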